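{- Let $k\ge 3$ and $\nu\ge 0$ be fixed integers. There exist two constants $c_1,c_2$, depending only on $k$ and $\nu$, satisfying \[ \max\left\{(k-1)\,ex\left(\nu,P_{2}^{3}\right),\;2(k-1)\left\lfloor\frac{\nu}{2}\right\rfloor \right\}\le c_1\le c_2\le \frac{k}{3}\binom{\nu}{2}+(k-1)\nu , \] and a constant $M_3$, depending only on $k$ and $\nu$, with $M_3\le f(k\nu,k,3,\nu-1)$, such that \[ f(n,k,3,\nu)\ge \binom{n-k\nu-1}{k-1}+\left\lfloor\frac{\nu}{2}\right\rfloor\binom{n-k\nu-1}{k-3}+c_1\binom{n-k\nu-1}{k-4}+\nu \] holds for all $n$ (with $n\ge k(\nu+1)$), and \[ f(n,k,3,\nu)\le\binom{n-k\nu-1}{k-1}+\left\lfloor\frac{\nu}{2}\right\rfloor\binom{n-k\nu-1}{k-3}+(c_2+o(1))\binom{n-k\nu-1}{k-4}+M_3 \] holds for all sufficiently large $n$, where $o(1)$ denotes a quantity tending to $0$ as $n\to\infty$ with $k,\nu$ fixed.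
   Context: $[n]=\{1,\dots,n\}$, and $\binom{V}{k}$ is the collection of all $k$-element subsets of a set $V$. For integers $m\ge 0$ and $j<0$, $\binom{m}{j}=0$. A $d$-cluster of $k$-sets is a collection of $d$ different $k$-sets $A_1,\dots,A_d$ with $|A_1\cup\dots\cup A_d|\le 2k$ and $A_1\cap\dots\cap A_d=\emptyset$. A family $\mathcal{F}\subset\binom{[n]}{k}$ is $d$-cluster-free if it contains no $d$-cluster. The matching number $\nu(\mathcal{F})$ is the maximum number of pairwise disjoint sets in $\mathcal{F}$. For $n\ge k(\nu+1)$, $f(n,k,d,\nu)$ is the maximum size of a $d$-cluster-free family $\mathcal{F}\subset\binom{[n]}{k}$ with $\nu(\mathcal{F})\ge\nu+1$. (In the degenerate case $\nu=0$, the expression $f(k\nu,k,3,\nu-1)=f(0,k,3,-1)$ is read as $0$.) An $r$-graph is an $r$-uniform hypergraph without multiple edges. The tight $\ell$-path $P_{\ell}^{r}$ is the $r$-graph with edge set $\{v_iv_{i+1}\dots v_{i+r-1}:1\le i\le\ell\}$ (with $v_1,\dots,v_{\ell+r-1}$ distinct); so $P_2^3$ consists of two $3$-sets sharing exactly two vertices. $ex(n,P_{\ell}^{r})$ is the maximum number of edges in an $n$-vertex $r$-graph containing no copy of $P_{\ell}^{r}$ as a subgraph. -}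

module Defs where

open import Data.Bool.Properties as Bool using ()
open import Data.Fin as Fin using (Fin)
open import Data.Fin.Subset using (Subset; inside; outside; ∣_∣; ⁅_⁆; _∩_; ⋃; ⋂; Empty)
open import Data.Fin.Subset.Properties using (nonempty?)
open import Data.Integer as ℤ using (ℤ; +_; -[1+_]; 1ℤ)
open import Data.List using (List; []; _∷_; _++_; map; filter; length; take; drop; applyUpTo; allFin; cartesianProductWith)
open import Data.List.Extrema.Nat using (max)
open import Data.List.Membership.Propositional using (_∈_)
import Data.List.Membership.DecPropositional as DecMembership
open import Data.List.Relation.Unary.All using (All; all?)
open import Data.List.Relation.Unary.AllPairs using (AllPairs; allPairs?)
open import Data.List.Relation.Unary.Any using (Any; any?)
open import Data.List.Relation.Unary.Unique.Propositional using (Unique)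
import Data.List.Relation.Unary.Unique.DecPropositional as DecUnique
open import Data.Nat as ℕ using (ℕ; zero; suc; _≤_)
open import Data.Nat.Combinatorics using (_C_)
open import Data.Product using (_×_; ∃-syntax)
open import Data.Rational as ℚ using (ℚ; 0ℚ)
open import Data.Vec as Vec using ()
open import Data.Vec.Properties using (≡-dec)
open import Relation.Binary.Definitions using (DecidableEquality)
open import Relation.Binary.PropositionalEquality using (_≡_)
open import Relation.Nullary.Decidable using (¬?; _×-dec_)
open import Relation.Nullary.Negation using (¬_)
open import Relation.Unary using (Pred; Decidable)

infix 8 ↑_
↑_ : ℕ → ℚ
↑ m = + m ℚ./ 1

-- The lower index is an integer so that k - 4 = -1 is a legitimate value when
-- k = 3; natural subtraction would turn it into 0.
binom : ℕ → ℤ → ℕ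
binom m (+ j)    = m C j
binom m -[1+ j ] = 0

TendsToZero : (ℕ → ℚ) → Set
TendsToZero o = ∀ (ε : ℚ) → 0ℚ ℚ.< ε → ∃[ N ] (∀ n → N ≤ n → ℚ.∣ o n ∣ ℚ.< ε)

-- The set [n] is represented by Fin n.  A family of k-subsets of [n] is a
-- sublist of kSubsets n k; that list has no repetitions, so each family occurs
-- exactly once in sublists (kSubsets n k), and its length is its cardinality.

sublists : ∀ {a} {A : Set a} → List A → List (List A)
sublists []       = [] ∷ []
sublists (x ∷ xs) = map (x ∷_) (sublists xs) ++ sublists xs

subsets : ∀ n → List (Subset n)
subsets zero    = Vec.[] ∷ []
subsets (suc n) = map (inside Vec.∷_) (subsets n) ++ map (outside Vec.∷_) (subsets n)

kSubsets : ∀ n → ℕ → List (Subset n)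
kSubsets n k = filter (λ s → ∣ s ∣ ℕ.≟ k) (subsets n)

-- The largest length of a sublist satisfying P (0 if there is none).
maxSize : ∀ {a p} {A : Set a} {P : Pred (List A) p} → Decidable P → List A → ℕ
maxSize P? xs = max 0 (map length (filter P? (sublists xs)))

_≟ˢ_ : ∀ {n} → DecidableEquality (Subset n)
_≟ˢ_ = ≡-dec Bool._≟_

PairwiseDisjoint : ∀ {n} → List (Subset n) → Set
PairwiseDisjoint = AllPairs (λ A B → Empty (A ∩ B))

pairwiseDisjoint? : ∀ {n} → Decidable (PairwiseDisjoint {n})
pairwiseDisjoint? = allPairs? (λ A B → ¬? (nonempty? (A ∩ B)))

matchingNumber : ∀ {n} → List (Subset n) → ℕ
matchingNumber = maxSize pairwiseDisjoint?

IsCluster : ∀ {n} → ℕ → ℕ → List (Subset n) → Set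
IsCluster d k 𝒜 =
    length 𝒜 ≡ d
  × Unique 𝒜
  × All (λ A → ∣ A ∣ ≡ k) 𝒜
  × ∣ ⋃ 𝒜 ∣ ≤ 2 ℕ.* k
  × Empty (⋂ 𝒜)

isCluster? : ∀ {n} d k → Decidable (IsCluster {n} d k)
isCluster? d k 𝒜 =
        (length 𝒜 ℕ.≟ d)
  ×-dec DecUnique.unique? _≟ˢ_ 𝒜
  ×-dec all? (λ A → ∣ A ∣ ℕ.≟ k) 𝒜
  ×-dec (∣ ⋃ 𝒜 ∣ ℕ.≤? 2 ℕ.* k)
  ×-dec ¬? (nonempty? (⋂ 𝒜))

ClusterFree : ∀ {n} → ℕ → ℕ → List (Subset n) → Set
ClusterFree d k ℱ = ¬ Any (IsCluster d k) (sublists ℱ)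

clusterFree? : ∀ {n} d k → Decidable (ClusterFree {n} d k)
clusterFree? d k ℱ = ¬? (any? (isCluster? d k) (sublists ℱ))

-- The last argument is an integer because f (k ν) k d (ν - 1) is needed also
-- for ν = 0: for k ≥ 1 only the empty family lies over [0], so
-- f 0 k d (- 1) = 0.
f : ℕ → ℕ → ℕ → ℤ → ℕ
f n k d ν =
  maxSize
    (λ ℱ → clusterFree? d k ℱ ×-dec (ν ℤ.+ 1ℤ ℤ.≤? + matchingNumber ℱ))
    (kSubsets n k)

words : ∀ {a} {A : Set a} → List A → ℕ → List (List A)
words xs zero    = [] ∷ []
words xs (suc m) = cartesianProductWith _∷_ xs (words xs m)

-- For vs = v₁ … v_{ℓ+r-1}, the sets {vᵢ, …, v_{i+r-1}} with 1 ≤ i ≤ ℓ.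
tightPathEdges : ∀ {n} → ℕ → ℕ → List (Fin n) → List (Subset n)
tightPathEdges ℓ r vs = applyUpTo (λ i → ⋃ (map ⁅_⁆ (take r (drop i vs)))) ℓ

-- vs traces out a copy of the tight path P_ℓ^r inside the r-graph ℱ.
IsTightPathIn : ∀ {n} → ℕ → ℕ → List (Subset n) → List (Fin n) → Set
IsTightPathIn ℓ r ℱ vs = Unique vs × All (_∈ ℱ) (tightPathEdges ℓ r vs)

isTightPathIn? : ∀ {n} ℓ r (ℱ : List (Subset n)) → Decidable (IsTightPathIn ℓ r ℱ)
isTightPathIn? ℓ r ℱ vs =
        DecUnique.unique? Fin._≟_ vs
  ×-dec all? (λ e → DecMembership._∈?_ _≟ˢ_ e ℱ) (tightPathEdges ℓ r vs)

TightPathFree : ∀ {n} → ℕ → ℕ → List (Subset n) → Set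
TightPathFree {n} ℓ r ℱ = ¬ Any (IsTightPathIn ℓ r ℱ) (words (allFin n) (ℓ ℕ.+ r ℕ.∸ 1))

tightPathFree? : ∀ {n} ℓ r → Decidable (TightPathFree {n} ℓ r)
tightPathFree? {n} ℓ r ℱ =
  ¬? (any? (isTightPathIn? ℓ r ℱ) (words (allFin n) (ℓ ℕ.+ r ℕ.∸ 1)))

-- exTightPath n ℓ r = ex(n, P_ℓ^r)
exTightPath : ℕ → ℕ → ℕ → ℕ
exTightPath n ℓ r = maxSize (tightPathFree? ℓ r) (kSubsets n r)

{-# OPTIONS --safe #-}

-- Upper bound.  Call a vertex x flexible if, for every small set W, some member of F contains x
-- and has no other vertex in W.  If A ∋ x and A′ ⊇ A \ x are members and x is flexible, then A = A′, as
-- otherwise A, A′ and a member meeting A ∪ A′ only in x form a cluster; so A \ x determines A.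
-- Replacing the elements of a member a few at a time by new ones shows that all but O(n^{k-2})
-- members contain a flexible vertex.  When |F| is at least the claimed leading term, almost every
-- (k-1)-set therefore is A \ x for a unique flexible x ∈ A, and this x does not change along
-- lines of (k-1)-tuples; hence one vertex x dominates, and P ∪ {x} ∈ F for all but O(n^{k-2})
-- sets P.  Take ν disjoint members B₁, …, B_ν avoiding x, with union R.  Members avoiding x that
-- leave R, and members through x touching exactly one Bᵢ, each force many sets P ∪ {x} to be
-- absent, so they do not pay off.  The members through x touching at least two blocks are counted
-- by their trace on R: two points (at most ⌊ν/2⌋ traces over each remainder), three points, or more.
--
-- Lower bound.  The blocks B₁, …, B_ν together with the sets {x} ∪ T ∪ Q, where T is an admissible
-- trace on R and Q avoids R ∪ {x}.

module Submission where

-- The search for x loses O(n^{k-2}) members, whereas the final bound has to be right up to the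
-- order n^{k-4}. The obstacle is met by `L`, the (k-1)-sets P outside R and x for which P ∪ {x} is
-- absent: members that touch fewer than two blocks are charged to `L`, and its size cancels against
-- the deficit of the star. The approximate structure only locates x and shows that `L` is small
-- enough for the charging to work. The constants come from traces of three points over a fixed
-- remainder of k - 4 points. A pair of blocks lies under at most k of the traces that hit three
-- blocks, and such a trace covers three pairs: (k/3) C(ν,2). For any other trace some block
-- contains two of its points; the pairs arising in one block intersect each other, so there are at
-- most k - 1 of them: (k-1)ν. In the lower bound, either a triple system on the indices of the
-- blocks is repeated in k - 1 rows, one row being reserved for the pairs, or each pair of points is
-- enlarged by any of the 2(k-1) further points of its two blocks. Larger traces leave at most k - 5
-- points free and make up the o(1).

module Development where

  open import Defs
  open import Data.Bool using (Bool; true; false; not)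
  open import Data.Empty using (⊥-elim)
  open import Data.Fin as Fin using (Fin; zero; suc)
  import Data.Fin.Properties as Finₚ
  open import Data.Fin.Subset using (Subset; inside; outside; ∣_∣; ⁅_⁆; _∩_; _∪_; _─_; _-_; _∈_; _∉_; _⊆_; ∁; ⋃; ⋂; Empty; Nonempty; ⊥; ⊤)
  open import Data.Fin.Subset.Properties using (_∈?_; _⊆?_; ∉⊥; ∈⊤; ∣⊤∣≡n; ∣⊥∣≡0; x∈⁅x⁆; x∈⁅y⁆⇒x≡y; ∣⁅x⁆∣≡1; ∣∁p∣≡n∸∣p∣; p⊆q⇒∣p∣≤∣q∣; ⊆-antisym; x∈p∩q⁺; x∈p∩q⁻; x∈p∪q⁺; x∈p∪q⁻; x∈p∧x∉q⇒x∈p─q; p─q⊆p; x∈∁p⇒x∉p; x∉p⇒x∈∁p; anySubset?; Empty-unique; nonempty?; drop-there; drop-∷-⊆; out⊆; s⊆s; ∪-identityʳ; ∣p∩q∣≤∣q∣; p─x─y≡p─y─x; p⊂q⇒∣p∣<∣q∣)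
  open import Data.Integer as ℤ using (ℤ; 1ℤ)
  import Data.Integer.Properties as ℤₚ
  open import Data.List using (List; []; _∷_; _++_; map; filter; length; concatMap; allFin)
  open import Data.List.Properties using (length-map; length-++; filter-++; filter-none; length-filter; length-tabulate)
  open import Data.List.Extrema.Nat using (xs≤max; max≤v⁺; argmax-sel)
  open import Data.List.Membership.Propositional using (find; lose) renaming (_∈_ to _∈ₗ_; _∉_ to _∉ₗ_)
  open import Data.List.Membership.Propositional.Properties using (∈-filter⁺; ∈-filter⁻; ∈-map⁺; ∈-map⁻; ∈-++⁺ˡ; ∈-++⁺ʳ; ∈-++⁻; ∈-∃++; ∈-concatMap⁺; ∈-concatMap⁻; ∈-allFin; ∈-cartesianProductWith⁺)
  open import Data.List.Relation.Unary.All as All using (All; []; _∷_)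
  import Data.List.Relation.Unary.All.Properties as Allₚ
  open import Data.List.Relation.Unary.AllPairs using (AllPairs; []; _∷_)
  open import Data.List.Relation.Unary.Any as Any using (Any; here; there)
  open import Data.List.Relation.Unary.Unique.Propositional using (Unique)
  import Data.List.Relation.Unary.Unique.Propositional.Properties as Uniqueₚ
  open import Data.Nat using (ℕ; zero; suc; NonZero; >-nonZero; _+_; _*_; _∸_; _^_; _≤_; _<_; z≤n; s≤s; _!; ⌊_/2⌋; _⊔_)
  open import Data.Nat.Combinatorics using (_C_; nC1≡n; nCk+nC[k+1]≡[n+1]C[k+1])
  open import Data.Nat.Properties
  open import Data.Nat.Tactic.RingSolver using (solve-∀)
  open import Data.Product using (_×_; _,_; proj₁; proj₂; ∃-syntax; Σ)
  open import Data.Sum using (_⊎_; inj₁; inj₂; [_,_]′)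
  open import Data.Vec as Vec using (Vec; []; _∷_; here; there)
  open import Data.Vec.Properties using (∷-injective; ∷-injectiveʳ)
  open import Level using (0ℓ)
  open import Function using (_∘_; id; case_of_)
  open import Relation.Binary.Definitions using (DecidableEquality)
  open import Relation.Binary.PropositionalEquality using (_≡_; _≢_; refl; sym; trans; cong; cong₂; subst; subst₂; module ≡-Reasoning)
  open import Relation.Nullary using (¬_; Dec; yes; no; does)
  open import Relation.Nullary.Decidable using (¬?; _×-dec_; _→-dec_; _⊎-dec_)
  open import Relation.Unary using (Pred; Decidable)
  open import Data.Nat.DivMod using (_/_; m/n*n≤m; /-monoˡ-≤; m*n/n≡m)

  -- Counting in lists

  length-mono-⊆ : {A : Set} {xs ys : List A} → Unique xs → (∀ {x} → x ∈ₗ xs → x ∈ₗ ys) → length xs ≤ length ys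
  length-mono-⊆ {xs = []} _ _ = z≤n
  length-mono-⊆ {xs = x ∷ xs} (x∉xs ∷ uxs) sub with ∈-∃++ (sub (here refl))
  ... | as , bs , refl = begin
    suc (length xs)              ≤⟨ s≤s (length-mono-⊆ uxs sub′) ⟩
    suc (length (as ++ bs))      ≡⟨ cong suc (length-++ as) ⟩
    suc (length as + length bs)  ≡⟨ sym (+-suc (length as) (length bs)) ⟩
    length as + suc (length bs)  ≡⟨ sym (length-++ as) ⟩
    length (as ++ x ∷ bs)        ∎
    where
    open ≤-Reasoning
    sub′ : ∀ {y} → y ∈ₗ xs → y ∈ₗ as ++ bs
    sub′ y∈ with ∈-++⁻ as (sub (there y∈))
    ... | inj₁ y∈as         = ∈-++⁺ˡ y∈as
    ... | inj₂ (here refl)  = ⊥-elim (All.lookup x∉xs y∈ refl)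
    ... | inj₂ (there y∈bs) = ∈-++⁺ʳ as y∈bs

  length-≤-cover : {A B : Set} {xs : List B} (is : List A) (g : A → B) → Unique xs →
                   (∀ {x} → x ∈ₗ xs → ∃[ i ] (i ∈ₗ is × x ≡ g i)) → length xs ≤ length is
  length-≤-cover {xs = xs} is g uxs cov = subst (length xs ≤_) (length-map g is)
    (length-mono-⊆ uxs λ x∈ → case cov x∈ of λ { (i , i∈ , refl) → ∈-map⁺ g i∈ })

  length-≤-inj : {A B : Set} {xs : List A} {ys : List B} (g : A → B) → Unique xs →
                 (∀ {x} → x ∈ₗ xs → g x ∈ₗ ys) →
                 (∀ {x y} → x ∈ₗ xs → y ∈ₗ xs → g x ≡ g y → x ≡ y) → length xs ≤ length ys
  length-≤-inj {xs = xs} {ys} g uxs into inj = subst (_≤ length ys) (length-map g xs)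
    (length-mono-⊆ (unique-map uxs id) λ y∈ → case ∈-map⁻ g y∈ of λ { (x , x∈ , refl) → into x∈ })
    where
    unique-map : ∀ {zs} → Unique zs → (∀ {z} → z ∈ₗ zs → z ∈ₗ xs) → Unique (map g zs)
    unique-map [] _ = []
    unique-map (z∉ ∷ uzs) sub =
      Allₚ.map⁺ (All.tabulate λ y∈ eq → All.lookup z∉ y∈ (inj (sub (here refl)) (sub (there y∈)) eq))
      ∷ unique-map uzs (sub ∘ there)

  length-≤1 : {A : Set} {xs : List A} → Unique xs → (∀ {x y} → x ∈ₗ xs → y ∈ₗ xs → x ≡ y) → length xs ≤ 1
  length-≤1 {xs = []} _ _ = z≤n
  length-≤1 {xs = x ∷ []} _ _ = ≤-refl
  length-≤1 {xs = x ∷ y ∷ xs} ((x≢y ∷ _) ∷ _) eq = ⊥-elim (x≢y (eq (here refl) (there (here refl))))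

  ∈-concatMap : {A B : Set} (f : A → List B) {xs : List A} {x : A} {y : B} → x ∈ₗ xs → y ∈ₗ f x → y ∈ₗ concatMap f xs
  ∈-concatMap f x∈ y∈ = ∈-concatMap⁺ f (lose x∈ y∈)

  length-concatMap-≤ : {A B : Set} (f : A → List B) (xs : List A) {b : ℕ} →
                       (∀ {x} → x ∈ₗ xs → length (f x) ≤ b) → length (concatMap f xs) ≤ length xs * b
  length-concatMap-≤ f [] h = z≤n
  length-concatMap-≤ f (x ∷ xs) h = begin
    length (f x ++ concatMap f xs)         ≡⟨ length-++ (f x) ⟩
    length (f x) + length (concatMap f xs) ≤⟨ +-mono-≤ (h (here refl)) (length-concatMap-≤ f xs (h ∘ there)) ⟩
    _                                      ∎
    where open ≤-Reasoning

  module _ {A : Set} {P : Pred A 0ℓ} (P? : Decidable P) where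

    count : List A → ℕ
    count xs = length (filter P? xs)

    count-++ : ∀ xs ys → count (xs ++ ys) ≡ count xs + count ys
    count-++ xs ys = trans (cong length (filter-++ P? xs ys)) (length-++ (filter P? xs))

  module _ {A : Set} {P : Pred A 0ℓ} (P? : Decidable P) where

    count-split : ∀ xs → length xs ≡ count P? xs + count (¬? ∘ P?) xs
    count-split [] = refl
    count-split (x ∷ xs) with P? x
    ... | yes _ = cong suc (count-split xs)
    ... | no  _ = trans (cong suc (count-split xs)) (sym (+-suc (count P? xs) _))

  total : {A : Set} → (A → ℕ) → List A → ℕ
  total g [] = 0
  total g (a ∷ as) = g a + total g as

  module _ {A B : Set} {R : A → B → Set} (R? : ∀ x y → Dec (R x y)) where

    private
      rows : List A → List B → ℕ
      rows xs ys = total (λ x → count (R? x) ys) xs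

      rows-[] : ∀ xs → rows xs [] ≡ 0
      rows-[] []       = refl
      rows-[] (x ∷ xs) = rows-[] xs

      swap : ∀ a b c → a + (b + c) ≡ b + (a + c)
      swap = solve-∀

      rows-∷ : ∀ xs y ys → rows xs (y ∷ ys) ≡ count (λ x → R? x y) xs + rows xs ys
      rows-∷ [] y ys = refl
      rows-∷ (x ∷ xs) y ys rewrite rows-∷ xs y ys with R? x y
      ... | yes _ = cong suc (swap (count (R? x) ys) (count (λ x → R? x y) xs) (rows xs ys))
      ... | no  _ = swap (count (R? x) ys) (count (λ x → R? x y) xs) (rows xs ys)

      rows-≥ : ∀ xs ys a → (∀ {x} → x ∈ₗ xs → a ≤ count (R? x) ys) → length xs * a ≤ rows xs ys
      rows-≥ [] ys a h = z≤n
      rows-≥ (x ∷ xs) ys a h = +-mono-≤ (h (here refl)) (rows-≥ xs ys a (h ∘ there))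

    total-count-≤ : ∀ xs ys b → (∀ {y} → y ∈ₗ ys → count (λ x → R? x y) xs ≤ b) →
                    total (λ x → count (R? x) ys) xs ≤ length ys * b
    total-count-≤ xs [] b h = ≤-reflexive (rows-[] xs)
    total-count-≤ xs (y ∷ ys) b h = ≤-trans (≤-reflexive (rows-∷ xs y ys))
      (+-mono-≤ (h (here refl)) (total-count-≤ xs ys b (h ∘ there)))

    -- Both sides estimate the number of related pairs, by rows on the left and by columns on the
    -- right.
    double-count : ∀ xs ys a b → (∀ {x} → x ∈ₗ xs → a ≤ count (R? x) ys) →
                   (∀ {y} → y ∈ₗ ys → count (λ x → R? x y) xs ≤ b) → length xs * a ≤ length ys * b
    double-count xs ys a b h₁ h₂ = ≤-trans (rows-≥ xs ys a h₁) (total-count-≤ xs ys b h₂)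

  length-≤-fibers : {A B : Set} (_≟_ : DecidableEquality B) (g : A → B) (xs : List A) (ys : List B) (b : ℕ) →
                    (∀ {x} → x ∈ₗ xs → g x ∈ₗ ys) →
                    (∀ {y} → y ∈ₗ ys → count (λ x → g x ≟ y) xs ≤ b) → length xs ≤ length ys * b
  length-≤-fibers _≟_ g xs ys b into fib = subst (_≤ length ys * b) (*-identityʳ (length xs))
    (double-count (λ x y → g x ≟ y) xs ys 1 b
      (λ {x} x∈ → nonempty (∈-filter⁺ (g x ≟_) (into x∈) refl)) fib)
    where
    nonempty : ∀ {z zs} → z ∈ₗ zs → 1 ≤ length zs
    nonempty (here _)  = s≤s z≤n
    nonempty (there _) = s≤s z≤n

  -- Binomial coefficients

  pascal : ∀ n k → suc n C suc k ≡ n C k + n C suc k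
  pascal n k = sym (nCk+nC[k+1]≡[n+1]C[k+1] n k)

  C≤^ : ∀ n j → n C j ≤ n ^ j
  C≤^ n zero = ≤-refl
  C≤^ zero (suc j) = z≤n
  C≤^ (suc n) (suc j) = begin
    suc n C suc j        ≡⟨ pascal n j ⟩
    n C j + n C suc j    ≤⟨ +-mono-≤ (C≤^ n j) (C≤^ n (suc j)) ⟩
    n ^ j + n * n ^ j    ≤⟨ *-monoʳ-≤ (suc n) (^-monoˡ-≤ j (n≤1+n n)) ⟩
    suc n ^ suc j        ∎
    where open ≤-Reasoning

  C-absorb : ∀ n j → suc j * (suc n C suc j) ≡ suc n * (n C j)
  C-absorb n zero = trans (cong (1 *_) (nC1≡n (suc n))) (trans (*-identityˡ (suc n)) (sym (*-identityʳ (suc n))))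
  C-absorb zero (suc j) = *-zeroʳ (suc (suc j))
  C-absorb (suc n) (suc j) = begin
    suc (suc j) * (suc (suc n) C suc (suc j))
      ≡⟨ cong (suc (suc j) *_) (pascal (suc n) (suc j)) ⟩
    suc (suc j) * (suc n C suc j + suc n C suc (suc j))
      ≡⟨ expand (suc j) (suc n C suc j) (suc n C suc (suc j)) ⟩
    suc n C suc j + (suc j * (suc n C suc j) + suc (suc j) * (suc n C suc (suc j)))
      ≡⟨ cong₂ (λ a b → suc n C suc j + (a + b)) (C-absorb n j) (C-absorb n (suc j)) ⟩
    suc n C suc j + (suc n * (n C j) + suc n * (n C suc j))
      ≡⟨ cong (suc n C suc j +_) (sym (*-distribˡ-+ (suc n) (n C j) (n C suc j))) ⟩
    suc n C suc j + suc n * (n C j + n C suc j)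
      ≡⟨ cong (λ a → suc n C suc j + suc n * a) (sym (pascal n j)) ⟩
    suc (suc n) * (suc n C suc j) ∎
    where
    open ≡-Reasoning
    expand : ∀ j a b → suc j * (a + b) ≡ a + (j * a + suc j * b)
    expand = solve-∀

  C-mono : ∀ {m n} j → m ≤ n → m C j ≤ n C j
  C-mono zero _ = ≤-refl
  C-mono {zero} (suc j) _ = z≤n
  C-mono {suc m} {suc n} (suc j) (s≤s m≤n) = begin
    suc m C suc j      ≡⟨ pascal m j ⟩
    m C j + m C suc j  ≤⟨ +-mono-≤ (C-mono j m≤n) (C-mono (suc j) m≤n) ⟩
    n C j + n C suc j  ≡⟨ sym (pascal n j) ⟩
    suc n C suc j      ∎
    where open ≤-Reasoning

  -- `j !` times the binomial is the product (p+1)⋯(p+j), and each factor is at least p.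
  ^≤!*C : ∀ p j → p ^ j ≤ (j !) * ((p + j) C j)
  ^≤!*C p zero = ≤-refl
  ^≤!*C p (suc j) = begin
    p * p ^ j                               ≤⟨ *-mono-≤ (m≤n⇒m≤1+n (m≤m+n p j)) (^≤!*C p j) ⟩
    suc (p + j) * ((j !) * ((p + j) C j))     ≡⟨ swap (suc (p + j)) (j !) ((p + j) C j) ⟩
    (j !) * (suc (p + j) * ((p + j) C j))     ≡⟨ cong ((j !) *_) (sym (C-absorb (p + j) j)) ⟩
    (j !) * (suc j * (suc (p + j) C suc j))   ≡⟨ swap (j !) (suc j) _ ⟩
    suc j * ((j !) * (suc (p + j) C suc j))   ≡⟨ sym (*-assoc (suc j) (j !) _) ⟩
    (suc j !) * (suc (p + j) C suc j)         ≡⟨ cong (λ a → (suc j !) * (a C suc j)) (sym (+-suc p j)) ⟩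
    (suc j !) * ((p + suc j) C suc j)         ∎
    where
    open ≤-Reasoning
    swap : ∀ a b c → a * (b * c) ≡ b * (a * c)
    swap = solve-∀

  -- With p = n′ - j the hypothesis becomes n ≤ 2p, and 2^j pays for the factor 2. It makes powers
  -- of n comparable with binomials over a slightly smaller ground set.
  ^≤C : ∀ {n n′} j → n + 2 * j ≤ 2 * n′ → n ^ j ≤ 2 ^ j * (j !) * (n′ C j)
  ^≤C {n} {n′} j h = begin
    n ^ j                               ≤⟨ ^-monoˡ-≤ j n≤2p ⟩
    (2 * p) ^ j                         ≡⟨ ^-distribʳ-* j 2 p ⟩
    2 ^ j * p ^ j                       ≤⟨ *-monoʳ-≤ (2 ^ j) (^≤!*C p j) ⟩
    2 ^ j * ((j !) * ((p + j) C j))       ≡⟨ cong (λ a → 2 ^ j * ((j !) * (a C j))) (m∸n+n≡m j≤n′) ⟩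
    2 ^ j * ((j !) * (n′ C j))            ≡⟨ sym (*-assoc (2 ^ j) (j !) _) ⟩
    2 ^ j * (j !) * (n′ C j)              ∎
    where
    open ≤-Reasoning
    p = n′ ∸ j
    j≤n′ : j ≤ n′
    j≤n′ = *-cancelˡ-≤ 2 (≤-trans (m≤n+m (2 * j) n) h)
    n≤2p : n ≤ 2 * p
    n≤2p = subst (n ≤_) (sym (*-distribˡ-∸ 2 n′ j)) (m+n≤o⇒m≤o∸n n h)
    ^-distribʳ-* : ∀ j a b → (a * b) ^ j ≡ a ^ j * b ^ j
    ^-distribʳ-* zero a b = refl
    ^-distribʳ-* (suc j) a b rewrite ^-distribʳ-* j a b = four a b (a ^ j) (b ^ j)
      where four : ∀ a b c d → a * b * (c * d) ≡ a * c * (b * d)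
            four = solve-∀

  -- The `suc j`-sets through one given point number at most n^j; the `a` points are discarded one
  -- at a time.
  C-drop : ∀ n a j → n C suc j ≤ (n ∸ a) C suc j + a * n ^ j
  C-drop n zero j = ≤-reflexive (sym (+-identityʳ _))
  C-drop zero (suc a) j = z≤n
  C-drop (suc n) (suc a) j = begin
    suc n C suc j                                   ≡⟨ pascal n j ⟩
    n C j + n C suc j                               ≤⟨ +-mono-≤ (C≤^ n j) (C-drop n a j) ⟩
    n ^ j + ((n ∸ a) C suc j + a * n ^ j)           ≡⟨ rearrange (n ^ j) ((n ∸ a) C suc j) (a * n ^ j) ⟩
    (n ∸ a) C suc j + suc a * n ^ j                 ≤⟨ +-monoʳ-≤ ((n ∸ a) C suc j) (*-monoʳ-≤ (suc a) (^-monoˡ-≤ j (n≤1+n n))) ⟩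
    (n ∸ a) C suc j + suc a * suc n ^ j             ∎
    where
    open ≤-Reasoning
    rearrange : ∀ a b c → a + (b + c) ≡ b + (a + c)
    rearrange = solve-∀

  -- Cardinalities of subsets

  ∣p∪q∣+∣p∩q∣ : ∀ {n} (p q : Subset n) → ∣ p ∪ q ∣ + ∣ p ∩ q ∣ ≡ ∣ p ∣ + ∣ q ∣
  ∣p∪q∣+∣p∩q∣ [] [] = refl
  ∣p∪q∣+∣p∩q∣ (inside ∷ p) (inside ∷ q) = cong suc (trans (+-suc _ _) (trans (cong suc (∣p∪q∣+∣p∩q∣ p q)) (sym (+-suc _ _))))
  ∣p∪q∣+∣p∩q∣ (inside ∷ p) (outside ∷ q) = cong suc (∣p∪q∣+∣p∩q∣ p q)
  ∣p∪q∣+∣p∩q∣ (outside ∷ p) (inside ∷ q) = trans (cong suc (∣p∪q∣+∣p∩q∣ p q)) (sym (+-suc _ _))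
  ∣p∪q∣+∣p∩q∣ (outside ∷ p) (outside ∷ q) = ∣p∪q∣+∣p∩q∣ p q

  ∣p∪q∣≤ : ∀ {n} (p q : Subset n) → ∣ p ∪ q ∣ ≤ ∣ p ∣ + ∣ q ∣
  ∣p∪q∣≤ p q = ≤-trans (m≤m+n _ _) (≤-reflexive (∣p∪q∣+∣p∩q∣ p q))

  ∣p∪q∣-disjoint : ∀ {n} (p q : Subset n) → (∀ {x} → x ∈ p → x ∉ q) → ∣ p ∪ q ∣ ≡ ∣ p ∣ + ∣ q ∣
  ∣p∪q∣-disjoint {n} p q disj = begin
    ∣ p ∪ q ∣              ≡⟨ sym (+-identityʳ _) ⟩
    ∣ p ∪ q ∣ + 0          ≡⟨ cong (∣ p ∪ q ∣ +_) (sym (trans (cong ∣_∣ empty) (∣⊥∣≡0 n))) ⟩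
    ∣ p ∪ q ∣ + ∣ p ∩ q ∣  ≡⟨ ∣p∪q∣+∣p∩q∣ p q ⟩
    ∣ p ∣ + ∣ q ∣          ∎
    where
    open ≡-Reasoning
    empty : p ∩ q ≡ ⊥
    empty = Empty-unique λ { (x , x∈) → let a , b = x∈p∩q⁻ p q x∈ in disj a b }

  ∣p∩q∣+∣p─q∣ : ∀ {n} (p q : Subset n) → ∣ p ∩ q ∣ + ∣ p ─ q ∣ ≡ ∣ p ∣
  ∣p∩q∣+∣p─q∣ [] [] = refl
  ∣p∩q∣+∣p─q∣ (inside ∷ p) (inside ∷ q) = cong suc (∣p∩q∣+∣p─q∣ p q)
  ∣p∩q∣+∣p─q∣ (inside ∷ p) (outside ∷ q) = trans (+-suc _ _) (cong suc (∣p∩q∣+∣p─q∣ p q))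
  ∣p∩q∣+∣p─q∣ (outside ∷ p) (inside ∷ q) = ∣p∩q∣+∣p─q∣ p q
  ∣p∩q∣+∣p─q∣ (outside ∷ p) (outside ∷ q) = ∣p∩q∣+∣p─q∣ p q

  x∈p─q⇒x∉q : ∀ {n} {x} (p q : Subset n) → x ∈ p ─ q → x ∉ q
  x∈p─q⇒x∉q (_ ∷ p) (inside ∷ q) (there x∈) (there x∈q) = x∈p─q⇒x∉q p q x∈ x∈q
  x∈p─q⇒x∉q (_ ∷ p) (outside ∷ q) (there x∈) (there x∈q) = x∈p─q⇒x∉q p q x∈ x∈q

  x∈p-y⇒x∈p : ∀ {n} {x} (p : Subset n) y → x ∈ p - y → x ∈ p
  x∈p-y⇒x∈p p y = p─q⊆p p ⁅ y ⁆

  x∈p-y⇒x≢y : ∀ {n} {x} (p : Subset n) y → x ∈ p - y → x ≢ y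
  x∈p-y⇒x≢y p y x∈ refl = x∈p─q⇒x∉q p ⁅ y ⁆ x∈ (x∈⁅x⁆ y)

  x∈p-y : ∀ {n} {x} (p : Subset n) {y} → x ∈ p → x ≢ y → x ∈ p - y
  x∈p-y p {y} x∈ x≢y = x∈p∧x∉q⇒x∈p─q x∈ λ x∈y → x≢y (x∈⁅y⁆⇒x≡y y x∈y)

  infixl 6 _∪⁅_⁆
  _∪⁅_⁆ : ∀ {n} → Subset n → Fin n → Subset n
  p ∪⁅ x ⁆ = p ∪ ⁅ x ⁆

  ∈-add : ∀ {n} {x} (p : Subset n) → x ∈ p ∪⁅ x ⁆
  ∈-add {x = x} p = x∈p∪q⁺ (inj₂ (x∈⁅x⁆ x))

  ⊆-add : ∀ {n} {x y} (p : Subset n) → y ∈ p → y ∈ p ∪⁅ x ⁆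
  ⊆-add p y∈ = x∈p∪q⁺ (inj₁ y∈)

  ∈-add⁻ : ∀ {n} {x y} (p : Subset n) → y ∈ p ∪⁅ x ⁆ → y ∈ p ⊎ y ≡ x
  ∈-add⁻ {x = x} p y∈ with x∈p∪q⁻ p ⁅ x ⁆ y∈
  ... | inj₁ y∈p = inj₁ y∈p
  ... | inj₂ y∈x = inj₂ (x∈⁅y⁆⇒x≡y x y∈x)

  ∣add∣ : ∀ {n} {x} (p : Subset n) → x ∉ p → ∣ p ∪⁅ x ⁆ ∣ ≡ suc ∣ p ∣
  ∣add∣ {x = x} p x∉ = trans (∣p∪q∣-disjoint p ⁅ x ⁆ λ y∈ y∈x → x∉ (subst (_∈ p) (x∈⁅y⁆⇒x≡y x y∈x) y∈))
    (trans (cong (∣ p ∣ +_) (∣⁅x⁆∣≡1 x)) (+-comm ∣ p ∣ 1))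

  ∣add∣≤ : ∀ {n} {x} (p : Subset n) → ∣ p ∪⁅ x ⁆ ∣ ≤ suc ∣ p ∣
  ∣add∣≤ {x = x} p = ≤-trans (∣p∪q∣≤ p ⁅ x ⁆) (≤-reflexive (trans (cong (∣ p ∣ +_) (∣⁅x⁆∣≡1 x)) (+-comm ∣ p ∣ 1)))

  sub-add : ∀ {n} {x} (p : Subset n) → x ∈ p → (p - x) ∪⁅ x ⁆ ≡ p
  sub-add {x = x} p x∈ = ⊆-antisym
    (λ y∈ → [ x∈p-y⇒x∈p p x , (λ { refl → x∈ }) ]′ (∈-add⁻ (p - x) y∈))
    (λ {y} y∈ → case y Fin.≟ x of λ { (yes refl) → ∈-add (p - x) ; (no y≢x) → ⊆-add (p - x) (x∈p-y p y∈ y≢x) })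

  x∉p-x : ∀ {n} {x} (p : Subset n) → x ∉ p - x
  x∉p-x {x = x} p x∈ = x∈p-y⇒x≢y p x x∈ refl

  ∣sub∣ : ∀ {n} {x} (p : Subset n) → x ∈ p → suc ∣ p - x ∣ ≡ ∣ p ∣
  ∣sub∣ {x = x} p x∈ = trans (sym (∣add∣ (p - x) (x∉p-x p))) (cong ∣_∣ (sub-add p x∈))

  ⊆-card-≡ : ∀ {n} {p q : Subset n} → p ⊆ q → ∣ q ∣ ≤ ∣ p ∣ → p ≡ q
  ⊆-card-≡ {p = p} {q} p⊆q ∣q∣≤∣p∣ = ⊆-antisym p⊆q λ {x} x∈q → case x ∈? p of λ
    { (yes x∈p) → x∈p
    ; (no x∉p) → ⊥-elim (1+n≰n (≤-trans (subst (_≤ ∣ q ∣) (∣add∣ p x∉p)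
        (p⊆q⇒∣p∣≤∣q∣ {p = p ∪⁅ x ⁆} λ y∈ → [ p⊆q , (λ { refl → x∈q }) ]′ (∈-add⁻ p y∈))) ∣q∣≤∣p∣)) }

  ⊆-or-new : ∀ {n} (p q : Subset n) → p ⊆ q ⊎ ∃[ x ] (x ∈ p × x ∉ q)
  ⊆-or-new p q with nonempty? (p ─ q)
  ... | yes (x , x∈) = inj₂ (x , p─q⊆p p q x∈ , x∈p─q⇒x∉q p q x∈)
  ... | no empty = inj₁ λ {x} x∈p → case x ∈? q of λ
    { (yes x∈q) → x∈q ; (no x∉q) → ⊥-elim (empty (x , x∈p∧x∉q⇒x∈p─q x∈p x∉q)) }

  card-lt⇒new : ∀ {n} (p q : Subset n) → ∣ q ∣ < ∣ p ∣ → ∃[ x ] (x ∈ p × x ∉ q)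
  card-lt⇒new p q lt with ⊆-or-new p q
  ... | inj₂ new = new
  ... | inj₁ p⊆q = ⊥-elim (<⇒≱ lt (p⊆q⇒∣p∣≤∣q∣ p⊆q))

  card>0⇒Nonempty : ∀ {n} (p : Subset n) → 1 ≤ ∣ p ∣ → Nonempty p
  card>0⇒Nonempty {n} p h with card-lt⇒new p ⊥ (subst (_< ∣ p ∣) (sym (∣⊥∣≡0 n)) h)
  ... | x , x∈ , _ = x , x∈

  elements : ∀ {n} → Subset n → List (Fin n)
  elements [] = []
  elements (inside ∷ p) = zero ∷ map suc (elements p)
  elements (outside ∷ p) = map suc (elements p)

  length-elements : ∀ {n} (p : Subset n) → length (elements p) ≡ ∣ p ∣
  length-elements [] = refl
  length-elements (inside ∷ p) = cong suc (trans (length-map suc (elements p)) (length-elements p))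
  length-elements (outside ∷ p) = trans (length-map suc (elements p)) (length-elements p)

  ∈-elements⁺ : ∀ {n} {x} {p : Subset n} → x ∈ p → x ∈ₗ elements p
  ∈-elements⁺ {p = inside ∷ p} here = here refl
  ∈-elements⁺ {p = inside ∷ p} (there x∈) = there (∈-map⁺ suc (∈-elements⁺ x∈))
  ∈-elements⁺ {p = outside ∷ p} (there x∈) = ∈-map⁺ suc (∈-elements⁺ x∈)

  ∈-elements⁻ : ∀ {n} {x} (p : Subset n) → x ∈ₗ elements p → x ∈ p
  ∈-elements⁻ (inside ∷ p) (here refl) = here
  ∈-elements⁻ (inside ∷ p) (there x∈) with ∈-map⁻ suc x∈
  ... | y , y∈ , refl = there (∈-elements⁻ p y∈)
  ∈-elements⁻ (outside ∷ p) x∈ with ∈-map⁻ suc x∈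
  ... | y , y∈ , refl = there (∈-elements⁻ p y∈)

  elements-unique : ∀ {n} (p : Subset n) → Unique (elements p)
  elements-unique [] = []
  elements-unique (inside ∷ p) = Allₚ.map⁺ (All.tabulate λ _ ()) ∷ Uniqueₚ.map⁺ Finₚ.suc-injective (elements-unique p)
  elements-unique (outside ∷ p) = Uniqueₚ.map⁺ Finₚ.suc-injective (elements-unique p)

  fromList : ∀ {n} → List (Fin n) → Subset n
  fromList xs = ⋃ (map ⁅_⁆ xs)

  ∈-fromList⁺ : ∀ {n} {x : Fin n} {xs} → x ∈ₗ xs → x ∈ fromList xs
  ∈-fromList⁺ {x = x} (here refl) = x∈p∪q⁺ (inj₁ (x∈⁅x⁆ x))
  ∈-fromList⁺ (there x∈) = x∈p∪q⁺ (inj₂ (∈-fromList⁺ x∈))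

  ∈-fromList⁻ : ∀ {n} {x : Fin n} xs → x ∈ fromList xs → x ∈ₗ xs
  ∈-fromList⁻ [] x∈ = ⊥-elim (∉⊥ x∈)
  ∈-fromList⁻ (y ∷ xs) x∈ with x∈p∪q⁻ ⁅ y ⁆ (fromList xs) x∈
  ... | inj₁ x∈y = here (x∈⁅y⁆⇒x≡y y x∈y)
  ... | inj₂ x∈xs = there (∈-fromList⁻ xs x∈xs)

  length≤∣p∣ : ∀ {n} {xs : List (Fin n)} {p : Subset n} → Unique xs → (∀ {x} → x ∈ₗ xs → x ∈ p) → length xs ≤ ∣ p ∣
  length≤∣p∣ {p = p} uxs sub = subst (_ ≤_) (length-elements p) (length-mono-⊆ uxs (∈-elements⁺ ∘ sub))

  ∣p∣≤length : ∀ {n} {xs : List (Fin n)} {p : Subset n} → (∀ {x} → x ∈ p → x ∈ₗ xs) → ∣ p ∣ ≤ length xs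
  ∣p∣≤length {p = p} sub = subst (_≤ _) (length-elements p) (length-mono-⊆ (elements-unique p) (sub ∘ ∈-elements⁻ p))

  ⋃-∈⁺ : ∀ {n} {x : Fin n} {S} {𝒜 : List (Subset n)} → S ∈ₗ 𝒜 → x ∈ S → x ∈ ⋃ 𝒜
  ⋃-∈⁺ (here refl) x∈ = x∈p∪q⁺ (inj₁ x∈)
  ⋃-∈⁺ (there S∈) x∈ = x∈p∪q⁺ (inj₂ (⋃-∈⁺ S∈ x∈))

  ⋃-∈⁻ : ∀ {n} {x : Fin n} (𝒜 : List (Subset n)) → x ∈ ⋃ 𝒜 → ∃[ S ] (S ∈ₗ 𝒜 × x ∈ S)
  ⋃-∈⁻ [] x∈ = ⊥-elim (∉⊥ x∈)
  ⋃-∈⁻ (S ∷ 𝒜) x∈ with x∈p∪q⁻ S (⋃ 𝒜) x∈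
  ... | inj₁ x∈S = S , here refl , x∈S
  ... | inj₂ x∈⋃ = let T , T∈ , x∈T = ⋃-∈⁻ 𝒜 x∈⋃ in T , there T∈ , x∈T

  ⋂-∈⁺ : ∀ {n} {x : Fin n} (𝒜 : List (Subset n)) → (∀ {S} → S ∈ₗ 𝒜 → x ∈ S) → x ∈ ⋂ 𝒜
  ⋂-∈⁺ [] h = ∈⊤
  ⋂-∈⁺ (S ∷ 𝒜) h = x∈p∩q⁺ (h (here refl) , ⋂-∈⁺ 𝒜 (h ∘ there))

  ⋂-∈⁻ : ∀ {n} {x : Fin n} {S} (𝒜 : List (Subset n)) → x ∈ ⋂ 𝒜 → S ∈ₗ 𝒜 → x ∈ S
  ⋂-∈⁻ (S ∷ 𝒜) x∈ (here refl) = proj₁ (x∈p∩q⁻ S (⋂ 𝒜) x∈)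
  ⋂-∈⁻ (S ∷ 𝒜) x∈ (there T∈) = ⋂-∈⁻ 𝒜 (proj₂ (x∈p∩q⁻ S (⋂ 𝒜) x∈)) T∈

  ∣⋃∣≤ : ∀ {n} (𝒜 : List (Subset n)) {t} → (∀ {S} → S ∈ₗ 𝒜 → ∣ S ∣ ≤ t) → ∣ ⋃ 𝒜 ∣ ≤ length 𝒜 * t
  ∣⋃∣≤ {n} [] h = ≤-reflexive (∣⊥∣≡0 n)
  ∣⋃∣≤ (S ∷ 𝒜) h = ≤-trans (∣p∪q∣≤ S (⋃ 𝒜)) (+-mono-≤ (h (here refl)) (∣⋃∣≤ 𝒜 (h ∘ there)))

  -- Enumerating the j-element subsets of a subset

  choose : ∀ {n} → Subset n → ℕ → List (Subset n)
  choose [] zero = [] ∷ []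
  choose [] (suc j) = []
  choose (outside ∷ U) j = map (outside ∷_) (choose U j)
  choose (inside ∷ U) zero = map (outside ∷_) (choose U zero)
  choose (inside ∷ U) (suc j) = map (inside ∷_) (choose U j) ++ map (outside ∷_) (choose U (suc j))

  length-choose : ∀ {n} (U : Subset n) j → length (choose U j) ≡ ∣ U ∣ C j
  length-choose [] zero = refl
  length-choose [] (suc j) = refl
  length-choose (outside ∷ U) j = trans (length-map _ (choose U j)) (length-choose U j)
  length-choose (inside ∷ U) zero = trans (length-map _ (choose U 0)) (length-choose U 0)
  length-choose (inside ∷ U) (suc j) = trans (length-++ (map (inside ∷_) (choose U j)))
    (trans (cong₂ _+_ (trans (length-map _ (choose U j)) (length-choose U j))
                      (trans (length-map _ (choose U (suc j))) (length-choose U (suc j))))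
           (sym (pascal ∣ U ∣ j)))

  choose-unique : ∀ {n} (U : Subset n) j → Unique (choose U j)
  choose-unique [] zero = [] ∷ []
  choose-unique [] (suc j) = []
  choose-unique (outside ∷ U) j = Uniqueₚ.map⁺ ∷-injectiveʳ (choose-unique U j)
  choose-unique (inside ∷ U) zero = Uniqueₚ.map⁺ ∷-injectiveʳ (choose-unique U 0)
  choose-unique (inside ∷ U) (suc j) = Uniqueₚ.++⁺ (Uniqueₚ.map⁺ ∷-injectiveʳ (choose-unique U j))
    (Uniqueₚ.map⁺ ∷-injectiveʳ (choose-unique U (suc j)))
    λ { (a , b) → case ∈-map⁻ _ a , ∈-map⁻ _ b of λ { ((_ , _ , refl) , (_ , _ , ())) } }

  ∈-choose⁻ : ∀ {n} {S} (U : Subset n) j → S ∈ₗ choose U j → S ⊆ U × ∣ S ∣ ≡ j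
  ∈-choose⁻ [] zero (here refl) = id , refl
  ∈-choose⁻ (outside ∷ U) j S∈ with ∈-map⁻ _ S∈
  ... | S , S∈′ , refl = let a , b = ∈-choose⁻ U j S∈′ in s⊆s a , b
  ∈-choose⁻ (inside ∷ U) zero S∈ with ∈-map⁻ _ S∈
  ... | S , S∈′ , refl = let a , b = ∈-choose⁻ U 0 S∈′ in out⊆ a , b
  ∈-choose⁻ (inside ∷ U) (suc j) S∈ with ∈-++⁻ (map (inside ∷_) (choose U j)) S∈
  ... | inj₁ S∈₁ with ∈-map⁻ _ S∈₁
  ...   | S , S∈′ , refl = let a , b = ∈-choose⁻ U j S∈′ in s⊆s a , cong suc b
  ∈-choose⁻ (inside ∷ U) (suc j) S∈ | inj₂ S∈₂ with ∈-map⁻ _ S∈₂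
  ...   | S , S∈′ , refl = let a , b = ∈-choose⁻ U (suc j) S∈′ in out⊆ a , b

  ∈-choose⁺ : ∀ {n} (S U : Subset n) → S ⊆ U → S ∈ₗ choose U ∣ S ∣
  ∈-choose⁺ [] [] _ = here refl
  ∈-choose⁺ (inside ∷ S) (outside ∷ U) sub = case sub here of λ ()
  ∈-choose⁺ (outside ∷ S) (outside ∷ U) sub = ∈-map⁺ _ (∈-choose⁺ S U (drop-∷-⊆ sub))
  ∈-choose⁺ (inside ∷ S) (inside ∷ U) sub = ∈-++⁺ˡ (∈-map⁺ _ (∈-choose⁺ S U (drop-∷-⊆ sub)))
  ∈-choose⁺ (outside ∷ S) (inside ∷ U) sub with ∣ S ∣ | ∈-choose⁺ S U (λ x∈ → drop-there (sub (there x∈)))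
  ... | zero  | S∈ = ∈-map⁺ _ S∈
  ... | suc j | S∈ = ∈-++⁺ʳ (map (inside ∷_) (choose U j)) (∈-map⁺ _ S∈)

  ∈-choose : ∀ {n j} {S U : Subset n} → S ⊆ U → ∣ S ∣ ≡ j → S ∈ₗ choose U j
  ∈-choose {S = S} {U} sub refl = ∈-choose⁺ S U sub

  subsets-unique : ∀ n → Unique (subsets n)
  subsets-unique zero = [] ∷ []
  subsets-unique (suc n) = Uniqueₚ.++⁺ (Uniqueₚ.map⁺ ∷-injectiveʳ (subsets-unique n))
    (Uniqueₚ.map⁺ ∷-injectiveʳ (subsets-unique n))
    λ { (a , b) → case ∈-map⁻ _ a , ∈-map⁻ _ b of λ { ((_ , _ , refl) , (_ , _ , ())) } }

  ∈-subsets : ∀ {n} (S : Subset n) → S ∈ₗ subsets n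
  ∈-subsets [] = here refl
  ∈-subsets (inside ∷ S) = ∈-++⁺ˡ (∈-map⁺ _ (∈-subsets S))
  ∈-subsets (outside ∷ S) = ∈-++⁺ʳ (map (inside ∷_) (subsets _)) (∈-map⁺ _ (∈-subsets S))

  kSubsets-unique : ∀ n k → Unique (kSubsets n k)
  kSubsets-unique n k = Uniqueₚ.filter⁺ _ (subsets-unique n)

  ∈-kSubsets⁺ : ∀ {n k} {S : Subset n} → ∣ S ∣ ≡ k → S ∈ₗ kSubsets n k
  ∈-kSubsets⁺ {S = S} eq = ∈-filter⁺ _ (∈-subsets S) eq

  ∈-kSubsets⁻ : ∀ {n k} {S : Subset n} → S ∈ₗ kSubsets n k → ∣ S ∣ ≡ k
  ∈-kSubsets⁻ {n} S∈ = proj₂ (∈-filter⁻ _ {xs = subsets n} S∈)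

  length-kSubsets : ∀ n k → length (kSubsets n k) ≡ n C k
  length-kSubsets n k = trans (≤-antisym
    (length-mono-⊆ (kSubsets-unique n k) (λ S∈ → ∈-choose (λ _ → ∈⊤) (∈-kSubsets⁻ S∈)))
    (length-mono-⊆ (choose-unique {n} ⊤ k) (λ S∈ → ∈-kSubsets⁺ (proj₂ (∈-choose⁻ {n} ⊤ k S∈)))))
    (trans (length-choose {n} ⊤ k) (cong (_C k) (∣⊤∣≡n n)))

  -- Sublists and maxSize

  ∈-sublists⁻ : {A : Set} {xs ys : List A} → ys ∈ₗ sublists xs → ∀ {x} → x ∈ₗ ys → x ∈ₗ xs
  ∈-sublists⁻ {xs = []} (here refl) ()
  ∈-sublists⁻ {xs = z ∷ xs} ys∈ x∈ with ∈-++⁻ (map (z ∷_) (sublists xs)) ys∈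
  ... | inj₂ ys∈′ = there (∈-sublists⁻ ys∈′ x∈)
  ... | inj₁ ys∈′ with ∈-map⁻ _ ys∈′
  ...   | zs , zs∈ , refl with x∈
  ...     | here refl = here refl
  ...     | there x∈zs = there (∈-sublists⁻ zs∈ x∈zs)

  sublists-unique : {A : Set} {xs ys : List A} → Unique xs → ys ∈ₗ sublists xs → Unique ys
  sublists-unique {xs = []} _ (here refl) = []
  sublists-unique {xs = z ∷ xs} (z∉ ∷ uxs) ys∈ with ∈-++⁻ (map (z ∷_) (sublists xs)) ys∈
  ... | inj₂ ys∈′ = sublists-unique uxs ys∈′
  ... | inj₁ ys∈′ with ∈-map⁻ _ ys∈′
  ...   | zs , zs∈ , refl = All.tabulate (λ x∈ → All.lookup z∉ (∈-sublists⁻ zs∈ x∈)) ∷ sublists-unique uxs zs∈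

  filter∈sublists : {A : Set} {P : Pred A 0ℓ} (P? : Decidable P) (xs : List A) → filter P? xs ∈ₗ sublists xs
  filter∈sublists P? [] = here refl
  filter∈sublists P? (x ∷ xs) with does (P? x)
  ... | true  = ∈-++⁺ˡ (∈-map⁺ _ (filter∈sublists P? xs))
  ... | false = ∈-++⁺ʳ (map (x ∷_) (sublists xs)) (filter∈sublists P? xs)

  module _ {A : Set} {P : Pred (List A) 0ℓ} (P? : Decidable P) where

    ≤maxSize : ∀ {xs ys} → ys ∈ₗ sublists xs → P ys → length ys ≤ maxSize P? xs
    ≤maxSize ys∈ pys = All.lookup (xs≤max 0 _) (∈-map⁺ length (∈-filter⁺ P? ys∈ pys))

    maxSize≤ : ∀ {xs b} → (∀ {ys} → ys ∈ₗ sublists xs → P ys → length ys ≤ b) → maxSize P? xs ≤ b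
    maxSize≤ {xs} h = max≤v⁺ z≤n (All.tabulate λ l∈ → case ∈-map⁻ length l∈ of λ
      { (ys , ys∈ , eq) → let a , b = ∈-filter⁻ P? {xs = sublists xs} ys∈ in subst (_≤ _) (sym eq) (h a b) })

    -- A value 0 may be the default of `maxSize`, so it need not be attained by a list satisfying
    -- `P`.
    maxSize-attained : ∀ xs → maxSize P? xs ≡ 0 ⊎ ∃[ ys ] (ys ∈ₗ sublists xs × P ys × length ys ≡ maxSize P? xs)
    maxSize-attained xs with argmax-sel id 0 (map length (filter P? (sublists xs)))
    ... | inj₁ eq = inj₁ eq
    ... | inj₂ m∈ with ∈-map⁻ length m∈
    ...   | ys , ys∈ , eq = let a , b = ∈-filter⁻ P? {xs = sublists xs} ys∈ in inj₂ (ys , a , b , sym eq)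

  module _ {A : Set} (_≟_ : DecidableEquality A) where
    open import Data.List.Membership.DecPropositional _≟_ using () renaming (_∈?_ to _∈ₗ?_)

    -- `sublists xs` holds only lists in the order of `xs`, so a list of members has to be
    -- rearranged before it can serve as a witness.
    asSublist : (xs ys : List A) → List A
    asSublist xs ys = filter (_∈ₗ? ys) xs

    module _ {xs ys : List A} (uxs : Unique xs) (uys : Unique ys) (sub : ∀ {y} → y ∈ₗ ys → y ∈ₗ xs) where

      asSublist∈ : asSublist xs ys ∈ₗ sublists xs
      asSublist∈ = filter∈sublists (_∈ₗ? ys) xs

      asSublist-unique : Unique (asSublist xs ys)
      asSublist-unique = Uniqueₚ.filter⁺ _ uxs

      ∈-asSublist⁻ : ∀ {x} → x ∈ₗ asSublist xs ys → x ∈ₗ ys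
      ∈-asSublist⁻ x∈ = proj₂ (∈-filter⁻ (_∈ₗ? ys) {xs = xs} x∈)

      ∈-asSublist⁺ : ∀ {x} → x ∈ₗ ys → x ∈ₗ asSublist xs ys
      ∈-asSublist⁺ x∈ = ∈-filter⁺ (_∈ₗ? ys) (sub x∈) x∈

      length-asSublist : length (asSublist xs ys) ≡ length ys
      length-asSublist = ≤-antisym (length-mono-⊆ asSublist-unique ∈-asSublist⁻) (length-mono-⊆ uys ∈-asSublist⁺)

  -- Flexible sets

  card≤1⇒≡ : ∀ {n} {p : Subset n} {x y} → ∣ p ∣ ≤ 1 → x ∈ p → y ∈ p → x ≡ y
  card≤1⇒≡ {p = p} {x} {y} h x∈ y∈ with x Fin.≟ y
  ... | yes x≡y = x≡y
  ... | no x≢y = ⊥-elim (<⇒≱ (length≤∣p∣ {xs = x ∷ y ∷ []} ((x≢y ∷ []) ∷ [] ∷ [])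
      (λ { (here refl) → x∈ ; (there (here refl)) → y∈ })) h)

  card≥2⇒≢ : ∀ {n} (p : Subset n) → 2 ≤ ∣ p ∣ → ∃[ x ] ∃[ y ] (x ∈ p × y ∈ p × x ≢ y)
  card≥2⇒≢ p h with card>0⇒Nonempty p (≤-trans (s≤s z≤n) h)
  ... | x , x∈ with card-lt⇒new p ⁅ x ⁆ (subst (_< ∣ p ∣) (sym (∣⁅x⁆∣≡1 x)) h)
  ...   | y , y∈ , y∉ = x , y , x∈ , y∈ , λ { refl → y∉ (x∈⁅x⁆ x) }

  module Flexibility {n : ℕ} (t : ℕ) (H : List (Subset n)) where

    -- K behaves like the kernel of a sunflower: members through K can be taken one after the other,
    -- each meeting the earlier ones only inside K, as long as their union fits into a set `W` of
    -- size `t`.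
    Flex : Subset n → Set
    Flex K = ∀ W → ∣ W ∣ ≤ t → Any (λ B → K ⊆ B × B ∩ W ⊆ K) H

    private
      avoids? : ∀ K W → Dec (Any (λ B → K ⊆ B × B ∩ W ⊆ K) H)
      avoids? K W = Any.any? (λ B → (K ⊆? B) ×-dec (B ∩ W ⊆? K)) H

      Blocked : Subset n → Subset n → Set
      Blocked K W = ∣ W ∣ ≤ t × ¬ Any (λ B → K ⊆ B × B ∩ W ⊆ K) H

      blocked? : ∀ K → Dec (∃[ W ] Blocked K W)
      blocked? K = anySubset? (λ W → (∣ W ∣ ≤? t) ×-dec ¬? (avoids? K W))

      ¬blocked⇒flex : ∀ K → ¬ (∃[ W ] Blocked K W) → Flex K
      ¬blocked⇒flex K ¬b W ∣W∣≤t with avoids? K W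
      ... | yes a = a
      ... | no ¬a = ⊥-elim (¬b (W , ∣W∣≤t , ¬a))

    abstract
      flex? : ∀ K → Dec (Flex K)
      flex? K with blocked? K
      ... | yes (W , ∣W∣≤t , ¬a) = no λ f → ¬a (f W ∣W∣≤t)
      ... | no ¬b = yes (¬blocked⇒flex K ¬b)

      -- For flexible `K` the value ⊥ is a placeholder; `obstacle-hits` speaks of inflexible `K`
      -- only.
      obstacle : Subset n → Subset n
      obstacle K with blocked? K
      ... | yes (W , _) = W
      ... | no _ = ⊥

      ∣obstacle∣≤ : ∀ K → ∣ obstacle K ∣ ≤ t
      ∣obstacle∣≤ K with blocked? K
      ... | yes (W , ∣W∣≤t , _) = ∣W∣≤t
      ... | no _ = subst (_≤ t) (sym (∣⊥∣≡0 n)) z≤n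

      -- This makes the members above inflexible sets countable: one further element of the member
      -- comes from a fixed set of at most `t` elements instead of from all n.
      obstacle-hits : ∀ {K B} → ¬ Flex K → B ∈ₗ H → K ⊆ B → ∃[ y ] (y ∈ B × y ∈ obstacle K × y ∉ K)
      obstacle-hits {K} {B} ¬f B∈ K⊆B with blocked? K
      ... | no ¬b = ⊥-elim (¬f (¬blocked⇒flex K ¬b))
      ... | yes (W , _ , ¬a) with ⊆-or-new (B ∩ W) K
      ...   | inj₁ sub = ⊥-elim (¬a (lose B∈ (K⊆B , sub)))
      ...   | inj₂ (y , y∈ , y∉) = let a , b = x∈p∩q⁻ B W y∈ in y , a , b , y∉

    flex-use : ∀ {K} → Flex K → ∀ W → ∣ W ∣ ≤ t → ∃[ B ] (B ∈ₗ H × K ⊆ B × (∀ {y} → y ∈ B → y ∈ W → y ∈ K))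
    flex-use f W h with find (f W h)
    ... | B , B∈ , K⊆B , sub = B , B∈ , K⊆B , λ a b → sub (x∈p∩q⁺ (a , b))

  -- Exchanging elements of a member for new ones

  module Moves {n : ℕ} (t : ℕ) where

    open Flexibility {n} t

    -- In a set that is not rigid, any two elements u, v allow a move: u, v or both can be
    -- exchanged. Admitting the double exchange makes rigid sets rare, since without it nothing
    -- would confine the first of the two elements to an obstacle.
    Rigid : List (Subset n) → Subset n → Set
    Rigid H A = ∃[ u ] ∃[ v ] ((u ∈ A × v ∈ A × u ≢ v) ×
      ¬ Flex H (A - u) × ¬ Flex H (A - v) × ¬ Flex H (A - u - v))

    abstract
      rigid? : ∀ H A → Dec (Rigid H A)
      rigid? H A = Finₚ.any? λ u → Finₚ.any? λ v →
        ((u ∈? A) ×-dec (v ∈? A) ×-dec ¬? (u Fin.≟ v)) ×-dec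
        ¬? (flex? H (A - u)) ×-dec ¬? (flex? H (A - v)) ×-dec ¬? (flex? H (A - u - v))

    -- Rigid members are removed in rounds, because each removal can make other members rigid. A
    -- member surviving `suc j` rounds can be moved within the survivors of `j` rounds, so it may
    -- start a chain of `suc j` moves.
    mobile : ℕ → List (Subset n) → List (Subset n)
    mobile zero H = H
    mobile (suc j) H = filter (¬? ∘ rigid? (mobile j H)) (mobile j H)

    mobile⊆ : ∀ j H {A} → A ∈ₗ mobile j H → A ∈ₗ H
    mobile⊆ zero H A∈ = A∈
    mobile⊆ (suc j) H A∈ = mobile⊆ j H (proj₁ (∈-filter⁻ (¬? ∘ rigid? (mobile j H)) {xs = mobile j H} A∈))

    mobile-unique : ∀ j H → Unique H → Unique (mobile j H)
    mobile-unique zero H u = u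
    mobile-unique (suc j) H u = Uniqueₚ.filter⁺ _ (mobile-unique j H u)

    -- A rigid A = Q ∪ {u, v} is reached from Q by two elements taken from obstacles.
    count-rigid : ∀ {k} H → Unique H → (∀ {A} → A ∈ₗ H → ∣ A ∣ ≡ suc (suc k)) →
                  count (rigid? H) H ≤ (n C k) * (t * t)
    count-rigid {k} H uH cardH = begin
      count (rigid? H) H                     ≤⟨ length-mono-⊆ (Uniqueₚ.filter⁺ _ uH) covered ⟩
      length (concatMap ext (kSubsets n k))  ≤⟨ length-concatMap-≤ ext (kSubsets n k) (λ {Q} _ → ext-length Q) ⟩
      length (kSubsets n k) * (t * t)        ≡⟨ cong (_* (t * t)) (length-kSubsets n k) ⟩
      (n C k) * (t * t)                      ∎
      where
      open ≤-Reasoning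
      ext₁ : Subset n → List (Subset n)
      ext₁ P = map (P ∪⁅_⁆) (elements (obstacle H P))
      ext : Subset n → List (Subset n)
      ext Q = concatMap (λ u → ext₁ (Q ∪⁅ u ⁆)) (elements (obstacle H Q))
      ext₁-length : ∀ P → length (ext₁ P) ≤ t
      ext₁-length P = ≤-trans (≤-reflexive (trans (length-map _ (elements (obstacle H P))) (length-elements (obstacle H P)))) (∣obstacle∣≤ H P)
      ext-length : ∀ Q → length (ext Q) ≤ t * t
      ext-length Q = ≤-trans (length-concatMap-≤ _ (elements (obstacle H Q)) (λ {u} _ → ext₁-length (Q ∪⁅ u ⁆)))
        (*-monoˡ-≤ t (≤-trans (≤-reflexive (length-elements (obstacle H Q))) (∣obstacle∣≤ H Q)))
      ∈-ext : ∀ {Q u P A} → u ∈ obstacle H Q → Q ∪⁅ u ⁆ ≡ P → A ∈ₗ ext₁ P → A ∈ₗ ext Q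
      ∈-ext {Q} u∈ refl A∈ = ∈-concatMap (λ u → ext₁ (Q ∪⁅ u ⁆)) (∈-elements⁺ u∈) A∈
      ∈-ext₁ : ∀ {A v} → A ∈ₗ H → v ∈ A → ¬ Flex H (A - v) → A ∈ₗ ext₁ (A - v)
      ∈-ext₁ {A} {v} A∈ v∈ ¬f with obstacle-hits H ¬f A∈ (x∈p-y⇒x∈p A v)
      ... | y , y∈A , y∈W , y∉ with y Fin.≟ v
      ...   | yes refl = subst (_∈ₗ ext₁ (A - v)) (sub-add A v∈) (∈-map⁺ ((A - v) ∪⁅_⁆) (∈-elements⁺ y∈W))
      ...   | no y≢v = ⊥-elim (y∉ (x∈p-y A y∈A y≢v))
      covered : ∀ {A} → A ∈ₗ filter (rigid? H) H → A ∈ₗ concatMap ext (kSubsets n k)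
      covered {A} A∈f with ∈-filter⁻ (rigid? H) {xs = H} A∈f
      ... | A∈ , u , v , (u∈ , v∈ , u≢v) , ¬fu , ¬fv , ¬fuv =
        ∈-concatMap ext {kSubsets n k} (∈-kSubsets⁺ ∣Q∣) A∈ext
        where
        v∈A-u : v ∈ A - u
        v∈A-u = x∈p-y A v∈ (u≢v ∘ sym)
        ∣Q∣ : ∣ A - u - v ∣ ≡ k
        ∣Q∣ = suc-injective (suc-injective (trans (cong suc (∣sub∣ (A - u) v∈A-u)) (trans (∣sub∣ A u∈) (cardH A∈))))
        swap : A - u - v ≡ A - v - u
        swap = p─x─y≡p─y─x A u v
        A∈ext : A ∈ₗ ext (A - u - v)
        A∈ext with obstacle-hits H ¬fuv A∈ (x∈p-y⇒x∈p A u ∘ x∈p-y⇒x∈p (A - u) v)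
        ... | y , y∈A , y∈W , y∉ with y Fin.≟ v | y Fin.≟ u
        ...   | yes refl | _ = ∈-ext {Q = A - u - v} y∈W (sub-add (A - u) v∈A-u) (∈-ext₁ A∈ u∈ ¬fu)
        ...   | no _ | yes refl = ∈-ext {Q = A - u - v} y∈W
                  (trans (cong (_∪⁅ u ⁆) swap) (sub-add (A - v) (x∈p-y A u∈ u≢v))) (∈-ext₁ A∈ v∈ ¬fv)
        ...   | no y≢v | no y≢u = ⊥-elim (y∉ (x∈p-y (A - u) (x∈p-y A y∈A y≢u) y≢v))

    length-mobile : ∀ {k} j H → Unique H → (∀ {A} → A ∈ₗ H → ∣ A ∣ ≡ suc (suc k)) →
                    length H ≤ length (mobile j H) + j * ((n C k) * (t * t))
    length-mobile zero H u c = m≤m+n _ _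
    length-mobile {k} (suc j) H u c = begin
      length H                                    ≤⟨ length-mobile j H u c ⟩
      length M + j * X                            ≡⟨ cong (_+ j * X) (count-split (rigid? M) M) ⟩
      count (rigid? M) M + length M′ + j * X      ≤⟨ +-monoˡ-≤ (j * X) (+-monoˡ-≤ (length M′)
                                                       (count-rigid M (mobile-unique j H u) (c ∘ mobile⊆ j H))) ⟩
      X + length M′ + j * X                       ≡⟨ cong (_+ j * X) (+-comm X (length M′)) ⟩
      length M′ + X + j * X                       ≡⟨ +-assoc (length M′) X (j * X) ⟩
      length M′ + suc j * X                       ∎
      where
      open ≤-Reasoning
      M = mobile j H
      M′ = mobile (suc j) H
      X = (n C k) * (t * t)

    -- One move away from A: one or two elements of O are replaced by elements outside W.
    record Move (H : List (Subset n)) (A O W : Subset n) : Set where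
      field
        kept moved : Subset n
        moved∈ : moved ∈ₗ H
        kept⊆moved : kept ⊆ moved
        kept⊆A : kept ⊆ A
        A⊆ : ∀ {y} → y ∈ A → y ∉ O → y ∈ kept
        new∉W : ∀ {y} → y ∈ moved → y ∈ W → y ∈ kept
        gone : Fin n
        gone∈O : gone ∈ O
        gone∉kept : gone ∉ kept
        ∣kept∣ : ∣ A ∣ ≤ 2 + ∣ kept ∣

    abstract
      -- Take two elements u, v of O. As A is not rigid in `mobile j H`, one of A - u, A - v, A - u
      -- - v is flexible there and supplies a member whose new elements avoid `W`.
      move : ∀ j H {A} O W → A ∈ₗ mobile (suc j) H → O ⊆ A → 2 ≤ ∣ O ∣ → ∣ W ∣ ≤ t → Move (mobile j H) A O W
      move j H {A} O W A∈ O⊆A ∣O∣ ∣W∣ with card≥2⇒≢ O ∣O∣ | ∈-filter⁻ (¬? ∘ rigid? (mobile j H)) {xs = mobile j H} A∈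
      ... | u , v , u∈O , v∈O , u≢v | A∈M , ¬rigid
        with flex? (mobile j H) (A - u) | flex? (mobile j H) (A - v) | flex? (mobile j H) (A - u - v)
      ... | yes f | _ | _ = let B , B∈ , K⊆B , new = flex-use (mobile j H) f W ∣W∣ in record
            { kept = A - u ; moved = B ; moved∈ = B∈ ; kept⊆moved = K⊆B ; kept⊆A = x∈p-y⇒x∈p A u
            ; A⊆ = λ y∈ y∉O → x∈p-y A y∈ (λ { refl → y∉O u∈O }) ; new∉W = new ; gone = u ; gone∈O = u∈O
            ; gone∉kept = x∉p-x A ; ∣kept∣ = ≤-trans (≤-reflexive (sym (∣sub∣ A (O⊆A u∈O)))) (n≤1+n _) }
      ... | no _ | yes f | _ = let B , B∈ , K⊆B , new = flex-use (mobile j H) f W ∣W∣ in record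
            { kept = A - v ; moved = B ; moved∈ = B∈ ; kept⊆moved = K⊆B ; kept⊆A = x∈p-y⇒x∈p A v
            ; A⊆ = λ y∈ y∉O → x∈p-y A y∈ (λ { refl → y∉O v∈O }) ; new∉W = new ; gone = v ; gone∈O = v∈O
            ; gone∉kept = x∉p-x A ; ∣kept∣ = ≤-trans (≤-reflexive (sym (∣sub∣ A (O⊆A v∈O)))) (n≤1+n _) }
      ... | no _ | no _ | yes f = let B , B∈ , K⊆B , new = flex-use (mobile j H) f W ∣W∣ in record
            { kept = A - u - v ; moved = B ; moved∈ = B∈ ; kept⊆moved = K⊆B
            ; kept⊆A = x∈p-y⇒x∈p A u ∘ x∈p-y⇒x∈p (A - u) v
            ; A⊆ = λ y∈ y∉O → x∈p-y (A - u) (x∈p-y A y∈ (λ { refl → y∉O u∈O })) (λ { refl → y∉O v∈O })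
            ; new∉W = new ; gone = v ; gone∈O = v∈O ; gone∉kept = x∉p-x (A - u)
            ; ∣kept∣ = ≤-reflexive (sym (trans (cong suc (∣sub∣ (A - u) (x∈p-y A (O⊆A v∈O) (u≢v ∘ sym)))) (∣sub∣ A (O⊆A u∈O)))) }
      ... | no ¬a | no ¬b | no ¬c = ⊥-elim (¬rigid (u , v , (O⊆A u∈O , O⊆A v∈O , u≢v) , ¬a , ¬b , ¬c))

    -- One element of O may be left over, because a move needs two elements of O to choose from.
    record Chained (H : List (Subset n)) (A O W : Subset n) : Set where
      field
        end : Subset n
        end∈ : end ∈ₗ H
        rest⊆end : ∀ {y} → y ∈ A → y ∉ O → y ∈ end
        ≤1-left : ∀ {y z} → y ∈ end → y ∈ O → z ∈ end → z ∈ O → y ≡ z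
        new∉W : ∀ {y} → y ∈ end → y ∈ W → y ∈ A

    abstract
      -- Every move takes at least one element, `gone`, out of O, so `j` moves bring `suc j`
      -- elements down to one. The inclusion O ⊆ W prevents lost elements from returning.
      chain : ∀ j H {A} O W → A ∈ₗ mobile j H → O ⊆ A → O ⊆ W → ∣ O ∣ ≤ suc j → ∣ W ∣ ≤ t → Chained H A O W
      chain j H {A} O W A∈ O⊆A O⊆W ∣O∣ ∣W∣ with 2 ≤? ∣ O ∣
      ... | no ≱2 = record { end = A ; end∈ = mobile⊆ j H A∈ ; rest⊆end = λ y∈ _ → y∈
                           ; ≤1-left = λ _ a _ b → card≤1⇒≡ {p = O} (≤-pred (≰⇒> ≱2)) a b ; new∉W = λ y∈ _ → y∈ }
      chain zero H O W A∈ O⊆A O⊆W ∣O∣ ∣W∣ | yes ≥2 = ⊥-elim (<⇒≱ ≥2 ∣O∣)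
      chain (suc j) H {A} O W A∈ O⊆A O⊆W ∣O∣ ∣W∣ | yes ≥2 = record
        { end = end ; end∈ = end∈
        ; rest⊆end = λ y∈ y∉O → rest⊆end (kept⊆moved (A⊆ y∈ y∉O)) (y∉O ∘ proj₁ ∘ x∈p∩q⁻ O kept)
        ; ≤1-left = λ y∈ y∈O z∈ z∈O → ≤1-left y∈ (left y∈ y∈O) z∈ (left z∈ z∈O)
        ; new∉W = λ y∈ y∈W → kept⊆A (M.new∉W (C.new∉W y∈ y∈W) y∈W) }
        where
        m : Move (mobile j H) A O W
        m = move j H O W A∈ O⊆A ≥2 ∣W∣
        module M = Move m
        open M hiding (new∉W)
        O′<O : ∣ O ∩ kept ∣ < ∣ O ∣
        O′<O = p⊂q⇒∣p∣<∣q∣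
          (proj₁ ∘ x∈p∩q⁻ O kept , gone , gone∈O , gone∉kept ∘ proj₂ ∘ x∈p∩q⁻ O kept)
        c : Chained H moved (O ∩ kept) W
        c = chain j H (O ∩ kept) W moved∈ (kept⊆moved ∘ proj₂ ∘ x∈p∩q⁻ O kept)
              (O⊆W ∘ proj₁ ∘ x∈p∩q⁻ O kept) (≤-pred (≤-trans O′<O ∣O∣)) ∣W∣
        module C = Chained c
        open C hiding (new∉W)
        left : ∀ {y} → y ∈ end → y ∈ O → y ∈ O ∩ kept
        left y∈ y∈O = x∈p∩q⁺ (y∈O , M.new∉W (C.new∉W y∈ (O⊆W y∈O)) (O⊆W y∈O))

  -- Cluster-free families, stars, and the constants of the structural argument

  record ClusterFreeFamily (n k : ℕ) : Set where
    field
      F         : List (Subset n)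
      unique    : Unique F
      card      : ∀ {A} → A ∈ₗ F → ∣ A ∣ ≡ k
      noCluster : ∀ {A B D} → A ∈ₗ F → B ∈ₗ F → D ∈ₗ F → A ≢ B → A ≢ D → B ≢ D →
                  ∣ A ∪ (B ∪ D) ∣ ≤ 2 * k → ¬ (∀ {y} → y ∈ A → y ∈ B → y ∉ D)

  ∣∪₃∣≤ : ∀ {n} (A B D Y : Subset n) {b} → A ⊆ Y → B ⊆ Y → D ⊆ Y → ∣ Y ∣ ≤ b → ∣ A ∪ (B ∪ D) ∣ ≤ b
  ∣∪₃∣≤ A B D Y a b c h = ≤-trans (p⊆q⇒∣p∣≤∣q∣ {p = A ∪ (B ∪ D)} {q = Y}
    (λ y∈ → [ a , [ b , c ]′ ∘ x∈p∪q⁻ B D ]′ (x∈p∪q⁻ A (B ∪ D) y∈))) h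

  infix 4 _∈ₗ?_
  _∈ₗ?_ : ∀ {n} (S : Subset n) (F : List (Subset n)) → Dec (S ∈ₗ F)
  S ∈ₗ? F = Any.any? (S ≟ˢ_) F

  -- The alternative x ∈ P makes this a condition on all (k-1)-sets, including those that x does not
  -- enlarge.
  InStar : ∀ {n} → List (Subset n) → Fin n → Subset n → Set
  InStar F x P = x ∈ P ⊎ P ∪⁅ x ⁆ ∈ₗ F

  abstract
    inStar? : ∀ {n} (F : List (Subset n)) x P → Dec (InStar F x P)
    inStar? F x P = (x ∈? P) ⊎-dec (P ∪⁅ x ⁆ ∈ₗ? F)

  -- abstract, since unfolding these constants makes type checking intractable.
  module Constants (r : ℕ) where

    abstract
      t₁ t₂ K₁ : ℕ
      -- `t₁` leaves room for the union of two members. `t₂` holds a member and the obstacles of its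
      -- k vertices. `K₁` stems from k rounds of removal, each costing at most t₂² times a binomial.
      t₁ = (3 + r) + (3 + r)
      t₂ = (3 + r) * t₁ + (3 + r)
      K₁ = (3 + r) * (t₂ * t₂)

      2k≤t₁ : (3 + r) + (3 + r) ≤ t₁
      2k≤t₁ = ≤-refl

      t₂-bound : (3 + r) * t₁ + (3 + r) ≤ t₂
      t₂-bound = ≤-refl

      K₁-bound : ∀ a → (3 + r) * (a * (t₂ * t₂)) ≤ K₁ * a
      K₁-bound a = ≤-reflexive (trans (cong ((3 + r) *_) (*-comm a (t₂ * t₂))) (sym (*-assoc (3 + r) (t₂ * t₂) a)))

    module _ (K₀ : ℕ) where

      abstract
        E K₃ K₄ : ℕ
        -- Multiplied by n^(k-2), `E` bounds the (k-1)-sets missed by the map `p₁` below, and `K₄`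
        -- the uncoloured ones. `K₃` bounds the number of flexible vertices; its last factor stems
        -- from counting pairs of such a vertex and a (k-1)-set through it.
        E = K₀ + K₁
        K₃ = 2 ^ (1 + r) * (1 + r) ! * (2 * E * (2 + r))
        K₄ = K₀ + K₁ + E + K₃ * t₁

        E-def : E ≡ K₀ + K₁
        E-def = refl

        K₃-def : K₃ ≡ 2 ^ (1 + r) * (1 + r) ! * (2 * E * (2 + r))
        K₃-def = refl

        K₄-def : K₄ ≡ K₀ + K₁ + E + K₃ * t₁
        K₄-def = refl

  -- All but O(n^{k-2}) members contain a flexible vertex

  module Centres {r n : ℕ} (𝓕 : ClusterFreeFamily n (3 + r)) where

    open ClusterFreeFamily 𝓕

    k : ℕ
    k = 3 + r

    open Constants r public

    open Flexibility {n} t₁ F public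

    abstract
      𝒞 : Subset n
      𝒞 = fromList (filter (λ x → flex? ⁅ x ⁆) (allFin n))

      ∈𝒞⁺ : ∀ {x} → Flex ⁅ x ⁆ → x ∈ 𝒞
      ∈𝒞⁺ {x} f = ∈-fromList⁺ (∈-filter⁺ (λ x → flex? ⁅ x ⁆) (∈-allFin x) f)

      ∈𝒞⁻ : ∀ {x} → x ∈ 𝒞 → Flex ⁅ x ⁆
      ∈𝒞⁻ x∈ = proj₂ (∈-filter⁻ (λ x → flex? ⁅ x ⁆) {xs = allFin n} (∈-fromList⁻ _ x∈))

    -- Otherwise A, A′ and a set meeting A ∪ A′ only in x would form a cluster.
    own : ∀ {x A A′} → x ∈ 𝒞 → A ∈ₗ F → x ∈ A → A′ ∈ₗ F → A - x ⊆ A′ → A ≡ A′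
    own {x} {A} {A′} x∈𝒞 A∈ x∈A A′∈ sub with x ∈? A′
    ... | yes x∈A′ = ⊆-card-≡ (λ {y} y∈ → case y Fin.≟ x of λ { (yes refl) → x∈A′ ; (no y≢x) → sub (x∈p-y A y∈ y≢x) })
                      (≤-reflexive (trans (card A′∈) (sym (card A∈))))
    ... | no x∉A′ with flex-use (∈𝒞⁻ x∈𝒞) A′ (≤-trans (≤-reflexive (card A′∈)) (≤-trans (m≤m+n k k) 2k≤t₁))
    ...   | B , B∈ , x⊆B , new = ⊥-elim (noCluster A∈ A′∈ B∈ A≢A′ A≢B A′≢B
            (∣∪₃∣≤ A A′ B (A′ ∪ B) A⊆ (λ y∈ → x∈p∪q⁺ (inj₁ y∈)) (λ y∈ → x∈p∪q⁺ (inj₂ y∈))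
              (≤-trans (∣p∪q∣≤ A′ B) (≤-reflexive (cong₂ _+_ (card A′∈) (trans (card B∈) (sym (+-identityʳ k)))))))
            (λ _ y∈A′ y∈B → disj y∈A′ y∈B))
      where
      x∈B = x⊆B (x∈⁅x⁆ x)
      disj : ∀ {y} → y ∈ A′ → y ∉ B
      disj y∈A′ y∈B = x∉A′ (subst (_∈ A′) (x∈⁅y⁆⇒x≡y x (new y∈B y∈A′)) y∈A′)
      A⊆ : A ⊆ A′ ∪ B
      A⊆ {y} y∈ with y Fin.≟ x
      ... | yes refl = x∈p∪q⁺ (inj₂ x∈B)
      ... | no y≢x = x∈p∪q⁺ (inj₁ (sub (x∈p-y A y∈ y≢x)))
      A≢A′ : A ≢ A′
      A≢A′ refl = x∉A′ x∈A
      A′≢B : A′ ≢ B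
      A′≢B refl = x∉A′ x∈B
      A≢B : A ≢ B
      A≢B refl with card>0⇒Nonempty (A - x) (≤-pred (subst (2 ≤_) (sym (trans (∣sub∣ A x∈A) (card A∈))) (s≤s (s≤s z≤n))))
      ... | y , y∈ = disj (sub y∈) (x∈p-y⇒x∈p A x y∈)

    meets? : ∀ S → Dec (Nonempty (S ∩ 𝒞))
    meets? S = nonempty? (S ∩ 𝒞)

    private
      open Moves {n} t₂ using (mobile; length-mobile; mobile⊆; move; chain; Move; module Move; Chained; module Chained)

      F₀ = filter (¬? ∘ meets?) F

      F₀⁻ : ∀ {A} → A ∈ₗ F₀ → A ∈ₗ F × ¬ Nonempty (A ∩ 𝒞)
      F₀⁻ = ∈-filter⁻ (¬? ∘ meets?) {xs = F}

      card₀ : ∀ {A} → A ∈ₗ F₀ → ∣ A ∣ ≡ k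
      card₀ A∈ = card (proj₁ (F₀⁻ A∈))

      -- A passes to `moved` by one move, and from there to `end` by a chain that clears `kept`.
      -- Then `moved` ⊆ A ∪ `end`, and as soon as A and `end` are known to be disjoint, the three
      -- sets form a cluster.
      module Collision {A W} (A∈F₀ : A ∈ₗ F₀) (A⊆W : A ⊆ W) (obs⊆W : ∀ {x} → x ∈ A → obstacle ⁅ x ⁆ ⊆ W)
                       {H} (H⊆F₀ : ∀ {S} → S ∈ₗ H → S ∈ₗ F₀) (m : Move H A A W)
                       (c : Chained F₀ (Move.moved m) (Move.kept m) W) where
        module M = Move m
        open M hiding (new∉W)
        module Ch = Chained c
        open Ch hiding (new∉W)
        A∈F = proj₁ (F₀⁻ A∈F₀)
        end∈F = proj₁ (F₀⁻ end∈)
        moved∈F = proj₁ (F₀⁻ (H⊆F₀ moved∈))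

        common : ∀ {y} → y ∈ A → y ∈ end → y ∈ kept
        common y∈A y∈end = M.new∉W (Ch.new∉W y∈end (A⊆W y∈A)) (A⊆W y∈A)

        -- As A has no flexible vertex, x is inflexible. If `end` contained x, it would contain
        -- another element of the obstacle of x; that element lies in W, hence in `kept`, but the
        -- chain leaves at most one element of `kept`.
        meeting : ∀ {x} → x ∈ kept → x ∉ end
        meeting {x} x∈kept x∈end = y∉x (subst (_∈ ⁅ x ⁆) (≤1-left x∈end x∈kept y∈end y∈kept) (x∈⁅x⁆ x))
          where
          hit : ∃[ y ] (y ∈ end × y ∈ obstacle ⁅ x ⁆ × y ∉ ⁅ x ⁆)
          hit = obstacle-hits (λ f → proj₂ (F₀⁻ A∈F₀) (x , x∈p∩q⁺ (kept⊆A x∈kept , ∈𝒞⁺ f))) end∈F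
                  (λ y∈ → subst (_∈ end) (sym (x∈⁅y⁆⇒x≡y x y∈)) x∈end)
          y∈end = proj₁ (proj₂ hit)
          y∉x = proj₂ (proj₂ (proj₂ hit))
          y∈W = obs⊆W (kept⊆A x∈kept) (proj₁ (proj₂ (proj₂ hit)))
          y∈kept = M.new∉W (Ch.new∉W y∈end y∈W) y∈W

        moved⊆ : moved ⊆ A ∪ end
        moved⊆ {y} y∈ = case y ∈? kept of λ
          { (yes y∈K) → x∈p∪q⁺ (inj₁ (kept⊆A y∈K)) ; (no y∉K) → x∈p∪q⁺ (inj₂ (rest⊆end y∈ y∉K)) }

        -- `gone` distinguishes A from `moved`. An element of `kept` lies in both but not in `end`,
        -- so it distinguishes these two from `end`; hence the three sets are distinct once `kept`
        -- is nonempty.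
        contradictory : ∀ {e} → e ∉ kept
        contradictory {e} e∈ = noCluster A∈F moved∈F end∈F
          (λ eq → gone∉kept (M.new∉W (subst (gone ∈_) eq gone∈O) (A⊆W gone∈O)))
          (λ eq → meeting e∈ (subst (e ∈_) eq (kept⊆A e∈)))
          (λ eq → meeting e∈ (subst (e ∈_) eq (kept⊆moved e∈)))
          (∣∪₃∣≤ A moved end (A ∪ end) (x∈p∪q⁺ ∘ inj₁) moved⊆ (x∈p∪q⁺ ∘ inj₂)
            (≤-trans (∣p∪q∣≤ A end) (≤-reflexive (cong₂ _+_ (card A∈F) (trans (card end∈F) (sym (+-identityʳ k)))))))
          (λ y∈A _ y∈end → meeting (common y∈A y∈end) y∈end)

      -- One move and a chain of `2 + r` further moves account for the k rounds, as `kept` has at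
      -- most k elements. A move takes at most two elements, so k ≥ 3 keeps `kept` nonempty.
      immobile : ∀ {A} → A ∉ₗ mobile k F₀
      immobile {A} A∈ = Collision.contradictory A∈F₀ A⊆W obs⊆W (mobile⊆ (2 + r) F₀) m c
                          (proj₂ (card>0⇒Nonempty (Move.kept m) 0<∣kept∣))
        where
        A∈F₀ = mobile⊆ k F₀ A∈
        ∣A∣ = card₀ A∈F₀
        obs = map (λ x → obstacle ⁅ x ⁆) (elements A)
        W = ⋃ obs ∪ A
        A⊆W : A ⊆ W
        A⊆W y∈ = x∈p∪q⁺ (inj₂ y∈)
        obs⊆W : ∀ {x} → x ∈ A → obstacle ⁅ x ⁆ ⊆ W
        obs⊆W x∈ y∈ = x∈p∪q⁺ (inj₁ (⋃-∈⁺ (∈-map⁺ (λ x → obstacle ⁅ x ⁆) (∈-elements⁺ x∈)) y∈))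
        ∣W∣ : ∣ W ∣ ≤ t₂
        ∣W∣ = ≤-trans (≤-trans (∣p∪q∣≤ (⋃ obs) A) (+-mono-≤
          (subst (λ l → ∣ ⋃ obs ∣ ≤ l * t₁) (trans (length-map _ (elements A)) (trans (length-elements A) ∣A∣))
            (∣⋃∣≤ obs λ S∈ → case ∈-map⁻ _ S∈ of λ { (x , _ , refl) → ∣obstacle∣≤ ⁅ x ⁆ }))
          (≤-reflexive ∣A∣))) t₂-bound
        m : Move (mobile (2 + r) F₀) A A W
        m = move (2 + r) F₀ A W A∈ id (subst (2 ≤_) (sym ∣A∣) (s≤s (s≤s z≤n))) ∣W∣
        c : Chained F₀ (Move.moved m) (Move.kept m) W
        c = chain (2 + r) F₀ (Move.kept m) W (Move.moved∈ m) (Move.kept⊆moved m) (A⊆W ∘ Move.kept⊆A m)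
              (≤-trans (p⊆q⇒∣p∣≤∣q∣ {p = Move.kept m} {A} (Move.kept⊆A m)) (≤-reflexive ∣A∣)) ∣W∣
        0<∣kept∣ : 1 ≤ ∣ Move.kept m ∣
        0<∣kept∣ = +-cancelˡ-≤ 2 1 ∣ Move.kept m ∣ (≤-trans (subst (3 ≤_) (sym ∣A∣) (s≤s (s≤s (s≤s z≤n)))) (Move.∣kept∣ m))

    count-centreless : count (¬? ∘ meets?) F ≤ K₁ * n ^ (1 + r)
    count-centreless = begin
      length F₀                                                 ≤⟨ length-mobile k F₀ (Uniqueₚ.filter⁺ _ unique) card₀ ⟩
      length (mobile k F₀) + k * ((n C (1 + r)) * (t₂ * t₂))   ≡⟨ cong (λ l → length l + k * ((n C (1 + r)) * (t₂ * t₂))) (empty (mobile k F₀) immobile) ⟩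
      k * ((n C (1 + r)) * (t₂ * t₂))                          ≤⟨ K₁-bound (n C (1 + r)) ⟩
      K₁ * (n C (1 + r))                                       ≤⟨ *-monoʳ-≤ K₁ (C≤^ n (1 + r)) ⟩
      K₁ * n ^ (1 + r)                                          ∎
      where
      open ≤-Reasoning
      empty : ∀ (xs : List (Subset n)) → (∀ {x} → x ∉ₗ xs) → xs ≡ []
      empty [] _ = refl
      empty (x ∷ xs) h = ⊥-elim (h (here refl))

  -- Colouring the (k-1)-sets by flexible vertices

  length-allFin : ∀ n → length (allFin n) ≡ n
  length-allFin n = length-tabulate {n = n} id

  add-injective : ∀ {n} {x : Fin n} {p q : Subset n} → x ∉ p → x ∉ q → p ∪⁅ x ⁆ ≡ q ∪⁅ x ⁆ → p ≡ q
  add-injective {x = x} {p} {q} x∉p x∉q eq = ⊆-antisym (half x∉p eq) (half x∉q (sym eq))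
    where
    half : ∀ {p q} → x ∉ p → p ∪⁅ x ⁆ ≡ q ∪⁅ x ⁆ → p ⊆ q
    half {p} {q} x∉ eq {y} y∈ with ∈-add⁻ q (subst (y ∈_) eq (⊆-add p y∈))
    ... | inj₁ y∈q = y∈q
    ... | inj₂ refl = ⊥-elim (x∉ y∈)

  count-⊎ : {A : Set} {P Q R : A → Set} (P? : Decidable P) (Q? : Decidable Q) (R? : Decidable R) (xs : List A) →
            (∀ {x} → x ∈ₗ xs → R x → P x ⊎ Q x) → count R? xs ≤ count P? xs + count Q? xs
  count-⊎ P? Q? R? [] h = z≤n
  count-⊎ P? Q? R? (x ∷ xs) h with R? x | P? x | Q? x | count-⊎ P? Q? R? xs (h ∘ there)
  ... | no _ | yes _ | yes _ | ih = m≤n⇒m≤1+n (≤-trans ih (+-monoʳ-≤ (count P? xs) (n≤1+n _)))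
  ... | no _ | yes _ | no _ | ih = m≤n⇒m≤1+n ih
  ... | no _ | no _ | yes _ | ih = ≤-trans ih (+-monoʳ-≤ (count P? xs) (n≤1+n _))
  ... | no _ | no _ | no _ | ih = ih
  ... | yes _ | yes _ | yes _ | ih = s≤s (≤-trans ih (+-monoʳ-≤ (count P? xs) (n≤1+n _)))
  ... | yes _ | yes _ | no _ | ih = s≤s ih
  ... | yes _ | no _ | yes _ | ih = ≤-trans (s≤s ih) (≤-reflexive (sym (+-suc (count P? xs) (count Q? xs))))
  ... | yes z | no ¬p | no ¬q | ih with h (here refl) z
  ...   | inj₁ p = ⊥-elim (¬p p)
  ...   | inj₂ q = ⊥-elim (¬q q)

  private
    -- `p` counts all (k-1)-sets, `col` and `unc` the coloured and the uncoloured ones, `f` the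
    -- members. Three of the four classes of members are O(N), and the last injects into the
    -- coloured sets; what is missing from `p` then bounds `unc`.
    combine : ∀ a b c d N {p col unc f f₀ f₂ i g} → p ≡ col + unc → p ≤ f + a * N → f ≤ f₀ + (f₂ + (i + g)) →
              f₀ ≤ b * N → f₂ ≤ c * N → i ≤ d * N → g ≤ col → unc ≤ (a + b + c + d) * N
    combine a b c d N {p} {col} {unc} {f} {f₀} {f₂} {i} {g} eq h hf h₀ h₂ hi hg = +-cancelˡ-≤ col _ _ (begin
      col + unc                                        ≡⟨ sym eq ⟩
      p                                                ≤⟨ h ⟩
      f + a * N                                        ≤⟨ +-monoˡ-≤ (a * N) hf ⟩
      f₀ + (f₂ + (i + g)) + a * N                      ≤⟨ +-monoˡ-≤ (a * N) (+-mono-≤ h₀ (+-mono-≤ h₂ (+-mono-≤ hi hg))) ⟩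
      b * N + (c * N + (d * N + col)) + a * N          ≡⟨ regroup a b c d N col ⟩
      col + (a + b + c + d) * N                        ∎)
      where
      open ≤-Reasoning
      regroup : ∀ a b c d N g → b * N + (c * N + (d * N + g)) + a * N ≡ g + (a + b + c + d) * N
      regroup = solve-∀

  length-++₄ : {A : Set} (as bs cs ds : List A) →
               length (as ++ bs ++ cs ++ ds) ≡ length as + (length bs + (length cs + length ds))
  length-++₄ as bs cs ds = trans (length-++ as) (cong (length as +_) (trans (length-++ bs) (cong (length bs +_) (length-++ cs))))

  module Colouring {r n : ℕ} (𝓕 : ClusterFreeFamily n (3 + r)) (K₀ : ℕ)
                   (large : n C (2 + r) ≤ length (ClusterFreeFamily.F 𝓕) + K₀ * n ^ (1 + r))
                   (n≥ : 4 + 2 * r ≤ n) where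

    open ClusterFreeFamily 𝓕
    open Centres {r} {n} 𝓕 hiding (E; K₃; K₄; E-def; K₃-def; K₄-def)
    open Constants r using () renaming (E to Eᶜ; K₃ to K₃ᶜ; K₄ to K₄ᶜ; E-def to E-defᶜ; K₃-def to K₃-defᶜ; K₄-def to K₄-defᶜ)

    E K₃ K₄ : ℕ
    E = Eᶜ K₀
    K₃ = K₃ᶜ K₀
    K₄ = K₄ᶜ K₀

    private
      N = n ^ (1 + r)
      Ps = kSubsets n (2 + r)

      instance
        n≢0 : NonZero n
        n≢0 = >-nonZero (≤-trans (s≤s z≤n) n≥)
        N≢0 : NonZero N
        N≢0 = m^n≢0 n (1 + r)

      -- The set S searched for a flexible vertex may differ from the set A it is removed from: `p₂`
      -- searches `p₁ A` and removes from A.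
      removeOne : ∀ A {S} → Dec (Nonempty (S ∩ 𝒞)) → Subset n
      removeOne A (yes (x , _)) = A - x
      removeOne A (no _) = A

      removeOne-spec : ∀ A {S} (d : Dec (Nonempty (S ∩ 𝒞))) → Nonempty (S ∩ 𝒞) →
                       ∃[ x ] (x ∈ S × x ∈ 𝒞 × removeOne A d ≡ A - x)
      removeOne-spec A {S} (yes (x , x∈)) _ = let a , b = x∈p∩q⁻ S 𝒞 x∈ in x , a , b , refl
      removeOne-spec A (no ¬m) m = ⊥-elim (¬m m)

      abstract
        p₁ p₂ : Subset n → Subset n
        p₁ A = removeOne A (meets? A)
        p₂ A = removeOne A (meets? (p₁ A))

        p₁-spec : ∀ {A} → Nonempty (A ∩ 𝒞) → ∃[ x ] (x ∈ A × x ∈ 𝒞 × p₁ A ≡ A - x)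
        p₁-spec {A} = removeOne-spec A (meets? A)

        p₂-spec : ∀ {A} → Nonempty (p₁ A ∩ 𝒞) → ∃[ x ] (x ∈ p₁ A × x ∈ 𝒞 × p₂ A ≡ A - x)
        p₂-spec {A} = removeOne-spec A (meets? (p₁ A))

      F₁ = filter meets? F
      F₂ = filter (meets? ∘ p₁) F₁

      F₁⁻ : ∀ {A} → A ∈ₗ F₁ → A ∈ₗ F × Nonempty (A ∩ 𝒞)
      F₁⁻ = ∈-filter⁻ meets? {xs = F}

      F₂⁻ : ∀ {A} → A ∈ₗ F₂ → A ∈ₗ F₁ × Nonempty (p₁ A ∩ 𝒞)
      F₂⁻ = ∈-filter⁻ (meets? ∘ p₁) {xs = F₁}

      image? : ∀ P → Dec (P ∈ₗ map p₁ F₁)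
      image? P = P ∈ₗ? map p₁ F₁

      own′ : ∀ {x x′ A A′} → x ∈ 𝒞 → A ∈ₗ F → x ∈ A → A′ ∈ₗ F → A - x ≡ A′ - x′ → A ≡ A′
      own′ {x′ = x′} {A′ = A′} x∈𝒞 A∈ x∈ A′∈ eq = own x∈𝒞 A∈ x∈ A′∈ λ {y} y∈ → x∈p-y⇒x∈p A′ x′ (subst (y ∈_) eq y∈)

      ∣A-x∣ : ∀ {A x} → A ∈ₗ F → x ∈ A → ∣ A - x ∣ ≡ 2 + r
      ∣A-x∣ {A} A∈ x∈ = suc-injective (trans (∣sub∣ A x∈) (card A∈))

      p₁∈Ps : ∀ {A} → A ∈ₗ F₁ → p₁ A ∈ₗ Ps
      p₁∈Ps A∈₁ with F₁⁻ A∈₁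
      ... | A∈ , m with p₁-spec m
      ...   | x , x∈ , _ , eq = ∈-kSubsets⁺ (trans (cong ∣_∣ eq) (∣A-x∣ A∈ x∈))

      p₁-injective : ∀ {A A′} → A ∈ₗ F₁ → A′ ∈ₗ F₁ → p₁ A ≡ p₁ A′ → A ≡ A′
      p₁-injective A∈₁ A′∈₁ eq with F₁⁻ A∈₁ | F₁⁻ A′∈₁
      ... | A∈ , m | A′∈ , m′ with p₁-spec m | p₁-spec m′
      ...   | x , x∈ , x∈𝒞 , e | x′ , _ , _ , e′ = own′ x∈𝒞 A∈ x∈ A′∈ (trans (sym e) (trans eq e′))

      length-F₁ : length F₁ ≤ count image? Ps
      length-F₁ = length-≤-inj p₁ (Uniqueₚ.filter⁺ meets? unique)
        (λ A∈ → ∈-filter⁺ image? (p₁∈Ps A∈) (∈-map⁺ p₁ A∈)) p₁-injective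

      p₂-data : ∀ {A} → A ∈ₗ F₂ → ∃[ x ] (A ∈ₗ F × x ∈ A × x ∈ 𝒞 × x ∈ p₁ A × p₂ A ≡ A - x)
      p₂-data {A} A∈₂ with F₂⁻ A∈₂
      ... | A∈₁ , m₂ with F₁⁻ A∈₁ | p₂-spec m₂
      ...   | A∈ , m | x , x∈p₁ , x∈𝒞 , e with p₁-spec m
      ...     | x′ , _ , _ , e′ = x , A∈ , x∈p-y⇒x∈p A x′ (subst (x ∈_) e′ x∈p₁) , x∈𝒞 , x∈p₁ , e

      -- `p₁` misses the set `p₂ A`: if it were `p₁ A′`, then `own` would give A ≡ A′, but the
      -- vertex removed in `p₂ A` is still present in `p₁ A`. So a member with two flexible vertices
      -- wastes a (k-1)-set.
      length-F₂ : length F₂ ≤ count (¬? ∘ image?) Ps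
      length-F₂ = length-≤-inj p₂ (Uniqueₚ.filter⁺ _ (Uniqueₚ.filter⁺ meets? unique)) into inj
        where
        inj : ∀ {A A′} → A ∈ₗ F₂ → A′ ∈ₗ F₂ → p₂ A ≡ p₂ A′ → A ≡ A′
        inj A∈₂ A′∈₂ eq with p₂-data A∈₂ | p₂-data A′∈₂
        ... | x , A∈ , x∈ , x∈𝒞 , _ , e | x′ , A′∈ , _ , _ , _ , e′ = own′ x∈𝒞 A∈ x∈ A′∈ (trans (sym e) (trans eq e′))
        into : ∀ {A} → A ∈ₗ F₂ → p₂ A ∈ₗ filter (¬? ∘ image?) Ps
        into {A} A∈₂ with p₂-data A∈₂
        ... | x , A∈ , x∈ , x∈𝒞 , x∈p₁ , e = ∈-filter⁺ (¬? ∘ image?) (∈-kSubsets⁺ (trans (cong ∣_∣ e) (∣A-x∣ A∈ x∈))) not-image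
          where
          not-image : p₂ A ∉ₗ map p₁ F₁
          not-image p₂∈ with ∈-map⁻ p₁ p₂∈
          ... | A′ , A′∈₁ , eq with F₁⁻ A′∈₁
          ...   | A′∈ , m′ with p₁-spec m′
          ...     | x′ , _ , _ , e′ with own′ x∈𝒞 A∈ x∈ A′∈ (trans (sym e) (trans eq e′))
          ...       | refl = x∉p-x A (subst (x ∈_) (trans (sym eq) e) x∈p₁)

      abstract
        -- By `large` the family is nearly as large as the collection of all (k-1)-sets, and `p₁` is
        -- injective on all but few members; hence it misses few sets.
        nonimages : count (¬? ∘ image?) Ps ≤ E * N
        nonimages = +-cancelˡ-≤ (count image? Ps) _ _ (begin
          count image? Ps + count (¬? ∘ image?) Ps      ≡⟨ sym (count-split image? Ps) ⟩
          length Ps                                     ≡⟨ length-kSubsets n (2 + r) ⟩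
          n C (2 + r)                                   ≤⟨ large ⟩
          length F + K₀ * N                             ≡⟨ cong (_+ K₀ * N) (count-split meets? F) ⟩
          length F₁ + count (¬? ∘ meets?) F + K₀ * N    ≤⟨ +-monoˡ-≤ (K₀ * N) (+-mono-≤ length-F₁ count-centreless) ⟩
          count image? Ps + K₁ * N + K₀ * N             ≡⟨ rearrange (count image? Ps) K₁ K₀ N ⟩
          count image? Ps + (K₀ + K₁) * N               ≡⟨ cong (λ e → count image? Ps + e * N) (sym (E-defᶜ K₀)) ⟩
          count image? Ps + E * N                       ∎)
          where
          open ≤-Reasoning
          rearrange : ∀ a b c d → a + b * d + c * d ≡ a + (c + b) * d
          rearrange = solve-∀

        -- A (k-1)-set with a flexible vertex is missed by `p₁`, or it is `p₁ A` for a member A with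
        -- a second flexible vertex. `nonimages` bounds both kinds.
        count-meets : count meets? Ps ≤ 2 * E * N
        count-meets = begin
          count meets? Ps                                               ≤⟨ length-mono-⊆ (Uniqueₚ.filter⁺ meets? (kSubsets-unique n (2 + r))) covered ⟩
          length (filter (¬? ∘ image?) Ps ++ map p₁ F₂)                 ≡⟨ length-++ (filter (¬? ∘ image?) Ps) ⟩
          count (¬? ∘ image?) Ps + length (map p₁ F₂)                   ≡⟨ cong (count (¬? ∘ image?) Ps +_) (length-map p₁ F₂) ⟩
          count (¬? ∘ image?) Ps + length F₂                            ≤⟨ +-mono-≤ nonimages (≤-trans length-F₂ nonimages) ⟩
          E * N + E * N                                                 ≡⟨ double E N ⟩
          2 * E * N                                                     ∎
          where
          open ≤-Reasoning
          double : ∀ a b → a * b + a * b ≡ 2 * a * b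
          double = solve-∀
          covered : ∀ {P} → P ∈ₗ filter meets? Ps → P ∈ₗ filter (¬? ∘ image?) Ps ++ map p₁ F₂
          covered {P} P∈f with ∈-filter⁻ meets? {xs = Ps} P∈f
          ... | P∈ , m with image? P
          ...   | no ¬im = ∈-++⁺ˡ (∈-filter⁺ (¬? ∘ image?) P∈ ¬im)
          ...   | yes im with ∈-map⁻ p₁ im
          ...     | A , A∈₁ , refl = ∈-++⁺ʳ (filter (¬? ∘ image?) Ps) (∈-map⁺ p₁ (∈-filter⁺ (meets? ∘ p₁) A∈₁ m))

        -- Each flexible vertex lies in C(n-1, k-2) of the sets counted by `count-meets`, which is
        -- the order of the bound there, and each such set holds at most k - 1 of these vertices. So
        -- their number is bounded independently of n.
        ∣𝒞∣≤ : ∣ 𝒞 ∣ ≤ K₃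
        ∣𝒞∣≤ = *-cancelʳ-≤ ∣ 𝒞 ∣ K₃ N (begin
          ∣ 𝒞 ∣ * N                                          ≤⟨ *-monoʳ-≤ ∣ 𝒞 ∣ (^≤C {n} {n ∸ 1} (1 + r) n-big) ⟩
          ∣ 𝒞 ∣ * (D * c)                                    ≡⟨ swap ∣ 𝒞 ∣ D c ⟩
          D * (∣ 𝒞 ∣ * c)                                    ≡⟨ cong (λ l → D * (l * c)) (sym (length-elements 𝒞)) ⟩
          D * (length (elements 𝒞) * c)                      ≤⟨ *-monoʳ-≤ D (double-count (λ x P → x ∈? P) (elements 𝒞) (filter meets? Ps) c (2 + r) low high) ⟩
          D * (count meets? Ps * (2 + r))                    ≤⟨ *-monoʳ-≤ D (*-monoˡ-≤ (2 + r) count-meets) ⟩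
          D * (2 * E * N * (2 + r))                          ≡⟨ regroup D (2 * E) N (2 + r) ⟩
          D * (2 * E * (2 + r)) * N                          ≡⟨ cong (_* N) (sym (K₃-defᶜ K₀)) ⟩
          K₃ * N                                             ∎)
          where
          open ≤-Reasoning
          D c : ℕ
          D = 2 ^ (1 + r) * (1 + r) !
          c = (n ∸ 1) C (1 + r)
          swap : ∀ a b c → a * (b * c) ≡ b * (a * c)
          swap = solve-∀
          regroup : ∀ a b c d → a * (b * c * d) ≡ a * (b * d) * c
          regroup = solve-∀
          n-big : n + 2 * (1 + r) ≤ 2 * (n ∸ 1)
          n-big = subst (n + 2 * (1 + r) ≤_) (sym (*-distribˡ-∸ 2 n 1)) (m+n≤o⇒m≤o∸n (n + 2 * (1 + r))
            (≤-trans (≤-reflexive (shift n r)) (+-monoʳ-≤ n (≤-trans n≥ (≤-reflexive (sym (+-identityʳ n)))))))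
            where shift : ∀ n r → n + 2 * (1 + r) + 2 ≡ n + (4 + 2 * r)
                  shift = solve-∀
          low : ∀ {x} → x ∈ₗ elements 𝒞 → c ≤ count (x ∈?_) (filter meets? Ps)
          low {x} x∈ = subst (_≤ count (x ∈?_) (filter meets? Ps))
            (trans (length-choose (∁ ⁅ x ⁆) (1 + r)) (cong (_C (1 + r)) (trans (∣∁p∣≡n∸∣p∣ ⁅ x ⁆) (cong (n ∸_) (∣⁅x⁆∣≡1 x)))))
            (length-≤-inj (_∪⁅ x ⁆) (choose-unique (∁ ⁅ x ⁆) (1 + r)) into
              (λ Q∈ Q′∈ → add-injective (x∉ Q∈) (x∉ Q′∈)))
            where
            x∉ : ∀ {Q} → Q ∈ₗ choose (∁ ⁅ x ⁆) (1 + r) → x ∉ Q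
            x∉ Q∈ x∈Q = x∈∁p⇒x∉p (proj₁ (∈-choose⁻ (∁ ⁅ x ⁆) (1 + r) Q∈) x∈Q) (x∈⁅x⁆ x)
            into : ∀ {Q} → Q ∈ₗ choose (∁ ⁅ x ⁆) (1 + r) → Q ∪⁅ x ⁆ ∈ₗ filter (x ∈?_) (filter meets? Ps)
            into {Q} Q∈ = ∈-filter⁺ (x ∈?_) (∈-filter⁺ meets?
              (∈-kSubsets⁺ (trans (∣add∣ Q (x∉ Q∈)) (cong suc (proj₂ (∈-choose⁻ (∁ ⁅ x ⁆) (1 + r) Q∈)))))
              (x , x∈p∩q⁺ (∈-add Q , ∈-elements⁻ 𝒞 x∈))) (∈-add Q)
          high : ∀ {P} → P ∈ₗ filter meets? Ps → count (_∈? P) (elements 𝒞) ≤ 2 + r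
          high {P} P∈ = ≤-trans (length≤∣p∣ {p = P} (Uniqueₚ.filter⁺ (_∈? P) (elements-unique 𝒞))
              (λ y∈ → proj₂ (∈-filter⁻ (_∈? P) {xs = elements 𝒞} y∈)))
            (≤-reflexive (∈-kSubsets⁻ (proj₁ (∈-filter⁻ meets? {xs = Ps} P∈))))

    -- The colour of P is the vertex x for which P ∪ {x} is a good member. `AllFlexible` provides,
    -- for each u in P, members through x and u that avoid everything else; the comparison of
    -- colours along a line rests on them.
    OnlyCentre AllFlexible Good Col : Subset n → Fin n → Set
    OnlyCentre A x = ∀ y → y ∈ A → y ∈ 𝒞 → y ≡ x
    AllFlexible A x = ∀ u → u ∈ A → u ≢ x → Flex (⁅ x ⁆ ∪⁅ u ⁆)
    Good A x = x ∈ A × x ∈ 𝒞 × OnlyCentre A x × AllFlexible A x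
    Col P x = x ∉ P × P ∪⁅ x ⁆ ∈ₗ F × Good (P ∪⁅ x ⁆) x

    abstract
      onlyCentre? : ∀ A x → Dec (OnlyCentre A x)
      onlyCentre? A x = Finₚ.all? {P = λ y → y ∈ A → y ∈ 𝒞 → y ≡ x} (λ y → (y ∈? A) →-dec ((y ∈? 𝒞) →-dec (y Fin.≟ x)))

      allFlexible? : ∀ A x → Dec (AllFlexible A x)
      allFlexible? A x = Finₚ.all? {P = λ u → u ∈ A → u ≢ x → Flex (⁅ x ⁆ ∪⁅ u ⁆)}
        (λ u → (u ∈? A) →-dec (¬? (u Fin.≟ x) →-dec flex? (⁅ x ⁆ ∪⁅ u ⁆)))

    abstract
      good? : ∀ A x → Dec (Good A x)
      good? A x = (x ∈? A) ×-dec ((x ∈? 𝒞) ×-dec (onlyCentre? A x ×-dec allFlexible? A x))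

    abstract
      col? : ∀ P x → Dec (Col P x)
      col? P x = ¬? (x ∈? P) ×-dec ((P ∪⁅ x ⁆ ∈ₗ? F) ×-dec good? (P ∪⁅ x ⁆) x)

    abstract
      coloured? : ∀ P → Dec (∃[ x ] Col P x)
      coloured? P = Finₚ.any? {P = Col P} (col? P)

      hasGood? : ∀ A → Dec (∃[ x ] Good A x)
      hasGood? A = Finₚ.any? {P = Good A} (good? A)

    private
      ext₃ : Fin n → Fin n → Fin n → List (Subset n)
      ext₃ x u w = map (λ Y → (⁅ x ⁆ ∪⁅ u ⁆ ∪⁅ w ⁆) ∪ Y) (kSubsets n r)

      ext₂ : Fin n → Fin n → List (Subset n)
      ext₂ x u = concatMap (ext₃ x u) (elements (obstacle (⁅ x ⁆ ∪⁅ u ⁆)))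

      ext₁ : Fin n → List (Subset n)
      ext₁ x = concatMap (ext₂ x) (allFin n)

      -- A supply of sets for the members with a flexible vertex x and an inflexible pair {x, u}:
      -- the obstacle of the pair gives a third vertex w. As x and w have boundedly many values,
      -- only u and the remaining k - 3 vertices are free.
      inflexible : List (Subset n)
      inflexible = concatMap ext₁ (elements 𝒞)

      length-inflexible : length inflexible ≤ K₃ * t₁ * N
      length-inflexible = begin
        length inflexible              ≤⟨ length-concatMap-≤ ext₁ (elements 𝒞) (λ {x} _ → len₁ x) ⟩
        length (elements 𝒞) * (n * (t₁ * n ^ r))  ≤⟨ *-monoˡ-≤ (n * (t₁ * n ^ r)) (≤-trans (≤-reflexive (length-elements 𝒞)) ∣𝒞∣≤) ⟩
        K₃ * (n * (t₁ * n ^ r))        ≡⟨ regroup K₃ n t₁ (n ^ r) ⟩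
        K₃ * t₁ * N                    ∎
        where
        open ≤-Reasoning
        regroup : ∀ a b c d → a * (b * (c * d)) ≡ a * c * (b * d)
        regroup = solve-∀
        len₂ : ∀ x u → length (ext₂ x u) ≤ t₁ * n ^ r
        len₂ x u = ≤-trans (length-concatMap-≤ (ext₃ x u) (elements (obstacle (⁅ x ⁆ ∪⁅ u ⁆)))
            (λ _ → ≤-trans (≤-reflexive (trans (length-map _ (kSubsets n r)) (length-kSubsets n r))) (C≤^ n r)))
          (*-monoˡ-≤ (n ^ r) (≤-trans (≤-reflexive (length-elements (obstacle (⁅ x ⁆ ∪⁅ u ⁆)))) (∣obstacle∣≤ (⁅ x ⁆ ∪⁅ u ⁆))))
        len₁ : ∀ x → length (ext₁ x) ≤ n * (t₁ * n ^ r)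
        len₁ x = ≤-trans (length-concatMap-≤ (ext₂ x) (allFin n) (λ {u} _ → len₂ x u))
          (≤-reflexive (cong (_* (t₁ * n ^ r)) (length-allFin n)))

      ∈-inflexible : ∀ {A x u} → A ∈ₗ F → x ∈ 𝒞 → x ∈ A → u ∈ A → u ≢ x → ¬ Flex (⁅ x ⁆ ∪⁅ u ⁆) → A ∈ₗ inflexible
      ∈-inflexible {A} {x} {u} A∈ x∈𝒞 x∈ u∈ u≢x ¬f with obstacle-hits {⁅ x ⁆ ∪⁅ u ⁆} ¬f A∈
          (λ y∈ → [ (λ y∈x → subst (_∈ A) (sym (x∈⁅y⁆⇒x≡y x y∈x)) x∈) , (λ { refl → u∈ }) ]′ (∈-add⁻ ⁅ x ⁆ y∈))
      ... | w , w∈A , w∈W , w∉ = ∈-concatMap ext₁ (∈-elements⁺ x∈𝒞) (∈-concatMap (ext₂ x) (∈-allFin u)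
              (∈-concatMap (ext₃ x u) (∈-elements⁺ w∈W)
                (subst (_∈ₗ ext₃ x u w) (sym A≡) (∈-map⁺ (λ Y → (⁅ x ⁆ ∪⁅ u ⁆ ∪⁅ w ⁆) ∪ Y) (∈-kSubsets⁺ {S = Y} ∣Y∣)))))
        where
        Y = A - x - u - w
        u∈′ = x∈p-y A u∈ u≢x
        w∈′ = x∈p-y (A - x) (x∈p-y A w∈A (λ { refl → w∉ (⊆-add ⁅ x ⁆ (x∈⁅x⁆ x)) })) (λ { refl → w∉ (∈-add ⁅ x ⁆) })
        ∣Y∣ : ∣ Y ∣ ≡ r
        ∣Y∣ = suc-injective (suc-injective (suc-injective (trans (cong (2 +_) (∣sub∣ (A - x - u) w∈′))
                (trans (cong suc (∣sub∣ (A - x) u∈′)) (trans (∣sub∣ A x∈) (card A∈))))))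
        A≡ : A ≡ (⁅ x ⁆ ∪⁅ u ⁆ ∪⁅ w ⁆) ∪ Y
        A≡ = ⊆-antisym
          (λ {y} y∈ → case (y Fin.≟ x) , (y Fin.≟ u) , (y Fin.≟ w) of λ
            { (yes refl , _) → x∈p∪q⁺ (inj₁ (⊆-add (⁅ x ⁆ ∪⁅ u ⁆) (⊆-add ⁅ x ⁆ (x∈⁅x⁆ x))))
            ; (_ , yes refl , _) → x∈p∪q⁺ (inj₁ (⊆-add (⁅ x ⁆ ∪⁅ u ⁆) (∈-add ⁅ x ⁆)))
            ; (_ , _ , yes refl) → x∈p∪q⁺ (inj₁ (∈-add (⁅ x ⁆ ∪⁅ u ⁆)))
            ; (no a , no b , no c) → x∈p∪q⁺ (inj₂ (x∈p-y (A - x - u) (x∈p-y (A - x) (x∈p-y A y∈ a) b) c)) })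
          (λ {y} y∈ → case x∈p∪q⁻ (⁅ x ⁆ ∪⁅ u ⁆ ∪⁅ w ⁆) Y y∈ of λ
            { (inj₂ y∈Y) → x∈p-y⇒x∈p A x (x∈p-y⇒x∈p (A - x) u (x∈p-y⇒x∈p (A - x - u) w y∈Y))
            ; (inj₁ y∈3) → case ∈-add⁻ (⁅ x ⁆ ∪⁅ u ⁆) y∈3 of λ
              { (inj₂ refl) → w∈A
              ; (inj₁ y∈2) → case ∈-add⁻ ⁅ x ⁆ y∈2 of λ
                { (inj₂ refl) → u∈
                ; (inj₁ y∈1) → subst (_∈ A) (sym (x∈⁅y⁆⇒x≡y x y∈1)) x∈ } } })

      G = filter hasGood? F

      classify : ∀ {A} → A ∈ₗ F → A ∈ₗ filter (¬? ∘ meets?) F ++ F₂ ++ inflexible ++ G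
      classify {A} A∈ with meets? A
      ... | no ¬m = ∈-++⁺ˡ (∈-filter⁺ (¬? ∘ meets?) A∈ ¬m)
      ... | yes m with meets? (p₁ A)
      ...   | yes m₂ = ∈-++⁺ʳ (filter (¬? ∘ meets?) F) (∈-++⁺ˡ (∈-filter⁺ (meets? ∘ p₁) (∈-filter⁺ meets? A∈ m) m₂))
      ...   | no ¬m₂ with p₁-spec m
      ...     | x , x∈ , x∈𝒞 , e with Finₚ.any? (λ u → (u ∈? A) ×-dec ¬? (u Fin.≟ x) ×-dec ¬? (flex? (⁅ x ⁆ ∪⁅ u ⁆)))
      ...       | yes (u , u∈ , u≢x , ¬f) = ∈-++⁺ʳ (filter (¬? ∘ meets?) F) (∈-++⁺ʳ F₂ (∈-++⁺ˡ (∈-inflexible A∈ x∈𝒞 x∈ u∈ u≢x ¬f)))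
      ...       | no ¬u = ∈-++⁺ʳ (filter (¬? ∘ meets?) F) (∈-++⁺ʳ F₂ (∈-++⁺ʳ inflexible (∈-filter⁺ hasGood? A∈ (x , x∈ , x∈𝒞 ,
              (λ y y∈ y∈𝒞 → case y Fin.≟ x of λ
                { (yes eq) → eq ; (no y≢x) → ⊥-elim (¬m₂ (y , x∈p∩q⁺ (subst (y ∈_) (sym e) (x∈p-y A y∈ y≢x) , y∈𝒞))) }) ,
              (λ u u∈ u≢x → case flex? (⁅ x ⁆ ∪⁅ u ⁆) of λ
                { (yes f) → f ; (no ¬f) → ⊥-elim (¬u (u , u∈ , u≢x , ¬f)) })))))

      -- A good member has only one flexible vertex, so `p₁` removes exactly this one and leaves a
      -- set of that colour.
      length-G : length G ≤ count coloured? Ps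
      length-G = length-≤-inj p₁ (Uniqueₚ.filter⁺ hasGood? unique) into
        (λ A∈ A′∈ → p₁-injective (proj₁ (G⊆F₁ A∈)) (proj₁ (G⊆F₁ A′∈)))
        where
        G⊆F₁ : ∀ {A} → A ∈ₗ G → A ∈ₗ F₁ × ∃[ x ] Good A x
        G⊆F₁ A∈G with ∈-filter⁻ hasGood? {xs = F} A∈G
        ... | A∈ , x , g@(x∈ , x∈𝒞 , _) = ∈-filter⁺ meets? A∈ (x , x∈p∩q⁺ (x∈ , x∈𝒞)) , x , g
        into : ∀ {A} → A ∈ₗ G → p₁ A ∈ₗ filter coloured? Ps
        into {A} A∈G with G⊆F₁ A∈G
        ... | A∈₁ , x , g@(_ , _ , uniq , _) with F₁⁻ A∈₁
        ...   | A∈ , m with p₁-spec m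
        ...     | y , y∈ , y∈𝒞 , e with uniq y y∈ y∈𝒞
        ...       | refl = ∈-filter⁺ coloured? (p₁∈Ps A∈₁) (x , subst (λ P → Col P x) (sym e)
                      (x∉p-x A , subst (_∈ₗ F) (sym (sub-add A y∈)) A∈ , subst (λ S → Good S x) (sym (sub-add A y∈)) g))

    private
      F-split : length F ≤ count (¬? ∘ meets?) F + (length F₂ + (length inflexible + length G))
      F-split = subst (length F ≤_) (length-++₄ (filter (¬? ∘ meets?) F) F₂ inflexible G)
        (length-mono-⊆ {xs = F} {ys = filter (¬? ∘ meets?) F ++ F₂ ++ inflexible ++ G} unique classify)

      Ps-split : n C (2 + r) ≡ count coloured? Ps + count (¬? ∘ coloured?) Ps
      Ps-split = trans (sym (length-kSubsets n (2 + r))) (count-split coloured? Ps)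

    uncoloured : count (¬? ∘ coloured?) (kSubsets n (2 + r)) ≤ K₄ * n ^ (1 + r)
    uncoloured = subst (λ e → count (¬? ∘ coloured?) Ps ≤ e * N) (sym (K₄-defᶜ K₀))
      (combine K₀ K₁ E (K₃ * t₁) N Ps-split large F-split count-centreless (≤-trans length-F₂ nonimages) length-inflexible length-G)

  -- A colouring of tuples that is constant along lines has a dominant colour

  count-map : {A B : Set} {P : B → Set} (P? : Decidable P) (f : A → B) (xs : List A) →
              count P? (map f xs) ≡ count (P? ∘ f) xs
  count-map P? f [] = refl
  count-map P? f (x ∷ xs) with P? (f x)
  ... | yes _ = cong suc (count-map P? f xs)
  ... | no _ = count-map P? f xs

  count-concatMap : {A B : Set} {P : B → Set} (P? : Decidable P) (f : A → List B) (as : List A) →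
                    count P? (concatMap f as) ≡ total (λ a → count P? (f a)) as
  count-concatMap P? f [] = refl
  count-concatMap P? f (a ∷ as) = trans (count-++ P? (f a) (concatMap f as)) (cong (count P? (f a) +_) (count-concatMap P? f as))

  total-≤ : {A : Set} {g h : A → ℕ} {c : ℕ} (as : List A) → (∀ a → g a ≤ h a + c) → total g as ≤ total h as + length as * c
  total-≤ [] b = z≤n
  total-≤ {g = g} {h} {c} (a ∷ as) b = ≤-trans (+-mono-≤ (b a) (total-≤ as b))
    (≤-reflexive (rearrange (h a) c (total h as) (length as)))
    where
    rearrange : ∀ h c t l → h + c + (t + l * c) ≡ h + t + (c + l * c)
    rearrange = solve-∀

  below-average : {A : Set} (g : A → ℕ) (as : List A) → 1 ≤ length as → ∃[ a ] (a ∈ₗ as × length as * g a ≤ total g as)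
  below-average g (a ∷ []) _ = a , here refl , ≤-refl
  below-average g (a ∷ b ∷ as) _ with below-average g (b ∷ as) (s≤s z≤n)
  ... | c , c∈ , h with ≤-total (g a) (g c)
  ...   | inj₁ ga≤gc = a , here refl , +-monoʳ-≤ (g a) (≤-trans (*-monoʳ-≤ (length (b ∷ as)) ga≤gc) h)
  ...   | inj₂ gc≤ga = c , there c∈ , +-mono-≤ gc≤ga h

  tuples : ∀ {n} → List (Fin n) → ∀ d → List (Vec (Fin n) d)
  tuples xs zero = [] ∷ []
  tuples xs (suc d) = concatMap (λ a → map (a ∷_) (tuples xs d)) xs

  length-tuples : ∀ {n} (xs : List (Fin n)) d → length (tuples xs d) ≤ length xs ^ d
  length-tuples xs zero = ≤-refl
  length-tuples xs (suc d) = length-concatMap-≤ (λ a → map (a ∷_) (tuples xs d)) xs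
    (λ _ → ≤-trans (≤-reflexive (length-map _ (tuples xs d))) (length-tuples xs d))

  toSet : ∀ {n d} → Vec (Fin n) d → Subset n
  toSet [] = ⊥
  toSet (a ∷ t) = toSet t ∪⁅ a ⁆

  ∣toSet∣≤ : ∀ {n d} (t : Vec (Fin n) d) → ∣ toSet t ∣ ≤ d
  ∣toSet∣≤ {n} [] = ≤-reflexive (∣⊥∣≡0 n)
  ∣toSet∣≤ (a ∷ t) = ≤-trans (∣add∣≤ (toSet t)) (s≤s (∣toSet∣≤ t))

  toSet-update : ∀ {n d} (t : Vec (Fin n) d) i b → toSet (t Vec.[ i ]≔ b) ⊆ toSet t ∪⁅ b ⁆
  toSet-update (a ∷ t) zero b y∈ with ∈-add⁻ (toSet t) y∈
  ... | inj₁ y∈t = ⊆-add (toSet (a ∷ t)) (⊆-add (toSet t) y∈t)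
  ... | inj₂ refl = ∈-add (toSet (a ∷ t))
  toSet-update (a ∷ t) (suc i) b y∈ with ∈-add⁻ (toSet (t Vec.[ i ]≔ b)) y∈
  ... | inj₂ refl = ⊆-add (toSet (a ∷ t)) (∈-add (toSet t))
  ... | inj₁ y∈u with ∈-add⁻ (toSet t) (toSet-update t i b y∈u)
  ...   | inj₁ y∈t = ⊆-add (toSet (a ∷ t)) (⊆-add (toSet t) y∈t)
  ...   | inj₂ refl = ∈-add (toSet (a ∷ t))

  ∈-tuples : ∀ {n d} {xs : List (Fin n)} (t : Vec (Fin n) d) → (∀ {y} → y ∈ toSet t → y ∈ₗ xs) → t ∈ₗ tuples xs d
  ∈-tuples [] h = here refl
  ∈-tuples {d = suc d} {xs} (a ∷ t) h = ∈-concatMap (λ a → map (a ∷_) (tuples xs d)) (h (∈-add (toSet t)))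
    (∈-map⁺ (a ∷_) (∈-tuples t (h ∘ ⊆-add (toSet t))))

  tuples-unique : ∀ {n} {xs : List (Fin n)} → Unique xs → ∀ d → Unique (tuples xs d)
  tuples-unique {xs = xs} uxs zero = [] ∷ []
  tuples-unique {n} {xs} uxs (suc d) = go xs uxs
    where
    go : ∀ ys → Unique ys → Unique (concatMap (λ a → map (a ∷_) (tuples xs d)) ys)
    go [] _ = []
    go (y ∷ ys) (y∉ ∷ uys) = Uniqueₚ.++⁺ (Uniqueₚ.map⁺ ∷-injectiveʳ (tuples-unique uxs d)) (go ys uys) disjoint
      where
      disjoint : ∀ {t} → ¬ (t ∈ₗ map (y ∷_) (tuples xs d) × t ∈ₗ concatMap (λ a → map (a ∷_) (tuples xs d)) ys)
      disjoint (t∈ , t∈′) with ∈-map⁻ (y ∷_) t∈ | find (∈-concatMap⁻ (λ a → map (a ∷_) (tuples xs d)) {xs = ys} t∈′)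
      ... | s , _ , refl | z , z∈ , t∈z with ∈-map⁻ (z ∷_) t∈z
      ...   | _ , _ , refl = All.lookup y∉ z∈ refl

  toSet-surjective : ∀ {n} d (P : Subset n) → ∣ P ∣ ≡ d → ∃[ t ] P ≡ toSet {n} {d} t
  toSet-surjective {n} zero P ∣P∣ = [] , Empty-unique λ { (x , x∈) → case subst (1 ≤_) ∣P∣ (≤-trans (≤-reflexive (sym (∣⁅x⁆∣≡1 x)))
      (p⊆q⇒∣p∣≤∣q∣ {p = ⁅ x ⁆} λ y∈ → subst (_∈ P) (sym (x∈⁅y⁆⇒x≡y x y∈)) x∈)) of λ () }
  toSet-surjective (suc d) P ∣P∣ with card>0⇒Nonempty P (subst (1 ≤_) (sym ∣P∣) (s≤s z≤n))
  ... | x , x∈ with toSet-surjective d (P - x) (suc-injective (trans (∣sub∣ P x∈) ∣P∣))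
  ...   | t , eq = x ∷ t , trans (sym (sub-add P x∈)) (cong (_∪⁅ x ⁆) eq)

  noninjective : ∀ n d → List (Vec (Fin n) d)
  noninjective n zero = []
  noninjective n (suc d) = concatMap (λ t → map (_∷ t) (elements (toSet t))) (tuples (allFin n) d)
                        ++ concatMap (λ a → map (a ∷_) (noninjective n d)) (allFin n)

  ∈-noninjective : ∀ {n d} (t : Vec (Fin n) d) → ∣ toSet t ∣ < d → t ∈ₗ noninjective n d
  ∈-noninjective {n} {suc d} (a ∷ t) h with a ∈? toSet t
  ... | yes a∈ = ∈-++⁺ˡ (∈-concatMap (λ t → map (_∷ t) (elements (toSet t))) (∈-tuples t (λ _ → ∈-allFin _))
                   (∈-map⁺ (_∷ t) (∈-elements⁺ a∈)))
  ... | no a∉ = ∈-++⁺ʳ (concatMap (λ t → map (_∷ t) (elements (toSet t))) (tuples (allFin n) d))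
                  (∈-concatMap (λ a → map (a ∷_) (noninjective n d)) (∈-allFin a)
                    (∈-map⁺ (a ∷_) (∈-noninjective t (≤-pred (subst (_< suc d) (∣add∣ (toSet t) a∉) h)))))

  -- d² exceeds the number of pairs of positions that can coincide. The factor n on the left avoids
  -- the exponent d - 1.
  length-noninjective : ∀ n d → n * length (noninjective n d) ≤ d * d * n ^ d
  length-noninjective n zero = ≤-reflexive (*-zeroʳ n)
  length-noninjective n (suc d) = begin
    n * length (X ++ Y)                    ≡⟨ cong (n *_) (length-++ X) ⟩
    n * (length X + length Y)              ≤⟨ *-monoʳ-≤ n (+-mono-≤ ∣X∣ ∣Y∣) ⟩
    n * (n ^ d * d + n * length Z)         ≤⟨ *-monoʳ-≤ n (+-monoʳ-≤ (n ^ d * d) (length-noninjective n d)) ⟩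
    n * (n ^ d * d + d * d * n ^ d)        ≤⟨ m≤m+n _ _ ⟩
    n * (n ^ d * d + d * d * n ^ d) + n * (n ^ d * (suc d)) ≡⟨ square n d (n ^ d) ⟩
    suc d * suc d * n ^ suc d              ∎
    where
    open ≤-Reasoning
    Z = noninjective n d
    X = concatMap (λ t → map (_∷ t) (elements (toSet t))) (tuples (allFin n) d)
    Y = concatMap (λ a → map (a ∷_) Z) (allFin n)
    square : ∀ n d e → n * (e * d + d * d * e) + n * (e * suc d) ≡ suc d * suc d * (n * e)
    square = solve-∀
    ∣X∣ : length X ≤ n ^ d * d
    ∣X∣ = ≤-trans (length-concatMap-≤ (λ t → map (_∷ t) (elements (toSet t))) (tuples (allFin n) d)
            (λ {t} _ → ≤-trans (≤-reflexive (trans (length-map _ (elements (toSet t))) (length-elements (toSet t)))) (∣toSet∣≤ t)))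
          (*-monoˡ-≤ d (≤-trans (length-tuples (allFin n) d) (≤-reflexive (cong (_^ d) (length-allFin n)))))
    ∣Y∣ : length Y ≤ n * length Z
    ∣Y∣ = ≤-trans (length-concatMap-≤ (λ a → map (a ∷_) Z) (allFin n) (λ _ → ≤-reflexive (length-map _ Z)))
          (≤-reflexive (cong (_* length Z) (length-allFin n)))

  ConstantOnLines : ∀ {n d} → (Vec (Fin n) d → Fin n → Set) → Set
  ConstantOnLines {n} {d} col = ∀ t i b {x y} → col t x → col (t Vec.[ i ]≔ b) y → x ≡ y

  -- Choose a first coordinate `a` whose slice has at most the average number of uncoloured tuples,
  -- and let x dominate this slice. Lines in the first direction carry x to every coloured b ∷ t for
  -- which a ∷ t has colour x. Each coordinate adds the number of uncoloured tuples once more.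
  dominant : ∀ {n} → 1 ≤ n → ∀ d (col : Vec (Fin n) d → Fin n → Set) (col? : ∀ t x → Dec (col t x))
             (some? : ∀ t → Dec (∃[ x ] col t x)) → ConstantOnLines col →
             ∃[ x ] count (λ t → ¬? (col? t x)) (tuples (allFin n) d) ≤ suc d * count (¬? ∘ some?) (tuples (allFin n) d)
  dominant {suc n} _ zero col col? some? adj with some? []
  ... | no _ = zero , ≤-trans (length-filter (λ t → ¬? (col? t zero)) ([] ∷ [])) (s≤s z≤n)
  ... | yes (x , c) = x , ≤-trans (≤-reflexive (cong length
    (filter-none (λ t → ¬? (col? t x)) {xs = [] ∷ []} ((λ ¬c → ¬c c) ∷ [])))) z≤n
  dominant {n} 1≤n (suc d) col col? some? adj
    with below-average (λ a → count (λ t → ¬? (some? (a ∷ t))) (tuples (allFin n) d)) (allFin n) (subst (1 ≤_) (sym (length-allFin n)) 1≤n)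
  ... | a , _ , avg with dominant 1≤n d (λ t → col (a ∷ t)) (λ t → col? (a ∷ t)) (λ t → some? (a ∷ t)) (λ t i b → adj (a ∷ t) (suc i) b)
  ...   | x , ih = x , (begin
    count (λ t → ¬? (col? t x)) (tuples as (suc d))       ≡⟨ slices (λ t → ¬? (col? t x)) ⟩
    total (λ b → count (λ t → ¬? (col? (b ∷ t) x)) ts) as ≤⟨ total-≤ as (λ b → count-⊎ (λ t → ¬? (some? (b ∷ t))) (λ t → ¬? (col? (a ∷ t) x)) (λ t → ¬? (col? (b ∷ t) x)) ts (λ {t} _ → transfer b t)) ⟩
    total bad as + length as * notx                       ≤⟨ +-monoʳ-≤ (total bad as) (*-monoʳ-≤ (length as) ih) ⟩
    total bad as + length as * (suc d * bad a)            ≡⟨ cong (total bad as +_) (swap (length as) (suc d) (bad a)) ⟩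
    total bad as + suc d * (length as * bad a)            ≤⟨ +-monoʳ-≤ (total bad as) (*-monoʳ-≤ (suc d) avg) ⟩
    suc (suc d) * total bad as                            ≡⟨ cong (suc (suc d) *_) (sym (slices (¬? ∘ some?))) ⟩
    suc (suc d) * count (¬? ∘ some?) (tuples as (suc d))  ∎)
    where
    open ≤-Reasoning
    as = allFin n
    ts = tuples as d
    bad : Fin n → ℕ
    bad b = count (λ t → ¬? (some? (b ∷ t))) ts
    notx = count (λ t → ¬? (col? (a ∷ t) x)) ts
    swap : ∀ a b c → a * (b * c) ≡ b * (a * c)
    swap = solve-∀
    slices : {P : Vec (Fin n) (suc d) → Set} (P? : Decidable P) →
             count P? (tuples as (suc d)) ≡ total (λ b → count (λ t → P? (b ∷ t)) ts) as
    slices P? = trans (count-concatMap P? (λ a → map (a ∷_) ts) as) (total-cong as)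
      where
      total-cong : ∀ bs → total (λ b → count P? (map (b ∷_) ts)) bs ≡ total (λ b → count (λ t → P? (b ∷ t)) ts) bs
      total-cong [] = refl
      total-cong (b ∷ bs) = cong₂ _+_ (count-map P? (b ∷_) ts) (total-cong bs)
    transfer : ∀ b t → ¬ col (b ∷ t) x → ¬ (∃[ y ] col (b ∷ t) y) ⊎ ¬ col (a ∷ t) x
    transfer b t ¬c with some? (b ∷ t)
    ... | no ¬s = inj₁ ¬s
    ... | yes (y , cy) = inj₂ λ cx → ¬c (subst (col (b ∷ t)) (sym (adj (a ∷ t) zero b cx cy)) cy)

  -- One vertex dominates the colouring

  module DominantConstant (r K₀ : ℕ) where

    abstract
      K₅ : ℕ
      -- The factor 3 + r is the loss in `dominant` for tuples of length 2 + r. The first summand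
      -- pays for tuples with repeated entries, the second for at most (2 + r)^(2 + r) tuples on
      -- each uncoloured set.
      K₅ = (3 + r) * ((2 + r) * (2 + r) + Constants.K₄ r K₀ * (2 + r) ^ (2 + r))

      K₅-def : K₅ ≡ (3 + r) * ((2 + r) * (2 + r) + Constants.K₄ r K₀ * (2 + r) ^ (2 + r))
      K₅-def = refl

  module Dominance {r n : ℕ} (𝓕 : ClusterFreeFamily n (3 + r)) (K₀ : ℕ)
                   (large : n C (2 + r) ≤ length (ClusterFreeFamily.F 𝓕) + K₀ * n ^ (1 + r))
                   (n≥ : 4 + 2 * r ≤ n) where

    open ClusterFreeFamily 𝓕
    open Centres {r} {n} 𝓕 hiding (E; K₃; K₄; E-def; K₃-def; K₄-def)
    open Colouring {r} {n} 𝓕 K₀ large n≥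
    open DominantConstant r K₀

    private
      -- If the colours differed, a member B through x and some u ∈ P outside P′ that avoids the
      -- rest of A ∪ A′ would complete A and A′ to a cluster. If P ⊆ P′ there is no such u, but then
      -- `own` identifies A with A′.
      module Line {P P′ : Subset n} {b x x′} (∣P∣ : ∣ P ∣ ≡ 2 + r) (∣P′∣ : ∣ P′ ∣ ≡ 2 + r) (P′⊆ : P′ ⊆ P ∪⁅ b ⁆)
                  (c : Col P x) (c′ : Col P′ x′) where
        A = P ∪⁅ x ⁆
        A′ = P′ ∪⁅ x′ ⁆
        x∉P = proj₁ c
        A∈ = proj₁ (proj₂ c)
        A′∈ = proj₁ (proj₂ c′)
        x∈A = ∈-add {x = x} P
        x∈𝒞 = proj₁ (proj₂ (proj₂ (proj₂ c)))
        x′∈𝒞 = proj₁ (proj₂ (proj₂ (proj₂ c′)))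
        only = proj₁ (proj₂ (proj₂ (proj₂ (proj₂ c))))
        only′ = proj₁ (proj₂ (proj₂ (proj₂ (proj₂ c′))))
        flexible = proj₂ (proj₂ (proj₂ (proj₂ (proj₂ c))))

        A-x⊆P : A - x ⊆ P
        A-x⊆P y∈ = case ∈-add⁻ P (x∈p-y⇒x∈p A x y∈) of λ
          { (inj₁ y∈P) → y∈P ; (inj₂ y≡x) → ⊥-elim (x∈p-y⇒x≢y A x y∈ y≡x) }

        same : P ⊆ P′ → x ≡ x′
        same P⊆P′ = sym (only x′ (subst (x′ ∈_) (sym A≡A′) (∈-add P′)) x′∈𝒞)
          where
          A≡A′ : A ≡ A′
          A≡A′ = own x∈𝒞 A∈ x∈A A′∈ (λ y∈ → ⊆-add P′ (P⊆P′ (A-x⊆P y∈)))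

        module _ {u} (u∈P : u ∈ P) (u∉P′ : u ∉ P′) (x≢x′ : x ≢ x′) where

          u≢x : u ≢ x
          u≢x refl = x∉P u∈P

          xu = ⁅ x ⁆ ∪⁅ u ⁆
          W = A ∪ A′

          third : ∃[ B ] (B ∈ₗ F × xu ⊆ B × (∀ {y} → y ∈ B → y ∈ W → y ∈ xu))
          third = flex-use (flexible u (⊆-add P u∈P) u≢x) W
            (≤-trans (≤-trans (∣p∪q∣≤ A A′) (+-mono-≤ (≤-reflexive (card A∈)) (≤-reflexive (card A′∈)))) 2k≤t₁)

          B = proj₁ third
          B∈ = proj₁ (proj₂ third)
          x∈B : x ∈ B
          x∈B = proj₁ (proj₂ (proj₂ third)) (⊆-add ⁅ x ⁆ (x∈⁅x⁆ x))
          u∈B : u ∈ B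
          u∈B = proj₁ (proj₂ (proj₂ third)) (∈-add ⁅ x ⁆)
          new = proj₂ (proj₂ (proj₂ third))

          xu⁻ : ∀ {y} → y ∈ xu → y ≡ x ⊎ y ≡ u
          xu⁻ y∈ = [ (λ y∈x → inj₁ (x∈⁅y⁆⇒x≡y x y∈x)) , inj₂ ]′ (∈-add⁻ ⁅ x ⁆ y∈)

          x∉A′ : x ∉ A′
          x∉A′ x∈A′ = x≢x′ (only′ x x∈A′ x∈𝒞)

          u∉A′ : u ∉ A′
          u∉A′ u∈A′ = case ∈-add⁻ P′ u∈A′ of λ
            { (inj₁ u∈P′) → u∉P′ u∈P′
            ; (inj₂ u≡x′) → u≢x (only u (⊆-add P u∈P) (subst (_∈ 𝒞) (sym u≡x′) x′∈𝒞)) }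

          A≢B : A ≢ B
          A≢B A≡B = <⇒≱ (≤-reflexive (sym (card A∈)) ) (≤-trans
            (p⊆q⇒∣p∣≤∣q∣ {p = A} {xu} (λ y∈ → new (subst (_ ∈_) A≡B y∈) (x∈p∪q⁺ (inj₁ y∈))))
            (≤-trans (∣add∣≤ ⁅ x ⁆) (≤-trans (≤-reflexive (cong suc (∣⁅x⁆∣≡1 x))) (s≤s (s≤s z≤n)))))

          Y₁ = P ∪⁅ b ⁆ ∪⁅ x ⁆ ∪⁅ x′ ⁆
          Y₂ = B - x - u

          ∣Y₁∣ : ∣ Y₁ ∣ ≤ 5 + r
          ∣Y₁∣ = ≤-trans (∣add∣≤ (P ∪⁅ b ⁆ ∪⁅ x ⁆)) (s≤s (≤-trans (∣add∣≤ (P ∪⁅ b ⁆)) (s≤s (≤-trans (∣add∣≤ P) (s≤s (≤-reflexive ∣P∣))))))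

          ∣Y₂∣ : ∣ Y₂ ∣ ≡ 1 + r
          ∣Y₂∣ = suc-injective (suc-injective (trans (cong suc (∣sub∣ (B - x) (x∈p-y B u∈B u≢x))) (trans (∣sub∣ B x∈B) (card B∈))))

          P⊆Y₁ : P ⊆ Y₁
          P⊆Y₁ y∈ = ⊆-add (P ∪⁅ b ⁆ ∪⁅ x ⁆) (⊆-add (P ∪⁅ b ⁆) (⊆-add P y∈))
          x∈Y₁ : x ∈ Y₁
          x∈Y₁ = ⊆-add (P ∪⁅ b ⁆ ∪⁅ x ⁆) (∈-add (P ∪⁅ b ⁆))

          B⊆ : B ⊆ Y₁ ∪ Y₂
          B⊆ {y} y∈ = case (y Fin.≟ x) , (y Fin.≟ u) of λ
            { (yes refl , _) → x∈p∪q⁺ (inj₁ x∈Y₁)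
            ; (_ , yes refl) → x∈p∪q⁺ (inj₁ (P⊆Y₁ u∈P))
            ; (no y≢x , no y≢u) → x∈p∪q⁺ (inj₂ (x∈p-y (B - x) (x∈p-y B y∈ y≢x) y≢u)) }

          -- P has k - 1 elements, P′ adds at most b, the colours add x and x′, and B contributes k
          -- - 2 elements besides x and u: 2k in all.
          size : ∣ Y₁ ∪ Y₂ ∣ ≤ 2 * (3 + r)
          size = ≤-trans (∣p∪q∣≤ Y₁ Y₂) (≤-trans (+-mono-≤ ∣Y₁∣ (≤-reflexive ∣Y₂∣)) (≤-reflexive (count-up r)))
            where count-up : ∀ r → 5 + r + (1 + r) ≡ 2 * (3 + r)
                  count-up = solve-∀

          impossible : Data.Empty.⊥
          impossible = noCluster A∈ A′∈ B∈ (λ A≡A′ → x∉A′ (subst (x ∈_) A≡A′ x∈A)) A≢B (λ A′≡B → x∉A′ (subst (x ∈_) (sym A′≡B) x∈B))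
            (∣∪₃∣≤ A A′ B (Y₁ ∪ Y₂)
              (λ y∈ → x∈p∪q⁺ (inj₁ ([ P⊆Y₁ , (λ { refl → x∈Y₁ }) ]′ (∈-add⁻ P y∈))))
              (λ y∈ → x∈p∪q⁺ (inj₁ ([ (λ y∈P′ → ⊆-add (P ∪⁅ b ⁆ ∪⁅ x ⁆) (⊆-add (P ∪⁅ b ⁆) (P′⊆ y∈P′))) ,
                                       (λ { refl → ∈-add (P ∪⁅ b ⁆ ∪⁅ x ⁆) }) ]′ (∈-add⁻ P′ y∈))))
              B⊆ size)
            (λ y∈A y∈A′ y∈B → case xu⁻ (new y∈B (x∈p∪q⁺ (inj₁ y∈A))) of λ
              { (inj₁ refl) → x∉A′ y∈A′ ; (inj₂ refl) → u∉A′ y∈A′ })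

      sameColour : ∀ {P P′ b x x′} → ∣ P ∣ ≡ 2 + r → ∣ P′ ∣ ≡ 2 + r → P′ ⊆ P ∪⁅ b ⁆ → Col P x → Col P′ x′ → x ≡ x′
      sameColour {P} {P′} {b} {x} {x′} ∣P∣ ∣P′∣ P′⊆ c c′ = case x Fin.≟ x′ of λ
        { (yes eq) → eq
        ; (no x≢x′) → case ⊆-or-new P P′ of λ
          { (inj₁ P⊆P′) → Line.same ∣P∣ ∣P′∣ P′⊆ c c′ P⊆P′
          ; (inj₂ (u , u∈P , u∉P′)) → ⊥-elim (Line.impossible ∣P∣ ∣P′∣ P′⊆ c c′ u∈P u∉P′ x≢x′) } }

      Ps = kSubsets n (2 + r)
      as = allFin n
      N = n ^ (1 + r)

      colT : Vec (Fin n) (2 + r) → Fin n → Set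
      colT t x = ∣ toSet t ∣ ≡ 2 + r × Col (toSet t) x

      colT? : ∀ t x → Dec (colT t x)
      colT? t x = (∣ toSet t ∣ ≟ 2 + r) ×-dec col? (toSet t) x

      someT? : ∀ t → Dec (∃[ x ] colT t x)
      someT? t = Finₚ.any? {P = colT t} (colT? t)

      lines : ConstantOnLines colT
      lines t i b (∣t∣ , c) (∣t′∣ , c′) = sameColour ∣t∣ ∣t′∣ (toSet-update t i b) c c′

      badPs = filter (¬? ∘ coloured?) Ps

      listings : Subset n → List (Vec (Fin n) (2 + r))
      listings P = tuples (elements P) (2 + r)

      bad-covered : ∀ {t} → t ∈ₗ filter (¬? ∘ someT?) (tuples as (2 + r)) →
                    t ∈ₗ noninjective n (2 + r) ++ concatMap listings badPs
      bad-covered {t} t∈ = case ∣ toSet t ∣ ≟ 2 + r of λ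
        { (no ≢) → ∈-++⁺ˡ (∈-noninjective t (≤∧≢⇒< (∣toSet∣≤ t) ≢))
        ; (yes eq) → ∈-++⁺ʳ (noninjective n (2 + r)) (∈-concatMap listings
            (∈-filter⁺ (¬? ∘ coloured?) (∈-kSubsets⁺ {S = toSet t} eq) (λ { (x , c) → ¬some (x , eq , c) }))
            (∈-tuples t ∈-elements⁺)) }
        where
        ¬some = proj₂ (∈-filter⁻ (¬? ∘ someT?) {xs = tuples as (2 + r)} t∈)

      length-noninj : length (noninjective n (2 + r)) ≤ (2 + r) * (2 + r) * N
      length-noninj = *-cancelˡ-≤ n (begin
        n * length (noninjective n (2 + r))      ≤⟨ length-noninjective n (2 + r) ⟩
        (2 + r) * (2 + r) * (n * N)              ≡⟨ swap ((2 + r) * (2 + r)) n N ⟩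
        n * ((2 + r) * (2 + r) * N)              ∎)
        where
        open ≤-Reasoning
        swap : ∀ a b c → a * (b * c) ≡ b * (a * c)
        swap = solve-∀
        instance
          n≢0 : NonZero n
          n≢0 = >-nonZero (≤-trans (s≤s z≤n) n≥)

      length-listings : length (concatMap listings badPs) ≤ K₄ * N * (2 + r) ^ (2 + r)
      length-listings = ≤-trans (length-concatMap-≤ listings badPs {(2 + r) ^ (2 + r)} (λ {P} P∈ →
          ≤-trans (length-tuples (elements P) (2 + r)) (≤-reflexive (cong (_^ (2 + r)) (trans (length-elements P)
            (∈-kSubsets⁻ (proj₁ (∈-filter⁻ (¬? ∘ coloured?) {xs = Ps} P∈))))))))
        (*-monoˡ-≤ ((2 + r) ^ (2 + r)) uncoloured)

      count-bad : count (¬? ∘ someT?) (tuples as (2 + r)) ≤ ((2 + r) * (2 + r) + K₄ * (2 + r) ^ (2 + r)) * N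
      count-bad = begin
        count (¬? ∘ someT?) (tuples as (2 + r))
          ≤⟨ length-mono-⊆ {ys = noninjective n (2 + r) ++ concatMap listings badPs}
               (Uniqueₚ.filter⁺ (¬? ∘ someT?) (tuples-unique (Uniqueₚ.allFin⁺ n) (2 + r))) bad-covered ⟩
        length (noninjective n (2 + r) ++ concatMap listings badPs)
          ≡⟨ length-++ (noninjective n (2 + r)) {concatMap listings badPs} ⟩
        length (noninjective n (2 + r)) + length (concatMap listings badPs)
          ≤⟨ +-mono-≤ length-noninj length-listings ⟩
        (2 + r) * (2 + r) * N + K₄ * N * (2 + r) ^ (2 + r)
          ≡⟨ regroup ((2 + r) * (2 + r)) N K₄ ((2 + r) ^ (2 + r)) ⟩
        ((2 + r) * (2 + r) + K₄ * (2 + r) ^ (2 + r)) * N ∎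
        where
        open ≤-Reasoning
        regroup : ∀ a b c d → a * b + c * b * d ≡ (a + c * d) * b
        regroup = solve-∀

    -- A (k-1)-set violating `InStar` is the set of entries of some tuple without colour x, so a
    -- bound on tuples bounds these sets.
    dominating-centre : ∃[ x ] count (λ P → ¬? (inStar? F x P)) (kSubsets n (2 + r)) ≤ K₅ * n ^ (1 + r)
    dominating-centre with dominant (≤-trans (s≤s z≤n) n≥) (2 + r) colT colT? someT? lines
    ... | x , h = x , ≤-trans covered (≤-trans h (≤-trans (*-monoʳ-≤ (3 + r) count-bad)
        (≤-reflexive (trans (sym (*-assoc (3 + r) ((2 + r) * (2 + r) + K₄ * (2 + r) ^ (2 + r)) N)) (cong (_* N) (sym K₅-def))))))
      where
      covered : count (λ P → ¬? (inStar? F x P)) Ps ≤ count (λ t → ¬? (colT? t x)) (tuples as (2 + r))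
      covered = length-≤-cover (filter (λ t → ¬? (colT? t x)) (tuples as (2 + r))) toSet
        (Uniqueₚ.filter⁺ (λ P → ¬? (inStar? F x P)) (kSubsets-unique n (2 + r))) (λ {P} P∈ →
          let P∈Ps , ¬star = ∈-filter⁻ (λ P → ¬? (inStar? F x P)) {xs = Ps} P∈
              t , eq = toSet-surjective (2 + r) P (∈-kSubsets⁻ P∈Ps)
          in t , ∈-filter⁺ (λ t → ¬? (colT? t x)) (∈-tuples t (λ _ → ∈-allFin _))
                   (λ { (_ , _ , inF , _) → ¬star (inj₂ (subst (λ S → S ∪⁅ x ⁆ ∈ₗ F) (sym eq) inF)) }) , eq)

  -- Families as sublists of kSubsets

  record Matching {n k} (𝓕 : ClusterFreeFamily n k) (μ : ℕ) : Set where
    open ClusterFreeFamily 𝓕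
    field
      blocks          : List (Subset n)
      blocks⊆F        : ∀ {B} → B ∈ₗ blocks → B ∈ₗ F
      blocks-unique   : Unique blocks
      blocks-disjoint : ∀ {A B} → A ∈ₗ blocks → B ∈ₗ blocks → A ≢ B → Empty (A ∩ B)
      μ≤blocks        : μ ≤ length blocks

  allPairs : {A : Set} {R : A → A → Set} {xs : List A} → Unique xs →
             (∀ {x y} → x ∈ₗ xs → y ∈ₗ xs → x ≢ y → R x y) → AllPairs R xs
  allPairs [] h = []
  allPairs (x∉ ∷ uxs) h = All.tabulate (λ y∈ → h (here refl) (there y∈) (All.lookup x∉ y∈))
                        ∷ allPairs uxs (λ a b → h (there a) (there b))

  allPairs⁻ : {A : Set} {R : A → A → Set} {xs : List A} → (∀ {x y} → R x y → R y x) → AllPairs R xs →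
              ∀ {x y} → x ∈ₗ xs → y ∈ₗ xs → x ≢ y → R x y
  allPairs⁻ s (r ∷ rs) (here refl) (here refl) x≢y = ⊥-elim (x≢y refl)
  allPairs⁻ s (r ∷ rs) (here refl) (there y∈) _ = All.lookup r y∈
  allPairs⁻ s (r ∷ rs) (there x∈) (here refl) _ = s (All.lookup r x∈)
  allPairs⁻ s (r ∷ rs) (there x∈) (there y∈) x≢y = allPairs⁻ s rs x∈ y∈ x≢y

  ∪-⊥ : ∀ {n} (p q r : Subset n) → p ∪ (q ∪ (r ∪ ⊥)) ≡ p ∪ (q ∪ r)
  ∪-⊥ p q r = cong (λ s → p ∪ (q ∪ s)) (∪-identityʳ r)

  ≤f : ∀ {n k} (𝓕 : ClusterFreeFamily n k) {μ} (M : Matching 𝓕 μ) {ν : ℤ} → ν ℤ.+ 1ℤ ℤ.≤ ℤ.+ μ →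
       length (ClusterFreeFamily.F 𝓕) ≤ f n k 3 ν
  ≤f {n} {k} 𝓕 {μ} M {ν} ν≤ = subst (_≤ f n k 3 ν) (length-asSublist _≟ˢ_ (kSubsets-unique n k) unique F⊆)
    (≤maxSize _ {kSubsets n k} {ℱ} (asSublist∈ _≟ˢ_ (kSubsets-unique n k) unique F⊆) (clusterFree , ℤₚ.≤-trans ν≤ (ℤ.+≤+ μ≤)))
    where
    open ClusterFreeFamily 𝓕
    open Matching M
    F⊆ : ∀ {A} → A ∈ₗ F → A ∈ₗ kSubsets n k
    F⊆ A∈ = ∈-kSubsets⁺ (card A∈)
    ℱ = asSublist _≟ˢ_ (kSubsets n k) F
    ∈F : ∀ {A} → A ∈ₗ ℱ → A ∈ₗ F
    ∈F = ∈-asSublist⁻ _≟ˢ_ (kSubsets-unique n k) unique F⊆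
    ℱ-unique : Unique ℱ
    ℱ-unique = asSublist-unique _≟ˢ_ (kSubsets-unique n k) unique F⊆
    blocks⊆ℱ : ∀ {B} → B ∈ₗ blocks → B ∈ₗ ℱ
    blocks⊆ℱ = ∈-asSublist⁺ _≟ˢ_ (kSubsets-unique n k) unique F⊆ ∘ blocks⊆F
    μ≤ : μ ≤ matchingNumber ℱ
    μ≤ = ≤-trans μ≤blocks (subst (_≤ matchingNumber ℱ) (length-asSublist _≟ˢ_ ℱ-unique blocks-unique blocks⊆ℱ)
      (≤maxSize pairwiseDisjoint? {ℱ} (asSublist∈ _≟ˢ_ ℱ-unique blocks-unique blocks⊆ℱ)
        (allPairs (asSublist-unique _≟ˢ_ ℱ-unique blocks-unique blocks⊆ℱ)
          (λ a b → blocks-disjoint (∈b a) (∈b b)))))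
      where
      ∈b : ∀ {A} → A ∈ₗ asSublist _≟ˢ_ ℱ blocks → A ∈ₗ blocks
      ∈b = ∈-asSublist⁻ _≟ˢ_ ℱ-unique blocks-unique blocks⊆ℱ
    noCluster₃ : ∀ {𝒜} → (∀ {A} → A ∈ₗ 𝒜 → A ∈ₗ F) → ¬ IsCluster 3 k 𝒜
    noCluster₃ {A ∷ B ∷ D ∷ []} sub (refl , (A≢B ∷ A≢D ∷ []) ∷ (B≢D ∷ []) ∷ _ , _ , size , empty) =
      noCluster (sub (here refl)) (sub (there (here refl))) (sub (there (there (here refl)))) A≢B A≢D B≢D
        (subst (λ S → ∣ S ∣ ≤ 2 * k) (∪-⊥ A B D) size)
        (λ a b d → empty (_ , ⋂-∈⁺ (A ∷ B ∷ D ∷ []) (λ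
          { (here refl) → a ; (there (here refl)) → b ; (there (there (here refl))) → d })))
    clusterFree : ClusterFree 3 k ℱ
    clusterFree any with find any
    ... | 𝒜 , 𝒜∈ , cluster = noCluster₃ (∈F ∘ ∈-sublists⁻ 𝒜∈) cluster

  f≤ : ∀ {n k ν b} → (∀ (𝓕 : ClusterFreeFamily n k) → Matching 𝓕 (ν + 1) → length (ClusterFreeFamily.F 𝓕) ≤ b) →
       f n k 3 (ℤ.+ ν) ≤ b
  f≤ {n} {k} {ν} {b} h = maxSize≤ _ {kSubsets n k} λ {ℱ} ℱ∈ (free , ν≤) → h (family ℱ ℱ∈ free) (matching ℱ ℱ∈ free (ℤ.drop‿+≤+ ν≤))
    where
    family : ∀ ℱ → ℱ ∈ₗ sublists (kSubsets n k) → ClusterFree 3 k ℱ → ClusterFreeFamily n k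
    family ℱ ℱ∈ free = record
      { F = ℱ ; unique = uℱ ; card = card ; noCluster = noCluster }
      where
      uℱ = sublists-unique (kSubsets-unique n k) ℱ∈
      card : ∀ {A} → A ∈ₗ ℱ → ∣ A ∣ ≡ k
      card A∈ = ∈-kSubsets⁻ (∈-sublists⁻ ℱ∈ A∈)
      noCluster : ∀ {A B D} → A ∈ₗ ℱ → B ∈ₗ ℱ → D ∈ₗ ℱ → A ≢ B → A ≢ D → B ≢ D →
                  ∣ A ∪ (B ∪ D) ∣ ≤ 2 * k → ¬ (∀ {y} → y ∈ A → y ∈ B → y ∉ D)
      noCluster {A} {B} {D} A∈ B∈ D∈ A≢B A≢D B≢D size empty = free (lose (asSublist∈ _≟ˢ_ uℱ uABD sub)
        ( length-asSublist _≟ˢ_ uℱ uABD sub , asSublist-unique _≟ˢ_ uℱ uABD sub , All.tabulate (card ∘ sub ∘ ∈ABD)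
        , ≤-trans (p⊆q⇒∣p∣≤∣q∣ {p = ⋃ 𝒜} ⋃⊆) size
        , λ { (y , y∈) → empty (⋂-∈⁻ 𝒜 y∈ (ABD∈ (here refl))) (⋂-∈⁻ 𝒜 y∈ (ABD∈ (there (here refl))))
                               (⋂-∈⁻ 𝒜 y∈ (ABD∈ (there (there (here refl))))) }))
        where
        ABD = A ∷ B ∷ D ∷ []
        𝒜 = asSublist _≟ˢ_ ℱ ABD
        uABD : Unique ABD
        uABD = (A≢B ∷ A≢D ∷ []) ∷ (B≢D ∷ []) ∷ [] ∷ []
        sub : ∀ {S} → S ∈ₗ ABD → S ∈ₗ ℱ
        sub (here refl) = A∈
        sub (there (here refl)) = B∈
        sub (there (there (here refl))) = D∈
        ∈ABD : ∀ {S} → S ∈ₗ 𝒜 → S ∈ₗ ABD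
        ∈ABD = ∈-asSublist⁻ _≟ˢ_ uℱ uABD sub
        ABD∈ : ∀ {S} → S ∈ₗ ABD → S ∈ₗ 𝒜
        ABD∈ = ∈-asSublist⁺ _≟ˢ_ uℱ uABD sub
        ⋃⊆ : ⋃ 𝒜 ⊆ A ∪ (B ∪ D)
        ⋃⊆ y∈ with ⋃-∈⁻ 𝒜 y∈
        ... | S , S∈ , y∈S with ∈ABD S∈
        ...   | here refl = x∈p∪q⁺ (inj₁ y∈S)
        ...   | there (here refl) = x∈p∪q⁺ (inj₂ (x∈p∪q⁺ (inj₁ y∈S)))
        ...   | there (there (here refl)) = x∈p∪q⁺ (inj₂ (x∈p∪q⁺ (inj₂ y∈S)))
    matching : ∀ ℱ ℱ∈ free → ν + 1 ≤ matchingNumber ℱ → Matching (family ℱ ℱ∈ free) (ν + 1)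
    matching ℱ ℱ∈ free ν≤ with maxSize-attained pairwiseDisjoint? ℱ
    -- A matching number 0, possibly the default, is below ν + 1.
    ... | inj₁ eq = ⊥-elim (case subst (1 ≤_) eq (≤-trans (m≤n+m 1 ν) ν≤) of λ ())
    ... | inj₂ (bs , bs∈ , disj , len) = record
      { blocks = bs ; blocks⊆F = ∈-sublists⁻ bs∈ ; blocks-unique = sublists-unique (sublists-unique (kSubsets-unique n k) ℱ∈) bs∈
      ; blocks-disjoint = allPairs⁻ (λ {A} {B} e → λ { (y , y∈) → let a , b = x∈p∩q⁻ B A y∈ in e (y , x∈p∩q⁺ (b , a)) }) disj
      ; μ≤blocks = subst (ν + 1 ≤_) (sym len) ν≤ }

  -- Compressing the subsets of R to subsets of a set with ∣ R ∣ elements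

  restrict : ∀ {n} (R : Subset n) → Subset n → Subset ∣ R ∣
  restrict [] [] = []
  restrict (inside ∷ R) (s ∷ S) = s ∷ restrict R S
  restrict (outside ∷ R) (s ∷ S) = restrict R S

  ∣restrict∣ : ∀ {n} (R S : Subset n) → S ⊆ R → ∣ restrict R S ∣ ≡ ∣ S ∣
  ∣restrict∣ [] [] _ = refl
  ∣restrict∣ (inside ∷ R) (inside ∷ S) sub = cong suc (∣restrict∣ R S (drop-∷-⊆ sub))
  ∣restrict∣ (inside ∷ R) (outside ∷ S) sub = ∣restrict∣ R S (drop-∷-⊆ sub)
  ∣restrict∣ (outside ∷ R) (inside ∷ S) sub = case sub here of λ ()
  ∣restrict∣ (outside ∷ R) (outside ∷ S) sub = ∣restrict∣ R S (drop-∷-⊆ sub)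

  restrict-∪ : ∀ {n} (R S S′ : Subset n) → restrict R (S ∪ S′) ≡ restrict R S ∪ restrict R S′
  restrict-∪ [] [] [] = refl
  restrict-∪ (inside ∷ R) (s ∷ S) (s′ ∷ S′) = cong (_ ∷_) (restrict-∪ R S S′)
  restrict-∪ (outside ∷ R) (s ∷ S) (s′ ∷ S′) = restrict-∪ R S S′

  restrict-∩ : ∀ {n} (R S S′ : Subset n) → restrict R (S ∩ S′) ≡ restrict R S ∩ restrict R S′
  restrict-∩ [] [] [] = refl
  restrict-∩ (inside ∷ R) (s ∷ S) (s′ ∷ S′) = cong (_ ∷_) (restrict-∩ R S S′)
  restrict-∩ (outside ∷ R) (s ∷ S) (s′ ∷ S′) = restrict-∩ R S S′

  restrict-injective : ∀ {n} (R S S′ : Subset n) → S ⊆ R → S′ ⊆ R → restrict R S ≡ restrict R S′ → S ≡ S′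
  restrict-injective [] [] [] _ _ _ = refl
  restrict-injective (inside ∷ R) (s ∷ S) (s′ ∷ S′) a b eq = cong₂ _∷_ (proj₁ (∷-injective eq))
    (restrict-injective R S S′ (drop-∷-⊆ a) (drop-∷-⊆ b) (∷-injectiveʳ eq))
  restrict-injective (outside ∷ R) (inside ∷ S) (_ ∷ S′) a b eq = case a here of λ ()
  restrict-injective (outside ∷ R) (outside ∷ S) (inside ∷ S′) a b eq = case b here of λ ()
  restrict-injective (outside ∷ R) (outside ∷ S) (outside ∷ S′) a b eq = cong (outside ∷_)
    (restrict-injective R S S′ (drop-∷-⊆ a) (drop-∷-⊆ b) eq)

  ∪-⊆ : ∀ {n} (p q : Subset n) {r} → p ⊆ r → q ⊆ r → p ∪ q ⊆ r
  ∪-⊆ p q a b y∈ = [ a , b ]′ (x∈p∪q⁻ p q y∈)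

  map-unique : {A B : Set} (g : A → B) {xs : List A} → Unique xs →
               (∀ {x y} → x ∈ₗ xs → y ∈ₗ xs → g x ≡ g y → x ≡ y) → Unique (map g xs)
  map-unique g [] _ = []
  map-unique g (x∉ ∷ uxs) inj = Allₚ.map⁺ (All.tabulate λ y∈ eq → All.lookup x∉ y∈ (inj (here refl) (there y∈) eq))
    ∷ map-unique g uxs (λ a b → inj (there a) (there b))

  module _ {n k} (𝓕 : ClusterFreeFamily n k) (R : Subset n) (F⊆R : ∀ {S} → S ∈ₗ ClusterFreeFamily.F 𝓕 → S ⊆ R) where

    open ClusterFreeFamily 𝓕

    private
      ρ = restrict R

      ρ-injective : ∀ {S S′} → S ∈ₗ F → S′ ∈ₗ F → ρ S ≡ ρ S′ → S ≡ S′
      ρ-injective {S} {S′} S∈ S′∈ = restrict-injective R S S′ (F⊆R S∈) (F⊆R S′∈)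

      ∣ρ∪∣ : ∀ {A B D} → A ∈ₗ F → B ∈ₗ F → D ∈ₗ F → ∣ ρ A ∪ (ρ B ∪ ρ D) ∣ ≡ ∣ A ∪ (B ∪ D) ∣
      ∣ρ∪∣ {A} {B} {D} A∈ B∈ D∈ = trans
        (cong ∣_∣ (sym (trans (restrict-∪ R A (B ∪ D)) (cong (ρ A ∪_) (restrict-∪ R B D)))))
        (∣restrict∣ R (A ∪ (B ∪ D)) (∪-⊆ A (B ∪ D) (F⊆R A∈) (∪-⊆ B D (F⊆R B∈) (F⊆R D∈))))

      ρ-nonempty : ∀ {S} → S ⊆ R → Nonempty S → Nonempty (ρ S)
      ρ-nonempty {S} S⊆R (y , y∈) = card>0⇒Nonempty (ρ S) (subst (1 ≤_) (sym (∣restrict∣ R S S⊆R))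
        (≤-trans (≤-reflexive (sym (∣⁅x⁆∣≡1 y))) (p⊆q⇒∣p∣≤∣q∣ {p = ⁅ y ⁆} λ z∈ → subst (_∈ S) (sym (x∈⁅y⁆⇒x≡y y z∈)) y∈)))

    compress : ClusterFreeFamily ∣ R ∣ k
    compress = record
      { F = map ρ F ; unique = map-unique ρ unique ρ-injective ; card = card′ ; noCluster = noCluster′ }
      where
      card′ : ∀ {A} → A ∈ₗ map ρ F → ∣ A ∣ ≡ k
      card′ A∈ with ∈-map⁻ ρ A∈
      ... | S , S∈ , refl = trans (∣restrict∣ R S (F⊆R S∈)) (card S∈)
      noCluster′ : ∀ {A B D} → A ∈ₗ map ρ F → B ∈ₗ map ρ F → D ∈ₗ map ρ F → A ≢ B → A ≢ D → B ≢ D →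
                   ∣ A ∪ (B ∪ D) ∣ ≤ 2 * k → ¬ (∀ {y} → y ∈ A → y ∈ B → y ∉ D)
      noCluster′ A∈ B∈ D∈ A≢B A≢D B≢D size empty with ∈-map⁻ ρ A∈ | ∈-map⁻ ρ B∈ | ∈-map⁻ ρ D∈
      ... | A , A∈F , refl | B , B∈F , refl | D , D∈F , refl =
        noCluster A∈F B∈F D∈F (A≢B ∘ cong ρ) (A≢D ∘ cong ρ) (B≢D ∘ cong ρ) (subst (_≤ 2 * k) (∣ρ∪∣ A∈F B∈F D∈F) size)
          (λ {y} a b d → let S = A ∩ (B ∩ D)
                             z , z∈ = ρ-nonempty {S} (F⊆R A∈F ∘ proj₁ ∘ x∈p∩q⁻ A (B ∩ D)) (y , x∈p∩q⁺ (a , x∈p∩q⁺ (b , d)))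
                             zA , zBD = x∈p∩q⁻ (ρ A) (ρ (B ∩ D)) (subst (z ∈_) (restrict-∩ R A (B ∩ D)) z∈)
                             zB , zD = x∈p∩q⁻ (ρ B) (ρ D) (subst (z ∈_) (restrict-∩ R B D) zBD)
                         in empty zA zB zD)

    compress-matching : ∀ {μ} → Matching 𝓕 μ → Matching compress μ
    compress-matching {μ} M = record
      { blocks = map ρ blocks
      ; blocks⊆F = λ B∈ → case ∈-map⁻ ρ B∈ of λ { (S , S∈ , refl) → ∈-map⁺ ρ (blocks⊆F S∈) }
      ; blocks-unique = map-unique ρ blocks-unique (λ a b → ρ-injective (blocks⊆F a) (blocks⊆F b))
      ; blocks-disjoint = disjoint
      ; μ≤blocks = subst (μ ≤_) (sym (length-map ρ blocks)) μ≤blocks }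
      where
      open Matching M
      disjoint : ∀ {A B} → A ∈ₗ map ρ blocks → B ∈ₗ map ρ blocks → A ≢ B → Empty (A ∩ B)
      disjoint A∈ B∈ A≢B (z , z∈) with ∈-map⁻ ρ A∈ | ∈-map⁻ ρ B∈
      ... | A , A∈b , refl | B , B∈b , refl = <⇒≱ (≤-trans (≤-reflexive (sym (∣⁅x⁆∣≡1 z))) (p⊆q⇒∣p∣≤∣q∣ {p = ⁅ z ⁆} {ρ (A ∩ B)}
          (λ w∈ → subst₂ _∈_ (sym (x∈⁅y⁆⇒x≡y z w∈)) (sym (restrict-∩ R A B)) z∈)))
        (≤-reflexive (trans (∣restrict∣ R (A ∩ B) (F⊆R (blocks⊆F A∈b) ∘ proj₁ ∘ x∈p∩q⁻ A B))
          (trans (cong ∣_∣ (Empty-unique (blocks-disjoint A∈b B∈b (A≢B ∘ cong ρ)))) (∣⊥∣≡0 n))))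

    -- This is how f(kν, k, 3, ν-1) enters the bound: members inside the union of ν disjoint blocks
    -- form a family on kν points that still contains the blocks.
    length≤f : ∀ {N μ} → ∣ R ∣ ≡ N → Matching 𝓕 μ → {ν : ℤ} → ν ℤ.+ 1ℤ ℤ.≤ ℤ.+ μ → length F ≤ f N k 3 ν
    length≤f refl M {ν} ν≤ = subst (_≤ f ∣ R ∣ k 3 ν) (length-map ρ F) (≤f compress (compress-matching M) {ν} ν≤)

  -- The upper bound around a dominating centre

  powerset : ∀ {n} → Subset n → List (Subset n)
  powerset [] = [] ∷ []
  powerset (inside ∷ p) = map (inside ∷_) (powerset p) ++ map (outside ∷_) (powerset p)
  powerset (outside ∷ p) = map (outside ∷_) (powerset p)

  length-powerset : ∀ {n} (p : Subset n) → length (powerset p) ≡ 2 ^ ∣ p ∣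
  length-powerset [] = refl
  length-powerset (inside ∷ p) = trans (length-++ (map (inside ∷_) (powerset p)))
    (cong₂ _+_ (trans (length-map _ (powerset p)) (length-powerset p))
               (trans (length-map _ (powerset p)) (trans (length-powerset p) (sym (+-identityʳ _)))))
  length-powerset (outside ∷ p) = trans (length-map _ (powerset p)) (length-powerset p)

  ∈-powerset : ∀ {n} {S : Subset n} (p : Subset n) → S ⊆ p → S ∈ₗ powerset p
  ∈-powerset {S = []} [] _ = here refl
  ∈-powerset {S = inside ∷ S} (inside ∷ p) sub = ∈-++⁺ˡ (∈-map⁺ _ (∈-powerset p (drop-∷-⊆ sub)))
  ∈-powerset {S = outside ∷ S} (inside ∷ p) sub = ∈-++⁺ʳ (map (inside ∷_) (powerset p))
    (∈-map⁺ _ (∈-powerset p (drop-∷-⊆ sub)))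
  ∈-powerset {S = inside ∷ S} (outside ∷ p) sub = case sub here of λ ()
  ∈-powerset {S = outside ∷ S} (outside ∷ p) sub = ∈-map⁺ _ (∈-powerset p (drop-∷-⊆ sub))

  enlarge : ∀ {n} d (p U : Subset n) → p ⊆ U → ∣ p ∣ + d ≤ ∣ U ∣ → ∃[ q ] (p ⊆ q × q ⊆ U × ∣ q ∣ ≡ ∣ p ∣ + d)
  enlarge zero p U sub h = p , id , sub , sym (+-identityʳ _)
  enlarge (suc d) p U sub h with card-lt⇒new U p (≤-trans (s≤s (m≤m+n ∣ p ∣ d)) (subst (_≤ ∣ U ∣) (+-suc ∣ p ∣ d) h))
  ... | x , x∈U , x∉p with enlarge d (p ∪⁅ x ⁆) U (λ y∈ → [ sub , (λ { refl → x∈U }) ]′ (∈-add⁻ p y∈))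
                            (subst (_≤ ∣ U ∣) (trans (+-suc ∣ p ∣ d) (cong (_+ d) (sym (∣add∣ p x∉p)))) h)
  ...   | q , a , b , c = q , a ∘ ⊆-add p , b , trans c (trans (cong (_+ d) (∣add∣ p x∉p)) (sym (+-suc ∣ p ∣ d)))

  -- Each S of X has at least ∣ U ∣ ∸ j supersets of its trace S ∩ U among the (j+1)-subsets of U.
  module _ {n : ℕ} (U V : Subset n) (j : ℕ) (X Y : List (Subset n)) (uX : Unique X)
           (X⊆ : ∀ {S} → S ∈ₗ X → S ⊆ U ∪ V) (small : ∀ {S} → S ∈ₗ X → ∣ S ∩ U ∣ ≤ j)
           (Y⊆ : ∀ {Q} → Q ∈ₗ Y → ∣ Q ∣ ≤ suc j)
           (into : ∀ {S Q} → S ∈ₗ X → Q ∈ₗ choose U (suc j) → S ∩ U ⊆ Q → Q ∈ₗ Y) where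

    length-extensions : length X * (∣ U ∣ ∸ j) ≤ length Y * 2 ^ (suc j + ∣ V ∣)
    length-extensions = double-count (λ S Q → S ∩ U ⊆? Q) X Y (∣ U ∣ ∸ j) (2 ^ (suc j + ∣ V ∣)) low high
      where
      low : ∀ {S} → S ∈ₗ X → ∣ U ∣ ∸ j ≤ count (λ Q → S ∩ U ⊆? Q) Y
      -- For j > ∣U∣ the truncated difference is 0. Otherwise the trace is first filled up to j
      -- elements of U, and every further element of U then gives another superset of size j + 1.
      low {S} S∈ = case j ≤? ∣ U ∣ of λ
        { (no j≰) → subst (_≤ count (λ Q → S ∩ U ⊆? Q) Y) (sym (m≤n⇒m∸n≡0 (<⇒≤ (≰⇒> j≰)))) z≤n
        ; (yes j≤) → extend j≤ (enlarge (j ∸ ∣ S ∩ U ∣) (S ∩ U) U (proj₂ ∘ x∈p∩q⁻ S U)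
            (subst (_≤ ∣ U ∣) (sym (m+[n∸m]≡n (small S∈))) j≤)) }
        where
        extend : j ≤ ∣ U ∣ → ∃[ q ] (S ∩ U ⊆ q × q ⊆ U × ∣ q ∣ ≡ ∣ S ∩ U ∣ + (j ∸ ∣ S ∩ U ∣)) → ∣ U ∣ ∸ j ≤ count (λ Q → S ∩ U ⊆? Q) Y
        extend j≤ (q , S⊆q , q⊆U , ∣q∣′) = subst (_≤ count (λ Q → S ∩ U ⊆? Q) Y)
          (trans (length-elements (U ─ q)) ∣U─q∣)
          (length-≤-inj (q ∪⁅_⁆) (elements-unique (U ─ q)) inY inj)
          where
          ∣q∣ : ∣ q ∣ ≡ j
          ∣q∣ = trans ∣q∣′ (m+[n∸m]≡n (small S∈))
          ∣U─q∣ : ∣ U ─ q ∣ ≡ ∣ U ∣ ∸ j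
          ∣U─q∣ = trans (sym (m+n∸m≡n ∣ q ∣ ∣ U ─ q ∣)) (cong₂ _∸_ (trans (cong (_+ ∣ U ─ q ∣) (cong ∣_∣ (sym U∩q≡q))) (∣p∩q∣+∣p─q∣ U q)) ∣q∣)
            where
            U∩q≡q : U ∩ q ≡ q
            U∩q≡q = ⊆-antisym (proj₂ ∘ x∈p∩q⁻ U q) (λ y∈ → x∈p∩q⁺ (q⊆U y∈ , y∈))
          new : ∀ {w} → w ∈ₗ elements (U ─ q) → w ∈ U × w ∉ q
          new w∈ = let w∈′ = ∈-elements⁻ (U ─ q) w∈ in p─q⊆p U q w∈′ , x∈p─q⇒x∉q U q w∈′
          inY : ∀ {w} → w ∈ₗ elements (U ─ q) → q ∪⁅ w ⁆ ∈ₗ filter (λ Q → S ∩ U ⊆? Q) Y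
          inY {w} w∈ = ∈-filter⁺ (λ Q → S ∩ U ⊆? Q) (into S∈
            (∈-choose (λ y∈ → [ q⊆U , (λ { refl → proj₁ (new w∈) }) ]′ (∈-add⁻ q y∈)) (trans (∣add∣ q (proj₂ (new w∈))) (cong suc ∣q∣)))
            (⊆-add q ∘ S⊆q)) (⊆-add q ∘ S⊆q)
          inj : ∀ {w w′} → w ∈ₗ elements (U ─ q) → w′ ∈ₗ elements (U ─ q) → q ∪⁅ w ⁆ ≡ q ∪⁅ w′ ⁆ → w ≡ w′
          inj {w} w∈ _ eq = [ (λ w∈q → ⊥-elim (proj₂ (new w∈) w∈q)) , id ]′ (∈-add⁻ q (subst (w ∈_) eq (∈-add q)))
      -- S ∩ U ⊆ Q forces S ⊆ Q ∪ V, a set of bounded size.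
      high : ∀ {Q} → Q ∈ₗ Y → count (λ S → S ∩ U ⊆? Q) X ≤ 2 ^ (suc j + ∣ V ∣)
      high {Q} Q∈ = ≤-trans (length-mono-⊆ (Uniqueₚ.filter⁺ (λ S → S ∩ U ⊆? Q) uX) covered)
        (≤-trans (≤-reflexive (length-powerset (Q ∪ V))) (^-monoʳ-≤ 2 (≤-trans (∣p∪q∣≤ Q V) (+-monoˡ-≤ ∣ V ∣ (Y⊆ Q∈)))))
        where
        covered : ∀ {S} → S ∈ₗ filter (λ S → S ∩ U ⊆? Q) X → S ∈ₗ powerset (Q ∪ V)
        covered {S} S∈f = let S∈ , sub = ∈-filter⁻ (λ S → S ∩ U ⊆? Q) {xs = X} S∈f in
          ∈-powerset (Q ∪ V) (λ y∈ → [ (λ y∈U → x∈p∪q⁺ (inj₁ (sub (x∈p∩q⁺ (y∈ , y∈U))))) , x∈p∪q⁺ ∘ inj₂ ]′ (x∈p∪q⁻ U V (X⊆ S∈ y∈)))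

  ⋃ᶠ : ∀ {n ν} → (Fin ν → Subset n) → Subset n
  ⋃ᶠ {ν = zero} B = ⊥
  ⋃ᶠ {ν = suc ν} B = B zero ∪ ⋃ᶠ (B ∘ suc)

  ∈-⋃ᶠ⁺ : ∀ {n ν y} (B : Fin ν → Subset n) i → y ∈ B i → y ∈ ⋃ᶠ B
  ∈-⋃ᶠ⁺ B zero y∈ = x∈p∪q⁺ (inj₁ y∈)
  ∈-⋃ᶠ⁺ B (suc i) y∈ = x∈p∪q⁺ (inj₂ (∈-⋃ᶠ⁺ (B ∘ suc) i y∈))

  ∈-⋃ᶠ⁻ : ∀ {n ν y} (B : Fin ν → Subset n) → y ∈ ⋃ᶠ B → ∃[ i ] y ∈ B i
  ∈-⋃ᶠ⁻ {ν = zero} B y∈ = ⊥-elim (∉⊥ y∈)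
  ∈-⋃ᶠ⁻ {ν = suc ν} B y∈ with x∈p∪q⁻ (B zero) (⋃ᶠ (B ∘ suc)) y∈
  ... | inj₁ y∈0 = zero , y∈0
  ... | inj₂ y∈s = let i , y∈i = ∈-⋃ᶠ⁻ (B ∘ suc) y∈s in suc i , y∈i

  ∣⋃ᶠ∣ : ∀ {n ν k} (B : Fin ν → Subset n) → (∀ i → ∣ B i ∣ ≡ k) → (∀ {i j y} → y ∈ B i → y ∈ B j → i ≡ j) → ∣ ⋃ᶠ B ∣ ≡ ν * k
  ∣⋃ᶠ∣ {n} {zero} B c d = ∣⊥∣≡0 n
  ∣⋃ᶠ∣ {ν = suc ν} B c d = trans (∣p∪q∣-disjoint (B zero) (⋃ᶠ (B ∘ suc))
      (λ y∈0 y∈s → let i , y∈i = ∈-⋃ᶠ⁻ (B ∘ suc) y∈s in case d y∈0 y∈i of λ ()))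
    (cong₂ _+_ (c zero) (∣⋃ᶠ∣ (B ∘ suc) (c ∘ suc) (λ a b → Finₚ.suc-injective (d a b))))

  -- Pairwise intersecting pairs

  pair-≡ : ∀ {n} {e e′ : Subset n} {a b} → ∣ e ∣ ≡ 2 → ∣ e′ ∣ ≡ 2 → a ≢ b → a ∈ e → b ∈ e → a ∈ e′ → b ∈ e′ → e ≡ e′
  pair-≡ {n} {e} {e′} {a} {b} ∣e∣ ∣e′∣ a≢b a∈ b∈ a∈′ b∈′ = trans (sym (is-ab ∣e∣ a∈ b∈)) (is-ab ∣e′∣ a∈′ b∈′)
    where
    is-ab : ∀ {e : Subset n} → ∣ e ∣ ≡ 2 → a ∈ e → b ∈ e → ⁅ a ⁆ ∪⁅ b ⁆ ≡ e
    is-ab {e} ∣e∣ a∈ b∈ = ⊆-card-≡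
      (λ y∈ → [ (λ y∈a → subst (_∈ e) (sym (x∈⁅y⁆⇒x≡y a y∈a)) a∈) , (λ { refl → b∈ }) ]′ (∈-add⁻ ⁅ a ⁆ y∈))
      (≤-reflexive (trans ∣e∣ (sym (trans (∣add∣ ⁅ a ⁆ (λ b∈a → a≢b (sym (x∈⁅y⁆⇒x≡y a b∈a)))) (cong suc (∣⁅x⁆∣≡1 a))))))

  other : ∀ {n} {e : Subset n} {a} → ∣ e ∣ ≡ 2 → ∃[ b ] (b ∈ e × b ≢ a)
  other {e = e} {a} ∣e∣ with card-lt⇒new e ⁅ a ⁆ (subst₂ _<_ (sym (∣⁅x⁆∣≡1 a)) (sym ∣e∣) (s≤s (s≤s z≤n)))
  ... | b , b∈ , b∉ = b , b∈ , λ { refl → b∉ (x∈⁅x⁆ b) }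

  module _ {n} (B : Subset n) (es : List (Subset n)) (ues : Unique es)
           (es⊆ : ∀ {e} → e ∈ₗ es → e ⊆ B) (pairs : ∀ {e} → e ∈ₗ es → ∣ e ∣ ≡ 2)
           (meet : ∀ {e e′} → e ∈ₗ es → e′ ∈ₗ es → Nonempty (e ∩ e′)) where

    private
      through : ∀ {a} → a ∈ B → (∀ {e} → e ∈ₗ es → a ∈ e) → length es < ∣ B ∣
      through {a} a∈B all = subst₂ _≤_ (cong suc (*-identityʳ (length es))) (trans (cong suc (trans (*-identityʳ _) (length-elements (B - a)))) (∣sub∣ B a∈B))
        (s≤s (double-count (λ e v → v ∈? e) es (elements (B - a)) 1 1
          (λ {e} e∈ → let b , b∈ , b≢a = other {e = e} {a} (pairs e∈) in
            length-mono-⊆ {xs = b ∷ []} ([] ∷ []) λ { (here refl) →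
              ∈-filter⁺ (_∈? e) (∈-elements⁺ {p = B - a} (x∈p-y B (es⊆ e∈ b∈) b≢a)) b∈ })
          (λ {v} v∈ → length-≤1 (Uniqueₚ.filter⁺ (v ∈?_) ues) λ e∈ e′∈ →
            let e∈es , v∈e = ∈-filter⁻ (v ∈?_) {xs = es} e∈
                e′∈es , v∈e′ = ∈-filter⁻ (v ∈?_) {xs = es} e′∈
            in pair-≡ (pairs e∈es) (pairs e′∈es) (x∈p-y⇒x≢y B a (∈-elements⁻ (B - a) v∈)) v∈e (all e∈es) v∈e′ (all e′∈es))))

      common : ∀ {a b e e′} → e ∈ₗ es → e′ ∈ₗ es → a ∈ e → b ∈ e → a ≢ b → a ∉ e′ → b ∈ e′
      common {a} {b} {e} {e′} e∈ e′∈ a∈ b∈ a≢b a∉ with meet e∈ e′∈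
      ... | y , y∈ with x∈p∩q⁻ e e′ y∈
      ...   | y∈e , y∈e′ with y Fin.≟ b
      ...     | yes refl = y∈e′
      ...     | no y≢b = ⊥-elim (<⇒≱ (≤-reflexive (cong suc (pairs e∈))) (length≤∣p∣ {xs = y ∷ a ∷ b ∷ []} {p = e}
                (((λ { refl → a∉ y∈e′ }) ∷ y≢b ∷ []) ∷ (a≢b ∷ []) ∷ [] ∷ [])
                (λ { (here refl) → y∈e ; (there (here refl)) → a∈ ; (there (there (here refl))) → b∈ })))

      ∈-or-missed : ∀ a → (∀ {e} → e ∈ₗ es → a ∈ e) ⊎ ∃[ e ] (e ∈ₗ es × a ∉ e)
      ∈-or-missed a with All.all? (a ∈?_) es
      ... | yes all = inj₁ (All.lookup all)
      ... | no ¬all = inj₂ (find (Allₚ.¬All⇒Any¬ (a ∈?_) es ¬all))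

    -- They form a star or a triangle.
    length-intersecting : 4 ≤ ∣ B ∣ → length es < ∣ B ∣
    length-intersecting 4≤ = go es refl
      where
      cases : ∀ {e₁} → e₁ ∈ₗ es → length es < ∣ B ∣
      go : ∀ zs → es ≡ zs → length es < ∣ B ∣
      go [] eq = subst (λ zs → length zs < ∣ B ∣) (sym eq) (≤-trans (s≤s z≤n) 4≤)
      go (e₁ ∷ rest) eq = cases (subst (e₁ ∈ₗ_) (sym eq) (here refl))
      cases {e₁} e₁∈ with card≥2⇒≢ e₁ (≤-reflexive (sym (pairs e₁∈)))
      ... | a , b , a∈₁ , b∈₁ , a≢b with ∈-or-missed a
      ...   | inj₁ all = through (es⊆ e₁∈ a∈₁) all
      ...   | inj₂ (e₂ , e₂∈ , a∉₂) with ∈-or-missed b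
      ...     | inj₁ all = through (es⊆ e₁∈ b∈₁) all
      ...     | inj₂ (e₃ , e₃∈ , b∉₃) with other {e = e₂} {b} (pairs e₂∈)
      ...       | c , c∈₂ , c≢b = ≤-trans (s≤s (length-mono-⊆ ues covered)) 4≤
        where
        b∈₂ = common e₁∈ e₂∈ a∈₁ b∈₁ a≢b a∉₂
        a∈₃ = common e₁∈ e₃∈ b∈₁ a∈₁ (a≢b ∘ sym) b∉₃
        c∈₃ = common e₂∈ e₃∈ b∈₂ c∈₂ (c≢b ∘ sym) b∉₃
        a≢c : a ≢ c
        a≢c refl = a∉₂ c∈₂
        covered : ∀ {e} → e ∈ₗ es → e ∈ₗ e₁ ∷ e₂ ∷ e₃ ∷ []
        covered {e} e∈ with a ∈? e | b ∈? e
        ... | yes a∈ | yes b∈ = here (pair-≡ (pairs e∈) (pairs e₁∈) a≢b a∈ b∈ a∈₁ b∈₁)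
        ... | yes a∈ | no b∉ = there (there (here (pair-≡ (pairs e∈) (pairs e₃∈) a≢c a∈ (common e₂∈ e∈ b∈₂ c∈₂ (c≢b ∘ sym) b∉) a∈₃ c∈₃)))
        ... | no a∉ | yes b∈ = there (here (pair-≡ (pairs e∈) (pairs e₂∈) (c≢b ∘ sym) b∈ (common e₃∈ e∈ a∈₃ c∈₃ a≢c a∉) b∈₂ c∈₂))
        ... | no a∉ | no b∉ = ⊥-elim (b∉ (common e₁∈ e∈ a∈₁ b∈₁ a≢b a∉))

  add-sub : ∀ {n} {x : Fin n} (p : Subset n) → x ∉ p → (p ∪⁅ x ⁆) - x ≡ p
  add-sub {x = x} p x∉ = ⊆-antisym
    (λ {y} y∈ → [ id , (λ y≡x → ⊥-elim (x∈p-y⇒x≢y (p ∪⁅ x ⁆) x y∈ y≡x)) ]′ (∈-add⁻ p (x∈p-y⇒x∈p (p ∪⁅ x ⁆) x y∈)))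
    (λ y∈ → x∈p-y (p ∪⁅ x ⁆) (⊆-add p y∈) (λ { refl → x∉ y∈ }))

  -- The vertex x, the blocks, and the members sorted by the way they touch them

  record Configuration (r n ν : ℕ) : Set where
    field
      𝓕          : ClusterFreeFamily n (3 + r)
      x          : Fin n
      B          : Fin ν → Subset n
      B∈F        : ∀ i → B i ∈ₗ ClusterFreeFamily.F 𝓕
      x∉B        : ∀ i → x ∉ B i
      B-disjoint : ∀ {i j y} → y ∈ B i → y ∈ B j → i ≡ j

  module Regions {r n ν : ℕ} (cfg : Configuration r n ν) where

    open Configuration cfg public
    open ClusterFreeFamily 𝓕 public

    R V U : Subset n
    R = ⋃ᶠ B
    V = R ∪⁅ x ⁆
    U = ∁ V

    ∣B∣ : ∀ i → ∣ B i ∣ ≡ 3 + r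
    ∣B∣ i = card (B∈F i)

    ∣R∣ : ∣ R ∣ ≡ ν * (3 + r)
    ∣R∣ = ∣⋃ᶠ∣ B ∣B∣ B-disjoint

    B⊆R : ∀ i → B i ⊆ R
    B⊆R i = ∈-⋃ᶠ⁺ B i

    x∉R : x ∉ R
    x∉R x∈ = let i , x∈i = ∈-⋃ᶠ⁻ B x∈ in x∉B i x∈i

    ∣V∣ : ∣ V ∣ ≡ suc (ν * (3 + r))
    ∣V∣ = trans (∣add∣ R x∉R) (cong suc ∣R∣)

    m : ℕ
    m = ∣ U ∣

    m≡ : m ≡ n ∸ suc (ν * (3 + r))
    m≡ = trans (∣∁p∣≡n∸∣p∣ V) (cong (n ∸_) ∣V∣)

    U⇒∉R : ∀ {y} → y ∈ U → y ∉ R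
    U⇒∉R y∈U y∈R = x∈∁p⇒x∉p y∈U (⊆-add R y∈R)

    U⇒≢x : ∀ {y} → y ∈ U → y ≢ x
    U⇒≢x y∈U refl = x∈∁p⇒x∉p y∈U (∈-add R)

    x∉U : x ∉ U
    x∉U x∈U = U⇒≢x x∈U refl

    region : ∀ y → y ∈ U ⊎ (y ≡ x ⊎ y ∈ R)
    region y with y ∈? V
    ... | no y∉V = inj₁ (x∉p⇒x∈∁p y∉V)
    ... | yes y∈V = inj₂ ([ inj₂ , inj₁ ]′ (∈-add⁻ R y∈V))

    trace-card : ∀ {S} → S ∈ₗ F → x ∈ S → ∣ S ∩ U ∣ + suc ∣ S ∩ R ∣ ≡ 3 + r
    trace-card {S} S∈ x∈ = trans (cong (∣ S ∩ U ∣ +_) (sym (trans (cong ∣_∣ S─U) (∣add∣ (S ∩ R) (x∉R ∘ proj₂ ∘ x∈p∩q⁻ S R)))))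
      (trans (∣p∩q∣+∣p─q∣ S U) (card S∈))
      where
      S─U : S ─ U ≡ (S ∩ R) ∪⁅ x ⁆
      S─U = ⊆-antisym
        (λ {y} y∈ → case region y of λ
          { (inj₁ y∈U) → ⊥-elim (x∈p─q⇒x∉q S U y∈ y∈U)
          ; (inj₂ (inj₁ refl)) → ∈-add (S ∩ R)
          ; (inj₂ (inj₂ y∈R)) → ⊆-add (S ∩ R) (x∈p∩q⁺ (p─q⊆p S U y∈ , y∈R)) })
        (λ y∈ → case ∈-add⁻ (S ∩ R) y∈ of λ
          { (inj₁ y∈SR) → let a , b = x∈p∩q⁻ S R y∈SR in x∈p∧x∉q⇒x∈p─q a (λ y∈U → U⇒∉R y∈U b)
          ; (inj₂ refl) → x∈p∧x∉q⇒x∈p─q x∈ x∉U })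

    -- The source of the contradictions about members through x that touch R: block and Y have at
    -- most 2k elements together, and the vertex x shared by S and S′ is not in the block, hence not
    -- in all three sets.
    noRowCluster : ∀ {S S′} i Y → S ∈ₗ F → S′ ∈ₗ F → x ∈ S → x ∈ S′ → S ≢ S′ → (∀ {y} → y ∈ B i → y ∈ S → y ∉ S′) →
                   S ⊆ B i ∪ Y → S′ ⊆ B i ∪ Y → ∣ Y ∣ ≤ 3 + r → Data.Empty.⊥
    noRowCluster {S} {S′} i Y S∈ S′∈ x∈ x∈′ S≢S′ empty S⊆ S′⊆ ∣Y∣ = noCluster (B∈F i) S∈ S′∈
      (λ eq → x∉B i (subst (x ∈_) (sym eq) x∈)) (λ eq → x∉B i (subst (x ∈_) (sym eq) x∈′)) S≢S′
      (∣∪₃∣≤ (B i) S S′ (B i ∪ Y) (x∈p∪q⁺ ∘ inj₁) S⊆ S′⊆ (≤-trans (∣p∪q∣≤ (B i) Y)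
        (+-mono-≤ (≤-reflexive (∣B∣ i)) (≤-trans ∣Y∣ (≤-reflexive (sym (+-identityʳ (3 + r))))))))
      empty

    Meets : Subset n → Fin ν → Set
    Meets S i = Nonempty (S ∩ B i)

    meets? : ∀ S i → Dec (Meets S i)
    meets? S i = nonempty? (S ∩ B i)

    Crossing : Subset n → Set
    Crossing S = ∃[ i ] ∃[ j ] (i ≢ j × Meets S i × Meets S j)

    abstract
      crossing? : ∀ S → Dec (Crossing S)
      crossing? S = Finₚ.any? {P = λ i → ∃[ j ] (i ≢ j × Meets S i × Meets S j)} λ i →
        Finₚ.any? {P = λ j → i ≢ j × Meets S i × Meets S j} λ j → ¬? (i Fin.≟ j) ×-dec (meets? S i ×-dec meets? S j)

    touches? : ∀ S → Dec (Nonempty (S ∩ R))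
    touches? S = nonempty? (S ∩ R)

    -- Fₛ, Fₐ, Fₓ: members through x touching no block, one block, several blocks; F∌: members
    -- avoiding x; L: the (k-1)-subsets P of U for which P ∪ {x} is absent.
    F∋ F∌ Fₛ Fₜ Fₐ Fₓ L : List (Subset n)
    F∋ = filter (x ∈?_) F
    F∌ = filter (¬? ∘ (x ∈?_)) F
    Fₜ = filter touches? F∋
    Fₛ = filter (¬? ∘ touches?) F∋
    Fₓ = filter crossing? Fₜ
    Fₐ = filter (¬? ∘ crossing?) Fₜ
    L  = filter (¬? ∘ inStar? F x) (choose U (2 + r))

    F-split : length F ≡ length Fₛ + (length Fₐ + length F∌) + length Fₓ
    F-split = trans (count-split (x ∈?_) F) (trans (cong (_+ length F∌)
      (trans (count-split touches? F∋) (cong (_+ length Fₛ) (count-split crossing? Fₜ))))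
      (rearrange (length Fₓ) (length Fₐ) (length Fₛ) (length F∌)))
      where
      rearrange : ∀ c a s o → c + a + s + o ≡ s + (a + o) + c
      rearrange = solve-∀

    F∋⁻ : ∀ {S} → S ∈ₗ F∋ → S ∈ₗ F × x ∈ S
    F∋⁻ = ∈-filter⁻ (x ∈?_) {xs = F}

    F∌⁻ : ∀ {S} → S ∈ₗ F∌ → S ∈ₗ F × x ∉ S
    F∌⁻ = ∈-filter⁻ (¬? ∘ (x ∈?_)) {xs = F}

    Fₜ⁻ : ∀ {S} → S ∈ₗ Fₜ → S ∈ₗ F × x ∈ S × Nonempty (S ∩ R)
    Fₜ⁻ S∈ = let S∈∋ , t = ∈-filter⁻ touches? {xs = F∋} S∈ ; S∈F , x∈ = F∋⁻ S∈∋ in S∈F , x∈ , t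

    F∋-unique : Unique F∋
    F∋-unique = Uniqueₚ.filter⁺ (x ∈?_) unique

    Fₜ-unique : Unique Fₜ
    Fₜ-unique = Uniqueₚ.filter⁺ touches? F∋-unique

    L⁻ : ∀ {P} → P ∈ₗ L → (P ⊆ U × ∣ P ∣ ≡ 2 + r) × P ∪⁅ x ⁆ ∉ₗ F
    L⁻ P∈ = let P∈U , ¬s = ∈-filter⁻ (¬? ∘ inStar? F x) {xs = choose U (2 + r)} P∈ in
      ∈-choose⁻ U (2 + r) P∈U , ¬s ∘ inj₂

    L⁺ : ∀ {P} → P ⊆ U → ∣ P ∣ ≡ 2 + r → P ∪⁅ x ⁆ ∉ₗ F → P ∈ₗ L
    L⁺ P⊆U ∣P∣ ∉F = ∈-filter⁺ (¬? ∘ inStar? F x) (∈-choose P⊆U ∣P∣) [ x∉U ∘ P⊆U , ∉F ]′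

    L-unique : Unique L
    L-unique = Uniqueₚ.filter⁺ (¬? ∘ inStar? F x) (choose-unique U (2 + r))

    -- S ↦ S - x embeds `Fₛ` into the (k-1)-subsets of U that are not in `L`. Keeping `length L` on
    -- the left is what later pays for the noncrossing members.
    length-star : length Fₛ + length L ≤ m C (2 + r)
    length-star = ≤-trans (+-monoˡ-≤ (length L) (length-≤-inj {ys = filter (inStar? F x) (choose U (2 + r))} (_- x)
        (Uniqueₚ.filter⁺ (¬? ∘ touches?) F∋-unique) into inj))
      (≤-reflexive (trans (sym (count-split (inStar? F x) (choose U (2 + r)))) (length-choose U (2 + r))))
      where
      Fₛ⁻ : ∀ {S} → S ∈ₗ Fₛ → S ∈ₗ F × x ∈ S × ¬ Nonempty (S ∩ R)
      Fₛ⁻ S∈ = let S∈∋ , t = ∈-filter⁻ (¬? ∘ touches?) {xs = F∋} S∈ ; S∈F , x∈ = F∋⁻ S∈∋ in S∈F , x∈ , t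
      into : ∀ {S} → S ∈ₗ Fₛ → S - x ∈ₗ filter (inStar? F x) (choose U (2 + r))
      into {S} S∈ = let S∈F , x∈ , ¬t = Fₛ⁻ S∈ in ∈-filter⁺ (inStar? F x)
        (∈-choose (λ {y} y∈ → case region y of λ
            { (inj₁ y∈U) → y∈U
            ; (inj₂ (inj₁ y≡x)) → ⊥-elim (x∈p-y⇒x≢y S x y∈ y≡x)
            ; (inj₂ (inj₂ y∈R)) → ⊥-elim (¬t (y , x∈p∩q⁺ (x∈p-y⇒x∈p S x y∈ , y∈R))) })
          (suc-injective (trans (∣sub∣ S x∈) (card S∈F))))
        (inj₂ (subst (_∈ₗ F) (sym (sub-add S x∈)) S∈F))
      inj : ∀ {S S′} → S ∈ₗ Fₛ → S′ ∈ₗ Fₛ → S - x ≡ S′ - x → S ≡ S′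
      inj {S} {S′} S∈ S′∈ eq = trans (sym (sub-add S (proj₁ (proj₂ (Fₛ⁻ S∈))))) (trans (cong (_∪⁅ x ⁆) eq) (sub-add S′ (proj₁ (proj₂ (Fₛ⁻ S′∈)))))

    everything : ∀ (S : Subset n) → S ⊆ U ∪ V
    everything S {y} _ = case region y of λ
      { (inj₁ y∈U) → x∈p∪q⁺ (inj₁ y∈U)
      ; (inj₂ (inj₁ refl)) → x∈p∪q⁺ (inj₂ (∈-add R))
      ; (inj₂ (inj₂ y∈R)) → x∈p∪q⁺ (inj₂ (⊆-add R y∈R)) }

    -- If S touches only the block B i and Q ⊆ U contains S ∩ U, then B i, S and Q ∪ {x} would form
    -- a cluster. So S forces all (k-1)-sets above its trace into `L`, and boundedly many S share
    -- one of them.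
    length-Fₐ : length Fₐ * (m ∸ (1 + r)) ≤ length L * 2 ^ (2 + r + ∣ V ∣)
    length-Fₐ = length-extensions U V (1 + r) Fₐ L (Uniqueₚ.filter⁺ (¬? ∘ crossing?) Fₜ-unique) (λ {S} _ → everything S)
      small (λ Q∈ → ≤-reflexive (proj₂ (proj₁ (L⁻ Q∈)))) into
      where
      Fₐ⁻ : ∀ {S} → S ∈ₗ Fₐ → (S ∈ₗ F × x ∈ S × Nonempty (S ∩ R)) × ¬ Crossing S
      Fₐ⁻ S∈ = let S∈t , ¬c = ∈-filter⁻ (¬? ∘ crossing?) {xs = Fₜ} S∈ in Fₜ⁻ S∈t , ¬c
      small : ∀ {S} → S ∈ₗ Fₐ → ∣ S ∩ U ∣ ≤ 1 + r
      small {S} S∈ = let (S∈F , x∈ , (y , y∈)) , _ = Fₐ⁻ S∈ in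
        +-cancelʳ-≤ 2 ∣ S ∩ U ∣ (1 + r) (≤-trans (+-monoʳ-≤ ∣ S ∩ U ∣ (s≤s (≤-trans (≤-reflexive (sym (∣⁅x⁆∣≡1 y)))
            (p⊆q⇒∣p∣≤∣q∣ {p = ⁅ y ⁆} λ z∈ → subst (_∈ S ∩ R) (sym (x∈⁅y⁆⇒x≡y y z∈)) y∈))))
          (≤-reflexive (trans (trace-card S∈F x∈) (+-comm 2 (1 + r)))))
      into : ∀ {S Q} → S ∈ₗ Fₐ → Q ∈ₗ choose U (2 + r) → S ∩ U ⊆ Q → Q ∈ₗ L
      into {S} {Q} S∈ Q∈ S∩U⊆Q = L⁺ Q⊆U ∣Q∣ impossible
        where
        S∈F = proj₁ (proj₁ (Fₐ⁻ S∈))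
        x∈S = proj₁ (proj₂ (proj₁ (Fₐ⁻ S∈)))
        y = proj₁ (proj₂ (proj₂ (proj₁ (Fₐ⁻ S∈))))
        y∈S = proj₁ (x∈p∩q⁻ S R (proj₂ (proj₂ (proj₂ (proj₁ (Fₐ⁻ S∈))))))
        y∈R = proj₂ (x∈p∩q⁻ S R (proj₂ (proj₂ (proj₂ (proj₁ (Fₐ⁻ S∈))))))
        i = proj₁ (∈-⋃ᶠ⁻ B y∈R)
        y∈B = proj₂ (∈-⋃ᶠ⁻ B y∈R)
        Q⊆U = proj₁ (∈-choose⁻ U (2 + r) Q∈)
        ∣Q∣ = proj₂ (∈-choose⁻ U (2 + r) Q∈)
        Q′ = Q ∪⁅ x ⁆
        B∩Q′ : ∀ {z} → z ∈ B i → z ∉ Q′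
        B∩Q′ z∈B z∈Q′ = case ∈-add⁻ Q z∈Q′ of λ
          { (inj₁ z∈Q) → U⇒∉R (Q⊆U z∈Q) (B⊆R i z∈B) ; (inj₂ refl) → x∉B i z∈B }
        S⊆ : S ⊆ B i ∪ Q′
        S⊆ {z} z∈ = case region z of λ
          { (inj₁ z∈U) → x∈p∪q⁺ (inj₂ (⊆-add Q (S∩U⊆Q (x∈p∩q⁺ (z∈ , z∈U)))))
          ; (inj₂ (inj₁ refl)) → x∈p∪q⁺ (inj₂ (∈-add Q))
          ; (inj₂ (inj₂ z∈R)) → let j , z∈Bj = ∈-⋃ᶠ⁻ B z∈R in case i Fin.≟ j of λ
            { (yes i≡j) → x∈p∪q⁺ (inj₁ (subst (λ j → z ∈ B j) (sym i≡j) z∈Bj))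
            ; (no i≢j) → ⊥-elim (proj₂ (Fₐ⁻ S∈) (i , j , i≢j , (y , x∈p∩q⁺ (y∈S , y∈B)) , (z , x∈p∩q⁺ (z∈ , z∈Bj)))) } }
        impossible : Q′ ∉ₗ F
        impossible Q′∈ = noRowCluster i Q′ S∈F Q′∈ x∈S (∈-add Q) (λ { eq → B∩Q′ y∈B (subst (y ∈_) eq y∈S) })
          (λ z∈B _ → B∩Q′ z∈B) S⊆ (x∈p∪q⁺ ∘ inj₂) (≤-reflexive (card Q′∈))

    -- A member avoiding x but meeting U in q makes most sets {x, q} ∪ Q′ absent from F.
    degree-≥ : ∀ {S q} → S ∈ₗ F → x ∉ S → q ∈ S → q ∈ U → (m ∸ (3 + r)) C (2 + r) ≤ length L + count (q ∈?_) L * n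
    degree-≥ {S} {q} S∈ x∉S q∈S q∈U = begin
      (m ∸ (3 + r)) C (2 + r)                           ≤⟨ C-mono (2 + r) big ⟩
      ∣ U ─ S ∣ C (2 + r)                               ≡⟨ sym (length-choose (U ─ S) (2 + r)) ⟩
      length (choose (U ─ S) (2 + r))                   ≤⟨ length-mono-⊆ {ys = L ++ concatMap swaps Lq} (choose-unique (U ─ S) (2 + r)) covered ⟩
      length (L ++ concatMap swaps Lq)                  ≡⟨ length-++ L ⟩
      length L + length (concatMap swaps Lq)            ≤⟨ +-monoʳ-≤ (length L) (length-concatMap-≤ swaps Lq
                                                            (λ _ → ≤-reflexive (trans (length-map _ (allFin n)) (length-allFin n)))) ⟩
      length L + length Lq * n                          ∎
      where
      open ≤-Reasoning
      Lq = filter (q ∈?_) L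
      -- P is recovered from P₂ = (P - y) ∪ {q} once the lost element y is named, which costs the
      -- factor n.
      swaps : Subset n → List (Subset n)
      swaps P = map ((P - q) ∪⁅_⁆) (allFin n)
      big : m ∸ (3 + r) ≤ ∣ U ─ S ∣
      big = m≤n+o⇒m∸n≤o m (3 + r) (≤-trans (≤-reflexive (sym (∣p∩q∣+∣p─q∣ U S)))
        (+-monoˡ-≤ ∣ U ─ S ∣ (≤-trans (∣p∩q∣≤∣q∣ U S) (≤-reflexive (card S∈)))))
      covered : ∀ {P} → P ∈ₗ choose (U ─ S) (2 + r) → P ∈ₗ L ++ concatMap swaps Lq
      covered {P} P∈ = case P ∪⁅ x ⁆ ∈ₗ? F of λ
        { (no ∉F) → ∈-++⁺ˡ (L⁺ P⊆U ∣P∣ ∉F)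
        ; (yes ∈F) → ∈-++⁺ʳ L (∈-concatMap swaps (∈-filter⁺ (q ∈?_) (L⁺ P₂⊆U ∣P₂∣ (impossible ∈F)) (∈-add (P - y)))
            (subst (_∈ₗ swaps P₂) (trans (cong (_∪⁅ y ⁆) (add-sub (P - y) q∉P-y)) (sub-add P y∈)) (∈-map⁺ ((P₂ - q) ∪⁅_⁆) (∈-allFin y)))) }
        where
        P⊆U─S = proj₁ (∈-choose⁻ (U ─ S) (2 + r) P∈)
        ∣P∣ = proj₂ (∈-choose⁻ (U ─ S) (2 + r) P∈)
        P⊆U : P ⊆ U
        P⊆U = p─q⊆p U S ∘ P⊆U─S
        P∌S : ∀ {z} → z ∈ P → z ∉ S
        P∌S z∈ = x∈p─q⇒x∉q U S (P⊆U─S z∈)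
        yy : Nonempty P
        yy = card>0⇒Nonempty P (subst (1 ≤_) (sym ∣P∣) (s≤s z≤n))
        y = proj₁ yy
        y∈ = proj₂ yy
        q∉P : q ∉ P
        q∉P q∈P = P∌S q∈P q∈S
        q∉P-y : q ∉ P - y
        q∉P-y = q∉P ∘ x∈p-y⇒x∈p P y
        P₂ = (P - y) ∪⁅ q ⁆
        P₂⊆U : P₂ ⊆ U
        P₂⊆U z∈ = [ P⊆U ∘ x∈p-y⇒x∈p P y , (λ { refl → q∈U }) ]′ (∈-add⁻ (P - y) z∈)
        ∣P₂∣ : ∣ P₂ ∣ ≡ 2 + r
        ∣P₂∣ = trans (∣add∣ (P - y) q∉P-y) (trans (∣sub∣ P y∈) ∣P∣)
        -- S and P ∪ {x} are disjoint and have 2k elements together; exchanging y for q ∈ S stays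
        -- within their union.
        impossible : P ∪⁅ x ⁆ ∈ₗ F → P₂ ∪⁅ x ⁆ ∉ₗ F
        impossible ∈F ∈F₂ = noCluster S∈ ∈F ∈F₂
          (λ eq → x∉S (subst (x ∈_) (sym eq) (∈-add P))) (λ eq → x∉S (subst (x ∈_) (sym eq) (∈-add P₂)))
          (λ eq → [ q∉P , U⇒≢x q∈U ]′ (∈-add⁻ P (subst (q ∈_) (sym eq) (⊆-add P₂ (∈-add (P - y))))))
          (∣∪₃∣≤ S (P ∪⁅ x ⁆) (P₂ ∪⁅ x ⁆) (S ∪ (P ∪⁅ x ⁆)) (x∈p∪q⁺ ∘ inj₁) (x∈p∪q⁺ ∘ inj₂)
            (λ z∈ → case ∈-add⁻ P₂ z∈ of λ
              { (inj₂ refl) → x∈p∪q⁺ (inj₂ (∈-add P))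
              ; (inj₁ z∈P₂) → case ∈-add⁻ (P - y) z∈P₂ of λ
                { (inj₁ z∈P-y) → x∈p∪q⁺ (inj₂ (⊆-add P (x∈p-y⇒x∈p P y z∈P-y)))
                ; (inj₂ refl) → x∈p∪q⁺ (inj₁ q∈S) } })
            (≤-trans (∣p∪q∣≤ S (P ∪⁅ x ⁆)) (+-mono-≤ (≤-reflexive (card S∈)) (≤-trans (≤-reflexive (card ∈F)) (≤-reflexive (sym (+-identityʳ (3 + r))))))))
          (λ z∈S z∈P _ → [ (λ z∈P → P∌S z∈P z∈S) , (λ { refl → x∉S z∈S }) ]′ (∈-add⁻ P z∈P))

  -- Noncrossing members are paid for by absent sets

  module NonCrossing {r n ν : ℕ} (cfg : Configuration r n ν) (K D : ℕ)
    (few : count (λ P → ¬? (inStar? (ClusterFreeFamily.F (Configuration.𝓕 cfg)) (Configuration.x cfg) P)) (kSubsets n (2 + r)) ≤ K * n ^ (1 + r))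
    (h₁ : n ^ (2 + r) ≤ D * ((Regions.m cfg ∸ (3 + r)) C (2 + r)))
    (1≤D : 1 ≤ D) (1≤n : 1 ≤ n)
    (h₂ : 2 * (D * K) ≤ n)
    (h₃ : 2 * 2 ^ (2 + r + ∣ Regions.V cfg ∣) ≤ Regions.m cfg ∸ (1 + r))
    (h₄ : 2 * D * (2 * 2 ^ (ν * (3 + r) + 2 * D * (K * (2 + r)))) ≤ n) where

    open Regions cfg

    private
      N ℓ M₃ : ℕ
      N = n ^ (1 + r)
      ℓ = length L
      M₃ = f ((3 + r) * ν) (3 + r) 3 (ℤ.+ ν ℤ.- 1ℤ)

      instance
        n≢0 : NonZero n
        n≢0 = >-nonZero 1≤n
        N≢0 : NonZero N
        N≢0 = m^n≢0 n (1 + r)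
        D≢0 : NonZero D
        D≢0 = >-nonZero 1≤D

      ℓ≤ : ℓ ≤ K * N
      ℓ≤ = ≤-trans (length-mono-⊆ {ys = filter (¬? ∘ inStar? F x) (kSubsets n (2 + r))} L-unique (λ P∈ →
        let (P⊆U , ∣P∣) , ∉F = L⁻ P∈ in ∈-filter⁺ (¬? ∘ inStar? F x) (∈-kSubsets⁺ ∣P∣) [ x∉U ∘ P⊆U , ∉F ]′)) few

      deg : Fin n → ℕ
      deg q = count (q ∈?_) L

      -- Each witness forces at least N / 2D absent sets through itself, so there are few witnesses.
      -- On the other hand a single one already makes `L` larger than twice the number of all
      -- subsets of R and the witnesses.
      Witness : Fin n → Set
      Witness q = q ∈ U × Any (q ∈_) F∌

      witness? : ∀ q → Dec (Witness q)
      witness? q = (q ∈? U) ×-dec Any.any? (q ∈?_) F∌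

      Zs : List (Fin n)
      Zs = filter witness? (allFin n)

      Zs-unique : Unique Zs
      Zs-unique = Uniqueₚ.filter⁺ witness? (Uniqueₚ.allFin⁺ n)

      -- The left side of `degree-≥` has order n^(k-1), while `ℓ` has order n^(k-2) only. By `h₁`
      -- and `h₂`, half of the main term is left for n · deg q.
      deg-large : ∀ {q} → q ∈ₗ Zs → N ≤ 2 * D * deg q
      deg-large {q} q∈ = let q∈U , any = proj₂ (∈-filter⁻ witness? {xs = allFin n} q∈)
                             S , S∈ , q∈S = find any ; S∈F , x∉S = F∌⁻ S∈
                         in bound (degree-≥ S∈F x∉S q∈S q∈U)
        where
        bound : (m ∸ (3 + r)) C (2 + r) ≤ ℓ + deg q * n → N ≤ 2 * D * deg q
        bound h = *-cancelˡ-≤ n (+-cancelˡ-≤ (n * N) _ _ (begin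
          n * N + n * N                                     ≤⟨ +-mono-≤ h₁ h₁ ⟩
          D * c + D * c                                     ≤⟨ +-mono-≤ (*-monoʳ-≤ D h) (*-monoʳ-≤ D h) ⟩
          D * (ℓ + deg q * n) + D * (ℓ + deg q * n)         ≡⟨ regroup₁ D ℓ (deg q) n ⟩
          2 * D * ℓ + n * (2 * D * deg q)                   ≤⟨ +-monoˡ-≤ (n * (2 * D * deg q)) (*-monoʳ-≤ (2 * D) ℓ≤) ⟩
          2 * D * (K * N) + n * (2 * D * deg q)             ≡⟨ cong (_+ n * (2 * D * deg q)) (regroup₂ D K N) ⟩
          2 * (D * K) * N + n * (2 * D * deg q)             ≤⟨ +-monoˡ-≤ (n * (2 * D * deg q)) (*-monoˡ-≤ N h₂) ⟩
          n * N + n * (2 * D * deg q)                       ∎))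
          where
          open ≤-Reasoning
          c = (m ∸ (3 + r)) C (2 + r)
          regroup₁ : ∀ D l d n → D * (l + d * n) + D * (l + d * n) ≡ 2 * D * l + n * (2 * D * d)
          regroup₁ = solve-∀
          regroup₂ : ∀ D K N → 2 * D * (K * N) ≡ 2 * (D * K) * N
          regroup₂ = solve-∀

      Kz : ℕ
      Kz = 2 * D * (K * (2 + r))

      -- The degrees of the witnesses add up to at most (k-1)∣L∣, which is O(N), and each is at
      -- least N / 2D.
      length-Zs : 1 ≤ length Zs → length Zs ≤ Kz
      length-Zs h with below-average deg Zs h
      ... | q , q∈ , avg = *-cancelʳ-≤ (length Zs) Kz N (begin
        length Zs * N                   ≤⟨ *-monoʳ-≤ (length Zs) (deg-large q∈) ⟩
        length Zs * (2 * D * deg q)     ≡⟨ swap (length Zs) (2 * D) (deg q) ⟩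
        2 * D * (length Zs * deg q)     ≤⟨ *-monoʳ-≤ (2 * D) avg ⟩
        2 * D * total deg Zs            ≤⟨ *-monoʳ-≤ (2 * D) (total-count-≤ (λ q P → q ∈? P) Zs L (2 + r) high) ⟩
        2 * D * (ℓ * (2 + r))           ≤⟨ *-monoʳ-≤ (2 * D) (*-monoˡ-≤ (2 + r) ℓ≤) ⟩
        2 * D * (K * N * (2 + r))       ≡⟨ regroup (2 * D) K N (2 + r) ⟩
        Kz * N                          ∎)
        where
        open ≤-Reasoning
        swap : ∀ a b c → a * (b * c) ≡ b * (a * c)
        swap = solve-∀
        regroup : ∀ a b c d → a * (b * c * d) ≡ a * (b * d) * c
        regroup = solve-∀
        high : ∀ {P} → P ∈ₗ L → count (_∈? P) Zs ≤ 2 + r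
        high {P} P∈ = ≤-trans (length≤∣p∣ {p = P} (Uniqueₚ.filter⁺ (_∈? P) Zs-unique) (λ y∈ → proj₂ (∈-filter⁻ (_∈? P) {xs = Zs} y∈)))
          (≤-reflexive (proj₂ (proj₁ (L⁻ P∈))))

      F∌-unique : Unique F∌
      F∌-unique = Uniqueₚ.filter⁺ (¬? ∘ (x ∈?_)) unique

      F∌⊆ : ∀ {S} → S ∈ₗ F∌ → S ⊆ R ∪ fromList Zs
      F∌⊆ S∈ {y} y∈ = case region y of λ
        { (inj₁ y∈U) → x∈p∪q⁺ (inj₂ (∈-fromList⁺ (∈-filter⁺ witness? (∈-allFin y) (y∈U , lose S∈ y∈))))
        ; (inj₂ (inj₁ refl)) → ⊥-elim (proj₂ (F∌⁻ S∈) y∈)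
        ; (inj₂ (inj₂ y∈R)) → x∈p∪q⁺ (inj₁ y∈R) }

      X : ℕ
      X = 2 ^ (ν * (3 + r) + Kz)

      length-F∌ : 1 ≤ length Zs → length F∌ ≤ X
      length-F∌ h = ≤-trans (length-mono-⊆ F∌-unique (∈-powerset (R ∪ fromList Zs) ∘ F∌⊆))
        (≤-trans (≤-reflexive (length-powerset (R ∪ fromList Zs)))
          (^-monoʳ-≤ 2 (≤-trans (∣p∪q∣≤ R (fromList Zs))
            (+-mono-≤ (≤-reflexive ∣R∣) (≤-trans (∣p∣≤length {p = fromList Zs} (∈-fromList⁻ Zs)) (length-Zs h))))))

      -- The degree of one witness is at least N / 2D ≥ n / 2D, and `h₄` makes this exceed a
      -- constant. The factor 2 leaves the other half of `L` for `Fₐ`.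
      2X≤ℓ : 1 ≤ length Zs → 2 * X ≤ ℓ
      2X≤ℓ h with below-average deg Zs h
      ... | q , q∈ , _ = *-cancelˡ-≤ (2 * D) {{m*n≢0 2 D}} (begin
        2 * D * (2 * X)     ≤⟨ h₄ ⟩
        n                   ≡⟨ sym (*-identityʳ n) ⟩
        n * 1               ≤⟨ *-monoʳ-≤ n (m^n>0 n r) ⟩
        N                   ≤⟨ deg-large q∈ ⟩
        2 * D * deg q       ≤⟨ *-monoʳ-≤ (2 * D) (length-filter (q ∈?_) L) ⟩
        2 * D * ℓ           ∎)
        where open ≤-Reasoning

      2Fₐ≤ℓ : 2 * length Fₐ ≤ ℓ
      2Fₐ≤ℓ = *-cancelʳ-≤ (2 * length Fₐ) ℓ Y {{m^n≢0 2 (2 + r + ∣ V ∣)}} (begin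
        2 * length Fₐ * Y         ≡⟨ regroup (length Fₐ) Y ⟩
        length Fₐ * (2 * Y)       ≤⟨ *-monoʳ-≤ (length Fₐ) h₃ ⟩
        length Fₐ * (m ∸ (1 + r)) ≤⟨ length-Fₐ ⟩
        ℓ * Y                     ∎)
        where
        open ≤-Reasoning
        Y = 2 ^ (2 + r + ∣ V ∣)
        regroup : ∀ a b → 2 * a * b ≡ a * (2 * b)
        regroup = solve-∀

      F∌-inside : length Zs ≡ 0 → length F∌ ≤ M₃
      F∌-inside none = length≤f 𝓕∌ R inside-R (trans ∣R∣ (*-comm ν (3 + r))) matching {ℤ.+ ν ℤ.- 1ℤ} (ℤₚ.≤-reflexive (minus-plus (ℤ.+ ν)))
        where
        minus-plus : ∀ i → i ℤ.- 1ℤ ℤ.+ 1ℤ ≡ i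
        minus-plus i = trans (ℤₚ.+-assoc i (ℤ.- 1ℤ) 1ℤ) (ℤₚ.+-identityʳ i)
        𝓕∌ : ClusterFreeFamily n (3 + r)
        𝓕∌ = record
          { F = F∌ ; unique = F∌-unique ; card = card ∘ proj₁ ∘ F∌⁻
          ; noCluster = λ A∈ B∈ D∈ → noCluster (proj₁ (F∌⁻ A∈)) (proj₁ (F∌⁻ B∈)) (proj₁ (F∌⁻ D∈)) }
        empty : ∀ (zs : List (Fin n)) → length zs ≡ 0 → ∀ {z} → z ∉ₗ zs
        empty [] _ ()
        inside-R : ∀ {S} → S ∈ₗ F∌ → S ⊆ R
        inside-R S∈ y∈ = case x∈p∪q⁻ R (fromList Zs) (F∌⊆ S∈ y∈) of λ
          { (inj₁ y∈R) → y∈R ; (inj₂ y∈Z) → ⊥-elim (empty Zs none (∈-fromList⁻ Zs y∈Z)) }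
        some : ∀ i → Nonempty (B i)
        some i = card>0⇒Nonempty (B i) (subst (1 ≤_) (sym (∣B∣ i)) (s≤s z≤n))
        B-injective : ∀ {i j} → B i ≡ B j → i ≡ j
        B-injective {i} eq = B-disjoint (proj₂ (some i)) (subst (proj₁ (some i) ∈_) eq (proj₂ (some i)))
        matching : Matching 𝓕∌ ν
        matching = record
          { blocks = map B (allFin ν)
          ; blocks⊆F = λ S∈ → case ∈-map⁻ B S∈ of λ { (i , _ , refl) → ∈-filter⁺ (¬? ∘ (x ∈?_)) (B∈F i) (x∉B i) }
          ; blocks-unique = Uniqueₚ.map⁺ B-injective (Uniqueₚ.allFin⁺ ν)
          ; blocks-disjoint = λ S∈ S′∈ S≢S′ → λ { (y , y∈) → case ∈-map⁻ B S∈ , ∈-map⁻ B S′∈ of λ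
              { ((i , _ , refl) , (j , _ , refl)) → let a , b = x∈p∩q⁻ (B i) (B j) y∈ in S≢S′ (cong B (B-disjoint a b)) } }
          ; μ≤blocks = ≤-reflexive (sym (trans (length-map B (allFin ν)) (length-allFin ν))) }

    -- Without witnesses `F∌` lies inside R and is bounded by `M₃`; with a witness, `Fₐ` and `F∌`
    -- are charged to one half of `L` each.
    length-noncrossing : length Fₐ + length F∌ ≤ length L + f ((3 + r) * ν) (3 + r) 3 (ℤ.+ ν ℤ.- 1ℤ)
    length-noncrossing = case length Zs ≟ 0 of λ
      { (yes none) → +-mono-≤ (≤-trans (m≤m+n (length Fₐ) _) 2Fₐ≤ℓ) (F∌-inside none)
      ; (no some) → ≤-trans (*-cancelˡ-≤ 2 (≤-trans (≤-reflexive (*-distribˡ-+ 2 (length Fₐ) (length F∌)))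
          (≤-trans (+-mono-≤ 2Fₐ≤ℓ (≤-trans (*-monoʳ-≤ 2 (length-F∌ (n≢0⇒n>0 some))) (2X≤ℓ (n≢0⇒n>0 some))))
            (≤-reflexive (cong (ℓ +_) (sym (+-identityʳ ℓ))))))) (m≤m+n ℓ M₃) }

  -- Crossing members, sorted by the size of their trace on R

  exhaust : ∀ {n} {p : Subset n} (xs : List (Fin n)) → Unique xs → (∀ {y} → y ∈ₗ xs → y ∈ p) → ∣ p ∣ ≤ length xs → ∀ {y} → y ∈ p → y ∈ₗ xs
  exhaust {p = p} xs uxs sub h {y} y∈ with Any.any? (y Fin.≟_) xs
  ... | yes y∈xs = y∈xs
  ... | no y∉ = ⊥-elim (<⇒≱ (s≤s h) (length≤∣p∣ {xs = y ∷ xs} {p = p} (All.tabulate (λ {z} z∈ y≡z → y∉ (subst (_∈ₗ xs) (sym y≡z) z∈)) ∷ uxs)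
      λ { (here refl) → y∈ ; (there z∈) → sub z∈ }))

  module Crossings {r n ν : ℕ} (cfg : Configuration r n ν) where

    open Regions cfg

    Fₓ⁻ : ∀ {S} → S ∈ₗ Fₓ → (S ∈ₗ F × x ∈ S × Nonempty (S ∩ R)) × Crossing S
    Fₓ⁻ S∈ = let S∈t , c = ∈-filter⁻ crossing? {xs = Fₜ} S∈ in Fₜ⁻ S∈t , c

    ∈F : ∀ {S} → S ∈ₗ Fₓ → S ∈ₗ F
    ∈F S∈ = proj₁ (proj₁ (Fₓ⁻ S∈))

    x∈ : ∀ {S} → S ∈ₗ Fₓ → x ∈ S
    x∈ S∈ = proj₁ (proj₂ (proj₁ (Fₓ⁻ S∈)))

    ∣trace∣ : ∀ {S} → S ∈ₗ Fₓ → ∣ S ∩ U ∣ + suc ∣ S ∩ R ∣ ≡ 3 + r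
    ∣trace∣ S∈ = trace-card (∈F S∈) (x∈ S∈)

    second-index : ∀ {S} → S ∈ₗ Fₓ → ∀ i → ∃[ j ] (j ≢ i × Meets S j)
    second-index S∈ i = let j , j′ , j≢j′ , mj , mj′ = proj₂ (Fₓ⁻ S∈) in case j Fin.≟ i of λ
      { (no j≢i) → j , j≢i , mj ; (yes j≡i) → j′ , (λ j′≡i → j≢j′ (trans j≡i (sym j′≡i))) , mj′ }

    ∈SR : ∀ {S y} i → y ∈ S → y ∈ B i → y ∈ S ∩ R
    ∈SR i y∈S y∈B = x∈p∩q⁺ (y∈S , B⊆R i y∈B)

    apart : ∀ {i j y z} → i ≢ j → y ∈ B i → z ∈ B j → y ≢ z
    apart i≢j y∈ z∈ refl = i≢j (B-disjoint y∈ z∈)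

    module _ {S S′ : Subset n} (S∈ : S ∈ₗ Fₓ) (S′∈ : S′ ∈ₗ Fₓ) (same : S ∩ U ≡ S′ ∩ U) (S≢S′ : S ≢ S′) where

      -- Outside B i both members lie in their common part in U, the vertex x and the points `zs`;
      -- the size condition keeps these within k elements.
      separated : ∀ i zs → suc ∣ S ∩ U ∣ + length zs ≤ 3 + r → (∀ {y} → y ∈ B i → y ∈ S → y ∉ S′) →
                  (∀ {y} → y ∈ S ∩ R → y ∈ B i ⊎ y ∈ₗ zs) → (∀ {y} → y ∈ S′ ∩ R → y ∈ B i ⊎ y ∈ₗ zs) → Data.Empty.⊥
      separated i zs size disj cov cov′ = noRowCluster i Y (∈F S∈) (∈F S′∈) (x∈ S∈) (x∈ S′∈) S≢S′ disj
        (within S id cov) (within S′ (λ {y} → subst (y ∈_) (sym same)) cov′)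
        (≤-trans (∣p∪q∣≤ ((S ∩ U) ∪⁅ x ⁆) (fromList zs))
          (≤-trans (+-mono-≤ (∣add∣≤ (S ∩ U)) (∣p∣≤length {p = fromList zs} (∈-fromList⁻ zs))) size))
        where
        Y = ((S ∩ U) ∪⁅ x ⁆) ∪ fromList zs
        within : ∀ T → (∀ {y} → y ∈ T ∩ U → y ∈ S ∩ U) → (∀ {y} → y ∈ T ∩ R → y ∈ B i ⊎ y ∈ₗ zs) → T ⊆ B i ∪ Y
        within T TU cov {y} y∈ = case region y of λ
          { (inj₁ y∈U) → x∈p∪q⁺ (inj₂ (x∈p∪q⁺ (inj₁ (⊆-add (S ∩ U) (TU (x∈p∩q⁺ (y∈ , y∈U)))))))
          ; (inj₂ (inj₁ refl)) → x∈p∪q⁺ (inj₂ (x∈p∪q⁺ (inj₁ (∈-add (S ∩ U)))))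
          ; (inj₂ (inj₂ y∈R)) → [ x∈p∪q⁺ ∘ inj₁ , (λ y∈zs → x∈p∪q⁺ (inj₂ (x∈p∪q⁺ (inj₂ (∈-fromList⁺ y∈zs))))) ]′ (cov (x∈p∩q⁺ (y∈ , y∈R))) }

      off-R : ∀ {y} → y ∈ S → y ∉ R → y ∈ S′
      off-R {y} y∈ y∉R = case region y of λ
        { (inj₁ y∈U) → proj₁ (x∈p∩q⁻ S′ U (subst (y ∈_) same (x∈p∩q⁺ (y∈ , y∈U))))
        ; (inj₂ (inj₁ refl)) → x∈ S′∈ ; (inj₂ (inj₂ y∈R)) → ⊥-elim (y∉R y∈R) }

      -- If d is the only element of S outside S′ and the only one in its block, S ∖ B j ⊆ S′.
      one-off : ∀ {d} j → d ∈ S → d ∈ B j → (∀ {y} → y ∈ S ∩ R → y ≡ d ⊎ y ∈ S′) → (∀ {y} → y ∈ B j → y ∈ S → y ≡ d) → Data.Empty.⊥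
      one-off {d} j d∈ d∈B rest only = case d ∈? S′ of λ
        { (yes d∈S′) → S≢S′ (⊆-card-≡ (λ {y} y∈ → case y ∈? R of λ
            { (no y∉R) → off-R y∈ y∉R
            ; (yes y∈R) → [ (λ { refl → d∈S′ }) , id ]′ (rest (x∈p∩q⁺ (y∈ , y∈R))) })
            (≤-reflexive (trans (card (∈F S′∈)) (sym (card (∈F S∈))))))
        ; (no d∉S′) → noRowCluster j S′ (∈F S∈) (∈F S′∈) (x∈ S∈) (x∈ S′∈) S≢S′
            (λ y∈B y∈S y∈S′ → d∉S′ (subst (_∈ S′) (only y∈B y∈S) y∈S′))
            (λ {y} y∈ → case y ∈? R of λ
              { (no y∉R) → x∈p∪q⁺ (inj₂ (off-R y∈ y∉R))
              ; (yes y∈R) → [ (λ { refl → x∈p∪q⁺ (inj₁ d∈B) }) , x∈p∪q⁺ ∘ inj₂ ]′ (rest (x∈p∩q⁺ (y∈ , y∈R))) })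
            (x∈p∪q⁺ ∘ inj₂) (≤-reflexive (card (∈F S′∈))) }

    sizeIs? : ∀ t S → Dec (∣ S ∩ R ∣ ≡ t)
    sizeIs? t S = ∣ S ∩ R ∣ ≟ t

    F₂ F₃ F₄ : List (Subset n)
    F₂ = filter (sizeIs? 2) Fₓ
    F₃ = filter (sizeIs? 3) (filter (¬? ∘ sizeIs? 2) Fₓ)
    F₄ = filter (¬? ∘ sizeIs? 3) (filter (¬? ∘ sizeIs? 2) Fₓ)

    Fₓ-unique : Unique Fₓ
    Fₓ-unique = Uniqueₚ.filter⁺ crossing? Fₜ-unique

    F₂⁻ : ∀ {S} → S ∈ₗ F₂ → S ∈ₗ Fₓ × ∣ S ∩ R ∣ ≡ 2
    F₂⁻ = ∈-filter⁻ (sizeIs? 2) {xs = Fₓ}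

    F₃⁻ : ∀ {S} → S ∈ₗ F₃ → S ∈ₗ Fₓ × ∣ S ∩ R ∣ ≡ 3
    F₃⁻ S∈ = let S∈′ , eq = ∈-filter⁻ (sizeIs? 3) {xs = filter (¬? ∘ sizeIs? 2) Fₓ} S∈ in
      proj₁ (∈-filter⁻ (¬? ∘ sizeIs? 2) {xs = Fₓ} S∈′) , eq

    F₄⁻ : ∀ {S} → S ∈ₗ F₄ → S ∈ₗ Fₓ × 4 ≤ ∣ S ∩ R ∣
    F₄⁻ {S} S∈ = let S∈′ , ≢3 = ∈-filter⁻ (¬? ∘ sizeIs? 3) {xs = filter (¬? ∘ sizeIs? 2) Fₓ} S∈
                     S∈ₓ , ≢2 = ∈-filter⁻ (¬? ∘ sizeIs? 2) {xs = Fₓ} S∈′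
                 in S∈ₓ , ≤∧≢⇒< (≤∧≢⇒< (2≤ S∈ₓ) (≢2 ∘ sym)) (≢3 ∘ sym)
      where
      2≤ : ∀ {S} → S ∈ₗ Fₓ → 2 ≤ ∣ S ∩ R ∣
      2≤ {S} S∈ = let i , j , i≢j , (b , b∈) , (c , c∈) = proj₂ (Fₓ⁻ S∈)
                      b∈S , b∈B = x∈p∩q⁻ S (B i) b∈ ; c∈S , c∈B = x∈p∩q⁻ S (B j) c∈
                  in length≤∣p∣ {xs = b ∷ c ∷ []} {p = S ∩ R} ((apart i≢j b∈B c∈B ∷ []) ∷ [] ∷ [])
                       λ { (here refl) → ∈SR i b∈S b∈B ; (there (here refl)) → ∈SR j c∈S c∈B }

    Fₓ-split : length Fₓ ≡ length F₂ + (length F₃ + length F₄)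
    Fₓ-split = trans (count-split (sizeIs? 2) Fₓ) (cong (length F₂ +_) (count-split (sizeIs? 3) (filter (¬? ∘ sizeIs? 2) Fₓ)))

    two-trace : ∀ {S i j b c} → ∣ S ∩ R ∣ ≡ 2 → i ≢ j → b ∈ S → b ∈ B i → c ∈ S → c ∈ B j → ∀ {y} → y ∈ S ∩ R → y ≡ b ⊎ y ≡ c
    two-trace {S} {i} {j} {b} {c} ∣T∣ i≢j b∈ b∈B c∈ c∈B y∈ = case exhaust {p = S ∩ R} (b ∷ c ∷ []) ((apart i≢j b∈B c∈B ∷ []) ∷ [] ∷ [])
        (λ { (here refl) → ∈SR i b∈ b∈B ; (there (here refl)) → ∈SR j c∈ c∈B }) (≤-reflexive ∣T∣) y∈ of λ
      { (here eq) → inj₁ eq ; (there (here eq)) → inj₂ eq }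

    -- Suppose both traces have a point in B i. If the points differ, B i gives a cluster: the
    -- remainder, x and the two other trace points are (k-3) + 1 + 2 = k elements. If they coincide,
    -- S and S′ differ only in their other trace points, and the block of such a point gives the
    -- cluster.
    meet-once : ∀ {S S′ i} → S ∈ₗ F₂ → S′ ∈ₗ F₂ → S ∩ U ≡ S′ ∩ U → Meets S i → Meets S′ i → S ≢ S′ → Data.Empty.⊥
    meet-once {S} {S′} {i} S∈₂ S′∈₂ same (b , b∈SB) (b′ , b′∈SB) S≢S′ = case b Fin.≟ b′ of λ
      { (no b≢b′) → separated S∈ S′∈ same S≢S′ i (c ∷ c′ ∷ []) size
          (λ y∈B y∈S y∈S′ → b≢b′ (trans (sym (is-b y∈B y∈S)) (is-b′ y∈B y∈S′)))
          (λ y∈ → [ (λ { refl → inj₁ b∈B }) , (λ { refl → inj₂ (here refl) }) ]′ (T y∈))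
          (λ y∈ → [ (λ { refl → inj₁ b′∈B }) , (λ { refl → inj₂ (there (here refl)) }) ]′ (T′ y∈))
      ; (yes b≡b′) → one-off S∈ S′∈ same S≢S′ j c∈S c∈B
          (λ y∈ → [ (λ { refl → inj₂ (subst (_∈ S′) (sym b≡b′) b′∈S) }) , inj₁ ]′ (T y∈))
          (λ y∈B y∈S → [ (λ y≡b → ⊥-elim (apart j≢i y∈B b∈B y≡b)) , id ]′ (T (∈SR j y∈S y∈B))) }
      where
      S∈ = proj₁ (F₂⁻ S∈₂)
      S′∈ = proj₁ (F₂⁻ S′∈₂)
      b∈S = proj₁ (x∈p∩q⁻ S (B i) b∈SB)
      b∈B = proj₂ (x∈p∩q⁻ S (B i) b∈SB)
      b′∈S = proj₁ (x∈p∩q⁻ S′ (B i) b′∈SB)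
      b′∈B = proj₂ (x∈p∩q⁻ S′ (B i) b′∈SB)
      si = second-index S∈ i
      si′ = second-index S′∈ i
      j = proj₁ si
      j′ = proj₁ si′
      j≢i = proj₁ (proj₂ si)
      j′≢i = proj₁ (proj₂ si′)
      c = proj₁ (proj₂ (proj₂ si))
      c′ = proj₁ (proj₂ (proj₂ si′))
      c∈S = proj₁ (x∈p∩q⁻ S (B j) (proj₂ (proj₂ (proj₂ si))))
      c∈B = proj₂ (x∈p∩q⁻ S (B j) (proj₂ (proj₂ (proj₂ si))))
      c′∈S = proj₁ (x∈p∩q⁻ S′ (B j′) (proj₂ (proj₂ (proj₂ si′))))
      c′∈B = proj₂ (x∈p∩q⁻ S′ (B j′) (proj₂ (proj₂ (proj₂ si′))))
      T : ∀ {y} → y ∈ S ∩ R → y ≡ b ⊎ y ≡ c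
      T = two-trace (proj₂ (F₂⁻ S∈₂)) (j≢i ∘ sym) b∈S b∈B c∈S c∈B
      T′ : ∀ {y} → y ∈ S′ ∩ R → y ≡ b′ ⊎ y ≡ c′
      T′ = two-trace (proj₂ (F₂⁻ S′∈₂)) (j′≢i ∘ sym) b′∈S b′∈B c′∈S c′∈B
      is-b : ∀ {y} → y ∈ B i → y ∈ S → y ≡ b
      is-b y∈B y∈S = [ id , (λ y≡c → ⊥-elim (apart (j≢i ∘ sym) y∈B c∈B y≡c)) ]′ (T (∈SR i y∈S y∈B))
      is-b′ : ∀ {y} → y ∈ B i → y ∈ S′ → y ≡ b′
      is-b′ y∈B y∈S = [ id , (λ y≡c → ⊥-elim (apart (j′≢i ∘ sym) y∈B c′∈B y≡c)) ]′ (T′ (∈SR i y∈S y∈B))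
      size : suc ∣ S ∩ U ∣ + 2 ≤ 3 + r
      size = ≤-reflexive (trans (sym (+-suc ∣ S ∩ U ∣ 2)) (trans (cong (λ t → ∣ S ∩ U ∣ + suc t) (sym (proj₂ (F₂⁻ S∈₂)))) (∣trace∣ S∈)))

    -- Over a fixed remainder Q every trace joins two blocks, and by `meet-once` these pairs form a
    -- matching on the ν blocks.
    length-F₂ : length F₂ ≤ ⌊ ν /2⌋ * (m C r)
    length-F₂ = ≤-trans (length-≤-fibers _≟ˢ_ (_∩ U) F₂ (choose U r) ⌊ ν /2⌋ into fiber)
      (≤-reflexive (trans (*-comm (length (choose U r)) ⌊ ν /2⌋) (cong (⌊ ν /2⌋ *_) (length-choose U r))))
      where
      into : ∀ {S} → S ∈ₗ F₂ → S ∩ U ∈ₗ choose U r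
      into {S} S∈₂ = let S∈ , ∣T∣ = F₂⁻ S∈₂ in ∈-choose (proj₂ ∘ x∈p∩q⁻ S U)
        (+-cancelʳ-≡ 3 ∣ S ∩ U ∣ r (trans (cong (λ t → ∣ S ∩ U ∣ + suc t) (sym ∣T∣)) (trans (∣trace∣ S∈) (+-comm 3 r))))
      half : ∀ a → a * 2 ≤ ν → a ≤ ⌊ ν /2⌋
      half a h = subst (_≤ ⌊ ν /2⌋) (trans (cong ⌊_/2⌋ (trans (*-comm a 2) (cong (a +_) (+-identityʳ a)))) (sym (n≡⌊n+n/2⌋ a))) (⌊n/2⌋-mono h)
      fiber : ∀ {Q} → Q ∈ₗ choose U r → count (λ S → (S ∩ U) ≟ˢ Q) F₂ ≤ ⌊ ν /2⌋
      fiber {Q} _ = half (length fib) (subst (length fib * 2 ≤_) (trans (*-identityʳ _) (length-allFin ν))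
        (double-count meets? fib (allFin ν) 2 1 low high))
        where
        fib = filter (λ S → (S ∩ U) ≟ˢ Q) F₂
        fib⁻ : ∀ {S} → S ∈ₗ fib → S ∈ₗ F₂ × S ∩ U ≡ Q
        fib⁻ = ∈-filter⁻ (λ S → (S ∩ U) ≟ˢ Q) {xs = F₂}
        low : ∀ {S} → S ∈ₗ fib → 2 ≤ count (meets? S) (allFin ν)
        low {S} S∈ = let i , j , i≢j , mi , mj = proj₂ (Fₓ⁻ (proj₁ (F₂⁻ (proj₁ (fib⁻ S∈))))) in
          length-mono-⊆ {xs = i ∷ j ∷ []} ((i≢j ∷ []) ∷ [] ∷ []) λ
            { (here refl) → ∈-filter⁺ (meets? S) (∈-allFin i) mi ; (there (here refl)) → ∈-filter⁺ (meets? S) (∈-allFin j) mj }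
        high : ∀ {i} → i ∈ₗ allFin ν → count (λ S → meets? S i) fib ≤ 1
        high {i} _ = length-≤1 (Uniqueₚ.filter⁺ (λ S → meets? S i) (Uniqueₚ.filter⁺ (λ S → (S ∩ U) ≟ˢ Q) (Uniqueₚ.filter⁺ (sizeIs? 2) Fₓ-unique)))
          (λ {S} {S′} S∈ S′∈ → case S ≟ˢ S′ of λ
            { (yes eq) → eq
            ; (no S≢S′) → let S∈f , mi = ∈-filter⁻ (λ S → meets? S i) {xs = fib} S∈
                              S′∈f , mi′ = ∈-filter⁻ (λ S → meets? S i) {xs = fib} S′∈
                              S∈₂ , eq = fib⁻ S∈f ; S′∈₂ , eq′ = fib⁻ S′∈f
                          in ⊥-elim (meet-once S∈₂ S′∈₂ (trans eq (sym eq′)) mi mi′ S≢S′) })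

  -- Traces of three points

  module Triples {s n ν : ℕ} (cfg : Configuration (suc s) n ν) where

    open Regions cfg
    open Crossings cfg

    ∣Q∣ : ∀ {S} → S ∈ₗ F₃ → ∣ S ∩ U ∣ ≡ s
    ∣Q∣ {S} S∈₃ = let S∈ , ∣T∣ = F₃⁻ S∈₃ in
      +-cancelʳ-≡ 4 ∣ S ∩ U ∣ s (trans (cong (λ t → ∣ S ∩ U ∣ + suc t) (sym ∣T∣)) (trans (∣trace∣ S∈) (+-comm 4 s)))

    three-trace : ∀ {S a b c} → ∣ S ∩ R ∣ ≡ 3 → a ≢ b → a ≢ c → b ≢ c → a ∈ S ∩ R → b ∈ S ∩ R → c ∈ S ∩ R →
                  ∀ {y} → y ∈ S ∩ R → y ≡ a ⊎ y ≡ b ⊎ y ≡ c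
    three-trace {S} {a} {b} {c} ∣T∣ a≢b a≢c b≢c a∈ b∈ c∈ y∈ = case exhaust {p = S ∩ R} (a ∷ b ∷ c ∷ [])
        ((a≢b ∷ a≢c ∷ []) ∷ (b≢c ∷ []) ∷ [] ∷ [])
        (λ { (here refl) → a∈ ; (there (here refl)) → b∈ ; (there (there (here refl))) → c∈ }) (≤-reflexive ∣T∣) y∈ of λ
      { (here eq) → inj₁ eq ; (there (here eq)) → inj₂ (inj₁ eq) ; (there (there (here eq))) → inj₂ (inj₂ eq) }

    met : Subset n → Subset ν
    met S = fromList (filter (meets? S) (allFin ν))

    ∈-met⁺ : ∀ {S i} → Meets S i → i ∈ met S
    ∈-met⁺ {S} {i} mi = ∈-fromList⁺ (∈-filter⁺ (meets? S) (∈-allFin i) mi)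

    ∈-met⁻ : ∀ {S i} → i ∈ met S → Meets S i
    ∈-met⁻ {S} i∈ = proj₂ (∈-filter⁻ (meets? S) {xs = allFin ν} (∈-fromList⁻ _ i∈))

    transversal? : ∀ S → Dec (3 ≤ ∣ met S ∣)
    transversal? S = 3 ≤? ∣ met S ∣

    record Transversal (S : Subset n) (b : Fin n) (i j : Fin ν) : Set where
      field
        {l} : Fin ν
        {c d} : Fin n
        c∈S : c ∈ S
        c∈B : c ∈ B j
        d∈S : d ∈ S
        d∈B : d ∈ B l
        l≢i : l ≢ i
        l≢j : l ≢ j
        trace : ∀ {y} → y ∈ S ∩ R → y ≡ b ⊎ y ≡ c ⊎ y ≡ d

    transversal : ∀ {S b i j} → S ∈ₗ F₃ → 3 ≤ ∣ met S ∣ → i ≢ j → b ∈ S → b ∈ B i → Meets S j → Transversal S b i j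
    transversal {S} {b} {i} {j} S∈₃ 3≤ i≢j b∈S b∈B (c , c∈) = record
      { c∈S = c∈S ; c∈B = c∈B ; d∈S = d∈S ; d∈B = d∈B ; l≢i = l≢i ; l≢j = l≢j
      ; trace = three-trace (proj₂ (F₃⁻ S∈₃)) (apart i≢j b∈B c∈B) (apart (l≢i ∘ sym) b∈B d∈B) (apart (l≢j ∘ sym) c∈B d∈B)
          (∈SR i b∈S b∈B) (∈SR j c∈S c∈B) (∈SR l d∈S d∈B) }
      where
      c∈S = proj₁ (x∈p∩q⁻ S (B j) c∈)
      c∈B = proj₂ (x∈p∩q⁻ S (B j) c∈)
      new : ∃[ l ] (l ∈ met S × l ∉ ⁅ i ⁆ ∪⁅ j ⁆)
      new = card-lt⇒new (met S) (⁅ i ⁆ ∪⁅ j ⁆) (≤-trans (s≤s (≤-trans (∣add∣≤ ⁅ i ⁆) (≤-reflexive (cong suc (∣⁅x⁆∣≡1 i))))) 3≤)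
      l = proj₁ new
      ml = ∈-met⁻ {S} (proj₁ (proj₂ new))
      d∈S = proj₁ (x∈p∩q⁻ S (B l) (proj₂ ml))
      d∈B = proj₂ (x∈p∩q⁻ S (B l) (proj₂ ml))
      l≢i : l ≢ i
      l≢i eq = proj₂ (proj₂ new) (⊆-add ⁅ i ⁆ (subst (_∈ ⁅ i ⁆) (sym eq) (x∈⁅x⁆ i)))
      l≢j : l ≢ j
      l≢j eq = proj₂ (proj₂ new) (subst (_∈ ⁅ i ⁆ ∪⁅ j ⁆) (sym eq) (∈-add ⁅ i ⁆))

    -- Compare the points c and c′ of the traces in B j. If they differ, B j gives a cluster: as b
    -- is common, at most three trace points lie outside B j. If they agree, S and S′ differ in
    -- their third points only, and the block of such a point gives the cluster.
    share : ∀ {S S′ b i j} → S ∈ₗ F₃ → S′ ∈ₗ F₃ → S ∩ U ≡ S′ ∩ U → 3 ≤ ∣ met S ∣ → 3 ≤ ∣ met S′ ∣ → i ≢ j →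
            Meets S j → Meets S′ j → b ∈ S → b ∈ S′ → b ∈ B i → S ≢ S′ → Data.Empty.⊥
    share {S} {S′} {b} {i} {j} S∈₃ S′∈₃ same 3≤ 3≤′ i≢j mj mj′ b∈S b∈S′ b∈B S≢S′ = case T.c Fin.≟ T′.c of λ
      { (no c≢c′) → separated S∈ S′∈ same S≢S′ j (b ∷ T.d ∷ T′.d ∷ []) size
          (λ y∈B y∈S y∈S′ → c≢c′ (trans (sym (is-c t y∈B y∈S)) (is-c t′ y∈B y∈S′)))
          (λ y∈ → case T.trace y∈ of λ
            { (inj₁ refl) → inj₂ (here refl) ; (inj₂ (inj₁ refl)) → inj₁ T.c∈B ; (inj₂ (inj₂ refl)) → inj₂ (there (here refl)) })
          (λ y∈ → case T′.trace y∈ of λ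
            { (inj₁ refl) → inj₂ (here refl) ; (inj₂ (inj₁ refl)) → inj₁ T′.c∈B ; (inj₂ (inj₂ refl)) → inj₂ (there (there (here refl))) })
      ; (yes c≡c′) → one-off S∈ S′∈ same S≢S′ T.l T.d∈S T.d∈B
          (λ y∈ → case T.trace y∈ of λ
            { (inj₁ refl) → inj₂ b∈S′ ; (inj₂ (inj₁ refl)) → inj₂ (subst (_∈ S′) (sym c≡c′) T′.c∈S) ; (inj₂ (inj₂ eq)) → inj₁ eq })
          (λ y∈B y∈S → case T.trace (∈SR T.l y∈S y∈B) of λ
            { (inj₁ eq) → ⊥-elim (apart T.l≢i y∈B b∈B eq) ; (inj₂ (inj₁ eq)) → ⊥-elim (apart T.l≢j y∈B T.c∈B eq) ; (inj₂ (inj₂ eq)) → eq }) }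
      where
      S∈ = proj₁ (F₃⁻ S∈₃)
      S′∈ = proj₁ (F₃⁻ S′∈₃)
      t : Transversal S b i j
      t = transversal S∈₃ 3≤ i≢j b∈S b∈B mj
      t′ : Transversal S′ b i j
      t′ = transversal S′∈₃ 3≤′ i≢j b∈S′ b∈B mj′
      module T = Transversal t
      module T′ = Transversal t′
      is-c : ∀ {S} (t : Transversal S b i j) → ∀ {y} → y ∈ B j → y ∈ S → y ≡ Transversal.c t
      is-c t y∈B y∈S = case Transversal.trace t (∈SR j y∈S y∈B) of λ
        { (inj₁ eq) → ⊥-elim (apart (i≢j ∘ sym) y∈B b∈B eq) ; (inj₂ (inj₁ eq)) → eq
        ; (inj₂ (inj₂ eq)) → ⊥-elim (apart (Transversal.l≢j t ∘ sym) y∈B (Transversal.d∈B t) eq) }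
      size : suc ∣ S ∩ U ∣ + 3 ≤ 4 + s
      size = ≤-reflexive (trans (cong (λ q → suc q + 3) (∣Q∣ S∈₃)) (+-comm (suc s) 3))

    module Fiber (Q : Subset n) where

      fib Tr Tw : List (Subset n)
      fib = filter (λ S → (S ∩ U) ≟ˢ Q) F₃
      Tr = filter transversal? fib
      Tw = filter (¬? ∘ transversal?) fib

      fib-unique : Unique fib
      fib-unique = Uniqueₚ.filter⁺ (λ S → (S ∩ U) ≟ˢ Q) (Uniqueₚ.filter⁺ (sizeIs? 3) (Uniqueₚ.filter⁺ (¬? ∘ sizeIs? 2) Fₓ-unique))

      fib⁻ : ∀ {S} → S ∈ₗ fib → S ∈ₗ F₃ × S ∩ U ≡ Q
      fib⁻ = ∈-filter⁻ (λ S → (S ∩ U) ≟ˢ Q) {xs = F₃}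

      Tr⁻ : ∀ {S} → S ∈ₗ Tr → (S ∈ₗ F₃ × S ∩ U ≡ Q) × 3 ≤ ∣ met S ∣
      Tr⁻ S∈ = let a , b = ∈-filter⁻ transversal? {xs = fib} S∈ in fib⁻ a , b

      -- Each of these traces uses a point of B i, and by `share` no point of B i is used twice.
      over-pair : ∀ {D} → D ∈ₗ kSubsets ν 2 → count (λ S → D ⊆? met S) Tr ≤ 4 + s
      over-pair {D} D∈ with card≥2⇒≢ D (≤-reflexive (sym (∈-kSubsets⁻ D∈)))
      ... | i , j , i∈D , j∈D , i≢j = subst₂ _≤_ (*-identityʳ _) (trans (*-identityʳ _) (trans (length-elements (B i)) (∣B∣ i)))
        (double-count (λ S b → b ∈? S) TD (elements (B i)) 1 1 low high)
        where
        TD = filter (λ S → D ⊆? met S) Tr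
        TD⁻ : ∀ {S} → S ∈ₗ TD → S ∈ₗ Tr × D ⊆ met S
        TD⁻ = ∈-filter⁻ (λ S → D ⊆? met S) {xs = Tr}
        low : ∀ {S} → S ∈ₗ TD → 1 ≤ count (_∈? S) (elements (B i))
        low {S} S∈ = let b , b∈ = ∈-met⁻ {S} (proj₂ (TD⁻ S∈) i∈D) ; b∈S , b∈B = x∈p∩q⁻ S (B i) b∈ in
          length-mono-⊆ {xs = b ∷ []} ([] ∷ []) λ { (here refl) → ∈-filter⁺ (_∈? S) (∈-elements⁺ {p = B i} b∈B) b∈S }
        high : ∀ {b} → b ∈ₗ elements (B i) → count (b ∈?_) TD ≤ 1
        high {b} b∈ = length-≤1 (Uniqueₚ.filter⁺ (b ∈?_) (Uniqueₚ.filter⁺ (λ S → D ⊆? met S) (Uniqueₚ.filter⁺ transversal? fib-unique)))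
          (λ {S} {S′} S∈ S′∈ → case S ≟ˢ S′ of λ
            { (yes eq) → eq
            ; (no S≢S′) → let S∈D , b∈S = ∈-filter⁻ (b ∈?_) {xs = TD} S∈ ; S′∈D , b∈S′ = ∈-filter⁻ (b ∈?_) {xs = TD} S′∈
                              S∈T , D⊆ = TD⁻ S∈D ; S′∈T , D⊆′ = TD⁻ S′∈D
                              (S∈₃ , eq) , 3≤ = Tr⁻ S∈T ; (S′∈₃ , eq′) , 3≤′ = Tr⁻ S′∈T
                          in ⊥-elim (share S∈₃ S′∈₃ (trans eq (sym eq′)) 3≤ 3≤′ i≢j (∈-met⁻ {S} (D⊆ j∈D)) (∈-met⁻ {S′} (D⊆′ j∈D))
                               b∈S b∈S′ (∈-elements⁻ (B i) b∈) S≢S′) })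

      length-Tr : length Tr * 3 ≤ (ν C 2) * (4 + s)
      length-Tr = subst (λ l → length Tr * 3 ≤ l * (4 + s)) (length-kSubsets ν 2)
        (double-count (λ S D → D ⊆? met S) Tr (kSubsets ν 2) 3 (4 + s) low over-pair)
        where
        low : ∀ {S} → S ∈ₗ Tr → 3 ≤ count (λ D → D ⊆? met S) (kSubsets ν 2)
        low {S} S∈ = ≤-trans (C-mono 2 (proj₂ (Tr⁻ S∈))) (≤-trans (≤-reflexive (sym (length-choose (met S) 2)))
          (length-mono-⊆ (choose-unique (met S) 2) λ D∈ → let D⊆ , ∣D∣ = ∈-choose⁻ (met S) 2 D∈ in
            ∈-filter⁺ (λ D → D ⊆? met S) (∈-kSubsets⁺ ∣D∣) D⊆))

      Double : Subset n → Fin ν → Set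
      Double S i = 2 ≤ ∣ S ∩ B i ∣

      double? : ∀ S i → Dec (Double S i)
      double? S i = 2 ≤? ∣ S ∩ B i ∣

      record DoubleTrace (S : Subset n) (i : Fin ν) : Set where
        field
          {j} : Fin ν
          {a a′ b} : Fin n
          a∈ : a ∈ S ∩ B i
          a′∈ : a′ ∈ S ∩ B i
          b∈S : b ∈ S
          b∈B : b ∈ B j
          j≢i : j ≢ i
          a≢a′ : a ≢ a′
          trace : ∀ {y} → y ∈ S ∩ R → y ≡ a ⊎ y ≡ a′ ⊎ y ≡ b

      double-trace : ∀ {S i} → S ∈ₗ F₃ → Double S i → DoubleTrace S i
      double-trace {S} {i} S∈₃ dbl = record
        { a∈ = a∈ ; a′∈ = a′∈ ; b∈S = b∈S ; b∈B = b∈B ; j≢i = j≢i ; a≢a′ = a≢a′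
        ; trace = three-trace (proj₂ (F₃⁻ S∈₃)) a≢a′ (apart (j≢i ∘ sym) (proj₂ aSB) b∈B) (apart (j≢i ∘ sym) (proj₂ a′SB) b∈B)
            (∈SR i (proj₁ aSB) (proj₂ aSB)) (∈SR i (proj₁ a′SB) (proj₂ a′SB)) (∈SR j b∈S b∈B) }
        where
        two = card≥2⇒≢ (S ∩ B i) dbl
        a∈ = proj₁ (proj₂ (proj₂ two))
        a′∈ = proj₁ (proj₂ (proj₂ (proj₂ two)))
        a≢a′ = proj₂ (proj₂ (proj₂ (proj₂ two)))
        aSB = x∈p∩q⁻ S (B i) a∈
        a′SB = x∈p∩q⁻ S (B i) a′∈
        si = second-index (proj₁ (F₃⁻ S∈₃)) i
        j = proj₁ si
        j≢i = proj₁ (proj₂ si)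
        b∈S = proj₁ (x∈p∩q⁻ S (B j) (proj₂ (proj₂ (proj₂ si))))
        b∈B = proj₂ (x∈p∩q⁻ S (B j) (proj₂ (proj₂ (proj₂ si))))

      -- Such a trace has two points in B i and one elsewhere. Equal pairs in B i are excluded by
      -- `one-off`, disjoint ones by `separated`. So the pairs are distinct and intersecting, and
      -- `length-intersecting` applies; k ≥ 4 covers the case of a triangle.
      over-block : ∀ i → count (λ S → double? S i) Tw ≤ 3 + s
      over-block i = ≤-pred (subst₂ _<_ (length-map (_∩ B i) E) (∣B∣ i)
        (length-intersecting (B i) (map (_∩ B i) E) (map-unique (_∩ B i) E-unique pair-injective)
          (λ e∈ → case ∈-map⁻ (_∩ B i) e∈ of λ { (S , _ , refl) → proj₂ ∘ x∈p∩q⁻ S (B i) })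
          (λ e∈ → case ∈-map⁻ (_∩ B i) e∈ of λ { (S , S∈ , refl) → pair S∈ })
          (λ e∈ e′∈ → case ∈-map⁻ (_∩ B i) e∈ , ∈-map⁻ (_∩ B i) e′∈ of λ { ((S , S∈ , refl) , (S′ , S′∈ , refl)) → intersecting S∈ S′∈ })
          (subst (4 ≤_) (sym (∣B∣ i)) (m≤m+n 4 s))))
        where
        E = filter (λ S → double? S i) Tw
        E-unique : Unique E
        E-unique = Uniqueₚ.filter⁺ (λ S → double? S i) (Uniqueₚ.filter⁺ (¬? ∘ transversal?) fib-unique)
        E⁻ : ∀ {S} → S ∈ₗ E → (S ∈ₗ F₃ × S ∩ U ≡ Q) × Double S i
        E⁻ S∈ = let a , b = ∈-filter⁻ (λ S → double? S i) {xs = Tw} S∈ in fib⁻ (proj₁ (∈-filter⁻ (¬? ∘ transversal?) {xs = fib} a)) , b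
        doubled : ∀ {S} → S ∈ₗ E → DoubleTrace S i
        doubled S∈ = let (a , _) , b = E⁻ S∈ in double-trace a b
        not-b : ∀ {S} (t : DoubleTrace S i) {y} → y ∈ S → y ∈ B i → y ≡ DoubleTrace.a t ⊎ y ≡ DoubleTrace.a′ t
        not-b t y∈S y∈B = case DoubleTrace.trace t (∈SR i y∈S y∈B) of λ
          { (inj₁ eq) → inj₁ eq ; (inj₂ (inj₁ eq)) → inj₂ eq
          ; (inj₂ (inj₂ eq)) → ⊥-elim (apart (DoubleTrace.j≢i t ∘ sym) y∈B (DoubleTrace.b∈B t) eq) }
        pair : ∀ {S} → S ∈ₗ E → ∣ S ∩ B i ∣ ≡ 2
        pair {S} S∈ = let t = doubled S∈ in ≤-antisym
          (∣p∣≤length {xs = DoubleTrace.a t ∷ DoubleTrace.a′ t ∷ []} {p = S ∩ B i} (λ y∈ → let y∈S , y∈B = x∈p∩q⁻ S (B i) y∈ in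
            [ here , (λ e → there (here e)) ]′ (not-b t y∈S y∈B)))
          (proj₂ (E⁻ S∈))
        same-pair : ∀ {S S′} → S ∈ₗ E → S′ ∈ₗ E → S ∩ B i ≡ S′ ∩ B i → S ≢ S′ → Data.Empty.⊥
        same-pair {S} {S′} S∈ S′∈ eq S≢S′ = one-off (proj₁ (F₃⁻ S∈₃)) (proj₁ (F₃⁻ S′∈₃)) same S≢S′ t.j t.b∈S t.b∈B
          (λ y∈ → case t.trace y∈ of λ
            { (inj₁ refl) → inj₂ (in-S′ t.a∈) ; (inj₂ (inj₁ refl)) → inj₂ (in-S′ t.a′∈) ; (inj₂ (inj₂ e)) → inj₁ e })
          (λ y∈B y∈S → case t.trace (∈SR t.j y∈S y∈B) of λ
            { (inj₁ e) → ⊥-elim (apart t.j≢i y∈B (proj₂ (x∈p∩q⁻ S (B i) t.a∈)) e)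
            ; (inj₂ (inj₁ e)) → ⊥-elim (apart t.j≢i y∈B (proj₂ (x∈p∩q⁻ S (B i) t.a′∈)) e)
            ; (inj₂ (inj₂ e)) → e })
          where
          module t = DoubleTrace (doubled S∈)
          S∈₃ = proj₁ (proj₁ (E⁻ S∈))
          S′∈₃ = proj₁ (proj₁ (E⁻ S′∈))
          same : S ∩ U ≡ S′ ∩ U
          same = trans (proj₂ (proj₁ (E⁻ S∈))) (sym (proj₂ (proj₁ (E⁻ S′∈))))
          in-S′ : ∀ {y} → y ∈ S ∩ B i → y ∈ S′
          in-S′ {y} y∈ = proj₁ (x∈p∩q⁻ S′ (B i) (subst (y ∈_) eq y∈))
        pair-injective : ∀ {S S′} → S ∈ₗ E → S′ ∈ₗ E → S ∩ B i ≡ S′ ∩ B i → S ≡ S′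
        pair-injective {S} {S′} S∈ S′∈ eq = case S ≟ˢ S′ of λ
          { (yes e) → e ; (no S≢S′) → ⊥-elim (same-pair S∈ S′∈ eq S≢S′) }
        covers : ∀ {S} (t : DoubleTrace S i) {y} → y ∈ S ∩ R → y ∈ B i ⊎ y ≡ DoubleTrace.b t
        covers {S} t y∈ = case DoubleTrace.trace t y∈ of λ
          { (inj₁ refl) → inj₁ (proj₂ (x∈p∩q⁻ S (B i) (DoubleTrace.a∈ t)))
          ; (inj₂ (inj₁ refl)) → inj₁ (proj₂ (x∈p∩q⁻ S (B i) (DoubleTrace.a′∈ t)))
          ; (inj₂ (inj₂ e)) → inj₂ e }
        intersecting : ∀ {S S′} → S ∈ₗ E → S′ ∈ₗ E → Nonempty ((S ∩ B i) ∩ (S′ ∩ B i))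
        intersecting {S} {S′} S∈ S′∈ = case nonempty? ((S ∩ B i) ∩ (S′ ∩ B i)) of λ
          { (yes ne) → ne
          ; (no empty) → let t = doubled S∈ ; t′ = doubled S′∈
                             (S∈₃ , q) , _ = E⁻ S∈ ; (S′∈₃ , q′) , _ = E⁻ S′∈
                             disj : ∀ {y} → y ∈ B i → y ∈ S → y ∉ S′
                             disj y∈B y∈S y∈S′ = empty (_ , x∈p∩q⁺ (x∈p∩q⁺ (y∈S , y∈B) , x∈p∩q⁺ (y∈S′ , y∈B)))
                             aS , aB = x∈p∩q⁻ S (B i) (DoubleTrace.a∈ t)
                         in ⊥-elim (separated (proj₁ (F₃⁻ S∈₃)) (proj₁ (F₃⁻ S′∈₃)) (trans q (sym q′))
                              (λ eq → disj aB aS (subst (_ ∈_) eq aS)) i (DoubleTrace.b t ∷ DoubleTrace.b t′ ∷ [])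
                              (≤-trans (≤-reflexive (trans (cong (λ z → suc z + 2) (∣Q∣ S∈₃)) (+-comm (suc s) 2))) (n≤1+n _))
                              disj
                              (λ y∈ → [ inj₁ , (λ e → inj₂ (here e)) ]′ (covers t y∈))
                              (λ y∈ → [ inj₁ , (λ e → inj₂ (there (here e))) ]′ (covers t′ y∈))) }

      -- Three points in at most two blocks put two of them into the same block.
      length-Tw : length Tw ≤ ν * (3 + s)
      length-Tw = subst₂ _≤_ (*-identityʳ _) (cong (_* (3 + s)) (length-allFin ν))
        (double-count double? Tw (allFin ν) 1 (3 + s) low (λ {i} _ → over-block i))
        where
        low : ∀ {S} → S ∈ₗ Tw → 1 ≤ count (double? S) (allFin ν)
        low {S} S∈Tw = found (Finₚ.any? (double? S))
          where
          S∈₃ = proj₁ (fib⁻ (proj₁ (∈-filter⁻ (¬? ∘ transversal?) {xs = fib} S∈Tw)))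
          ¬3≤ = proj₂ (∈-filter⁻ (¬? ∘ transversal?) {xs = fib} S∈Tw)
          S∈ = proj₁ (F₃⁻ S∈₃)
          single : ¬ (∃[ i ] Double S i) → Data.Empty.⊥
          single none = ¬3≤ (≤-trans (≤-reflexive (trans (sym (proj₂ (F₃⁻ S∈₃))) (sym (length-elements (S ∩ R)))))
            (≤-trans (subst₂ _≤_ (*-identityʳ _) (*-identityʳ _) (double-count (λ y i → y ∈? B i) (elements (S ∩ R)) (elements (met S)) 1 1
              (λ {y} y∈ → let y∈S , y∈R = x∈p∩q⁻ S R (∈-elements⁻ (S ∩ R) y∈) ; i , y∈B = ∈-⋃ᶠ⁻ B y∈R in
                length-mono-⊆ {xs = i ∷ []} ([] ∷ []) λ { (here refl) →
                  ∈-filter⁺ (λ i → y ∈? B i) (∈-elements⁺ (∈-met⁺ {S} (y , x∈p∩q⁺ (y∈S , y∈B)))) y∈B })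
              (λ {i} _ → length-≤1 (Uniqueₚ.filter⁺ (_∈? B i) (elements-unique (S ∩ R))) (λ y∈ z∈ →
                let y∈e , y∈B = ∈-filter⁻ (_∈? B i) {xs = elements (S ∩ R)} y∈
                    z∈e , z∈B = ∈-filter⁻ (_∈? B i) {xs = elements (S ∩ R)} z∈
                in card≤1⇒≡ {p = S ∩ B i} (≤-pred (≰⇒> (λ d → none (i , d))))
                     (x∈p∩q⁺ (proj₁ (x∈p∩q⁻ S R (∈-elements⁻ (S ∩ R) y∈e)) , y∈B))
                     (x∈p∩q⁺ (proj₁ (x∈p∩q⁻ S R (∈-elements⁻ (S ∩ R) z∈e)) , z∈B))))))
              (≤-reflexive (length-elements (met S)))))
          found : Dec (∃[ i ] Double S i) → 1 ≤ count (double? S) (allFin ν)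
          found (yes (i , d)) = length-mono-⊆ {xs = i ∷ []} ([] ∷ []) λ { (here refl) → ∈-filter⁺ (double? S) (∈-allFin i) d }
          found (no none) = ⊥-elim (single none)

      length-fib : length fib * 3 ≤ (4 + s) * (ν C 2) + 3 * ((3 + s) * ν)
      length-fib = begin
        length fib * 3                             ≡⟨ cong (_* 3) (count-split transversal? fib) ⟩
        (length Tr + length Tw) * 3                ≡⟨ *-distribʳ-+ 3 (length Tr) (length Tw) ⟩
        length Tr * 3 + length Tw * 3              ≤⟨ +-mono-≤ length-Tr (*-monoˡ-≤ 3 length-Tw) ⟩
        (ν C 2) * (4 + s) + ν * (3 + s) * 3        ≡⟨ regroup (ν C 2) (4 + s) ν (3 + s) ⟩
        (4 + s) * (ν C 2) + 3 * ((3 + s) * ν)      ∎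
        where
        open ≤-Reasoning
        regroup : ∀ a b c d → a * b + c * d * 3 ≡ b * a + 3 * (d * c)
        regroup = solve-∀

    length-F₃ : length F₃ * 3 ≤ (m C s) * ((4 + s) * (ν C 2) + 3 * ((3 + s) * ν))
    length-F₃ = begin
      length F₃ * 3                          ≤⟨ *-monoˡ-≤ 3 (length-≤-fibers _≟ˢ_ (_∩ U) F₃ (choose U s) (w / 3)
                                                  (λ {S} S∈₃ → ∈-choose (proj₂ ∘ x∈p∩q⁻ S U) (∣Q∣ S∈₃)) (λ {Q} _ → fiber Q)) ⟩
      length (choose U s) * (w / 3) * 3      ≡⟨ *-assoc (length (choose U s)) (w / 3) 3 ⟩
      length (choose U s) * (w / 3 * 3)      ≤⟨ *-mono-≤ (≤-reflexive (length-choose U s)) (m/n*n≤m w 3) ⟩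
      (m C s) * w                            ∎
      where
      open ≤-Reasoning
      w = (4 + s) * (ν C 2) + 3 * ((3 + s) * ν)
      fiber : ∀ Q → length (Fiber.fib Q) ≤ w / 3
      fiber Q = subst (_≤ w / 3) (m*n/n≡m (length (Fiber.fib Q)) 3) (/-monoˡ-≤ 3 (Fiber.length-fib Q))

  -- Collecting the bounds on crossing members

  m*n≤o⇒m≤o/n : ∀ a b n .{{_ : NonZero n}} → a * n ≤ b → a ≤ b / n
  m*n≤o⇒m≤o/n a b n h = subst (_≤ b / n) (m*n/n≡m a n) (/-monoˡ-≤ n h)

  no-members : {A : Set} (xs : List A) → (∀ {z} → z ∉ₗ xs) → ∀ {t} → length xs ≤ t
  no-members [] _ = z≤n
  no-members (z ∷ xs) h = ⊥-elim (h (here refl))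

  -- For k = 3 the lower index is -1 and the value 0, where truncated subtraction would give 1.
  bin₄ : ℕ → ℕ → ℕ
  bin₄ r m = binom m (ℤ.+ (3 + r) ℤ.- ℤ.+ 4)

  -- Three times (k/3) C(ν,2) + (k-1)ν, so that the counting can stay in ℕ.
  weight : ℕ → ℕ → ℕ
  weight r ν = (3 + r) * (ν C 2) + 3 * ((2 + r) * ν)

  private
    too-big : ∀ {q t k} → k < t → q + suc t ≢ suc k
    too-big {q} {t} k<t eq = <⇒≱ k<t (≤-pred (≤-trans (m≤n+m (suc t) q) (≤-reflexive eq)))

  -- For k = 3 a trace of three points leaves no place for x, in agreement with `bin₄` being 0.
  length-F₃-≤ : ∀ r {n ν} (cfg : Configuration r n ν) → length (Crossings.F₃ cfg) ≤ bin₄ r (Regions.m cfg) * weight r ν / 3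
  length-F₃-≤ zero cfg = no-members (Crossings.F₃ cfg) λ S∈₃ → let S∈ , ∣T∣ = Crossings.F₃⁻ cfg S∈₃ in
    too-big (≤-reflexive (sym ∣T∣)) (Crossings.∣trace∣ cfg S∈)
  length-F₃-≤ (suc s) cfg = m*n≤o⇒m≤o/n (length (Crossings.F₃ cfg)) _ 3 (Triples.length-F₃ cfg)

  -- Four points in R and x leave at most k - 5 points in U. Counting (k-4)-subsets of U above this
  -- part gains a factor of order m over `bin₄`, which becomes the o(1). The divisor is a successor,
  -- so that it is visibly nonzero.
  length-F₄-≤ : ∀ r {n ν} (cfg : Configuration r n ν) → 3 + r ≤ Regions.m cfg →
                length (Crossings.F₄ cfg) ≤ bin₄ r (Regions.m cfg) * 2 ^ (r + ∣ Regions.V cfg ∣) / suc (Regions.m cfg ∸ (3 + r))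
  length-F₄-≤ zero cfg _ = no-members (Crossings.F₄ cfg) λ S∈₄ → let S∈ , 4≤ = Crossings.F₄⁻ cfg S∈₄ in
    too-big (≤-trans (n≤1+n 3) 4≤) (Crossings.∣trace∣ cfg S∈)
  length-F₄-≤ (suc zero) cfg _ = no-members (Crossings.F₄ cfg) λ S∈₄ → let S∈ , 4≤ = Crossings.F₄⁻ cfg S∈₄ in
    too-big 4≤ (Crossings.∣trace∣ cfg S∈)
  length-F₄-≤ (suc (suc s)) cfg 5≤ = m*n≤o⇒m≤o/n (length (F₄)) _ (suc (m ∸ (5 + s))) (begin
    length F₄ * suc (m ∸ (5 + s))                             ≤⟨ *-monoʳ-≤ (length F₄) gap ⟩
    length F₄ * (m ∸ s)                                       ≤⟨ length-extensions U V s F₄ (choose U (suc s)) F₄-unique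
                                                                   (λ {S} _ → everything S) small (λ Q∈ → ≤-reflexive (proj₂ (∈-choose⁻ U (suc s) Q∈))) (λ _ Q∈ _ → Q∈) ⟩
    length (choose U (suc s)) * 2 ^ (suc s + ∣ V ∣)           ≤⟨ *-mono-≤ (≤-reflexive (length-choose U (suc s))) (^-monoʳ-≤ 2 (n≤1+n (suc s + ∣ V ∣))) ⟩
    (m C suc s) * 2 ^ (2 + s + ∣ V ∣)                         ∎)
    where
    open ≤-Reasoning
    open Regions cfg
    open Crossings cfg
    F₄-unique : Unique F₄
    F₄-unique = Uniqueₚ.filter⁺ (¬? ∘ sizeIs? 3) (Uniqueₚ.filter⁺ (¬? ∘ sizeIs? 2) Fₓ-unique)
    gap : suc (m ∸ (5 + s)) ≤ m ∸ s
    gap = ∸-monoʳ-< (s≤s (m≤n+m s 4)) 5≤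
    small : ∀ {S} → S ∈ₗ F₄ → ∣ S ∩ U ∣ ≤ s
    small {S} S∈₄ = let S∈ , 4≤ = F₄⁻ S∈₄ in +-cancelʳ-≤ 5 ∣ S ∩ U ∣ s
      (≤-trans (+-monoʳ-≤ ∣ S ∩ U ∣ (s≤s 4≤)) (≤-reflexive (trans (∣trace∣ S∈) (+-comm 5 s))))

  length-Fₓ : ∀ {r n ν} (cfg : Configuration r n ν) → let m = Regions.m cfg in 3 + r ≤ m →
              length (Regions.Fₓ cfg) ≤ ⌊ ν /2⌋ * (m C r) + (bin₄ r m * weight r ν / 3 + bin₄ r m * 2 ^ (r + ∣ Regions.V cfg ∣) / suc (m ∸ (3 + r)))
  length-Fₓ {r} cfg h = ≤-trans (≤-reflexive (Crossings.Fₓ-split cfg))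
    (+-mono-≤ (Crossings.length-F₂ cfg) (+-mono-≤ (length-F₃-≤ r cfg) (length-F₄-≤ r cfg h)))

  pick : ∀ {A : Set} ν (xs : List A) → Unique xs → ν ≤ length xs →
         Σ (Fin ν → A) λ g → (∀ i → g i ∈ₗ xs) × (∀ {i j} → g i ≡ g j → i ≡ j)
  pick zero xs u h = (λ ()) , (λ ()) , λ { {()} }
  pick {A} (suc ν) (x ∷ xs) (x∉ ∷ u) (s≤s h) with pick ν xs u h
  ... | g , g∈ , g-inj = g′ , g′∈ , g′-inj
    where
    g′ : Fin (suc ν) → A
    g′ zero = x
    g′ (suc i) = g i
    g′∈ : ∀ i → g′ i ∈ₗ x ∷ xs
    g′∈ zero = here refl
    g′∈ (suc i) = there (g∈ i)
    g′-inj : ∀ {i j} → g′ i ≡ g′ j → i ≡ j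
    g′-inj {zero} {zero} _ = refl
    g′-inj {zero} {suc j} eq = ⊥-elim (All.lookup x∉ (g∈ j) eq)
    g′-inj {suc i} {zero} eq = ⊥-elim (All.lookup x∉ (g∈ i) (sym eq))
    g′-inj {suc i} {suc j} eq = cong suc (g-inj eq)

  -- At most one of ν + 1 disjoint members contains x, so ν blocks avoiding x remain for every
  -- choice of x.
  configuration : ∀ {r n ν} (𝓕 : ClusterFreeFamily n (3 + r)) → Matching 𝓕 (ν + 1) → Fin n → Configuration r n ν
  configuration {r} {n} {ν} 𝓕 M x = record
    { 𝓕 = 𝓕 ; x = x ; B = B ; B∈F = blocks⊆F ∘ proj₁ ∘ B∈ ; x∉B = proj₂ ∘ B∈ ; B-disjoint = disjoint }
    where
    open Matching M
    avoiding = filter (¬? ∘ (x ∈?_)) blocks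
    one : count (x ∈?_) blocks ≤ 1
    one = length-≤1 (Uniqueₚ.filter⁺ (x ∈?_) blocks-unique) (λ {S} {S′} S∈ S′∈ → case S ≟ˢ S′ of λ
      { (yes eq) → eq
      ; (no S≢S′) → let a , x∈S = ∈-filter⁻ (x ∈?_) {xs = blocks} S∈ ; b , x∈S′ = ∈-filter⁻ (x ∈?_) {xs = blocks} S′∈
                    in ⊥-elim (blocks-disjoint a b S≢S′ (x , x∈p∩q⁺ (x∈S , x∈S′))) })
    enough : ν ≤ length avoiding
    enough = +-cancelˡ-≤ 1 ν (length avoiding) (≤-trans (≤-reflexive (+-comm 1 ν)) (≤-trans μ≤blocks
      (≤-trans (≤-reflexive (count-split (x ∈?_) blocks)) (+-monoˡ-≤ (length avoiding) one))))
    picked = pick ν avoiding (Uniqueₚ.filter⁺ (¬? ∘ (x ∈?_)) blocks-unique) enough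
    B : Fin ν → Subset n
    B = proj₁ picked
    B∈ : ∀ i → B i ∈ₗ blocks × x ∉ B i
    B∈ i = ∈-filter⁻ (¬? ∘ (x ∈?_)) {xs = blocks} (proj₁ (proj₂ picked) i)
    disjoint : ∀ {i j y} → y ∈ B i → y ∈ B j → i ≡ j
    disjoint {i} {j} {y} y∈i y∈j = case i Fin.≟ j of λ
      { (yes eq) → eq
      ; (no i≢j) → ⊥-elim (blocks-disjoint (proj₁ (B∈ i)) (proj₁ (B∈ j)) (i≢j ∘ proj₂ (proj₂ picked)) (y , x∈p∩q⁺ (y∈i , y∈j))) }

  -- The upper bound for large n

  module UpperBound (r ν : ℕ) where

    private
      k a : ℕ
      k = 3 + r
      a = suc (ν * k)

    abstract
      K D T₁ T₂ T₃ T₄ K₇ threshold : ℕ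
      -- `a` is the size of V. `T₁` makes n^(k-1) comparable with C(m-k, k-1); `T₂`, `T₃` and `T₄`
      -- provide the hypotheses `h₂`, `h₃` and `h₄` of `NonCrossing`.
      K = DominantConstant.K₅ r a
      D = 2 ^ (2 + r) * (2 + r) !
      K₇ = 2 ^ (r + a)
      T₁ = 2 * (a + k) + 2 * (2 + r)
      T₂ = 2 * (D * K)
      T₃ = a + (1 + r) + 2 * 2 ^ (2 + r + a)
      T₄ = 2 * D * (2 * 2 ^ (ν * k + 2 * D * (K * (2 + r))))
      threshold = (4 + 2 * r) ⊔ (T₁ ⊔ (T₂ ⊔ (T₃ ⊔ T₄)))

      K-def : K ≡ DominantConstant.K₅ r a
      K-def = refl

      K₇-def : K₇ ≡ 2 ^ (r + a)
      K₇-def = refl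

      D-def : D ≡ 2 ^ (2 + r) * (2 + r) !
      D-def = refl

      1≤D : 1 ≤ D
      1≤D = *-mono-≤ (m^n>0 2 (2 + r)) (1≤n! (2 + r))

      n≥ : ∀ {n} → threshold ≤ n → 4 + 2 * r ≤ n
      n≥ h = m⊔n≤o⇒m≤o (4 + 2 * r) (T₁ ⊔ (T₂ ⊔ (T₃ ⊔ T₄))) h

      n≥T₁ : ∀ {n} → threshold ≤ n → 2 * (a + k) + 2 * (2 + r) ≤ n
      n≥T₁ h = m⊔n≤o⇒m≤o T₁ (T₂ ⊔ (T₃ ⊔ T₄)) (m⊔n≤o⇒n≤o (4 + 2 * r) (T₁ ⊔ (T₂ ⊔ (T₃ ⊔ T₄))) h)

      n≥T₂ : ∀ {n} → threshold ≤ n → 2 * (D * K) ≤ n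
      n≥T₂ h = m⊔n≤o⇒m≤o T₂ (T₃ ⊔ T₄) (m⊔n≤o⇒n≤o T₁ (T₂ ⊔ (T₃ ⊔ T₄)) (m⊔n≤o⇒n≤o (4 + 2 * r) (T₁ ⊔ (T₂ ⊔ (T₃ ⊔ T₄))) h))

      n≥T₃ : ∀ {n} → threshold ≤ n → a + (1 + r) + 2 * 2 ^ (2 + r + a) ≤ n
      n≥T₃ h = m⊔n≤o⇒m≤o T₃ T₄ (m⊔n≤o⇒n≤o T₂ (T₃ ⊔ T₄) (m⊔n≤o⇒n≤o T₁ (T₂ ⊔ (T₃ ⊔ T₄)) (m⊔n≤o⇒n≤o (4 + 2 * r) (T₁ ⊔ (T₂ ⊔ (T₃ ⊔ T₄))) h)))

      n≥T₄ : ∀ {n} → threshold ≤ n → 2 * D * (2 * 2 ^ (ν * k + 2 * D * (K * (2 + r)))) ≤ n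
      n≥T₄ h = m⊔n≤o⇒n≤o T₃ T₄ (m⊔n≤o⇒n≤o T₂ (T₃ ⊔ T₄) (m⊔n≤o⇒n≤o T₁ (T₂ ⊔ (T₃ ⊔ T₄)) (m⊔n≤o⇒n≤o (4 + 2 * r) (T₁ ⊔ (T₂ ⊔ (T₃ ⊔ T₄))) h)))

    bound : ℕ → ℕ
    bound m = (m C (2 + r)) + ⌊ ν /2⌋ * (m C r) + (bin₄ r m * weight r ν / 3 + bin₄ r m * K₇ / suc (m ∸ k))
            + f (k * ν) k 3 (ℤ.+ ν ℤ.- 1ℤ)

    module _ {n : ℕ} (h : threshold ≤ n) (𝓕 : ClusterFreeFamily n k) (M : Matching 𝓕 (ν + 1)) where

      open ClusterFreeFamily 𝓕

      private
        -- A family below the leading term satisfies the bound at once; any other is large enough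
        -- for a dominating vertex.
        small-ok : length F ≤ (n ∸ a) C (2 + r) → length F ≤ bound (n ∸ a)
        small-ok le = ≤-trans le (≤-trans (m≤m+n _ _) (≤-trans (m≤m+n _ _) (m≤m+n _ _)))

        module Large (ge : (n ∸ a) C (2 + r) ≤ length F) where

          large : n C (2 + r) ≤ length F + a * n ^ (1 + r)
          -- Passing from n to n - a points costs at most a · n^(k-2), which is why `a` serves as
          -- `K₀`.
          large = ≤-trans (C-drop n a (1 + r)) (+-monoˡ-≤ (a * n ^ (1 + r)) ge)

          centre = Dominance.dominating-centre 𝓕 a large (n≥ h)
          x = proj₁ centre

          cfg : Configuration r n ν
          cfg = configuration 𝓕 M x

          open Regions cfg using (m; m≡; ∣V∣; Fₛ; Fₐ; F∌; Fₓ; L; F-split; length-star; V)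

          n-big : n + 2 * (2 + r) ≤ 2 * (m ∸ k)
          n-big = subst (n + 2 * (2 + r) ≤_) (sym twice) (m+n≤o⇒m≤o∸n (n + 2 * (2 + r))
            (≤-trans (≤-reflexive (+-assoc n (2 * (2 + r)) (2 * (a + k)))) (+-mono-≤ (≤-refl {n})
              (≤-trans (≤-trans (≤-reflexive (+-comm (2 * (2 + r)) (2 * (a + k)))) (n≥T₁ h)) (m≤m+n n 0)))))
            where
            twice : 2 * (m ∸ k) ≡ 2 * n ∸ 2 * (a + k)
            twice = trans (cong (λ m → 2 * (m ∸ k)) m≡) (trans (cong (2 *_) (∸-+-assoc n a k)) (*-distribˡ-∸ 2 n (a + k)))

          3+r≤m : k ≤ m
          3+r≤m = subst (k ≤_) (sym m≡) (m+n≤o⇒m≤o∸n k (≤-trans (≤-reflexive (+-comm k a))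
            (≤-trans (m≤m+n (a + k) _) (≤-trans (m≤m+n (2 * (a + k)) _) (n≥T₁ h)))))

          h₁ : n ^ (2 + r) ≤ D * ((m ∸ k) C (2 + r))
          h₁ = subst (λ d → n ^ (2 + r) ≤ d * ((m ∸ k) C (2 + r))) (sym D-def) (^≤C {n} {m ∸ k} (2 + r) n-big)

          h₃ : 2 * 2 ^ (2 + r + ∣ V ∣) ≤ m ∸ (1 + r)
          h₃ = subst₂ (λ v m → 2 * 2 ^ (2 + r + v) ≤ m ∸ (1 + r)) (sym ∣V∣) (sym m≡)
            (subst (2 * 2 ^ (2 + r + a) ≤_) (sym (∸-+-assoc n a (1 + r)))
              (m+n≤o⇒m≤o∸n (2 * 2 ^ (2 + r + a)) (≤-trans (≤-reflexive (+-comm (2 * 2 ^ (2 + r + a)) (a + (1 + r)))) (n≥T₃ h))))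

          noncrossing : length Fₐ + length F∌ ≤ length L + f (k * ν) k 3 (ℤ.+ ν ℤ.- 1ℤ)
          noncrossing = NonCrossing.length-noncrossing cfg K D
            (subst (λ c → count (λ P → ¬? (inStar? F x P)) (kSubsets n (2 + r)) ≤ c * n ^ (1 + r)) (sym K-def) (proj₂ centre))
            h₁ 1≤D (≤-trans (s≤s z≤n) (n≥ h)) (n≥T₂ h) h₃ (n≥T₄ h)

          crossing : length Fₓ ≤ ⌊ ν /2⌋ * (m C r) + (bin₄ r m * weight r ν / 3 + bin₄ r m * K₇ / suc (m ∸ k))
          crossing = subst (λ c → length Fₓ ≤ ⌊ ν /2⌋ * (m C r) + (bin₄ r m * weight r ν / 3 + bin₄ r m * c / suc (m ∸ k)))
            (trans (cong (λ v → 2 ^ (r + v)) ∣V∣) (sym K₇-def)) (length-Fₓ cfg 3+r≤m)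

          large-ok : length F ≤ bound (n ∸ a)
          large-ok = subst (λ m → length F ≤ bound m) m≡ (add-up (length Fₛ) (length L) F-split length-star noncrossing crossing)
            where
            -- `l`, the number of absent sets, cancels: the star falls short of C(m, k-1) by at
            -- least `l`, and the noncrossing members exceed `M₃` by at most `l`.
            add-up : ∀ {F s t o c C₁ M₃} (ss l : ℕ) → F ≡ ss + o + c → ss + l ≤ C₁ → o ≤ l + M₃ → c ≤ s + t → F ≤ C₁ + s + t + M₃
            add-up {F} {s} {t} {o} {c} {C₁} {M₃} ss l eq hs ho hc = begin
              F                          ≡⟨ eq ⟩
              ss + o + c                 ≤⟨ +-mono-≤ (+-monoʳ-≤ ss ho) hc ⟩
              ss + (l + M₃) + (s + t)    ≡⟨ regroup ss l M₃ s t ⟩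
              ss + l + s + t + M₃        ≤⟨ +-monoˡ-≤ M₃ (+-monoˡ-≤ t (+-monoˡ-≤ s hs)) ⟩
              C₁ + s + t + M₃            ∎
              where
              open ≤-Reasoning
              regroup : ∀ a b c d e → a + (b + c) + (d + e) ≡ a + b + d + e + c
              regroup = solve-∀

      length-≤-bound : length F ≤ bound (n ∸ a)
      length-≤-bound = [ small-ok , Large.large-ok ]′ (≤-total (length F) ((n ∸ a) C (2 + r)))

    f-≤-bound : ∀ {n} → threshold ≤ n → f n k 3 (ℤ.+ ν) ≤ bound (n ∸ a)
    f-≤-bound h = f≤ (length-≤-bound h)

  -- Lower bound constructions

  record Grid (n ν k m : ℕ) : Set where
    field
      x              : Fin n
      cell           : Fin ν → Fin k → Fin n
      cell-injective : ∀ {i j s t} → cell i s ≡ cell j t → i ≡ j × s ≡ t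
      cell≢x         : ∀ i s → cell i s ≢ x
      U              : Subset n
      ∣U∣            : ∣ U ∣ ≡ m
      x∉U            : x ∉ U
      cell∉U         : ∀ i s → cell i s ∉ U

  module Blocks {n ν k m : ℕ} (grid : Grid n ν k m) where

    open Grid grid public

    B : Fin ν → Subset n
    B i = fromList (map (cell i) (allFin k))

    cell∈B : ∀ i s → cell i s ∈ B i
    cell∈B i s = ∈-fromList⁺ (∈-map⁺ (cell i) (∈-allFin s))

    ∈-B⁻ : ∀ {i y} → y ∈ B i → ∃[ s ] y ≡ cell i s
    ∈-B⁻ {i} y∈ with ∈-map⁻ (cell i) (∈-fromList⁻ (map (cell i) (allFin k)) y∈)
    ... | s , _ , eq = s , eq

    B-disjoint : ∀ {i j y} → y ∈ B i → y ∈ B j → i ≡ j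
    B-disjoint {i} {j} y∈i y∈j = let s , eq = ∈-B⁻ {i} y∈i ; t , eq′ = ∈-B⁻ {j} y∈j in
      proj₁ (cell-injective (trans (sym eq) eq′))

    ∣B∣ : ∀ i → ∣ B i ∣ ≡ k
    ∣B∣ i = ≤-antisym
      (≤-trans (∣p∣≤length {xs = map (cell i) (allFin k)} {p = B i} (∈-fromList⁻ (map (cell i) (allFin k)))) (≤-reflexive (trans (length-map (cell i) (allFin k)) (length-allFin k))))
      (≤-trans (≤-reflexive (sym (trans (length-map (cell i) (allFin k)) (length-allFin k))))
        (length≤∣p∣ {p = B i} (Uniqueₚ.map⁺ (λ eq → proj₂ (cell-injective eq)) (Uniqueₚ.allFin⁺ k)) ∈-fromList⁺))

    x∉B : ∀ i → x ∉ B i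
    x∉B i x∈ = let s , eq = ∈-B⁻ {i} x∈ in cell≢x i s (sym eq)

    R : Subset n
    R = ⋃ᶠ B

    B⊆R : ∀ i → B i ⊆ R
    B⊆R i = ∈-⋃ᶠ⁺ B i

    x∉R : x ∉ R
    x∉R x∈ = let i , x∈i = ∈-⋃ᶠ⁻ B x∈ in x∉B i x∈i

    U∉R : ∀ {y} → y ∈ U → y ∉ R
    U∉R y∈U y∈R = let i , y∈i = ∈-⋃ᶠ⁻ B y∈R ; s , eq = ∈-B⁻ {i} y∈i in cell∉U i s (subst (_∈ U) eq y∈U)

    MeetsBlock : Subset n → Fin ν → Set
    MeetsBlock T i = Nonempty (T ∩ B i)

  -- Admissible traces on the union R of the blocks, for sets through x.
  record Traces {n ν k m : ℕ} (grid : Grid n ν (suc k) m) (𝒯 : List (Subset n)) : Set where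
    open Blocks grid
    field
      traces-unique : Unique 𝒯
      ⊥∈𝒯           : ⊥ ∈ₗ 𝒯
      trace⊆R       : ∀ {T} → T ∈ₗ 𝒯 → T ⊆ R
      ∣trace∣≤      : ∀ {T} → T ∈ₗ 𝒯 → ∣ T ∣ ≤ k
      -- These last two conditions keep a block and two sets through x from forming a cluster. If
      -- only T meets the block, one point of T outside the block and T′ makes the union too large;
      -- if both meet it without a common point there, sufficiently many trace points outside the
      -- block do.
      escapes       : ∀ {T T′} i → T ∈ₗ 𝒯 → T′ ∈ₗ 𝒯 → MeetsBlock T i → ¬ MeetsBlock T′ i → ∃[ y ] (y ∈ T × y ∉ B i × y ∉ T′)
      spreads       : ∀ {T T′} i → T ∈ₗ 𝒯 → T′ ∈ₗ 𝒯 → MeetsBlock T i → MeetsBlock T′ i → (∀ {y} → y ∈ B i → y ∈ T → y ∉ T′) →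
                      ∃[ zs ] (Unique zs × (∀ {z} → z ∈ₗ zs → (z ∈ T ⊎ z ∈ T′) × z ∉ B i) × (suc ∣ T ∣ ≤ length zs ⊎ suc ∣ T′ ∣ ≤ length zs))

  module TraceFamily {n ν k m : ℕ} (grid : Grid n ν (suc k) m) {𝒯 : List (Subset n)} (traces : Traces grid 𝒯) where

    open Blocks grid
    open Traces traces

    member : Subset n → Subset n → Subset n
    member T Q = (T ∪ Q) ∪⁅ x ⁆

    members : Subset n → List (Subset n)
    members T = map (member T) (choose U (k ∸ ∣ T ∣))

    stars blocks family : List (Subset n)
    stars = concatMap members 𝒯
    blocks = map B (allFin ν)
    family = stars ++ blocks

    record Star (S : Subset n) : Set where
      field
        {T Q} : Subset n
        T∈    : T ∈ₗ 𝒯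
        Q⊆U   : Q ⊆ U
        ∣Q∣   : ∣ Q ∣ ≡ k ∸ ∣ T ∣
        S≡    : S ≡ member T Q

    star : ∀ {S} → S ∈ₗ stars → Star S
    star S∈ with find (∈-concatMap⁻ members {xs = 𝒯} S∈)
    ... | T , T∈ , S∈T with ∈-map⁻ (member T) S∈T
    ...   | Q , Q∈ , refl = let Q⊆U , ∣Q∣ = ∈-choose⁻ U (k ∸ ∣ T ∣) Q∈ in
      record { T∈ = T∈ ; Q⊆U = Q⊆U ; ∣Q∣ = ∣Q∣ ; S≡ = refl }

    module _ {S} (st : Star S) where
      open Star st

      x∈star : x ∈ S
      x∈star = subst (x ∈_) (sym S≡) (∈-add (T ∪ Q))

      T⊆star : T ⊆ S
      T⊆star y∈ = subst (_ ∈_) (sym S≡) (⊆-add (T ∪ Q) (x∈p∪q⁺ (inj₁ y∈)))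

      Q⊆star : Q ⊆ S
      Q⊆star y∈ = subst (_ ∈_) (sym S≡) (⊆-add (T ∪ Q) (x∈p∪q⁺ (inj₂ y∈)))

      star⁻ : ∀ {y} → y ∈ S → y ∈ T ⊎ (y ∈ Q ⊎ y ≡ x)
      star⁻ y∈ = case ∈-add⁻ (T ∪ Q) (subst (_ ∈_) S≡ y∈) of λ
        { (inj₂ eq) → inj₂ (inj₂ eq) ; (inj₁ y∈TQ) → [ inj₁ , inj₂ ∘ inj₁ ]′ (x∈p∪q⁻ T Q y∈TQ) }

      star-R : ∀ {y} → y ∈ S → y ∈ R → y ∈ T
      star-R y∈ y∈R = case star⁻ y∈ of λ
        { (inj₁ y∈T) → y∈T ; (inj₂ (inj₁ y∈Q)) → ⊥-elim (U∉R (Q⊆U y∈Q) y∈R) ; (inj₂ (inj₂ refl)) → ⊥-elim (x∉R y∈R) }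

      star-U : ∀ {y} → y ∈ S → y ∈ U → y ∈ Q
      star-U y∈ y∈U = case star⁻ y∈ of λ
        { (inj₁ y∈T) → ⊥-elim (U∉R y∈U (trace⊆R T∈ y∈T)) ; (inj₂ (inj₁ y∈Q)) → y∈Q ; (inj₂ (inj₂ refl)) → ⊥-elim (x∉U y∈U) }

      T-off : ∀ {y} → y ∈ T → y ∉ Q
      T-off y∈T y∈Q = U∉R (Q⊆U y∈Q) (trace⊆R T∈ y∈T)

      ∣TQ∣ : ∣ T ∣ + ∣ Q ∣ ≡ k
      ∣TQ∣ = trans (cong (∣ T ∣ +_) ∣Q∣) (m+[n∸m]≡n (∣trace∣≤ T∈))

      ∣star∣ : ∣ S ∣ ≡ suc k
      ∣star∣ = trans (cong ∣_∣ S≡) (trans (∣add∣ (T ∪ Q) x∉TQ) (cong suc (trans (∣p∪q∣-disjoint T Q T-off) ∣TQ∣)))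
        where
        x∉TQ : x ∉ T ∪ Q
        x∉TQ x∈ = [ x∉R ∘ trace⊆R T∈ , x∉U ∘ Q⊆U ]′ (x∈p∪q⁻ T Q x∈)

    stars-unique : Unique stars
    stars-unique = go 𝒯 traces-unique id
      where
      members-unique : ∀ {T} → T ∈ₗ 𝒯 → Unique (members T)
      members-unique {T} T∈ = map-unique (member T) (choose-unique U (k ∸ ∣ T ∣)) (λ {Q} {Q′} Q∈ Q′∈ eq →
        ⊆-antisym (half T∈ Q∈ Q′∈ eq) (half T∈ Q′∈ Q∈ (sym eq)))
        where
        half : ∀ {T Q Q′} → T ∈ₗ 𝒯 → Q ∈ₗ choose U (k ∸ ∣ T ∣) → Q′ ∈ₗ choose U (k ∸ ∣ T ∣) → member T Q ≡ member T Q′ → Q ⊆ Q′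
        half {T} {Q} {Q′} T∈ Q∈ Q′∈ eq {y} y∈ = let Q⊆ , _ = ∈-choose⁻ U (k ∸ ∣ T ∣) Q∈ ; Q′⊆ , c = ∈-choose⁻ U (k ∸ ∣ T ∣) Q′∈ in
          star-U (record { T∈ = T∈ ; Q⊆U = Q′⊆ ; ∣Q∣ = c ; S≡ = eq }) (⊆-add (T ∪ Q) (x∈p∪q⁺ (inj₂ y∈))) (Q⊆ y∈)
      go : ∀ 𝒮 → Unique 𝒮 → (∀ {T} → T ∈ₗ 𝒮 → T ∈ₗ 𝒯) → Unique (concatMap members 𝒮)
      go [] _ _ = []
      go (T ∷ 𝒮) (T∉ ∷ u) sub = Uniqueₚ.++⁺ (members-unique (sub (here refl))) (go 𝒮 u (sub ∘ there)) disjoint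
        where
        disjoint : ∀ {S} → ¬ (S ∈ₗ members T × S ∈ₗ concatMap members 𝒮)
        disjoint (S∈ , S∈′) with ∈-map⁻ (member T) S∈ | find (∈-concatMap⁻ members {xs = 𝒮} S∈′)
        ... | Q , Q∈ , eq | T′ , T′∈ , S∈T′ with ∈-map⁻ (member T′) S∈T′
        ...   | Q′ , Q′∈ , eq′ = All.lookup T∉ T′∈ (⊆-antisym
                (λ y∈ → star-R st′ (T⊆star st y∈) (trace⊆R (sub (here refl)) y∈))
                (λ y∈ → star-R st (T⊆star st′ y∈) (trace⊆R (sub (there T′∈)) y∈)))
          where
          st : Star _
          st = record { T∈ = sub (here refl) ; Q⊆U = proj₁ (∈-choose⁻ U (k ∸ ∣ T ∣) Q∈) ; ∣Q∣ = proj₂ (∈-choose⁻ U (k ∸ ∣ T ∣) Q∈) ; S≡ = eq }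
          st′ : Star _
          st′ = record { T∈ = sub (there T′∈) ; Q⊆U = proj₁ (∈-choose⁻ U (k ∸ ∣ T′ ∣) Q′∈) ; ∣Q∣ = proj₂ (∈-choose⁻ U (k ∸ ∣ T′ ∣) Q′∈) ; S≡ = eq′ }

    some : ∀ i → Nonempty (B i)
    some i = card>0⇒Nonempty (B i) (subst (1 ≤_) (sym (∣B∣ i)) (s≤s z≤n))

    B-injective : ∀ {i j} → B i ≡ B j → i ≡ j
    B-injective {i} eq = B-disjoint (proj₂ (some i)) (subst (proj₁ (some i) ∈_) eq (proj₂ (some i)))

    blocks-unique : Unique blocks
    blocks-unique = Uniqueₚ.map⁺ B-injective (Uniqueₚ.allFin⁺ ν)

    x∉block : ∀ {S} → S ∈ₗ blocks → x ∉ S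
    x∉block S∈ with ∈-map⁻ B S∈
    ... | i , _ , refl = x∉B i

    family-unique : Unique family
    family-unique = Uniqueₚ.++⁺ stars-unique blocks-unique (λ { (S∈ , S∈′) → x∉block S∈′ (x∈star (star S∈)) })

    module _ {Y : Subset n} (small : ∣ Y ∣ ≤ 2 * suc k) where

      -- The block has `suc k` elements, so a disjoint set with one more exceeds 2 · `suc k`.
      -- Clusters involving a block are refuted by exhibiting such a set.
      overfull : ∀ i Z → B i ⊆ Y → Z ⊆ Y → (∀ {y} → y ∈ B i → y ∉ Z) → suc (suc k) ≤ ∣ Z ∣ → Data.Empty.⊥
      overfull i Z B⊆ Z⊆ disj large = <⇒≱ (s≤s small) (≤-trans (≤-reflexive (double k))
        (≤-trans (+-mono-≤ (≤-reflexive (sym (∣B∣ i))) large) (≤-trans (≤-reflexive (sym (∣p∪q∣-disjoint (B i) Z disj)))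
          (p⊆q⇒∣p∣≤∣q∣ {p = B i ∪ Z} {Y} (∪-⊆ (B i) Z B⊆ Z⊆)))))
        where
        double : ∀ k → suc (2 * suc k) ≡ suc k + suc (suc k)
        double = solve-∀

      two-blocks : ∀ i j z → i ≢ j → B i ⊆ Y → B j ⊆ Y → z ∈ Y → z ∉ B i → z ∉ B j → Data.Empty.⊥
      two-blocks i j z i≢j Bi⊆ Bj⊆ z∈ z∉i z∉j = overfull i (B j ∪⁅ z ⁆) Bi⊆
        (λ y∈ → [ Bj⊆ , (λ { refl → z∈ }) ]′ (∈-add⁻ (B j) y∈))
        (λ y∈i y∈ → [ (λ y∈j → i≢j (B-disjoint y∈i y∈j)) , (λ { refl → z∉i y∈i }) ]′ (∈-add⁻ (B j) y∈))
        (≤-reflexive (sym (trans (∣add∣ (B j) z∉j) (cong suc (∣B∣ j)))))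

      -- S′ misses the block and has full size, so a single further element y is enough for
      -- `overfull`.
      lopsided : ∀ i {S S′} → Star S → (st′ : Star S′) → B i ⊆ Y → S ⊆ Y → S′ ⊆ Y → ¬ MeetsBlock (Star.T st′) i →
                 ∀ {y} → y ∈ S → y ∉ B i → y ∉ S′ → Data.Empty.⊥
      lopsided i {S} {S′} st st′ B⊆ S⊆ S′⊆ ¬m {y} y∈S y∉B y∉S′ = overfull i (S′ ∪⁅ y ⁆) B⊆
        (λ z∈ → [ S′⊆ , (λ { refl → S⊆ y∈S }) ]′ (∈-add⁻ S′ z∈))
        (λ z∈B z∈ → [ (λ z∈S′ → ¬m (_ , x∈p∩q⁺ (star-R st′ z∈S′ (B⊆R i z∈B) , z∈B))) , (λ { refl → y∉B z∈B }) ]′ (∈-add⁻ S′ z∈))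
        (≤-reflexive (sym (trans (∣add∣ S′ y∉S′) (cong suc (∣star∣ st′)))))

      -- S consists of its trace, Q and x. Replacing the trace by the more numerous points `zs`
      -- gives a set outside the block that is larger than S.
      spread-out : ∀ i {S S′} (st : Star S) → Star S′ → B i ⊆ Y → S ⊆ Y → S′ ⊆ Y → ∀ zs → Unique zs →
                   (∀ {z} → z ∈ₗ zs → (z ∈ S ⊎ z ∈ S′) × z ∈ R × z ∉ B i) → suc ∣ Star.T st ∣ ≤ length zs → Data.Empty.⊥
      spread-out i {S} {S′} st st′ B⊆ S⊆ S′⊆ zs uzs z∈ large = overfull i Z B⊆ Z⊆ disj big
        where
        open Star st
        Z = (fromList zs ∪ Q) ∪⁅ x ⁆
        Z⊆ : Z ⊆ Y
        Z⊆ y∈ = case ∈-add⁻ (fromList zs ∪ Q) y∈ of λ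
          { (inj₂ refl) → S⊆ (x∈star st)
          ; (inj₁ y∈zQ) → [ (λ y∈z → [ S⊆ , S′⊆ ]′ (proj₁ (z∈ (∈-fromList⁻ zs y∈z)))) , S⊆ ∘ Q⊆star st ]′ (x∈p∪q⁻ (fromList zs) Q y∈zQ) }
        disj : ∀ {y} → y ∈ B i → y ∉ Z
        disj y∈B y∈ = case ∈-add⁻ (fromList zs ∪ Q) y∈ of λ
          { (inj₂ refl) → x∉B i y∈B
          ; (inj₁ y∈zQ) → [ (λ y∈z → proj₂ (proj₂ (z∈ (∈-fromList⁻ zs y∈z))) y∈B) , (λ y∈Q → U∉R (Q⊆U y∈Q) (B⊆R i y∈B)) ]′ (x∈p∪q⁻ (fromList zs) Q y∈zQ) }
        x∉ : x ∉ fromList zs ∪ Q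
        x∉ x∈ = [ (λ x∈z → x∉R (proj₁ (proj₂ (z∈ (∈-fromList⁻ zs x∈z))))) , x∉U ∘ Q⊆U ]′ (x∈p∪q⁻ (fromList zs) Q x∈)
        big : suc (suc k) ≤ ∣ Z ∣
        big = ≤-trans (s≤s (≤-trans (≤-reflexive (cong suc (sym (∣TQ∣ st)))) (≤-trans (+-monoˡ-≤ ∣ Q ∣ (≤-trans large (length≤∣p∣ {p = fromList zs} uzs ∈-fromList⁺)))
                (≤-reflexive (sym (∣p∪q∣-disjoint (fromList zs) Q (λ y∈z y∈Q → U∉R (Q⊆U y∈Q) (proj₁ (proj₂ (z∈ (∈-fromList⁻ zs y∈z)))))))))))
              (≤-reflexive (sym (∣add∣ (fromList zs ∪ Q) x∉)))

      one-block : ∀ i {S S′} → Star S → Star S′ → S ≢ S′ → B i ⊆ Y → S ⊆ Y → S′ ⊆ Y →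
                  ¬ (∀ {y} → y ∈ B i → y ∈ S → y ∉ S′)
      one-block i {S} {S′} st st′ S≢S′ B⊆ S⊆ S′⊆ empty = case nonempty? (St.T ∩ B i) , nonempty? (St′.T ∩ B i) of λ
        { (no ¬m , no ¬m′) → case ⊆-or-new S S′ of λ
            { (inj₁ S⊆S′) → S≢S′ (⊆-card-≡ S⊆S′ (≤-reflexive (trans (∣star∣ st′) (sym (∣star∣ st)))))
            ; (inj₂ (y , y∈S , y∉S′)) → lopsided i st st′ B⊆ S⊆ S′⊆ ¬m′ y∈S
                (λ y∈B → ¬m (y , x∈p∩q⁺ (star-R st y∈S (B⊆R i y∈B) , y∈B))) y∉S′ }
        ; (yes mt , no ¬m′) → let y , y∈T , y∉B , y∉T′ = escapes i St.T∈ St′.T∈ mt ¬m′ in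
            lopsided i st st′ B⊆ S⊆ S′⊆ ¬m′ (T⊆star st y∈T) y∉B (λ y∈S′ → y∉T′ (star-R st′ y∈S′ (trace⊆R St.T∈ y∈T)))
        ; (no ¬m , yes mt′) → let y , y∈T , y∉B , y∉T′ = escapes i St′.T∈ St.T∈ mt′ ¬m in
            lopsided i st′ st B⊆ S′⊆ S⊆ ¬m (T⊆star st′ y∈T) y∉B (λ y∈S → y∉T′ (star-R st y∈S (trace⊆R St′.T∈ y∈T)))
        ; (yes mt , yes mt′) → let zs , uzs , z∈ , large = spreads i St.T∈ St′.T∈ mt mt′
                                     (λ y∈B y∈T y∈T′ → empty y∈B (T⊆star st y∈T) (T⊆star st′ y∈T′))
                                   in-R : ∀ {z} → z ∈ₗ zs → z ∈ R
                                   in-R z∈zs = [ trace⊆R St.T∈ , trace⊆R St′.T∈ ]′ (proj₁ (z∈ z∈zs))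
                                   in-S : ∀ {z} → z ∈ₗ zs → z ∈ S ⊎ z ∈ S′
                                   in-S z∈zs = [ inj₁ ∘ T⊆star st , inj₂ ∘ T⊆star st′ ]′ (proj₁ (z∈ z∈zs))
                               in [ spread-out i st st′ B⊆ S⊆ S′⊆ zs uzs (λ z∈zs → in-S z∈zs , in-R z∈zs , proj₂ (z∈ z∈zs))
                                  , spread-out i st′ st B⊆ S′⊆ S⊆ zs uzs (λ z∈zs → [ inj₂ , inj₁ ]′ (in-S z∈zs) , in-R z∈zs , proj₂ (z∈ z∈zs)) ]′ large }
        where
        module St = Star st
        module St′ = Star st′

    classify : ∀ {S} → S ∈ₗ family → Star S ⊎ ∃[ i ] S ≡ B i
    classify S∈ = case ∈-++⁻ stars S∈ of λ
      { (inj₁ S∈s) → inj₁ (star S∈s) ; (inj₂ S∈b) → case ∈-map⁻ B S∈b of λ { (i , _ , eq) → inj₂ (i , eq) } }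

    outside-blocks : ∀ {S} i j → Star S ⊎ (∃[ l ] S ≡ B l) → S ≢ B i → S ≢ B j → ∃[ z ] (z ∈ S × z ∉ B i × z ∉ B j)
    outside-blocks i j (inj₁ st) _ _ = x , x∈star st , x∉B i , x∉B j
    outside-blocks i j (inj₂ (l , refl)) ≢i ≢j = let z , z∈ = some l in
      z , z∈ , (λ z∈i → ≢i (cong B (B-disjoint z∈ z∈i))) , (λ z∈j → ≢j (cong B (B-disjoint z∈ z∈j)))

    -- Three sets through x have x in common; two blocks and a point beyond them are too large
    -- already; a single block is the case of `one-block`.
    noCluster′ : ∀ {A A′ D} → A ∈ₗ family → A′ ∈ₗ family → D ∈ₗ family → A ≢ A′ → A ≢ D → A′ ≢ D →
                 ∣ A ∪ (A′ ∪ D) ∣ ≤ 2 * suc k → ¬ (∀ {y} → y ∈ A → y ∈ A′ → y ∉ D)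
    noCluster′ {A} {A′} {D} A∈ A′∈ D∈ A≢A′ A≢D A′≢D small empty = go (classify A∈) (classify A′∈) (classify D∈)
      where
      Y = A ∪ (A′ ∪ D)
      A⊆ : A ⊆ Y
      A⊆ = x∈p∪q⁺ ∘ inj₁
      A′⊆ : A′ ⊆ Y
      A′⊆ y∈ = x∈p∪q⁺ (inj₂ (x∈p∪q⁺ (inj₁ y∈)))
      D⊆ : D ⊆ Y
      D⊆ y∈ = x∈p∪q⁺ (inj₂ (x∈p∪q⁺ (inj₂ y∈)))
      Kind : Subset n → Set
      Kind S = Star S ⊎ ∃[ i ] S ≡ B i
      two : ∀ {S S′ S″} → S ⊆ Y → S′ ⊆ Y → S″ ⊆ Y → S ≢ S′ → S″ ≢ S → S″ ≢ S′ → ∀ i j → S ≡ B i → S′ ≡ B j → Kind S″ → Data.Empty.⊥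
      two S⊆ S′⊆ S″⊆ S≢S′ ≢S ≢S′ i j refl refl c = let z , z∈ , z∉i , z∉j = outside-blocks i j c ≢S ≢S′ in
        two-blocks small i j z (S≢S′ ∘ cong B) S⊆ S′⊆ (S″⊆ z∈) z∉i z∉j
      go : Kind A → Kind A′ → Kind D → Data.Empty.⊥
      go (inj₁ a) (inj₁ a′) (inj₁ d) = empty (x∈star a) (x∈star a′) (x∈star d)
      go (inj₂ (i , refl)) (inj₁ a′) (inj₁ d) = one-block small i a′ d A′≢D A⊆ A′⊆ D⊆ empty
      go (inj₁ a) (inj₂ (i , refl)) (inj₁ d) = one-block small i a d A≢D A′⊆ A⊆ D⊆ (λ b a d → empty a b d)
      go (inj₁ a) (inj₁ a′) (inj₂ (i , refl)) = one-block small i a a′ A≢A′ D⊆ A⊆ A′⊆ (λ d a a′ → empty a a′ d)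
      go (inj₂ (i , ei)) (inj₂ (j , ej)) c = two A⊆ A′⊆ D⊆ A≢A′ (A≢D ∘ sym) (A′≢D ∘ sym) i j ei ej c
      go (inj₂ (i , ei)) (inj₁ a′) (inj₂ (j , ej)) = two A⊆ D⊆ A′⊆ A≢D (A≢A′ ∘ sym) A′≢D i j ei ej (inj₁ a′)
      go (inj₁ a) (inj₂ (i , ei)) (inj₂ (j , ej)) = two A′⊆ D⊆ A⊆ A′≢D A≢A′ A≢D i j ei ej (inj₁ a)

    clusterFreeFamily : ClusterFreeFamily n (suc k)
    clusterFreeFamily = record { F = family ; unique = family-unique ; card = λ S∈ → cardOf (classify S∈) ; noCluster = noCluster′ }
      where
      cardOf : ∀ {S} → Star S ⊎ (∃[ i ] S ≡ B i) → ∣ S ∣ ≡ suc k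
      cardOf (inj₁ st) = ∣star∣ st
      cardOf (inj₂ (i , refl)) = ∣B∣ i

    -- A set through x with empty trace is disjoint from all blocks and completes the matching;
    -- `k ≤ m` gives it room in U.
    matching : k ≤ m → Matching clusterFreeFamily (ν + 1)
    matching k≤m = record
      { blocks = S₀ ∷ blocks
      ; blocks⊆F = λ { (here refl) → ∈-++⁺ˡ S₀∈ ; (there S∈) → ∈-++⁺ʳ stars S∈ }
      ; blocks-unique = All.tabulate (λ S∈ eq → x∉block S∈ (subst (x ∈_) eq (x∈star st₀))) ∷ blocks-unique
      ; blocks-disjoint = disjoint
      ; μ≤blocks = ≤-reflexive (trans (+-comm ν 1) (cong suc (sym (trans (length-map B (allFin ν)) (length-allFin ν))))) }
      where
      Q₀ : ∃[ Q ] (⊥ ⊆ Q × Q ⊆ U × ∣ Q ∣ ≡ ∣ ⊥ {n} ∣ + k)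
      Q₀ = enlarge k ⊥ U (λ y∈ → ⊥-elim (∉⊥ y∈)) (≤-trans (≤-reflexive (cong (_+ k) (∣⊥∣≡0 n))) (≤-trans k≤m (≤-reflexive (sym ∣U∣))))
      ∣Q₀∣ : ∣ proj₁ Q₀ ∣ ≡ k ∸ ∣ ⊥ {n} ∣
      ∣Q₀∣ = trans (proj₂ (proj₂ (proj₂ Q₀))) (trans (cong (_+ k) (∣⊥∣≡0 n)) (sym (cong (k ∸_) (∣⊥∣≡0 n))))
      S₀ = member ⊥ (proj₁ Q₀)
      S₀∈ : S₀ ∈ₗ stars
      S₀∈ = ∈-concatMap members ⊥∈𝒯 (∈-map⁺ (member ⊥) (∈-choose (proj₁ (proj₂ (proj₂ Q₀))) ∣Q₀∣))
      st₀ : Star S₀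
      st₀ = record { T∈ = ⊥∈𝒯 ; Q⊆U = proj₁ (proj₂ (proj₂ Q₀)) ; ∣Q∣ = ∣Q₀∣ ; S≡ = refl }
      off : ∀ {S y} → S ∈ₗ blocks → y ∈ S₀ → y ∉ S
      off S∈ y∈ y∈S = case ∈-map⁻ B S∈ of λ { (i , _ , refl) → ∉⊥ (star-R st₀ y∈ (B⊆R i y∈S)) }
      disjoint : ∀ {S S′} → S ∈ₗ S₀ ∷ blocks → S′ ∈ₗ S₀ ∷ blocks → S ≢ S′ → Empty (S ∩ S′)
      disjoint (here refl) (here refl) S≢ _ = S≢ refl
      disjoint {S′ = S′} (here refl) (there S′∈) _ (y , y∈) = let a , b = x∈p∩q⁻ S₀ S′ y∈ in off S′∈ a b
      disjoint {S} (there S∈) (here refl) _ (y , y∈) = let a , b = x∈p∩q⁻ S S₀ y∈ in off S∈ b a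
      disjoint {S} {S′} (there S∈) (there S′∈) S≢ (y , y∈) = case ∈-map⁻ B S∈ , ∈-map⁻ B S′∈ of λ
        { ((i , _ , refl) , (j , _ , refl)) → let a , b = x∈p∩q⁻ (B i) (B j) y∈ in S≢ (cong B (B-disjoint a b)) }

    length-family : length family ≡ total (λ T → m C (k ∸ ∣ T ∣)) 𝒯 + ν
    length-family = trans (length-++ stars) (cong₂ _+_ (go 𝒯) (trans (length-map B (allFin ν)) (length-allFin ν)))
      where
      go : ∀ 𝒮 → length (concatMap members 𝒮) ≡ total (λ T → m C (k ∸ ∣ T ∣)) 𝒮
      go [] = refl
      go (T ∷ 𝒮) = trans (length-++ (members T)) (cong₂ _+_
        (trans (length-map (member T) (choose U (k ∸ ∣ T ∣))) (trans (length-choose U (k ∸ ∣ T ∣)) (cong (_C (k ∸ ∣ T ∣)) ∣U∣))) (go 𝒮))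

    traces-≤-f : k ≤ m → total (λ T → m C (k ∸ ∣ T ∣)) 𝒯 + ν ≤ f n (suc k) 3 (ℤ.+ ν)
    traces-≤-f k≤m = ≤-trans (≤-reflexive (sym length-family)) (≤f clusterFreeFamily (matching k≤m) {ℤ.+ ν} ℤₚ.≤-refl)

  grid-exists : ∀ {n} ν k → suc (ν * k) ≤ n → Grid n ν k (n ∸ suc (ν * k))
  grid-exists {n} ν k h = record
    { x = ι zero ; cell = λ i s → ι (suc (Fin.combine i s))
    ; cell-injective = λ {i} {j} {s} {t} eq → Finₚ.combine-injective i s j t (Finₚ.suc-injective (ι-injective eq))
    ; cell≢x = λ i s eq → case ι-injective eq of λ ()
    ; U = ∁ V ; ∣U∣ = trans (∣∁p∣≡n∸∣p∣ V) (cong (n ∸_) ∣V∣)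
    ; x∉U = λ x∈ → x∈∁p⇒x∉p x∈ (ι∈V zero) ; cell∉U = λ i s c∈ → x∈∁p⇒x∉p c∈ (ι∈V _) }
    where
    ι : Fin (suc (ν * k)) → Fin n
    ι a = Fin.inject≤ a h
    ι-injective : ∀ {a b} → ι a ≡ ι b → a ≡ b
    ι-injective = Finₚ.inject≤-injective h h _ _
    images = map ι (allFin (suc (ν * k)))
    len : length images ≡ suc (ν * k)
    len = trans (length-map ι (allFin (suc (ν * k)))) (length-allFin (suc (ν * k)))
    V : Subset n
    V = fromList images
    ι∈V : ∀ a → ι a ∈ V
    ι∈V a = ∈-fromList⁺ (∈-map⁺ ι (∈-allFin a))
    ∣V∣ : ∣ V ∣ ≡ suc (ν * k)
    ∣V∣ = ≤-antisym (≤-trans (∣p∣≤length {xs = images} {p = V} (∈-fromList⁻ images)) (≤-reflexive len))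
      (≤-trans (≤-reflexive (sym len)) (length≤∣p∣ {p = V} (Uniqueₚ.map⁺ ι-injective (Uniqueₚ.allFin⁺ (suc (ν * k)))) ∈-fromList⁺))

  concatMap-unique : {A B : Set} (g : A → List B) {as : List A} → Unique as → (∀ {a} → a ∈ₗ as → Unique (g a)) →
                     (∀ {a a′ z} → a ∈ₗ as → a′ ∈ₗ as → z ∈ₗ g a → z ∈ₗ g a′ → a ≡ a′) → Unique (concatMap g as)
  concatMap-unique g [] _ _ = []
  concatMap-unique g {a ∷ as} (a∉ ∷ u) each sep = Uniqueₚ.++⁺ (each (here refl))
    (concatMap-unique g u (each ∘ there) (λ p q → sep (there p) (there q)))
    (λ { (z∈ , z∈′) → let a′ , a′∈ , z∈a′ = find (∈-concatMap⁻ g {xs = as} z∈′) in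
         All.lookup a∉ a′∈ (sep (here refl) (there a′∈) z∈ z∈a′) })

  total-++ : {A : Set} (g : A → ℕ) (as bs : List A) → total g (as ++ bs) ≡ total g as + total g bs
  total-++ g [] bs = refl
  total-++ g (a ∷ as) bs = trans (cong (g a +_) (total-++ g as bs)) (sym (+-assoc (g a) (total g as) (total g bs)))

  total-const : {A : Set} (g : A → ℕ) (as : List A) {c : ℕ} → (∀ {a} → a ∈ₗ as → g a ≡ c) → total g as ≡ length as * c
  total-const g [] h = refl
  total-const g (a ∷ as) h = cong₂ _+_ (h (here refl)) (total-const g as (h ∘ there))

  total-concatMap : {A B : Set} (g : B → ℕ) (φ : A → List B) (as : List A) → total g (concatMap φ as) ≡ total (λ a → total g (φ a)) as
  total-concatMap g φ [] = refl
  total-concatMap g φ (a ∷ as) = trans (total-++ g (φ a) (concatMap φ as)) (cong (total g (φ a) +_) (total-concatMap g φ as))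

  -- The indices 0, 1, …, ν-1 are paired as {0, 1}, {2, 3}, …

  side : ∀ ν → Fin ⌊ ν /2⌋ → Bool → Fin ν
  side (suc (suc ν)) zero false = zero
  side (suc (suc ν)) zero true = suc zero
  side (suc (suc ν)) (suc p) β = suc (suc (side ν p β))

  side-injective : ∀ ν {p q β γ} → side ν p β ≡ side ν q γ → p ≡ q × β ≡ γ
  side-injective (suc (suc ν)) {zero} {zero} {false} {false} eq = refl , refl
  side-injective (suc (suc ν)) {zero} {zero} {true} {true} eq = refl , refl
  side-injective (suc (suc ν)) {zero} {suc q} {false} {γ} ()
  side-injective (suc (suc ν)) {zero} {suc q} {true} {γ} ()
  side-injective (suc (suc ν)) {suc p} {zero} {β} {false} ()
  side-injective (suc (suc ν)) {suc p} {zero} {β} {true} ()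
  side-injective (suc (suc ν)) {suc p} {suc q} eq =
    let a , b = side-injective ν (Finₚ.suc-injective (Finₚ.suc-injective eq)) in cong suc a , b

  flip≢ : ∀ β → not β ≢ β
  flip≢ false ()
  flip≢ true ()

  module PairTraces {n ν k m : ℕ} (grid : Grid n ν (suc k) m) where

    open Blocks grid public

    σ : Fin ⌊ ν /2⌋ → Bool → Fin ν
    σ = side ν

    -- Slot 0 of every block carries the pairs; the triples of `SecondConstruction` use the
    -- remaining slots.
    c₀ : Fin ν → Fin n
    c₀ i = cell i zero

    pairT : Fin ⌊ ν /2⌋ → Subset n
    pairT p = ⁅ c₀ (σ p false) ⁆ ∪⁅ c₀ (σ p true) ⁆

    ∈-pairT⁺ : ∀ p β → c₀ (σ p β) ∈ pairT p
    ∈-pairT⁺ p false = ⊆-add ⁅ c₀ (σ p false) ⁆ (x∈⁅x⁆ (c₀ (σ p false)))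
    ∈-pairT⁺ p true = ∈-add ⁅ c₀ (σ p false) ⁆

    ∈-pairT⁻ : ∀ {p y} → y ∈ pairT p → ∃[ β ] y ≡ c₀ (σ p β)
    ∈-pairT⁻ {p} y∈ = case ∈-add⁻ ⁅ c₀ (σ p false) ⁆ y∈ of λ
      { (inj₁ y∈f) → false , x∈⁅y⁆⇒x≡y (c₀ (σ p false)) y∈f ; (inj₂ eq) → true , eq }

    σ-block : ∀ {p q β γ y} → y ∈ B (σ p β) → y ∈ B (σ q γ) → p ≡ q × β ≡ γ
    σ-block a b = side-injective ν (B-disjoint a b)

    ∣pairT∣ : ∀ p → ∣ pairT p ∣ ≡ 2
    ∣pairT∣ p = trans (∣add∣ ⁅ c₀ (σ p false) ⁆ (λ t∈ → case x∈⁅y⁆⇒x≡y (c₀ (σ p false)) t∈ of λ eq →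
      case proj₂ (side-injective ν (proj₁ (cell-injective eq))) of λ ())) (cong suc (∣⁅x⁆∣≡1 (c₀ (σ p false))))

  -- Traces between a pair and the union of its two blocks
  module FirstConstruction {n ν s m : ℕ} (grid : Grid n ν (4 + s) m) where

    open PairTraces grid

    hull : Fin ⌊ ν /2⌋ → Subset n
    hull p = B (σ p false) ∪ B (σ p true)

    room : Fin ⌊ ν /2⌋ → Subset n
    room p = hull p ─ pairT p

    over : Fin ⌊ ν /2⌋ → List (Subset n)
    over p = pairT p ∷ map (pairT p ∪⁅_⁆) (elements (room p))

    𝒯 : List (Subset n)
    𝒯 = ⊥ ∷ concatMap over (allFin ⌊ ν /2⌋)

    -- This is all the verification needs: traces over the same pair share a point in each of its
    -- two blocks, and traces over different pairs touch different blocks.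
    InPair : Fin ⌊ ν /2⌋ → Subset n → Set
    InPair p T = (∀ β → c₀ (σ p β) ∈ T) × (∀ {y} → y ∈ T → ∃[ β ] y ∈ B (σ p β))

    hull⁻ : ∀ {p y} → y ∈ hull p → ∃[ β ] y ∈ B (σ p β)
    hull⁻ {p} y∈ = [ (λ a → false , a) , (λ a → true , a) ]′ (x∈p∪q⁻ (B (σ p false)) (B (σ p true)) y∈)

    pair-in : ∀ {p y} → y ∈ pairT p → ∃[ β ] y ∈ B (σ p β)
    pair-in {p} y∈ = let β , eq = ∈-pairT⁻ y∈ in β , subst (_∈ B (σ p β)) (sym eq) (cell∈B (σ p β) zero)

    ∈-over⁻ : ∀ {p T} → T ∈ₗ over p → InPair p T × ∣ T ∣ ≤ 3
    ∈-over⁻ {p} (here refl) = (∈-pairT⁺ p , pair-in) , ≤-trans (≤-reflexive (∣pairT∣ p)) (n≤1+n 2)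
    ∈-over⁻ {p} (there T∈) with ∈-map⁻ (pairT p ∪⁅_⁆) T∈
    ... | z , z∈ , refl = ((λ β → ⊆-add (pairT p) (∈-pairT⁺ p β)) ,
        (λ y∈ → [ pair-in , (λ { refl → hull⁻ (p─q⊆p (hull p) (pairT p) (∈-elements⁻ (room p) z∈)) }) ]′ (∈-add⁻ (pairT p) y∈))) ,
      ≤-trans (∣add∣≤ (pairT p)) (s≤s (≤-reflexive (∣pairT∣ p)))

    Kind : Subset n → Set
    Kind T = T ≡ ⊥ ⊎ ∃[ p ] (InPair p T × ∣ T ∣ ≤ 3)

    kind : ∀ {T} → T ∈ₗ 𝒯 → Kind T
    kind (here eq) = inj₁ eq
    kind (there T∈) = let p , _ , T∈p = find (∈-concatMap⁻ over {xs = allFin ⌊ ν /2⌋} T∈) in inj₂ (p , ∈-over⁻ T∈p)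

    same-pair : ∀ {p q T} → InPair p T → InPair q T → p ≡ q
    same-pair {p} (c , _) (_ , sub) = let γ , y∈ = sub (c false) in proj₁ (σ-block {p} {β = false} (cell∈B (σ p false) zero) y∈)

    meets-side : ∀ {p T i} → InPair p T → MeetsBlock T i → ∃[ β ] i ≡ σ p β
    meets-side {T = T} {i} (_ , sub) (y , y∈) = let y∈T , y∈B = x∈p∩q⁻ T (B i) y∈ ; β , y∈σ = sub y∈T in β , B-disjoint y∈B y∈σ

    over-unique : ∀ p → Unique (over p)
    over-unique p = All.tabulate (λ T∈ eq → case ∈-map⁻ (pairT p ∪⁅_⁆) T∈ of λ
        { (z , z∈ , refl) → fresh z∈ (subst (z ∈_) (sym eq) (∈-add (pairT p))) })
      ∷ map-unique (pairT p ∪⁅_⁆) (elements-unique (room p)) (λ {y} {z} y∈ z∈ eq →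
          [ (λ y∈p → ⊥-elim (fresh y∈ y∈p)) , id ]′ (∈-add⁻ (pairT p) (subst (y ∈_) eq (∈-add (pairT p)))))
      where
      fresh : ∀ {z} → z ∈ₗ elements (room p) → z ∉ pairT p
      fresh z∈ = x∈p─q⇒x∉q (hull p) (pairT p) (∈-elements⁻ (room p) z∈)

    traces : Traces grid 𝒯
    traces = record
      { traces-unique = All.tabulate (λ T∈ eq → let p , _ , T∈p = find (∈-concatMap⁻ over {xs = allFin ⌊ ν /2⌋} T∈) in
            ∉⊥ (subst (c₀ (σ p false) ∈_) (sym eq) (proj₁ (proj₁ (∈-over⁻ T∈p)) false)))
          ∷ concatMap-unique over (Uniqueₚ.allFin⁺ ⌊ ν /2⌋) (λ {p} _ → over-unique p)
              (λ _ _ T∈p T∈q → same-pair (proj₁ (∈-over⁻ T∈p)) (proj₁ (∈-over⁻ T∈q)))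
      ; ⊥∈𝒯 = here refl
      ; trace⊆R = λ T∈ y∈ → case kind T∈ of λ
          { (inj₁ refl) → ⊥-elim (∉⊥ y∈) ; (inj₂ (p , (_ , sub) , _)) → let β , y∈B = sub y∈ in B⊆R (σ p β) y∈B }
      ; ∣trace∣≤ = λ T∈ → case kind T∈ of λ
          { (inj₁ refl) → ≤-trans (≤-reflexive (∣⊥∣≡0 n)) z≤n ; (inj₂ (_ , _ , ≤3)) → ≤-trans ≤3 (m≤m+n 3 s) }
      ; escapes = λ i T∈ T′∈ mt ¬mt′ → escape i (kind T∈) (kind T′∈) mt ¬mt′
      -- The premise never holds: two traces that meet the same block share its slot 0.
      ; spreads = λ i T∈ T′∈ mt mt′ empty → ⊥-elim (meet-shared i (kind T∈) (kind T′∈) mt mt′ empty) }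
      where
      escape : ∀ {T T′} i → Kind T → Kind T′ → MeetsBlock T i → ¬ MeetsBlock T′ i → ∃[ y ] (y ∈ T × y ∉ B i × y ∉ T′)
      escape i (inj₁ refl) _ (y , y∈) _ = ⊥-elim (∉⊥ (proj₁ (x∈p∩q⁻ ⊥ (B i) y∈)))
      escape {T} {T′} i (inj₂ (p , inp , _)) kind′ mt ¬mt′ with meets-side inp mt
      ... | β , refl = c₀ (σ p (not β)) , proj₁ inp (not β)
          , (λ y∈B → flip≢ β (proj₂ (σ-block {p} {p} (cell∈B (σ p (not β)) zero) y∈B))) , missing kind′
        where
        missing : Kind T′ → c₀ (σ p (not β)) ∉ T′
        missing (inj₁ refl) = ∉⊥
        missing (inj₂ (q , inq , _)) y∈ with proj₂ inq y∈
        ... | γ , y∈σ with σ-block {p} {q} (cell∈B (σ p (not β)) zero) y∈σ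
        ...   | refl , _ = ¬mt′ (c₀ (σ p β) , x∈p∩q⁺ (proj₁ inq β , cell∈B (σ p β) zero))
      meet-shared : ∀ {T T′} i → Kind T → Kind T′ → MeetsBlock T i → MeetsBlock T′ i → ¬ (∀ {y} → y ∈ B i → y ∈ T → y ∉ T′)
      meet-shared i (inj₁ refl) _ (y , y∈) _ _ = ∉⊥ (proj₁ (x∈p∩q⁻ ⊥ (B i) y∈))
      meet-shared i (inj₂ _) (inj₁ refl) _ (y , y∈) _ = ∉⊥ (proj₁ (x∈p∩q⁻ ⊥ (B i) y∈))
      meet-shared i (inj₂ (p , inp , _)) (inj₂ (q , inq , _)) mt mt′ empty with meets-side inp mt | meets-side inq mt′
      ... | β , refl | γ , eq with side-injective ν {p} {q} eq
      ...   | refl , refl = empty (cell∈B (σ p β) zero) (proj₁ inp β) (proj₁ inq β)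

    private
      k = 3 + s

      ∣room∣ : ∀ p → ∣ room p ∣ ≡ 2 * (3 + s)
      ∣room∣ p = +-cancelˡ-≡ 2 ∣ room p ∣ (2 * (3 + s)) (begin
        2 + ∣ room p ∣                              ≡⟨ cong (_+ ∣ room p ∣) (sym (trans (cong ∣_∣ hull∩pair) (∣pairT∣ p))) ⟩
        ∣ hull p ∩ pairT p ∣ + ∣ room p ∣           ≡⟨ ∣p∩q∣+∣p─q∣ (hull p) (pairT p) ⟩
        ∣ hull p ∣                                  ≡⟨ ∣p∪q∣-disjoint (B (σ p false)) (B (σ p true)) (λ a b → case proj₂ (σ-block {p} {p} a b) of λ ()) ⟩
        ∣ B (σ p false) ∣ + ∣ B (σ p true) ∣        ≡⟨ cong₂ _+_ (∣B∣ (σ p false)) (∣B∣ (σ p true)) ⟩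
        (4 + s) + (4 + s)                           ≡⟨ double s ⟩
        2 + 2 * (3 + s)                             ∎)
        where
        open ≡-Reasoning
        double : ∀ s → (4 + s) + (4 + s) ≡ 2 + 2 * (3 + s)
        double = solve-∀
        hull∩pair : hull p ∩ pairT p ≡ pairT p
        hull∩pair = ⊆-antisym (proj₂ ∘ x∈p∩q⁻ (hull p) (pairT p)) (λ y∈ → x∈p∩q⁺ ((case pair-in y∈ of λ
          { (false , y∈B) → x∈p∪q⁺ (inj₁ y∈B) ; (true , y∈B) → x∈p∪q⁺ (inj₂ y∈B) }) , y∈))

      over-total : ∀ p → total (λ T → m C (k ∸ ∣ T ∣)) (over p) ≡ (m C (1 + s)) + 2 * (3 + s) * (m C s)
      over-total p = cong₂ _+_ (cong (λ t → m C (k ∸ t)) (∣pairT∣ p))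
        (trans (total-const (λ T → m C (k ∸ ∣ T ∣)) (map (pairT p ∪⁅_⁆) (elements (room p))) (λ T∈ → case ∈-map⁻ (pairT p ∪⁅_⁆) T∈ of λ
            { (z , z∈ , refl) → cong (λ t → m C (k ∸ t)) (trans (∣add∣ (pairT p) (x∈p─q⇒x∉q (hull p) (pairT p) (∈-elements⁻ (room p) z∈))) (cong suc (∣pairT∣ p))) }))
          (cong (_* (m C s)) (trans (length-map (pairT p ∪⁅_⁆) (elements (room p))) (trans (length-elements (room p)) (∣room∣ p)))))

    lower-bound : 3 + s ≤ m → (m C (3 + s)) + ⌊ ν /2⌋ * (m C (1 + s)) + 2 * (3 + s) * ⌊ ν /2⌋ * (m C s) + ν ≤ f n (4 + s) 3 (ℤ.+ ν)
    lower-bound h = subst (λ t → t + ν ≤ f n (4 + s) 3 (ℤ.+ ν)) eq (TraceFamily.traces-≤-f grid traces h)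
      where
      regroup : ∀ a h b c d → a + h * (b + c * d) ≡ a + h * b + c * h * d
      regroup = solve-∀
      eq : total (λ T → m C (k ∸ ∣ T ∣)) 𝒯 ≡ (m C (3 + s)) + ⌊ ν /2⌋ * (m C (1 + s)) + 2 * (3 + s) * ⌊ ν /2⌋ * (m C s)
      eq = trans (cong₂ _+_ (cong (λ t → m C (k ∸ t)) (∣⊥∣≡0 n))
          (trans (total-concatMap (λ T → m C (k ∸ ∣ T ∣)) over (allFin ⌊ ν /2⌋))
            (trans (total-const (λ p → total (λ T → m C (k ∸ ∣ T ∣)) (over p)) (allFin ⌊ ν /2⌋) (λ {p} _ → over-total p))
              (cong (_* ((m C (1 + s)) + 2 * (3 + s) * (m C s))) (length-allFin ⌊ ν /2⌋)))))
        (regroup (m C (3 + s)) ⌊ ν /2⌋ (m C (1 + s)) (2 * (3 + s)) (m C s))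

  -- Triple systems without two triples sharing exactly two points

  record LinearTriples (ν : ℕ) : Set where
    field
      H        : List (Subset ν)
      H-unique : Unique H
      ∣e∣      : ∀ {e} → e ∈ₗ H → ∣ e ∣ ≡ 3
      linear   : ∀ {e e′ i j} → e ∈ₗ H → e′ ∈ₗ H → i ≢ j → i ∈ e → j ∈ e → i ∈ e′ → j ∈ e′ → e ≡ e′

    record Others (e : Subset ν) (i : Fin ν) : Set where
      field
        {j l} : Fin ν
        j∈ : j ∈ e
        l∈ : l ∈ e
        j≢i : j ≢ i
        l≢i : l ≢ i
        j≢l : j ≢ l

    others : ∀ {e} i → e ∈ₗ H → Others e i
    others {e} i e∈ with card-lt⇒new e ⁅ i ⁆ (subst₂ _<_ (sym (∣⁅x⁆∣≡1 i)) (sym (∣e∣ e∈)) (s≤s (s≤s z≤n)))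
    ... | j , j∈ , j∉ with card-lt⇒new e (⁅ i ⁆ ∪⁅ j ⁆) (≤-trans (s≤s (≤-trans (∣add∣≤ ⁅ i ⁆) (≤-reflexive (cong suc (∣⁅x⁆∣≡1 i))))) (≤-reflexive (sym (∣e∣ e∈))))
    ...   | l , l∈ , l∉ = record
      { j∈ = j∈ ; l∈ = l∈ ; j≢i = λ { refl → j∉ (x∈⁅x⁆ i) } ; l≢i = λ { refl → l∉ (⊆-add ⁅ i ⁆ (x∈⁅x⁆ i)) } ; j≢l = λ { refl → l∉ (∈-add ⁅ i ⁆) } }

    -- Each triple covers three pairs, and by linearity no pair is covered twice. This is what
    -- compares the two constants of the theorem.
    length-H : length H * 3 ≤ ν C 2
    length-H = subst (length H * 3 ≤_) (trans (*-identityʳ _) (length-kSubsets ν 2))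
      (double-count (λ e D → D ⊆? e) H (kSubsets ν 2) 3 1 low high)
      where
      low : ∀ {e} → e ∈ₗ H → 3 ≤ count (λ D → D ⊆? e) (kSubsets ν 2)
      low {e} e∈ = ≤-trans (≤-reflexive (trans (cong (_C 2) (sym (∣e∣ e∈))) (sym (length-choose e 2))))
        (length-mono-⊆ (choose-unique e 2) λ D∈ → let D⊆ , ∣D∣ = ∈-choose⁻ e 2 D∈ in ∈-filter⁺ (λ D → D ⊆? e) (∈-kSubsets⁺ ∣D∣) D⊆)
      high : ∀ {D} → D ∈ₗ kSubsets ν 2 → count (D ⊆?_) H ≤ 1
      high {D} D∈ = let i , j , i∈ , j∈ , i≢j = card≥2⇒≢ D (≤-reflexive (sym (∈-kSubsets⁻ D∈))) in
        length-≤1 (Uniqueₚ.filter⁺ (D ⊆?_) H-unique) (λ e∈ e′∈ →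
          let a , D⊆ = ∈-filter⁻ (D ⊆?_) {xs = H} e∈ ; b , D⊆′ = ∈-filter⁻ (D ⊆?_) {xs = H} e′∈
          in linear a b i≢j (D⊆ i∈) (D⊆ j∈) (D⊆′ i∈) (D⊆′ j∈))

  no-triples : ∀ {ν} → LinearTriples ν
  no-triples = record { H = [] ; H-unique = [] ; ∣e∣ = λ () ; linear = λ () }

  ∈-words : {A : Set} {xs : List A} (ys : List A) → (∀ {y} → y ∈ₗ ys → y ∈ₗ xs) → ys ∈ₗ words xs (length ys)
  ∈-words [] _ = here refl
  ∈-words (y ∷ ys) h = ∈-cartesianProductWith⁺ _∷_ (h (here refl)) (∈-words ys (h ∘ there))

  -- Distinct triples through i and j have the form {l, i, j} and {i, j, l′}, the edges of the tight
  -- path l, i, j, l′; so path-freeness gives linearity. A value 0, possibly a default, is realised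
  -- by the empty system.
  extremal-triples : ∀ ν → ∃[ 𝓗 ] length (LinearTriples.H {ν} 𝓗) ≡ exTightPath ν 2 3
  extremal-triples ν with maxSize-attained (tightPathFree? 2 3) (kSubsets ν 3)
  ... | inj₁ eq = no-triples , sym eq
  ... | inj₂ (H , H∈ , free , len) = record
    { H = H ; H-unique = sublists-unique (kSubsets-unique ν 3) H∈ ; ∣e∣ = ∣e∣ ; linear = linear } , len
    where
    ∣e∣ : ∀ {e} → e ∈ₗ H → ∣ e ∣ ≡ 3
    ∣e∣ e∈ = ∈-kSubsets⁻ (∈-sublists⁻ H∈ e∈)
    triple : ∀ {e a b c} → e ∈ₗ H → a ≢ b → a ≢ c → b ≢ c → a ∈ e → b ∈ e → c ∈ e → fromList (a ∷ b ∷ c ∷ []) ≡ e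
    triple {e} {a} {b} {c} e∈ a≢b a≢c b≢c a∈ b∈ c∈ = ⊆-card-≡
      (λ y∈ → case ∈-fromList⁻ (a ∷ b ∷ c ∷ []) y∈ of λ { (here refl) → a∈ ; (there (here refl)) → b∈ ; (there (there (here refl))) → c∈ })
      (≤-trans (≤-reflexive (∣e∣ e∈)) (length≤∣p∣ {p = fromList (a ∷ b ∷ c ∷ [])} ((a≢b ∷ a≢c ∷ []) ∷ (b≢c ∷ []) ∷ [] ∷ []) ∈-fromList⁺))
    linear : ∀ {e e′ i j} → e ∈ₗ H → e′ ∈ₗ H → i ≢ j → i ∈ e → j ∈ e → i ∈ e′ → j ∈ e′ → e ≡ e′
    linear {e} {e′} {i} {j} e∈ e′∈ i≢j i∈ j∈ i∈′ j∈′ with ⊆-or-new e e′ | ⊆-or-new e′ e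
    ... | inj₁ e⊆e′ | _ = ⊆-card-≡ e⊆e′ (≤-reflexive (trans (∣e∣ e′∈) (sym (∣e∣ e∈))))
    ... | inj₂ _ | inj₁ e′⊆e = sym (⊆-card-≡ e′⊆e (≤-reflexive (trans (∣e∣ e∈) (sym (∣e∣ e′∈)))))
    ... | inj₂ (l , l∈ , l∉) | inj₂ (l′ , l′∈ , l′∉) = ⊥-elim (free (lose (∈-words (l ∷ i ∷ j ∷ l′ ∷ []) (λ _ → ∈-allFin _))
        ( (l≢i ∷ l≢j ∷ (λ { refl → l∉ l′∈ }) ∷ []) ∷ (i≢j ∷ i≢l′ ∷ []) ∷ (j≢l′ ∷ []) ∷ [] ∷ []
        , subst (_∈ₗ H) (sym (triple e∈ l≢i l≢j i≢j l∈ i∈ j∈)) e∈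
        ∷ subst (_∈ₗ H) (sym (triple e′∈ i≢j i≢l′ j≢l′ i∈′ j∈′ l′∈)) e′∈ ∷ [])))
      where
      l≢i : l ≢ i
      l≢i refl = l∉ i∈′
      l≢j : l ≢ j
      l≢j refl = l∉ j∈′
      i≢l′ : i ≢ l′
      i≢l′ refl = l′∉ i∈
      j≢l′ : j ≢ l′
      j≢l′ refl = l′∉ j∈

  -- Traces from the pairs and k - 1 parallel copies of each triple
  module SecondConstruction {n ν r m : ℕ} (grid : Grid n ν (3 + r) m) (𝓗 : LinearTriples ν)
                            -- A set through x with a trace of three points requires k ≥ 4; for k =
                            -- 3 the construction is applied without triples.
                            (room : ∀ {e} → e ∈ₗ LinearTriples.H 𝓗 → 1 ≤ r) where

    open PairTraces grid
    open LinearTriples 𝓗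

    copy : Subset ν → Fin (2 + r) → Subset n
    copy e s = fromList (map (λ i → cell i (suc s)) (elements e))

    ∈-copy⁺ : ∀ {e i} s → i ∈ e → cell i (suc s) ∈ copy e s
    ∈-copy⁺ {e} s i∈ = ∈-fromList⁺ (∈-map⁺ (λ i → cell i (suc s)) (∈-elements⁺ i∈))

    ∈-copy⁻ : ∀ {e s y} → y ∈ copy e s → ∃[ i ] (i ∈ e × y ≡ cell i (suc s))
    ∈-copy⁻ {e} {s} y∈ with ∈-map⁻ (λ i → cell i (suc s)) (∈-fromList⁻ (map (λ i → cell i (suc s)) (elements e)) y∈)
    ... | i , i∈ , eq = i , ∈-elements⁻ e i∈ , eq

    cell-copy : ∀ {e s t i} → cell i (suc t) ∈ copy e s → i ∈ e × t ≡ s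
    cell-copy {e} {s} y∈ = let j , j∈ , eq = ∈-copy⁻ {e} {s} y∈ ; i≡j , t≡s = cell-injective eq in subst (_∈ e) (sym i≡j) j∈ , Finₚ.suc-injective t≡s

    c₀∉copy : ∀ {e s i} → c₀ i ∉ copy e s
    c₀∉copy {e} {s} y∈ = let j , _ , eq = ∈-copy⁻ {e} {s} y∈ in case proj₂ (cell-injective eq) of λ ()

    cell∉pair : ∀ {p i s} → cell i (suc s) ∉ pairT p
    cell∉pair {p} y∈ = let β , eq = ∈-pairT⁻ {p} y∈ in case proj₂ (cell-injective eq) of λ ()

    ∣copy∣ : ∀ {e} s → e ∈ₗ H → ∣ copy e s ∣ ≡ 3
    ∣copy∣ {e} s e∈ = trans (≤-antisym
      (≤-trans (∣p∣≤length {p = copy e s} (∈-fromList⁻ cells)) (≤-reflexive (length-map (λ i → cell i (suc s)) (elements e))))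
      (≤-trans (≤-reflexive (sym (length-map (λ i → cell i (suc s)) (elements e))))
        (length≤∣p∣ {p = copy e s} (Uniqueₚ.map⁺ (proj₁ ∘ cell-injective) (elements-unique e)) ∈-fromList⁺)))
      (trans (length-elements e) (∣e∣ e∈))
      where
      cells = map (λ i → cell i (suc s)) (elements e)

    copies : Subset ν → List (Subset n)
    copies e = map (copy e) (allFin (2 + r))

    pairs triples 𝒯 : List (Subset n)
    pairs = map pairT (allFin ⌊ ν /2⌋)
    triples = concatMap copies H
    𝒯 = ⊥ ∷ pairs ++ triples

    data Kind (T : Subset n) : Set where
      none : T ≡ ⊥ → Kind T
      pair : ∀ p → T ≡ pairT p → Kind T
      tri  : ∀ e s → e ∈ₗ H → T ≡ copy e s → Kind T

    ∈-pairs⁻ : ∀ {T} → T ∈ₗ pairs → ∃[ p ] T ≡ pairT p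
    ∈-pairs⁻ T∈ = let p , _ , eq = ∈-map⁻ pairT T∈ in p , eq

    ∈-triples⁻ : ∀ {T} → T ∈ₗ triples → ∃[ e ] ∃[ s ] (e ∈ₗ H × T ≡ copy e s)
    ∈-triples⁻ T∈ = let e , e∈ , T∈e = find (∈-concatMap⁻ copies {xs = H} T∈) ; s , _ , eq = ∈-map⁻ (copy e) T∈e in e , s , e∈ , eq

    kind : ∀ {T} → T ∈ₗ 𝒯 → Kind T
    kind (here eq) = none eq
    kind (there T∈) = case ∈-++⁻ pairs T∈ of λ
      { (inj₁ T∈p) → let p , eq = ∈-pairs⁻ T∈p in pair p eq ; (inj₂ T∈t) → let e , s , e∈ , eq = ∈-triples⁻ T∈t in tri e s e∈ eq }

    pair-meets : ∀ {p i} → MeetsBlock (pairT p) i → ∃[ β ] i ≡ σ p β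
    pair-meets {p} {i} (y , y∈) = let y∈T , y∈B = x∈p∩q⁻ (pairT p) (B i) y∈ ; β , eq = ∈-pairT⁻ {p} y∈T in
      β , B-disjoint y∈B (subst (_∈ B (σ p β)) (sym eq) (cell∈B (σ p β) zero))

    copy-meets : ∀ {e s i} → MeetsBlock (copy e s) i → i ∈ e
    copy-meets {e} {s} {i} (y , y∈) = let y∈T , y∈B = x∈p∩q⁻ (copy e s) (B i) y∈ ; j , j∈ , eq = ∈-copy⁻ {e} {s} y∈T in
      subst (_∈ e) (sym (B-disjoint y∈B (subst (_∈ B j) (sym eq) (cell∈B j (suc s))))) j∈

    meets-pair : ∀ p β → MeetsBlock (pairT p) (σ p β)
    meets-pair p β = c₀ (σ p β) , x∈p∩q⁺ (∈-pairT⁺ p β , cell∈B (σ p β) zero)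

    meets-copy : ∀ {e s i} → i ∈ e → MeetsBlock (copy e s) i
    meets-copy {s = s} {i} i∈ = cell i (suc s) , x∈p∩q⁺ (∈-copy⁺ s i∈ , cell∈B i (suc s))

    off : ∀ {i j t} → j ≢ i → cell j t ∉ B i
    off {i} {j} {t} j≢i y∈ = j≢i (B-disjoint (cell∈B j t) y∈)

    σ-not : ∀ p β → σ p (not β) ≢ σ p β
    σ-not p β eq = flip≢ β (proj₂ (side-injective ν {p} {p} eq))

    no-meet : ∀ {i} → ¬ MeetsBlock ⊥ i
    no-meet {i} (y , y∈) = ∉⊥ (proj₁ (x∈p∩q⁻ ⊥ (B i) y∈))

    -- For a pair, its second point serves, since a pair containing it would be the same pair and
    -- meet B i. For a copy of e, try its two points outside B i: if T′ contains both, it is a copy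
    -- of a triple sharing two indices with e, hence of e itself, and meets B i.
    escape : ∀ {T T′} i → Kind T → Kind T′ → MeetsBlock T i → ¬ MeetsBlock T′ i → ∃[ y ] (y ∈ T × y ∉ B i × y ∉ T′)
    escape i (none refl) _ mt _ = ⊥-elim (no-meet {i} mt)
    escape {T′ = T′} i (pair p refl) kind′ mt ¬mt′ with pair-meets {p} mt
    ... | β , refl = c₀ (σ p (not β)) , ∈-pairT⁺ p (not β) , off (σ-not p β) , missing kind′
      where
      missing : Kind T′ → c₀ (σ p (not β)) ∉ T′
      missing (none refl) = ∉⊥
      missing (tri e s e∈ refl) = c₀∉copy {e} {s}
      missing (pair q refl) y∈ with ∈-pairT⁻ {q} y∈
      ... | γ , eq with side-injective ν {p} {q} (proj₁ (cell-injective eq))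
      ...   | refl , _ = ¬mt′ (meets-pair p β)
    escape {T′ = T′} i (tri e s e∈ refl) kind′ mt ¬mt′ = found kind′
      where
      o = others i e∈
      open Others o
      found : Kind T′ → ∃[ y ] (y ∈ copy e s × y ∉ B i × y ∉ T′)
      found (none refl) = cell j (suc s) , ∈-copy⁺ s j∈ , off j≢i , ∉⊥
      found (pair q refl) = cell j (suc s) , ∈-copy⁺ s j∈ , off j≢i , cell∉pair {q}
      found (tri e′ s′ e′∈ refl) with j ∈? e′
      ... | no j∉ = cell j (suc s) , ∈-copy⁺ s j∈ , off j≢i , (j∉ ∘ proj₁ ∘ cell-copy {e′} {s′})
      ... | yes j∈′ = cell l (suc s) , ∈-copy⁺ s l∈ , off l≢i , λ y∈ →
        ¬mt′ (meets-copy {e′} {s′} (subst (i ∈_) (linear e∈ e′∈ j≢l j∈ l∈ j∈′ (proj₁ (cell-copy {e′} {s′} y∈))) (copy-meets {e} {s} mt)))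

    Spread : Subset n → Subset n → Fin ν → Set
    Spread T T′ i = ∃[ zs ] (Unique zs × (∀ {z} → z ∈ₗ zs → (z ∈ T ⊎ z ∈ T′) × z ∉ B i) × (suc ∣ T ∣ ≤ length zs ⊎ suc ∣ T′ ∣ ≤ length zs))

    spread-sym : ∀ {T T′ i} → Spread T T′ i → Spread T′ T i
    spread-sym (zs , u , z∈ , large) = zs , u , (λ a → let b , c = z∈ a in [ inj₂ , inj₁ ]′ b , c) , [ inj₂ , inj₁ ]′ large

    cell-≢ : ∀ {i j s t} → i ≢ j → cell i s ≢ cell j t
    cell-≢ i≢j eq = i≢j (proj₁ (cell-injective eq))

    row-≢ : ∀ {i j s t} → s ≢ t → cell i s ≢ cell j t
    row-≢ s≢t eq = s≢t (proj₂ (cell-injective eq))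

    -- Outside the common block the pair has one point and the copy two, together one more than the
    -- size of the pair. They are distinct because only the pair uses slot 0.
    pair-tri : ∀ {e} p s {i} → e ∈ₗ H → MeetsBlock (pairT p) i → MeetsBlock (copy e s) i → Spread (pairT p) (copy e s) i
    pair-tri {e} p s {i} e∈ mt mt′ with pair-meets {p} mt
    ... | β , refl = c₀ (σ p (not β)) ∷ cell j (suc s) ∷ cell l (suc s) ∷ []
        , (row-≢ (λ ()) ∷ row-≢ (λ ()) ∷ []) ∷ (cell-≢ j≢l ∷ []) ∷ [] ∷ []
        , (λ { (here refl) → inj₁ (∈-pairT⁺ p (not β)) , off (σ-not p β)
             ; (there (here refl)) → inj₂ (∈-copy⁺ s j∈) , off j≢i
             ; (there (there (here refl))) → inj₂ (∈-copy⁺ s l∈) , off l≢i })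
        , inj₁ (≤-reflexive (cong suc (∣pairT∣ p)))
      where
      o = others (σ p β) e∈
      open Others o

    -- Copies in different rows have two points each outside the block, four against a trace size of
    -- three. Copies in the same row share their point in the block, and so do two pairs meeting the
    -- same block.
    spread : ∀ {T T′} i → Kind T → Kind T′ → MeetsBlock T i → MeetsBlock T′ i → (∀ {y} → y ∈ B i → y ∈ T → y ∉ T′) → Spread T T′ i
    spread i (none refl) _ mt _ _ = ⊥-elim (no-meet {i} mt)
    spread i (pair _ _) (none refl) _ mt′ _ = ⊥-elim (no-meet {i} mt′)
    spread i (tri _ _ _ _) (none refl) _ mt′ _ = ⊥-elim (no-meet {i} mt′)
    spread i (pair p refl) (tri e s e∈ refl) mt mt′ _ = pair-tri p s e∈ mt mt′
    spread i (tri e s e∈ refl) (pair p refl) mt mt′ _ = spread-sym (pair-tri p s e∈ mt′ mt)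
    spread i (pair p refl) (pair q refl) mt mt′ empty with pair-meets {p} mt | pair-meets {q} mt′
    ... | β , refl | γ , eq with side-injective ν {p} {q} eq
    ...   | refl , refl = ⊥-elim (empty (cell∈B (σ p β) zero) (∈-pairT⁺ p β) (∈-pairT⁺ p β))
    spread i (tri e s e∈ refl) (tri e′ s′ e′∈ refl) mt mt′ empty with s Fin.≟ s′
    ... | yes refl = ⊥-elim (empty (cell∈B i (suc s)) (∈-copy⁺ s (copy-meets {e} {s} mt)) (∈-copy⁺ s (copy-meets {e′} {s} mt′)))
    ... | no s≢s′ = cell O.j (suc s) ∷ cell O.l (suc s) ∷ cell O′.j (suc s′) ∷ cell O′.l (suc s′) ∷ []
        , (cell-≢ O.j≢l ∷ row-≢ ≢′ ∷ row-≢ ≢′ ∷ []) ∷ (row-≢ ≢′ ∷ row-≢ ≢′ ∷ []) ∷ (cell-≢ O′.j≢l ∷ []) ∷ [] ∷ []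
        , (λ { (here refl) → inj₁ (∈-copy⁺ s O.j∈) , off O.j≢i
             ; (there (here refl)) → inj₁ (∈-copy⁺ s O.l∈) , off O.l≢i
             ; (there (there (here refl))) → inj₂ (∈-copy⁺ s′ O′.j∈) , off O′.j≢i
             ; (there (there (there (here refl)))) → inj₂ (∈-copy⁺ s′ O′.l∈) , off O′.l≢i })
        , inj₁ (≤-reflexive (cong suc (∣copy∣ s e∈)))
      where
      module O = Others (others i e∈)
      module O′ = Others (others i e′∈)
      ≢′ : _≢_ {A = Fin (3 + r)} (suc s) (suc s′)
      ≢′ = s≢s′ ∘ Finₚ.suc-injective

    traces : Traces grid 𝒯
    traces = record
      { traces-unique = All.tabulate (λ T∈ eq → nonempty (kind′ T∈) (sym eq)) ∷ Uniqueₚ.++⁺ pairs-unique triples-unique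
          (λ { (T∈ , T∈′) → let p , eq = ∈-pairs⁻ T∈ ; e , s , _ , eq′ = ∈-triples⁻ T∈′ in
               c₀∉copy {e} {s} (subst (c₀ (σ p false) ∈_) (trans (sym eq) eq′) (∈-pairT⁺ p false)) })
      ; ⊥∈𝒯 = here refl
      ; trace⊆R = λ T∈ → inside-R (kind T∈)
      ; ∣trace∣≤ = λ T∈ → small (kind T∈)
      ; escapes = λ i T∈ T′∈ → escape i (kind T∈) (kind T′∈)
      ; spreads = λ i T∈ T′∈ → spread i (kind T∈) (kind T′∈) }
      where
      kind′ : ∀ {T} → T ∈ₗ pairs ++ triples → (∃[ p ] T ≡ pairT p) ⊎ (∃[ e ] ∃[ s ] (e ∈ₗ H × T ≡ copy e s))
      kind′ T∈ = [ inj₁ ∘ ∈-pairs⁻ , inj₂ ∘ ∈-triples⁻ ]′ (∈-++⁻ pairs T∈)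
      first : ∀ {e} → e ∈ₗ H → Nonempty e
      first {e} e∈ = card>0⇒Nonempty e (subst (1 ≤_) (sym (∣e∣ e∈)) (s≤s z≤n))
      nonempty : ∀ {T} → (∃[ p ] T ≡ pairT p) ⊎ (∃[ e ] ∃[ s ] (e ∈ₗ H × T ≡ copy e s)) → T ≢ ⊥
      nonempty (inj₁ (p , refl)) eq = ∉⊥ (subst (c₀ (σ p false) ∈_) eq (∈-pairT⁺ p false))
      nonempty (inj₂ (e , s , e∈ , refl)) eq = ∉⊥ (subst (cell (proj₁ (first e∈)) (suc s) ∈_) eq (∈-copy⁺ s (proj₂ (first e∈))))
      pairs-unique : Unique pairs
      pairs-unique = Uniqueₚ.map⁺ (λ {p} {q} eq → let γ , eq′ = ∈-pairT⁻ {q} (subst (c₀ (σ p false) ∈_) eq (∈-pairT⁺ p false)) in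
        proj₁ (side-injective ν {p} {q} (proj₁ (cell-injective eq′)))) (Uniqueₚ.allFin⁺ ⌊ ν /2⌋)
      copy-injective : ∀ {e e′ s s′} → e ∈ₗ H → e′ ∈ₗ H → copy e s ≡ copy e′ s′ → e ≡ e′ × s ≡ s′
      copy-injective {e} {e′} {s} {s′} e∈ e′∈ eq =
          ⊆-antisym (λ i∈ → proj₁ (cell-copy {e′} {s′} (subst (_ ∈_) eq (∈-copy⁺ s i∈)))) (λ i∈ → proj₁ (cell-copy {e} {s} (subst (_ ∈_) (sym eq) (∈-copy⁺ s′ i∈))))
        , proj₂ (cell-copy {e′} {s′} (subst (cell (proj₁ (first e∈)) (suc s) ∈_) eq (∈-copy⁺ s (proj₂ (first e∈)))))
      triples-unique : Unique triples
      triples-unique = concatMap-unique copies H-unique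
        (λ {e} e∈ → map-unique (copy e) (Uniqueₚ.allFin⁺ (2 + r)) (λ _ _ eq → proj₂ (copy-injective e∈ e∈ eq)))
        (λ {e} {e′} e∈ e′∈ z∈ z∈′ → let s , _ , eq = ∈-map⁻ (copy e) z∈ ; s′ , _ , eq′ = ∈-map⁻ (copy e′) z∈′ in
          proj₁ (copy-injective e∈ e′∈ (trans (sym eq) eq′)))
      inside-R : ∀ {T} → Kind T → T ⊆ R
      inside-R (none refl) y∈ = ⊥-elim (∉⊥ y∈)
      inside-R (pair p refl) y∈ = let β , eq = ∈-pairT⁻ {p} y∈ in subst (_∈ R) (sym eq) (B⊆R (σ p β) (cell∈B (σ p β) zero))
      inside-R (tri e s _ refl) y∈ = let i , _ , eq = ∈-copy⁻ {e} {s} y∈ in subst (_∈ R) (sym eq) (B⊆R i (cell∈B i (suc s)))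
      small : ∀ {T} → Kind T → ∣ T ∣ ≤ 2 + r
      small (none refl) = ≤-trans (≤-reflexive (∣⊥∣≡0 n)) z≤n
      small (pair p refl) = ≤-trans (≤-reflexive (∣pairT∣ p)) (m≤m+n 2 r)
      small (tri e s e∈ refl) = ≤-trans (≤-reflexive (∣copy∣ s e∈)) (s≤s (s≤s (room e∈)))

    private
      k = 2 + r
      g : Subset n → ℕ
      g T = m C (k ∸ ∣ T ∣)

    lower-bound : 2 + r ≤ m → (m C (2 + r)) + ⌊ ν /2⌋ * (m C r) + (2 + r) * length H * (m C (k ∸ 3)) + ν ≤ f n (3 + r) 3 (ℤ.+ ν)
    lower-bound h = subst (λ t → t + ν ≤ f n (3 + r) 3 (ℤ.+ ν)) eq (TraceFamily.traces-≤-f grid traces h)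
      where
      eq : total g 𝒯 ≡ (m C (2 + r)) + ⌊ ν /2⌋ * (m C r) + (2 + r) * length H * (m C (k ∸ 3))
      eq = trans (cong₂ _+_ (cong (λ t → m C (k ∸ t)) (∣⊥∣≡0 n)) (trans (total-++ g pairs triples) (cong₂ _+_ pair-total triple-total)))
        (sym (+-assoc (m C (2 + r)) (⌊ ν /2⌋ * (m C r)) ((2 + r) * length H * (m C (k ∸ 3)))))
        where
        pair-total : total g pairs ≡ ⌊ ν /2⌋ * (m C r)
        pair-total = trans (total-const g pairs (λ T∈ → let p , eq = ∈-pairs⁻ T∈ in cong (λ t → m C (k ∸ t)) (trans (cong ∣_∣ eq) (∣pairT∣ p))))
          (cong (_* (m C r)) (trans (length-map pairT (allFin ⌊ ν /2⌋)) (length-allFin ⌊ ν /2⌋)))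
        triple-total : total g triples ≡ (2 + r) * length H * (m C (k ∸ 3))
        triple-total = trans (total-const g triples (λ T∈ → let e , s , e∈ , eq = ∈-triples⁻ T∈ in cong (λ t → m C (k ∸ t)) (trans (cong ∣_∣ eq) (∣copy∣ s e∈))))
          (cong (_* (m C (k ∸ 3))) (trans (len H) (*-comm (length H) (2 + r))))
          where
          len : ∀ es → length (concatMap copies es) ≡ length es * (2 + r)
          len [] = refl
          len (e ∷ es) = trans (length-++ (copies e)) (cong₂ _+_ (trans (length-map (copy e) (allFin (2 + r))) (length-allFin (2 + r))) (len es))

  -- For k = 3 the coefficient is multiplied by 0, and the pairs alone give the bound. For k ≥ 4 the
  -- larger of the two constants selects the construction.
  ≤-f : ∀ {n ν} r → suc (ν * (3 + r)) ≤ n → let m = n ∸ suc (ν * (3 + r)) in 2 + r ≤ m →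
        (m C (2 + r)) + ⌊ ν /2⌋ * (m C r) + (((2 + r) * exTightPath ν 2 3) ⊔ (2 * (2 + r) * ⌊ ν /2⌋)) * bin₄ r m + ν ≤ f n (3 + r) 3 (ℤ.+ ν)
  ≤-f {n} {ν} zero h h′ = subst (_≤ f n 3 3 (ℤ.+ ν)) (cong (_+ ν) (cong ((m C 2) + ⌊ ν /2⌋ * (m C 0) +_) (sym (*-zeroʳ c₁))))
    (SecondConstruction.lower-bound (grid-exists ν 3 h) no-triples (λ ()) h′)
    where
    m = n ∸ suc (ν * 3)
    c₁ = (2 * exTightPath ν 2 3) ⊔ (2 * 2 * ⌊ ν /2⌋)
  ≤-f {n} {ν} (suc s) h h′ = [ (λ eq → subst Bound (sym eq) first) , (λ eq → subst Bound (sym eq) second) ]′ (⊔-sel a b)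
    where
    m = n ∸ suc (ν * (4 + s))
    a = (3 + s) * exTightPath ν 2 3
    b = 2 * (3 + s) * ⌊ ν /2⌋
    Bound : ℕ → Set
    Bound c = (m C (3 + s)) + ⌊ ν /2⌋ * (m C (1 + s)) + c * bin₄ (suc s) m + ν ≤ f n (4 + s) 3 (ℤ.+ ν)
    grid = grid-exists ν (4 + s) h
    first : Bound a
    first = let 𝓗 , eq = extremal-triples ν in
      subst (λ l → Bound ((3 + s) * l)) eq (SecondConstruction.lower-bound grid 𝓗 (λ _ → s≤s z≤n) h′)
    second : Bound b
    second = FirstConstruction.lower-bound grid h′

open Development using (weight; bin₄; ≤-f; extremal-triples; module LinearTriples; module UpperBound)

open import Defs
open import Data.Integer as ℤ using (+_; 1ℤ)
open import Data.Nat as ℕ using (ℕ; suc; _∸_; _⊔_; ⌊_/2⌋)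
open import Data.Nat.Combinatorics using (_C_)
open import Data.Product using (_×_; ∃-syntax)
open import Data.Rational using (ℚ; _+_; _*_; _≤_; _/_)

import Data.Integer.Properties as ℤₚ
import Data.Nat.DivMod as ℕ
import Data.Nat.Properties as ℕₚ
open import Data.Nat.Tactic.RingSolver using (solve-∀)
open import Data.Product using (_,_; proj₁; proj₂)
open import Data.Rational as ℚ using (mkℚ; Positive; toℚᵘ)
import Data.Rational.Properties as ℚₚ
open import Data.Rational.Unnormalised as ℚᵘ using (mkℚᵘ; *≡*; *≤*; *<*)
import Data.Rational.Unnormalised.Properties as ℚᵘₚ
open import Relation.Binary.PropositionalEquality using (_≡_; refl; sym; trans; cong; cong₂; subst; subst₂; module ≡-Reasoning)
open import Relation.Nullary using (contradiction)

-- Passing from natural numbers to rationals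

toℚᵘ-/ : ∀ i d → toℚᵘ (i / suc d) ℚᵘ.≃ mkℚᵘ i d
toℚᵘ-/ i d = ℚₚ.toℚᵘ-fromℚᵘ (mkℚᵘ i d)

↑-homo-+ : ∀ a b → ↑ (a ℕ.+ b) ≡ ↑ a + ↑ b
↑-homo-+ a b = ℚₚ.toℚᵘ-injective (ℚᵘₚ.≃-trans (toℚᵘ-/ (+ (a ℕ.+ b)) 0) (ℚᵘₚ.≃-trans
  (*≡* (cong (ℤ._* + 1) (trans (ℤₚ.pos-+ a b) (cong₂ ℤ._+_ (sym (ℤₚ.*-identityʳ (+ a))) (sym (ℤₚ.*-identityʳ (+ b)))))))
  (ℚᵘₚ.≃-sym (ℚᵘₚ.≃-trans (ℚₚ.toℚᵘ-homo-+ (↑ a) (↑ b)) (ℚᵘₚ.+-cong (toℚᵘ-/ (+ a) 0) (toℚᵘ-/ (+ b) 0))))))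

↑-homo-* : ∀ a b → ↑ (a ℕ.* b) ≡ ↑ a * ↑ b
↑-homo-* a b = ℚₚ.toℚᵘ-injective (ℚᵘₚ.≃-trans (toℚᵘ-/ (+ (a ℕ.* b)) 0) (ℚᵘₚ.≃-trans
  (*≡* (cong (ℤ._* + 1) (ℤₚ.pos-* a b)))
  (ℚᵘₚ.≃-sym (ℚᵘₚ.≃-trans (ℚₚ.toℚᵘ-homo-* (↑ a) (↑ b)) (ℚᵘₚ.*-cong (toℚᵘ-/ (+ a) 0) (toℚᵘ-/ (+ b) 0))))))

↑-mono : ∀ {a b} → a ℕ.≤ b → ↑ a ≤ ↑ b
↑-mono {a} {b} a≤b = ℚₚ.toℚᵘ-cancel-≤ (ℚᵘₚ.≤-respˡ-≃ (ℚᵘₚ.≃-sym (toℚᵘ-/ (+ a) 0)) (ℚᵘₚ.≤-respʳ-≃ (ℚᵘₚ.≃-sym (toℚᵘ-/ (+ b) 0))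
  (*≤* (ℤₚ.*-monoʳ-≤-nonNeg (+ 1) (ℤ.+≤+ a≤b)))))

/-*-cancel : ∀ a d → (+ a / suc d) * ↑ (suc d) ≡ ↑ a
/-*-cancel a d = ℚₚ.toℚᵘ-injective (ℚᵘₚ.≃-trans (ℚₚ.toℚᵘ-homo-* (+ a / suc d) (↑ (suc d)))
  (ℚᵘₚ.≃-trans (ℚᵘₚ.*-cong (toℚᵘ-/ (+ a) d) (toℚᵘ-/ (+ suc d) 0)) (ℚᵘₚ.≃-trans (*≡* eq) (ℚᵘₚ.≃-sym (toℚᵘ-/ (+ a) 0)))))
  where
  eq : (+ a ℤ.* + suc d) ℤ.* + 1 ≡ + a ℤ.* (+ (suc d ℕ.* 1))
  eq = trans (ℤₚ.*-identityʳ (+ a ℤ.* + suc d)) (cong (λ e → + a ℤ.* + e) (sym (ℕₚ.*-identityʳ (suc d))))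

↑-pos : ∀ d → Positive (↑ (suc d))
↑-pos d = ℚₚ.normalize-pos (suc d) 1

↑-≤-scaled : ∀ {a w} (q b : ℚ) d → q * ↑ (suc d) ≡ ↑ w → ↑ a * ↑ (suc d) ≤ ↑ w * b → ↑ a ≤ q * b
↑-≤-scaled {a} {w} q b d eq h = ℚₚ.*-cancelʳ-≤-pos (↑ (suc d)) {{↑-pos d}} (subst (↑ a * ↑ (suc d) ≤_) (begin
  ↑ w * b                ≡⟨ cong (_* b) (sym eq) ⟩
  q * ↑ (suc d) * b      ≡⟨ ℚₚ.*-assoc q (↑ (suc d)) b ⟩
  q * (↑ (suc d) * b)    ≡⟨ cong (q *_) (ℚₚ.*-comm (↑ (suc d)) b) ⟩
  q * (b * ↑ (suc d))    ≡⟨ sym (ℚₚ.*-assoc q b (↑ (suc d))) ⟩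
  q * b * ↑ (suc d)      ∎) h)
  where open ≡-Reasoning

-- The quotient in ℕ is rounded down, so it stays below b times the rational coefficient q = w / (d
-- + 1).
↑-quotient : ∀ (q : ℚ) b w d → q * ↑ (suc d) ≡ ↑ w → ↑ (b ℕ.* w ℕ./ suc d) ≤ q * ↑ b
↑-quotient q b w d eq = ↑-≤-scaled {b ℕ.* w ℕ./ suc d} {w} q (↑ b) d eq (subst₂ _≤_
  (↑-homo-* (b ℕ.* w ℕ./ suc d) (suc d)) (trans (cong ↑_ (ℕₚ.*-comm b w)) (↑-homo-* w b)) (↑-mono (ℕ.m/n*n≤m (b ℕ.* w) (suc d))))

vanishing : ∀ K c → TendsToZero (λ n → + K / suc (n ∸ c))
vanishing K c (mkℚ (ℤ.-[1+ p ]) q _) 0<ε = contradiction (ℚ.positive 0<ε) λ ()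
vanishing K c (mkℚ (+ 0) q _) 0<ε = contradiction (ℚ.positive 0<ε) λ ()
-- For ε = (p+1)/(q+1) the value K / (n - c + 1) is below ε as soon as n - c ≥ K(q+1).
vanishing K c ε@(mkℚ (+ suc p) q _) 0<ε = c ℕ.+ K ℕ.* suc q , λ n N≤n →
  subst (ℚ._< ε) (sym (ℚₚ.0≤p⇒∣p∣≡p (ℚₚ.nonNegative⁻¹ (+ K / suc (n ∸ c)) {{ℚₚ.normalize-nonNeg K (suc (n ∸ c))}})))
    (ℚₚ.toℚᵘ-cancel-< (ℚᵘₚ.<-respˡ-≃ (ℚᵘₚ.≃-sym (toℚᵘ-/ (+ K) (n ∸ c))) (*<* (subst₂ ℤ._<_ (ℤₚ.pos-* K (suc q)) (ℤₚ.pos-* (suc p) (suc (n ∸ c)))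
      (ℤ.+<+ (ℕₚ.≤-trans (ℕ.s≤s (ℕₚ.m+n≤o⇒m≤o∸n (K ℕ.* suc q) (ℕₚ.≤-trans (ℕₚ.≤-reflexive (ℕₚ.+-comm (K ℕ.* suc q) c)) N≤n)))
        (ℕₚ.m≤m+n (suc (n ∸ c)) (p ℕ.* suc (n ∸ c)))))))))

-- Comparing the constants and passing to rational inequalities

private
  weight′ : ∀ r ν → ((+ (3 ℕ.+ r) / 3) * ↑ (ν C 2) + ↑ ((2 ℕ.+ r) ℕ.* ν)) * ↑ 3 ≡ ↑ weight r ν
  weight′ r ν = begin
    ((+ k / 3) * c + e) * ↑ 3              ≡⟨ ℚₚ.*-distribʳ-+ (↑ 3) ((+ k / 3) * c) e ⟩
    (+ k / 3) * c * ↑ 3 + e * ↑ 3          ≡⟨ cong (_+ e * ↑ 3) (ℚₚ.*-assoc (+ k / 3) c (↑ 3)) ⟩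
    (+ k / 3) * (c * ↑ 3) + e * ↑ 3        ≡⟨ cong (λ z → (+ k / 3) * z + e * ↑ 3) (ℚₚ.*-comm c (↑ 3)) ⟩
    (+ k / 3) * (↑ 3 * c) + e * ↑ 3        ≡⟨ cong (_+ e * ↑ 3) (sym (ℚₚ.*-assoc (+ k / 3) (↑ 3) c)) ⟩
    (+ k / 3) * ↑ 3 * c + e * ↑ 3          ≡⟨ cong₂ (λ y z → y * c + z) (/-*-cancel k 2) (ℚₚ.*-comm e (↑ 3)) ⟩
    ↑ k * c + ↑ 3 * e                      ≡⟨ cong₂ _+_ (sym (↑-homo-* k (ν C 2))) (sym (↑-homo-* 3 ((2 ℕ.+ r) ℕ.* ν))) ⟩
    ↑ (k ℕ.* (ν C 2)) + ↑ (3 ℕ.* ((2 ℕ.+ r) ℕ.* ν)) ≡⟨ sym (↑-homo-+ (k ℕ.* (ν C 2)) (3 ℕ.* ((2 ℕ.+ r) ℕ.* ν))) ⟩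
    ↑ weight r ν                           ∎
    where
    open ≡-Reasoning
    k = 3 ℕ.+ r
    c = ↑ (ν C 2)
    e = ↑ ((2 ℕ.+ r) ℕ.* ν)

  -- 3 ex(ν, P_2^3) ≤ C(ν,2) bounds the first constant by the first summand of `weight`, and 2⌊ν/2⌋
  -- ≤ ν bounds the second constant by the second summand.
  constant≤weight : ∀ r ν → (((2 ℕ.+ r) ℕ.* exTightPath ν 2 3) ⊔ (2 ℕ.* (2 ℕ.+ r) ℕ.* ⌊ ν /2⌋)) ℕ.* 3 ℕ.≤ weight r ν
  constant≤weight r ν = ℕₚ.≤-trans (ℕₚ.≤-reflexive (ℕₚ.*-distribʳ-⊔ 3 a b)) (ℕₚ.⊔-lub a≤ b≤)
    where
    open ℕₚ.≤-Reasoning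
    a = (2 ℕ.+ r) ℕ.* exTightPath ν 2 3
    b = 2 ℕ.* (2 ℕ.+ r) ℕ.* ⌊ ν /2⌋
    a≤ : a ℕ.* 3 ℕ.≤ weight r ν
    a≤ = let 𝓗 , eq = extremal-triples ν in begin
      (2 ℕ.+ r) ℕ.* exTightPath ν 2 3 ℕ.* 3     ≡⟨ ℕₚ.*-assoc (2 ℕ.+ r) (exTightPath ν 2 3) 3 ⟩
      (2 ℕ.+ r) ℕ.* (exTightPath ν 2 3 ℕ.* 3)   ≤⟨ ℕₚ.*-mono-≤ (ℕₚ.n≤1+n (2 ℕ.+ r)) (subst (λ l → l ℕ.* 3 ℕ.≤ ν C 2) eq (LinearTriples.length-H 𝓗)) ⟩
      (3 ℕ.+ r) ℕ.* (ν C 2)                     ≤⟨ ℕₚ.m≤m+n ((3 ℕ.+ r) ℕ.* (ν C 2)) _ ⟩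
      weight r ν                                ∎
    b≤ : b ℕ.* 3 ℕ.≤ weight r ν
    b≤ = begin
      2 ℕ.* (2 ℕ.+ r) ℕ.* ⌊ ν /2⌋ ℕ.* 3            ≡⟨ regroup (2 ℕ.+ r) ⌊ ν /2⌋ ⟩
      3 ℕ.* ((2 ℕ.+ r) ℕ.* (⌊ ν /2⌋ ℕ.+ ⌊ ν /2⌋))  ≤⟨ ℕₚ.*-monoʳ-≤ 3 (ℕₚ.*-monoʳ-≤ (2 ℕ.+ r)
                                                       (ℕₚ.≤-trans (ℕₚ.+-monoʳ-≤ ⌊ ν /2⌋ (ℕₚ.⌊n/2⌋≤⌈n/2⌉ ν)) (ℕₚ.≤-reflexive (ℕₚ.⌊n/2⌋+⌈n/2⌉≡n ν)))) ⟩
      3 ℕ.* ((2 ℕ.+ r) ℕ.* ν)                      ≤⟨ ℕₚ.m≤n+m _ ((3 ℕ.+ r) ℕ.* (ν C 2)) ⟩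
      weight r ν                                   ∎
      where
      regroup : ∀ a h → 2 ℕ.* a ℕ.* h ℕ.* 3 ≡ 3 ℕ.* (a ℕ.* (h ℕ.+ h))
      regroup = solve-∀

  shift : ∀ n k ν → n ∸ suc (ν ℕ.* k) ≡ n ∸ k ℕ.* ν ∸ 1
  shift n k ν = trans (cong (λ z → n ∸ z) (trans (cong suc (ℕₚ.*-comm ν k)) (ℕₚ.+-comm 1 (k ℕ.* ν)))) (sym (ℕₚ.∸-+-assoc n (k ℕ.* ν) 1))

  ↑-lower : ∀ A h B c b ν t → A ℕ.+ h ℕ.* B ℕ.+ c ℕ.* b ℕ.+ ν ℕ.≤ t → ↑ A + ↑ h * ↑ B + ↑ c * ↑ b + ↑ ν ≤ ↑ t
  ↑-lower A h B c b ν t le = subst (_≤ ↑ t) (begin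
    ↑ (A ℕ.+ h ℕ.* B ℕ.+ c ℕ.* b ℕ.+ ν)          ≡⟨ ↑-homo-+ (A ℕ.+ h ℕ.* B ℕ.+ c ℕ.* b) ν ⟩
    ↑ (A ℕ.+ h ℕ.* B ℕ.+ c ℕ.* b) + ↑ ν          ≡⟨ cong (_+ ↑ ν) (↑-homo-+ (A ℕ.+ h ℕ.* B) (c ℕ.* b)) ⟩
    ↑ (A ℕ.+ h ℕ.* B) + ↑ (c ℕ.* b) + ↑ ν        ≡⟨ cong₂ (λ y z → y + z + ↑ ν) (trans (↑-homo-+ A (h ℕ.* B)) (cong (_+_ (↑ A)) (↑-homo-* h B))) (↑-homo-* c b) ⟩
    ↑ A + ↑ h * ↑ B + ↑ c * ↑ b + ↑ ν            ∎) (↑-mono le)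
    where open ≡-Reasoning

  ↑-upper : ∀ A h B n₃ n₄ M t b (q o : ℚ) → t ℕ.≤ A ℕ.+ h ℕ.* B ℕ.+ (n₃ ℕ.+ n₄) ℕ.+ M → ↑ n₃ ≤ q * ↑ b → ↑ n₄ ≤ o * ↑ b →
            ↑ t ≤ ↑ A + ↑ h * ↑ B + (q + o) * ↑ b + ↑ M
  ↑-upper A h B n₃ n₄ M t b q o le h₃ h₄ = begin
    ↑ t                                                  ≤⟨ ↑-mono le ⟩
    ↑ (A ℕ.+ h ℕ.* B ℕ.+ (n₃ ℕ.+ n₄) ℕ.+ M)              ≡⟨ ↑-homo-+ (A ℕ.+ h ℕ.* B ℕ.+ (n₃ ℕ.+ n₄)) M ⟩
    ↑ (A ℕ.+ h ℕ.* B ℕ.+ (n₃ ℕ.+ n₄)) + ↑ M              ≡⟨ cong (_+ ↑ M) (↑-homo-+ (A ℕ.+ h ℕ.* B) (n₃ ℕ.+ n₄)) ⟩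
    ↑ (A ℕ.+ h ℕ.* B) + ↑ (n₃ ℕ.+ n₄) + ↑ M              ≡⟨ cong₂ (λ y z → y + z + ↑ M) (trans (↑-homo-+ A (h ℕ.* B)) (cong (_+_ (↑ A)) (↑-homo-* h B))) (↑-homo-+ n₃ n₄) ⟩
    ↑ A + ↑ h * ↑ B + (↑ n₃ + ↑ n₄) + ↑ M                ≤⟨ ℚₚ.+-monoˡ-≤ (↑ M) (ℚₚ.+-monoʳ-≤ (↑ A + ↑ h * ↑ B) (ℚₚ.+-mono-≤ h₃ h₄)) ⟩
    ↑ A + ↑ h * ↑ B + (q * ↑ b + o * ↑ b) + ↑ M          ≡⟨ cong (λ z → ↑ A + ↑ h * ↑ B + z + ↑ M) (sym (ℚₚ.*-distribʳ-+ (↑ b) q o)) ⟩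
    ↑ A + ↑ h * ↑ B + (q + o) * ↑ b + ↑ M                ∎
    where open ℚₚ.≤-Reasoning

theorem1p6 : ∀ (k ν : ℕ) → 3 ℕ.≤ k →
    ∃[ c₁ ] ∃[ c₂ ] ∃[ M₃ ]
    ( ↑ (((k ∸ 1) ℕ.* exTightPath ν 2 3) ⊔ (2 ℕ.* (k ∸ 1) ℕ.* ⌊ ν /2⌋)) ≤ c₁
    × c₁ ≤ c₂
    × c₂ ≤ (+ k / 3) * ↑ (ν C 2) + ↑ ((k ∸ 1) ℕ.* ν)
    × M₃ ≤ ↑ f (k ℕ.* ν) k 3 (+ ν ℤ.- 1ℤ)
    × (∀ (n : ℕ) → k ℕ.* (ν ℕ.+ 1) ℕ.≤ n →
    let m = n ∸ k ℕ.* ν ∸ 1 in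
    ↑ binom m (+ k ℤ.- + 1)
    + ↑ ⌊ ν /2⌋ * ↑ binom m (+ k ℤ.- + 3)
    + c₁ * ↑ binom m (+ k ℤ.- + 4)
    + ↑ ν
    ≤ ↑ f n k 3 (+ ν))
    × (∃[ o ] (TendsToZero o × (∃[ N ] (∀ (n : ℕ) → N ℕ.≤ n →
    let m = n ∸ k ℕ.* ν ∸ 1 in
    ↑ f n k 3 (+ ν)
    ≤ ↑ binom m (+ k ℤ.- + 1)
    + ↑ ⌊ ν /2⌋ * ↑ binom m (+ k ℤ.- + 3)
    + (c₂ + o n) * ↑ binom m (+ k ℤ.- + 4)
    + M₃)))))
theorem1p6 (suc (suc (suc r))) ν (ℕ.s≤s (ℕ.s≤s (ℕ.s≤s ℕ.z≤n))) =
    -- Each constant is taken at an end of its range: c₁ at its lower bound, c₂ and M₃ at their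
    -- upper bounds.
    ↑ c₁ , c₂ , ↑ M₃ , ℚₚ.≤-refl , c₁≤c₂ , ℚₚ.≤-refl , ℚₚ.≤-refl , lower
  , o , vanishing K (suc (ν ℕ.* k) ℕ.+ k) , UpperBound.threshold r ν , upper
  where
  k c₁ M₃ K : ℕ
  k = 3 ℕ.+ r
  c₁ = ((2 ℕ.+ r) ℕ.* exTightPath ν 2 3) ⊔ (2 ℕ.* (2 ℕ.+ r) ℕ.* ⌊ ν /2⌋)
  M₃ = f (k ℕ.* ν) k 3 (+ ν ℤ.- 1ℤ)
  K = UpperBound.K₇ r ν
  c₂ : ℚ
  c₂ = (+ k / 3) * ↑ (ν C 2) + ↑ ((2 ℕ.+ r) ℕ.* ν)
  o : ℕ → ℚ
  -- This is the factor from traces of at least four points, since m - k = n - (∣V∣ + k).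
  o n = + K / suc (n ∸ (suc (ν ℕ.* k) ℕ.+ k))
  c₁≤c₂ : ↑ c₁ ≤ c₂
  c₁≤c₂ = ℚₚ.*-cancelʳ-≤-pos (↑ 3) (subst₂ _≤_ (↑-homo-* c₁ 3) (sym (weight′ r ν)) (↑-mono (constant≤weight r ν)))
  lower : ∀ n → k ℕ.* (ν ℕ.+ 1) ℕ.≤ n → let m = n ∸ k ℕ.* ν ∸ 1 in
          ↑ (m C (2 ℕ.+ r)) + ↑ ⌊ ν /2⌋ * ↑ (m C r) + ↑ c₁ * ↑ bin₄ r m + ↑ ν ≤ ↑ f n k 3 (+ ν)
  lower n k[ν+1]≤n = subst (λ m → ↑ (m C (2 ℕ.+ r)) + ↑ ⌊ ν /2⌋ * ↑ (m C r) + ↑ c₁ * ↑ bin₄ r m + ↑ ν ≤ ↑ f n k 3 (+ ν)) (shift n k ν)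
    (↑-lower (m C (2 ℕ.+ r)) ⌊ ν /2⌋ (m C r) c₁ (bin₄ r m) ν (f n k 3 (+ ν)) (≤-f {n} {ν} r
      (ℕₚ.≤-trans (ℕₚ.≤-trans (ℕₚ.≤-reflexive (ℕₚ.+-comm 1 (ν ℕ.* k))) (ℕₚ.+-monoʳ-≤ (ν ℕ.* k) (ℕ.s≤s ℕ.z≤n))) enough)
      (ℕₚ.m+n≤o⇒m≤o∸n (2 ℕ.+ r) (ℕₚ.≤-trans (ℕₚ.≤-reflexive (swap r (ν ℕ.* k))) enough))))
    where
    m = n ∸ suc (ν ℕ.* k)
    enough : ν ℕ.* k ℕ.+ k ℕ.≤ n
    enough = ℕₚ.≤-trans (ℕₚ.≤-reflexive (distribute ν k)) k[ν+1]≤n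
      where
      distribute : ∀ ν k → ν ℕ.* k ℕ.+ k ≡ k ℕ.* (ν ℕ.+ 1)
      distribute = solve-∀
    swap : ∀ r x → 2 ℕ.+ r ℕ.+ suc x ≡ x ℕ.+ (3 ℕ.+ r)
    swap = solve-∀
  upper : ∀ n → UpperBound.threshold r ν ℕ.≤ n → let m = n ∸ k ℕ.* ν ∸ 1 in
          ↑ f n k 3 (+ ν) ≤ ↑ (m C (2 ℕ.+ r)) + ↑ ⌊ ν /2⌋ * ↑ (m C r) + (c₂ + o n) * ↑ bin₄ r m + ↑ M₃
  upper n N≤n = subst (λ m → ↑ f n k 3 (+ ν) ≤ ↑ (m C (2 ℕ.+ r)) + ↑ ⌊ ν /2⌋ * ↑ (m C r) + (c₂ + o n) * ↑ bin₄ r m + ↑ M₃) (shift n k ν)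
    (↑-upper (m C (2 ℕ.+ r)) ⌊ ν /2⌋ (m C r) (bin₄ r m ℕ.* weight r ν ℕ./ 3) (bin₄ r m ℕ.* K ℕ./ suc (m ∸ k)) M₃ (f n k 3 (+ ν)) (bin₄ r m) c₂ (o n) (UpperBound.f-≤-bound r ν N≤n)
      (↑-quotient c₂ (bin₄ r m) (weight r ν) 2 (weight′ r ν))
      (↑-quotient (o n) (bin₄ r m) K (m ∸ k)
        (trans (cong (λ d → (+ K / suc d) * ↑ (suc (m ∸ k))) (sym (ℕₚ.∸-+-assoc n (suc (ν ℕ.* k)) k))) (/-*-cancel K (m ∸ k)))))
    where
    m = n ∸ suc (ν ℕ.* k)
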